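{- Let $m,t,s$ be positive integers with $t+s\ge 3$ and $m\ge 2s\ge 4$, and let $\mathcal{F}_5^S(m,t,K_{s,s})$ be the $3$-graph defined below. Then, for $n$ large enough, $$\mathrm{ex}_3\big(n,\mathcal{F}_5^S(m,t,K_{s,s})\big)\le e(T_3(n,3))+6\cdot \mathrm{ex}^{bip}_3(n/3,n/3,K_{t,s,s})+3\cdot \mathrm{ex}_3(n/3,K_{t,s,s})+o\big(n^{3-\frac{1}{s^2}}\big),$$ and $$\mathrm{ex}_3\big(n,\mathcal{F}_5^S(m,t,K_{s,s})\big)\ge e(T_3(n,3))+3\cdot \mathrm{ex}_3(\lfloor n/3\rfloor,K_{t,s,s}).$$ Moreover, when $t=1$, $$\mathrm{ex}_3\big(n,\mathcal{F}_5^S(m,1,K_{s,s})\big)\le e(T_3(n,3))+6\cdot \mathrm{ex}^{bip}_3(n/3,n/3,K_{1,s,s})+3\cdot \mathrm{ex}_3(n/3,K_{1,s,s})+o\big(n^{3-\frac{1}{s}}\big).$$ (The $o(\cdot)$ terms are as $n\to\infty$ with $m,t,s$ fixed.)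
   Context: All hypergraphs are $3$-uniform ($3$-graphs). For a $3$-graph $\mathcal{F}$, $\mathrm{ex}_3(n,\mathcal{F})$ is the maximum number of hyperedges in an $n$-vertex $3$-graph containing no copy of $\mathcal{F}$ as a subhypergraph. $T_3(n,3)$ is the complete $3$-partite $3$-graph on $n$ vertices (hyperedges are the triples meeting each part in exactly one vertex) with parts of sizes $\lfloor n/3\rfloor$ or $\lceil n/3\rceil$; $e(\cdot)$ denotes the number of hyperedges. $K_{t,s,s}$ is the complete $3$-partite $3$-graph with parts of sizes $t,s,s$. $\mathrm{ex}^{bip}_3(m,n,K_{t,s,s})$ is the maximum number of hyperedges in a $3$-graph on vertex set $A\cup B$ with $|A|=m$, $|B|=n$, $A\cap B=\emptyset$, in which every hyperedge consists of one vertex of $A$ and two vertices of $B$, and which contains no copy of $K_{t,s,s}$ whose $t$-vertex part lies in $A$ and whose other two parts lie in $B$ (equivalently, no $t$ vertices of $A$ whose link graphs all contain a common copy of $K_{s,s}$ inside $B$). $\mathcal{F}_5^S(m,t,K_{s,s})$ (for $t+s\ge 3$, $m\ge 2s$) is the $3$-graph obtained as follows: take $T_3(3m,3)$, choose two disjoint $s$-sets $S_0,S_1$ inside one of its parts, add a set $T$ of $t$ new vertices, and take all hyperedges of $T_3(3m,3)$ together with every triple consisting of one vertex of $T$, one vertex of $S_0$ and one vertex of $S_1$. -}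

module Defs where

open import Data.Nat using (ℕ; zero; suc; _+_; _*_; _∸_; _≤_; _<ᵇ_; _≡ᵇ_; _%_; _/_)
open import Data.Bool using (Bool; true; false; _∧_; _∨_; not; if_then_else_)
open import Data.Fin using (Fin; toℕ)
open import Data.List using (List; map; allFin)
open import Data.Nat.ListAction using (sum)
open import Data.Product using (Σ; _×_; _,_)
open import Relation.Nullary using (¬_)
open import Relation.Binary.PropositionalEquality using (_≡_; _≢_)
open import Function.Definitions using (Injective)

-- 3-graphs on the vertex set Fin n.
-- A 3-graph is given by a raw Boolean function E; the triple {x,y,z}
-- is a hyperedge iff x,y,z are pairwise distinct and E holds for some
-- ordering of (x,y,z).  Every 3-graph on Fin n arises this way.

Graph3 : ℕ → Set
Graph3 n = Fin n → Fin n → Fin n → Bool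

neq : ℕ → ℕ → Bool
neq a b = not (a ≡ᵇ b)

distinct3 : ℕ → ℕ → ℕ → Bool
distinct3 a b c = neq a b ∧ neq b c ∧ neq a c

edge? : ∀ {n} → Graph3 n → Fin n → Fin n → Fin n → Bool
edge? E x y z =
  distinct3 (toℕ x) (toℕ y) (toℕ z)
  ∧ (E x y z ∨ E x z y ∨ E y x z ∨ E y z x ∨ E z x y ∨ E z y x)

IsEdge : ∀ {n} → Graph3 n → Fin n → Fin n → Fin n → Set
IsEdge E x y z = edge? E x y z ≡ true

count3 : ∀ {n} → (Fin n → Fin n → Fin n → Bool) → ℕ
count3 {n} P =
  sum (map (λ x → sum (map (λ y → sum (map (λ z → if P x y z then 1 else 0)
    (allFin n))) (allFin n))) (allFin n))

e : ∀ {n} → Graph3 n → ℕ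
e E = count3 (λ x y z → (toℕ x <ᵇ toℕ y) ∧ (toℕ y <ᵇ toℕ z) ∧ edge? E x y z)

Contains : ∀ {v n} → Graph3 v → Graph3 n → Set
Contains {v} {n} F H =
  Σ (Fin v → Fin n) λ φ →
    Injective _≡_ _≡_ φ ×
    (∀ x y z → IsEdge F x y z → IsEdge H (φ x) (φ y) (φ z))

IsEx : ∀ {v} → ℕ → Graph3 v → ℕ → Set
IsEx n F x =
  (Σ (Graph3 n) λ H → (¬ Contains F H) × e H ≡ x) ×
  (∀ (H : Graph3 n) → ¬ Contains F H → e H ≤ x)

-- T_3(n,3): vertex i lies in part (i mod 3); parts have sizes
-- ⌊n/3⌋ or ⌈n/3⌉.
T3 : (n : ℕ) → Graph3 n
T3 n x y z = distinct3 (toℕ x % 3) (toℕ y % 3) (toℕ z % 3)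

partK : ℕ → ℕ → ℕ → ℕ
partK t s k = if k <ᵇ t then 0 else (if k <ᵇ t + s then 1 else 2)

K : (t s : ℕ) → Graph3 (t + s + s)
K t s x y z = distinct3 (partK t s (toℕ x)) (partK t s (toℕ y)) (partK t s (toℕ z))

-- F_5^S(m,t,K_{s,s}) on Fin (3 * m + t):
-- vertices 0..3m-1 form T_3(3m,3) (part = i mod 3, each part of size m);
-- S_0 = {3j : j < s}, S_1 = {3j : s ≤ j < 2s} lie in part 0
-- (disjoint s-sets, using m ≥ 2s); T = {3m, ..., 3m+t-1} new vertices;
-- extra hyperedges: all {τ, a, b} with τ ∈ T, a ∈ S_0, b ∈ S_1.

inOld : ℕ → ℕ → Bool
inOld m k = k <ᵇ 3 * m

inT : ℕ → ℕ → Bool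
inT m k = not (inOld m k)

inS0 : ℕ → ℕ → ℕ → Bool
inS0 m s k = inOld m k ∧ (k % 3 ≡ᵇ 0) ∧ (k / 3 <ᵇ s)

inS1 : ℕ → ℕ → ℕ → Bool
inS1 m s k = inOld m k ∧ (k % 3 ≡ᵇ 0) ∧ not (k / 3 <ᵇ s) ∧ (k / 3 <ᵇ 2 * s)

F5S : (m t s : ℕ) → Graph3 (3 * m + t)
F5S m t s x y z =
  (inOld m a ∧ inOld m b ∧ inOld m c ∧ distinct3 (a % 3) (b % 3) (c % 3))
  ∨ (inT m a ∧ inS0 m s b ∧ inS1 m s c)
  where
    a = toℕ x
    b = toℕ y
    c = toℕ z

-- Bipartite setting: A = Fin m, B = Fin n; hyperedges {a, y, z} with
-- a ∈ A and y ≠ z ∈ B.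

BipGraph : ℕ → ℕ → Set
BipGraph m n = Fin m → Fin n → Fin n → Bool

bipEdge? : ∀ {m n} → BipGraph m n → Fin m → Fin n → Fin n → Bool
bipEdge? G a y z = neq (toℕ y) (toℕ z) ∧ (G a y z ∨ G a z y)

IsBipEdge : ∀ {m n} → BipGraph m n → Fin m → Fin n → Fin n → Set
IsBipEdge G a y z = bipEdge? G a y z ≡ true

eBip : ∀ {m n} → BipGraph m n → ℕ
eBip {m} {n} G =
  sum (map (λ a → sum (map (λ y → sum (map (λ z →
    if (toℕ y <ᵇ toℕ z) ∧ bipEdge? G a y z then 1 else 0)
    (allFin n))) (allFin n))) (allFin m))

ContainsBipK : ∀ {m n} → ℕ → ℕ → BipGraph m n → Set
ContainsBipK {m} {n} t s G =
  Σ (Fin t → Fin m) λ α → Σ (Fin s → Fin n) λ β → Σ (Fin s → Fin n) λ γ →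
    Injective _≡_ _≡_ α × Injective _≡_ _≡_ β × Injective _≡_ _≡_ γ ×
    (∀ j k → β j ≢ γ k) ×
    (∀ i j k → IsBipEdge G (α i) (β j) (γ k))

IsExBip : ℕ → ℕ → ℕ → ℕ → ℕ → Set
IsExBip m n t s x =
  (Σ (BipGraph m n) λ G → (¬ ContainsBipK t s G) × eBip G ≡ x) ×
  (∀ (G : BipGraph m n) → ¬ ContainsBipK t s G → eBip G ≤ x)

{-# OPTIONS --safe #-}
-- Lower bound: put an extremal K_{t,s,s}-free 3-graph inside each part of T₃(n,3).  In a copy of F₅ˢ the
-- 3-partite subgraph K_{m,m,m} is either crossing or inside one part; in both cases S₀ ∪ S₁ lies in one
-- part, hence so does T, which gives a K_{t,s,s} there.
--
-- Upper bound.  All counts are over ordered tuples.  A dense relation contains complete boxes, so an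
-- F₅ˢ-free 3-graph has few copies of F₅ = {abc, abv, cvτ}, of which F₅ˢ is contained in a blow-up.  Stability
-- follows without Turán's theorem or the removal lemma.  Let d be the codegree, δ(c) the size of the link
-- of c, and D(c) the number of vertices whose codegree with c is linear.  Then (4d − (2n − D))² ≥ 0 and AM–GM
-- bound 2 n Σ δ by Σ Dδ + 2 Σ d² + (4/27) n⁴, and the scarcity of F₅ gives Σ Dδ + Σ d² ≤ n Σ δ up to a small
-- error.  Together with the density 2/9 this forces an edge xyz whose codegrees sum to almost n, and nearly
-- all edges cross the partition N(yz), N(xz), N(xy).
--
-- Pass to a locally optimal 3-colouring.  Only boundedly many vertices lie in quadratically many
-- noncrossing edges, and any other vertex missing δn² crossing triples loses at least what it gains.  The
-- remaining noncrossing edges form six bipartite and three ordinary K_{t,s,s}-free 3-graphs on classes of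
-- size n/3 + o(n), since K_{t,s,s} with S₀ and S₁ in one class completes to F₅ˢ.  The o(n) surplus vertices are
-- absorbed by the Kővári–Sós–Turán bound with one small part.
module Submission where

open import Defs
open import Data.Nat using (ℕ; zero; suc; _+_; _*_; _∸_; _^_; _≤_; _<_; z≤n; s≤s; _/_; _%_; _<ᵇ_; _≤ᵇ_; _≡ᵇ_; _≤?_; _<?_; _⊔_; NonZero; nonZero; >-nonZero) renaming (_≟_ to _≟ⁿ_)
open import Data.Nat.Properties hiding (_≟_; _≤?_; _<?_; ≡-irrelevant; suc-injective)
open import Data.Nat.DivMod using (m≡m%n+[m/n]*n; m%n<n; m<n*o⇒m/o<n; [m+kn]%n≡m%n; [m+n]%n≡m%n; +-distrib-/-∣ʳ; m*n/n≡m; m/n*n≤m; m<n⇒m%n≡m; m/n≤m; m<n⇒m/n≡0)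
open import Data.Nat.Divisibility using (divides)
open import Data.Nat.Tactic.RingSolver using (solve-∀)
open import Data.Nat.ListAction using (sum)
open import Data.Bool using (Bool; true; false; _∧_; _∨_; not; if_then_else_; T; T?) renaming (_≟_ to _≟ᵇ_)
open import Data.Bool.Properties using (∧-comm; ∨-comm; ∧-conicalˡ; ∧-conicalʳ; ∨-conicalˡ; ∨-conicalʳ)
open import Data.Fin using (Fin; toℕ; fromℕ<; _≟_; _↑ˡ_; _↑ʳ_; splitAt) renaming (zero to fzero; suc to fsuc)
open import Data.Fin.Properties using (all?; any?; splitAt⁻¹-↑ˡ; splitAt⁻¹-↑ʳ; toℕ-injective; toℕ<n; toℕ-fromℕ<; toℕ-↑ˡ; toℕ-↑ʳ; ↑ˡ-injective; ↑ʳ-injective; suc-injective)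
open import Data.List using (List; []; _∷_; map; allFin; length; _++_; concatMap; filterᵇ; cartesianProduct; drop)
open import Data.List.Properties using (map-tabulate; length-tabulate; length-drop)
open import Data.List.Membership.Propositional using (_∈_)
open import Data.List.Relation.Unary.Any using (here; there)
open import Data.List.Membership.Propositional.Properties using (∈-filter⁻)
open import Data.List.Relation.Unary.All using (All; []; _∷_) renaming (lookup to All-lookup)
open import Data.List.Relation.Unary.AllPairs using ([]; _∷_)
open import Data.List.Relation.Unary.Unique.Propositional using (Unique)
open import Data.List.Relation.Unary.Unique.Propositional.Properties using (allFin⁺; filter⁺; drop⁺; ++⁺)
open import Data.Vec using (Vec; []; _∷_; lookup; replicate)
open import Data.Product using (Σ; _×_; _,_; proj₁; proj₂; ∃)
open import Data.Maybe using (Maybe; just; nothing)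
open import Data.Sum using (_⊎_; inj₁; inj₂)
open import Data.Empty using (⊥; ⊥-elim)
open import Data.Unit using (⊤; tt)
open import Function using (_∘_; id; case_of_)
open import Function.Definitions using (Injective)
open import Relation.Nullary using (¬_; yes; no; Dec)
open import Relation.Nullary.Decidable using (⌊_⌋; toWitness; _→-dec_)
open import Relation.Binary.PropositionalEquality using (_≡_; _≢_; refl; sym; trans; cong; cong₂; subst; subst₂; module ≡-Reasoning)

-- Sums over lists

-- The main term is exact, so the o(n³) of stability may appear nowhere in the final bound. Hence
-- linearly many vertices cannot simply be deleted: a vertex with many bad edges has to pay for them
-- with missing crossing triples. Vertices for which this fails may cost order n² each, which is
-- harmless for O(1) of them but not for εn. That there are only O(1) comes from the box lemma: one
-- class of a box may be sought in a list of bounded length, so even a bounded set of vertices with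
-- many copies of F₅ through each yields a blow-up. The codegree inequalities are tuned to be sharp
-- for T₃(n,3), to leading order: there D = 2n/3 and a heavy pair has d = n/3, so 4d = 2n - D, and D
-- : (2n - D) = 1 : 2 is the equality case of AM-GM for D(2n - D)². The error o(n^(3 - 1/p)), with p
-- = s² or p = s, needs more than the usual Kővári-Sós-Turán bound, which gives only O. The gain
-- comes from the short list: its length enters the p-th power of the count with exponent p - 1 ≥ 1
-- and is at most n/K for any prescribed constant K.

∑ : {A : Set} → List A → (A → ℕ) → ℕ
∑ xs f = sum (map f xs)

𝟙 : Bool → ℕ
𝟙 b = if b then 1 else 0

𝟙≤1 : ∀ b → 𝟙 b ≤ 1
𝟙≤1 true  = ≤-refl
𝟙≤1 false = z≤n

𝟙-∧ : ∀ a b → 𝟙 (a ∧ b) ≡ 𝟙 a * 𝟙 b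
𝟙-∧ true  b = sym (+-identityʳ _)
𝟙-∧ false b = refl

𝟙*≤ : ∀ b x → 𝟙 b * x ≤ x
𝟙*≤ true  x = ≤-reflexive (+-identityʳ x)
𝟙*≤ false x = z≤n

-- The slack s turns an inequality into an equation that the ring solver can check.
lin≤ : ∀ {L R a b} s → a ≤ b → L + b + s ≡ R + a → L ≤ R
lin≤ {L} {R} {a} {b} s a≤b eq = +-cancelʳ-≤ b L R
  (≤-trans (≤-trans (m≤m+n (L + b) s) (≤-reflexive eq)) (+-monoʳ-≤ R a≤b))

cong-+ˡ : ∀ {a b c} → a ≡ b → a + c ≡ b + c
cong-+ˡ refl = refl

eq≤ : ∀ {L R} s → L + s ≡ R → L ≤ R
eq≤ {L} s eq = ≤-trans (m≤m+n L s) (≤-reflexive eq)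

^-distribʳ-* : ∀ k a b → (a * b) ^ k ≡ a ^ k * b ^ k
^-distribʳ-* zero    a b = refl
^-distribʳ-* (suc k) a b rewrite ^-distribʳ-* k a b = lemma a b (a ^ k) (b ^ k)
  where lemma : ∀ a b x y → a * b * (x * y) ≡ a * x * (b * y)
        lemma = solve-∀

module _ {A : Set} where
  ∑-cong : ∀ (xs : List A) {f g} → (∀ x → f x ≡ g x) → ∑ xs f ≡ ∑ xs g
  ∑-cong []       h = refl
  ∑-cong (x ∷ xs) h = cong₂ _+_ (h x) (∑-cong xs h)

  ∑-mono : ∀ (xs : List A) {f g} → (∀ x → f x ≤ g x) → ∑ xs f ≤ ∑ xs g
  ∑-mono []       h = z≤n
  ∑-mono (x ∷ xs) h = +-mono-≤ (h x) (∑-mono xs h)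

  ∑-+ : ∀ (xs : List A) f g → ∑ xs (λ x → f x + g x) ≡ ∑ xs f + ∑ xs g
  ∑-+ []       f g = refl
  ∑-+ (x ∷ xs) f g rewrite ∑-+ xs f g = lemma (f x) (g x) (∑ xs f) (∑ xs g)
    where lemma : ∀ a b c d → (a + b) + (c + d) ≡ (a + c) + (b + d)
          lemma = solve-∀

  ∑-* : ∀ (xs : List A) c f → ∑ xs (λ x → c * f x) ≡ c * ∑ xs f
  ∑-* []       c f = sym (*-zeroʳ c)
  ∑-* (x ∷ xs) c f rewrite ∑-* xs c f = sym (*-distribˡ-+ c (f x) (∑ xs f))

  ∑-*ʳ : ∀ (xs : List A) c f → ∑ xs (λ x → f x * c) ≡ ∑ xs f * c
  ∑-*ʳ xs c f = trans (∑-cong xs (λ x → *-comm (f x) c)) (trans (∑-* xs c f) (*-comm c _))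

  ∑-const : ∀ (xs : List A) c → ∑ xs (λ _ → c) ≡ length xs * c
  ∑-const []       c = refl
  ∑-const (x ∷ xs) c = cong (c +_) (∑-const xs c)

  ∑-≤const : ∀ (xs : List A) {c f} → (∀ x → f x ≤ c) → ∑ xs f ≤ length xs * c
  ∑-≤const xs h = ≤-trans (∑-mono xs h) (≤-reflexive (∑-const xs _))

  ∑-++ : ∀ (xs ys : List A) f → ∑ (xs ++ ys) f ≡ ∑ xs f + ∑ ys f
  ∑-++ []       ys f = refl
  ∑-++ (x ∷ xs) ys f rewrite ∑-++ xs ys f = sym (+-assoc (f x) _ _)

module _ {A B : Set} where
  ∑-swap : ∀ (xs : List A) (ys : List B) (f : A → B → ℕ) →
    ∑ xs (λ x → ∑ ys (λ y → f x y)) ≡ ∑ ys (λ y → ∑ xs (λ x → f x y))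
  ∑-swap []       ys f = sym (trans (∑-const ys 0) (*-zeroʳ (length ys)))
  ∑-swap (x ∷ xs) ys f rewrite ∑-swap xs ys f = sym (∑-+ ys (f x) (λ y → ∑ xs (λ x → f x y)))

  ∑-map : ∀ (h : B → A) (ys : List B) f → ∑ (map h ys) f ≡ ∑ ys (λ y → f (h y))
  ∑-map h []       f = refl
  ∑-map h (y ∷ ys) f = cong (f (h y) +_) (∑-map h ys f)

  ∑-concatMap : ∀ (h : B → List A) (ys : List B) f →
    ∑ (concatMap h ys) f ≡ ∑ ys (λ y → ∑ (h y) f)
  ∑-concatMap h []       f = refl
  ∑-concatMap h (y ∷ ys) f = trans (∑-++ (h y) (concatMap h ys) f) (cong (∑ (h y) f +_) (∑-concatMap h ys f))

  ∑-*∑ : ∀ (xs : List A) (ys : List B) f g →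
    ∑ xs (λ x → ∑ ys (λ y → f x * g y)) ≡ ∑ xs f * ∑ ys g
  ∑-*∑ xs ys f g = trans (∑-cong xs (λ x → ∑-* ys (f x) g)) (∑-*ʳ xs (∑ ys g) f)

module _ {A : Set} where
  ∑<⇒∃ : ∀ (xs : List A) {f g : A → ℕ} → ∑ xs f < ∑ xs g → ∃ λ x → f x < g x
  ∑<⇒∃ (x ∷ xs) {f} {g} lt with f x <? g x
  ... | yes p = x , p
  ... | no ¬p = ∑<⇒∃ xs (≰⇒> λ q → <⇒≱ lt (+-mono-≤ (≮⇒≥ ¬p) q))

  private
    -- The difference of the two sides is (a - b)(a^k - b^k), a product of numbers of equal sign.
    -- The slack `d * u` is this product, with the smaller number and its power subtracted by hand.
    rearrange : ∀ k a b → a * b ^ k + b * a ^ k ≤ a * a ^ k + b * b ^ k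
    rearrange k a b with ≤-total a b
    ... | inj₁ a≤b = case (m≤n⇒∃[o]m+o≡n a≤b) of λ { (d , refl) →
            case m≤n⇒∃[o]m+o≡n (^-monoˡ-≤ k a≤b) of λ { (u , eq) →
              subst (λ z → a * z + (a + d) * a ^ k ≤ a * a ^ k + (a + d) * z) eq
                (eq≤ (d * u) (lemma a d (a ^ k) u)) } }
      where lemma : ∀ a d x u → a * (x + u) + (a + d) * x + d * u ≡ a * x + (a + d) * (x + u)
            lemma = solve-∀
    ... | inj₂ b≤a = case (m≤n⇒∃[o]m+o≡n b≤a) of λ { (d , refl) →
            case m≤n⇒∃[o]m+o≡n (^-monoˡ-≤ k b≤a) of λ { (u , eq) →
              subst (λ z → (b + d) * b ^ k + b * z ≤ (b + d) * z + b * b ^ k) eq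
                (eq≤ (d * u) (lemma b d (b ^ k) u)) } }
      where lemma : ∀ b d x u → (b + d) * x + b * (x + u) + d * u ≡ (b + d) * (x + u) + b * x
            lemma = solve-∀

  -- Chebyshev's sum inequality for the similarly ordered sequences f and f^k: summing `rearrange`
  -- over all pairs (x, y) gives twice the claim.
  chebyshev : ∀ (xs : List A) f k → ∑ xs f * ∑ xs (λ x → f x ^ k) ≤ length xs * ∑ xs (λ x → f x ^ suc k)
  chebyshev xs f k = *-cancelˡ-≤ 2 (begin
    2 * (∑ xs f * ∑ xs g)
      ≡⟨ two (∑ xs f) (∑ xs g) ⟩
    ∑ xs f * ∑ xs g + ∑ xs g * ∑ xs f
      ≡⟨ cong₂ _+_ (∑-*∑ xs xs f g) (∑-*∑ xs xs g f) ⟨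
    ∑ xs (λ x → ∑ xs (λ y → f x * g y)) + ∑ xs (λ x → ∑ xs (λ y → g x * f y))
      ≡⟨ ∑-+ xs _ _ ⟨
    ∑ xs (λ x → ∑ xs (λ y → f x * g y) + ∑ xs (λ y → g x * f y))
      ≡⟨ ∑-cong xs (λ x → ∑-+ xs _ _) ⟨
    ∑ xs (λ x → ∑ xs (λ y → f x * g y + g x * f y))
      ≤⟨ ∑-mono xs (λ x → ∑-mono xs (λ y →
           ≤-trans (≤-reflexive (cong (f x * g y +_) (*-comm (g x) (f y)))) (rearrange k (f x) (f y)))) ⟩
    ∑ xs (λ x → ∑ xs (λ y → h x + h y))
      ≡⟨ ∑-cong xs (λ x → trans (∑-+ xs _ _) (cong (_+ ∑ xs h) (∑-const xs (h x)))) ⟩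
    ∑ xs (λ x → length xs * h x + ∑ xs h)
      ≡⟨ trans (∑-+ xs _ _) (cong₂ _+_ (∑-* xs (length xs) h) (∑-const xs _)) ⟩
    length xs * ∑ xs h + length xs * ∑ xs h
      ≡⟨ cong (length xs * ∑ xs h +_) (+-identityʳ _) ⟨
    2 * (length xs * ∑ xs h) ∎)
    where
    open ≤-Reasoning
    g h : A → ℕ
    g x = f x ^ k
    h x = f x ^ suc k
    two : ∀ a b → 2 * (a * b) ≡ a * b + b * a
    two = solve-∀

  power-mean : ∀ (xs : List A) f k → ∑ xs f ^ suc k ≤ length xs ^ k * ∑ xs (λ x → f x ^ suc k)
  power-mean xs f zero = ≤-reflexive (trans (*-identityʳ _)
    (trans (∑-cong xs (λ x → sym (*-identityʳ (f x)))) (sym (+-identityʳ _))))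
  power-mean xs f (suc k) = begin
    ∑ xs f * ∑ xs f ^ suc k                                     ≤⟨ *-monoʳ-≤ (∑ xs f) (power-mean xs f k) ⟩
    ∑ xs f * (length xs ^ k * ∑ xs (λ x → f x ^ suc k))         ≡⟨ lemma (∑ xs f) (length xs ^ k) _ ⟩
    length xs ^ k * (∑ xs f * ∑ xs (λ x → f x ^ suc k))         ≤⟨ *-monoʳ-≤ (length xs ^ k) (chebyshev xs f (suc k)) ⟩
    length xs ^ k * (length xs * ∑ xs (λ x → f x ^ suc (suc k))) ≡⟨ lemma₂ (length xs ^ k) (length xs) _ ⟩
    length xs ^ suc k * ∑ xs (λ x → f x ^ suc (suc k))          ∎
    where
    open ≤-Reasoning
    lemma : ∀ a b c → a * (b * c) ≡ b * (a * c)
    lemma = solve-∀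
    lemma₂ : ∀ a b c → a * (b * c) ≡ b * a * c
    lemma₂ = solve-∀

length-allFin : ∀ n → length (allFin n) ≡ n
length-allFin n = length-tabulate {n = n} id

∑-allFin-suc : ∀ {n} (f : Fin (suc n) → ℕ) → ∑ (allFin (suc n)) f ≡ f fzero + ∑ (allFin n) (λ x → f (fsuc x))
∑-allFin-suc {n} f = cong (f fzero +_) (trans (cong (λ l → ∑ l f) (sym (map-tabulate {n = n} id fsuc))) (∑-map fsuc (allFin n) f))

-- Boxes in dense relations

allTuples : ∀ {A : Set} {k} → Vec (List A) k → List (Vec A k)
allTuples []         = [] ∷ []
allTuples (xs ∷ xss) = concatMap (λ x → map (x ∷_) (allTuples xss)) xs

∑-allTuples : ∀ {A : Set} {k} xs (xss : Vec (List A) k) f →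
  ∑ (allTuples (xs ∷ xss)) f ≡ ∑ xs (λ x → ∑ (allTuples xss) (λ v → f (x ∷ v)))
∑-allTuples xs xss f = trans (∑-concatMap _ xs f) (∑-cong xs (λ x → ∑-map (x ∷_) (allTuples xss) f))

length-∑ : ∀ {A : Set} (xs : List A) → length xs ≡ ∑ xs (λ _ → 1)
length-∑ xs = sym (trans (∑-const xs 1) (*-identityʳ _))

length-allTuples : ∀ {A : Set} {k} xs (xss : Vec (List A) k) →
  length (allTuples (xs ∷ xss)) ≡ length xs * length (allTuples xss)
length-allTuples xs xss = begin
  length (allTuples (xs ∷ xss))                 ≡⟨ length-∑ (allTuples (xs ∷ xss)) ⟩
  ∑ (allTuples (xs ∷ xss)) (λ _ → 1)            ≡⟨ ∑-allTuples xs xss _ ⟩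
  ∑ xs (λ _ → ∑ (allTuples xss) (λ _ → 1))      ≡⟨ ∑-const xs _ ⟩
  length xs * ∑ (allTuples xss) (λ _ → 1)       ≡⟨ cong (length xs *_) (length-∑ (allTuples xss)) ⟨
  length xs * length (allTuples xss)            ∎
  where open ≡-Reasoning

tuples : ∀ {A : Set} → List A → (k : ℕ) → List (Vec A k)
tuples xs k = allTuples (replicate k xs)

length-tuples : ∀ {A : Set} (xs : List A) k → length (tuples xs k) ≡ length xs ^ k
length-tuples xs zero    = refl
length-tuples xs (suc k) = trans (length-allTuples xs (replicate k xs)) (cong (length xs *_) (length-tuples xs k))

allV : ∀ {A : Set} {k} → (A → Bool) → Vec A k → Bool
allV p []      = true
allV p (x ∷ v) = p x ∧ allV p v

∧-trueˡ : ∀ {a b} → a ∧ b ≡ true → a ≡ true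
∧-trueˡ {a} {b} = ∧-conicalˡ a b

∧-trueʳ : ∀ {a b} → a ∧ b ≡ true → b ≡ true
∧-trueʳ {a} {b} = ∧-conicalʳ a b

∧-true : ∀ {a b} → a ≡ true → b ≡ true → a ∧ b ≡ true
∧-true refl refl = refl

allV-lookup : ∀ {A : Set} {k} (p : A → Bool) (v : Vec A k) → allV p v ≡ true → ∀ i → p (lookup v i) ≡ true
allV-lookup p (x ∷ v) e fzero    = ∧-trueˡ e
allV-lookup p (x ∷ v) e (fsuc i) = allV-lookup p v (∧-trueʳ {p x} e) i

power-tuples : ∀ {A : Set} (xs : List A) (p : A → Bool) k →
  ∑ xs (λ x → 𝟙 (p x)) ^ k ≡ ∑ (tuples xs k) (λ v → 𝟙 (allV p v))
power-tuples xs p zero    = refl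
power-tuples xs p (suc k) = begin
  ∑ xs (λ x → 𝟙 (p x)) * ∑ xs (λ x → 𝟙 (p x)) ^ k
    ≡⟨ cong (∑ xs (λ x → 𝟙 (p x)) *_) (power-tuples xs p k) ⟩
  ∑ xs (λ x → 𝟙 (p x)) * ∑ (tuples xs k) (λ v → 𝟙 (allV p v))
    ≡⟨ ∑-*∑ xs (tuples xs k) _ _ ⟨
  ∑ xs (λ x → ∑ (tuples xs k) (λ v → 𝟙 (p x) * 𝟙 (allV p v)))
    ≡⟨ ∑-cong xs (λ x → ∑-cong (tuples xs k) (λ v → 𝟙-∧ (p x) (allV p v))) ⟨
  ∑ xs (λ x → ∑ (tuples xs k) (λ v → 𝟙 (p x ∧ allV p v)))
    ≡⟨ ∑-allTuples xs (replicate k xs) _ ⟨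
  ∑ (tuples xs (suc k)) (λ v → 𝟙 (allV p v)) ∎
  where open ≡-Reasoning

-- The double count behind Kővári-Sós-Turán: a power of a degree counts tuples inside a
-- neighbourhood, so after the power mean the sum can be read as one over tuples of the sizes of
-- their common neighbourhoods.
power-mean-tuples : ∀ {A B : Set} (ys : List A) (xs : List B) (P : A → B → Bool) k →
  ∑ ys (λ y → ∑ xs (λ x → 𝟙 (P y x))) ^ suc k
    ≤ length ys ^ k * ∑ (tuples xs (suc k)) (λ v → ∑ ys (λ y → 𝟙 (allV (P y) v)))
power-mean-tuples ys xs P k = ≤-trans (power-mean ys _ k) (≤-reflexive (cong (length ys ^ k *_)
  (trans (∑-cong ys (λ y → power-tuples xs (P y) (suc k))) (∑-swap ys (tuples xs (suc k)) _))))

-- Tuples with distinct entries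

_==_ : ∀ {n} → Fin n → Fin n → Bool
x == y = ⌊ x ≟ y ⌋

==-refl : ∀ {n} (x : Fin n) → (x == x) ≡ true
==-refl x with x ≟ x
... | yes _ = refl
... | no ¬p = ⊥-elim (¬p refl)

==-false : ∀ {n} {x y : Fin n} → (x == y) ≡ false → x ≢ y
==-false {x = x} e refl with trans (sym e) (==-refl x)
... | ()

==-true : ∀ {n} (x y : Fin n) → (x == y) ≡ true → x ≡ y
==-true x y e with x ≟ y
... | yes p = p

mem : ∀ {n k} → Fin n → Vec (Fin n) k → Bool
mem x []      = false
mem x (y ∷ v) = (x == y) ∨ mem x v

dup : ∀ {n k} → Vec (Fin n) k → Bool
dup []      = false
dup (x ∷ v) = mem x v ∨ dup v

∨-falseˡ : ∀ {a b} → a ∨ b ≡ false → a ≡ false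
∨-falseˡ {a} {b} = ∨-conicalˡ a b

∨-falseʳ : ∀ {a b} → a ∨ b ≡ false → b ≡ false
∨-falseʳ {a} {b} = ∨-conicalʳ a b

𝟙-∨ : ∀ a b → 𝟙 (a ∨ b) ≤ 𝟙 a + 𝟙 b
𝟙-∨ true  b = s≤s z≤n
𝟙-∨ false b = ≤-refl

mem-false : ∀ {n k} (x : Fin n) (v : Vec (Fin n) k) → mem x v ≡ false → ∀ i → x ≢ lookup v i
mem-false x (y ∷ v) e fzero    = ==-false (∨-falseˡ e)
mem-false x (y ∷ v) e (fsuc i) = mem-false x v (∨-falseʳ {x == y} e) i

dup-false : ∀ {n k} (v : Vec (Fin n) k) → dup v ≡ false → Injective _≡_ _≡_ (lookup v)
dup-false (x ∷ v) e {fzero}  {fzero}  _  = refl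
dup-false (x ∷ v) e {fzero}  {fsuc j} eq = ⊥-elim (mem-false x v (∨-falseˡ e) j eq)
dup-false (x ∷ v) e {fsuc i} {fzero}  eq = ⊥-elim (mem-false x v (∨-falseˡ e) i (sym eq))
dup-false (x ∷ v) e {fsuc i} {fsuc j} eq = cong fsuc (dup-false v (∨-falseʳ {mem x v} e) eq)

∑-== : ∀ {n} {xs : List (Fin n)} → Unique xs → ∀ y → ∑ xs (λ x → 𝟙 (x == y)) ≤ 1
∑-== []                    y = z≤n
∑-== {xs = x ∷ xs} (p ∷ u) y with x ≟ y
... | no  _    = ∑-== u y
... | yes refl = ≤-reflexive (cong suc (absent xs p))
  where
  absent : ∀ ys → All (x ≢_) ys → ∑ ys (λ z → 𝟙 (z == x)) ≡ 0
  absent []       []       = refl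
  absent (z ∷ ys) (q ∷ qs) with z ≟ x
  ... | yes r = ⊥-elim (q (sym r))
  ... | no  _ = absent ys qs

∑-mem : ∀ {n k} {xs : List (Fin n)} → Unique xs → (v : Vec (Fin n) k) → ∑ xs (λ x → 𝟙 (mem x v)) ≤ k
∑-mem {xs = xs} u []              = ≤-reflexive (trans (∑-const xs 0) (*-zeroʳ (length xs)))
∑-mem {xs = xs} u (_∷_ {n = k} y v) = begin
  ∑ xs (λ x → 𝟙 ((x == y) ∨ mem x v))                 ≤⟨ ∑-mono xs (λ x → 𝟙-∨ (x == y) (mem x v)) ⟩
  ∑ xs (λ x → 𝟙 (x == y) + 𝟙 (mem x v))               ≡⟨ ∑-+ xs _ _ ⟩
  ∑ xs (λ x → 𝟙 (x == y)) + ∑ xs (λ x → 𝟙 (mem x v))  ≤⟨ +-mono-≤ (∑-== u y) (∑-mem u v) ⟩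
  1 + k ∎
  where open ≤-Reasoning

-- Union bound on the first entry: either it recurs among the k others, for at most k · L^k tuples,
-- or the others already contain a repetition. The factor L on the left replaces a truncated
-- exponent on the right.
∑-dup : ∀ {n} {xs : List (Fin n)} → Unique xs → ∀ k →
  ∑ (tuples xs k) (λ v → 𝟙 (dup v)) * length xs ≤ k * k * length xs ^ k
∑-dup u zero = z≤n
∑-dup {xs = xs} u (suc k) = begin
  ∑ (tuples xs (suc k)) (λ v → 𝟙 (dup v)) * L
    ≡⟨ cong (_* L) (∑-allTuples xs (replicate k xs) _) ⟩
  ∑ xs (λ x → ∑ (tuples xs k) (λ v → 𝟙 (mem x v ∨ dup v))) * L
    ≤⟨ *-monoˡ-≤ L (∑-mono xs (λ x → ∑-mono (tuples xs k) (λ v → 𝟙-∨ (mem x v) (dup v)))) ⟩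
  ∑ xs (λ x → ∑ (tuples xs k) (λ v → 𝟙 (mem x v) + 𝟙 (dup v))) * L
    ≡⟨ cong (_* L) (trans (∑-cong xs (λ x → ∑-+ (tuples xs k) _ _)) (∑-+ xs _ _)) ⟩
  (∑ xs (λ x → ∑ (tuples xs k) (λ v → 𝟙 (mem x v))) + ∑ xs (λ x → N)) * L
    ≤⟨ *-monoˡ-≤ L (+-mono-≤ members (≤-reflexive (∑-const xs N))) ⟩
  (L ^ k * k + L * N) * L
    ≡⟨ lemma (L ^ k) k L N ⟩
  k * (L * L ^ k) + L * (N * L)
    ≤⟨ +-monoʳ-≤ (k * (L * L ^ k)) (*-monoʳ-≤ L (∑-dup u k)) ⟩
  k * (L * L ^ k) + L * (k * k * L ^ k)
    ≤⟨ eq≤ ((k + 1) * (L * L ^ k)) (lemma₂ k L (L ^ k)) ⟩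
  suc k * suc k * L ^ suc k ∎
  where
  open ≤-Reasoning
  L = length xs
  N = ∑ (tuples xs k) (λ v → 𝟙 (dup v))
  members : ∑ xs (λ x → ∑ (tuples xs k) (λ v → 𝟙 (mem x v))) ≤ L ^ k * k
  members = begin
    ∑ xs (λ x → ∑ (tuples xs k) (λ v → 𝟙 (mem x v)))  ≡⟨ ∑-swap xs (tuples xs k) _ ⟩
    ∑ (tuples xs k) (λ v → ∑ xs (λ x → 𝟙 (mem x v)))  ≤⟨ ∑-≤const (tuples xs k) (∑-mem u) ⟩
    length (tuples xs k) * k                          ≡⟨ cong (_* k) (length-tuples xs k) ⟩
    L ^ k * k ∎
  lemma : ∀ a k L N → (a * k + L * N) * L ≡ k * (L * a) + L * (N * L)
  lemma = solve-∀
  lemma₂ : ∀ k L a → k * (L * a) + L * (k * k * a) + (k + 1) * (L * a) ≡ (1 + k) * (1 + k) * (L * a)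
  lemma₂ = solve-∀

-- The lower bound on |xs| excludes that the tuples with a repeated entry carry half of the mass.
common-neighbourhood : ∀ {n} {B : Set} (M k : ℕ) {xs : List (Fin n)} (ys : List B) (P : Fin n → B → Bool) →
  Unique xs → 1 ≤ length ys → 2 * k ^ suc M * (suc M * suc M) < length xs →
  length xs * length ys ≤ k * ∑ xs (λ x → ∑ ys (λ y → 𝟙 (P x y))) →
  Σ (Vec (Fin n) (suc M)) λ v → dup v ≡ false × length ys ≤ (2 * k ^ suc M) * ∑ ys (λ y → 𝟙 (allV (λ x → P x y) v))
common-neighbourhood {n} M k {xs} ys P u ys≥1 big dense = finish found
  where
  m = suc M
  L = length xs
  Y = length ys
  κ = 2 * k ^ m
  Z : Vec (Fin n) m → ℕ
  Z v = ∑ ys (λ y → 𝟙 (allV (λ x → P x y) v))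
  cnt = ∑ xs (λ x → ∑ ys (λ y → 𝟙 (P x y)))
  instance
    Y≢0 : NonZero Y
    Y≢0 = >-nonZero ys≥1
  Yᴹ≢0 : NonZero (Y ^ M)
  Yᴹ≢0 = m^n≢0 Y M
  mass : L ^ m * Y ≤ k ^ m * ∑ (tuples xs m) Z
  mass = *-cancelˡ-≤ (Y ^ M) {{Yᴹ≢0}} (begin
    Y ^ M * (L ^ m * Y)                        ≡⟨ e1 (Y ^ M) (L ^ m) Y ⟩
    L ^ m * Y ^ m                              ≡⟨ ^-distribʳ-* m L Y ⟨
    (L * Y) ^ m                                ≤⟨ ^-monoˡ-≤ m dense ⟩
    (k * cnt) ^ m                              ≡⟨ ^-distribʳ-* m k cnt ⟩
    k ^ m * cnt ^ m                            ≡⟨ cong (λ z → k ^ m * z ^ m) (∑-swap xs ys _) ⟩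
    k ^ m * ∑ ys (λ y → ∑ xs (λ x → 𝟙 (P x y))) ^ m
      ≤⟨ *-monoʳ-≤ (k ^ m) (power-mean-tuples ys xs (λ y x → P x y) M) ⟩
    k ^ m * (Y ^ M * ∑ (tuples xs m) Z)        ≡⟨ e2 (k ^ m) (Y ^ M) _ ⟩
    Y ^ M * (k ^ m * ∑ (tuples xs m) Z)        ∎)
    where
    open ≤-Reasoning
    e1 : ∀ a b c → a * (b * c) ≡ b * (c * a)
    e1 = solve-∀
    e2 : ∀ a b c → a * (b * c) ≡ b * (a * c)
    e2 = solve-∀
  dups : κ * ∑ (tuples xs m) (λ v → 𝟙 (dup v)) < L ^ m
  dups = *-cancelʳ-< L _ _ (begin-strict
    κ * ∑ (tuples xs m) (λ v → 𝟙 (dup v)) * L    ≡⟨ *-assoc κ _ L ⟩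
    κ * (∑ (tuples xs m) (λ v → 𝟙 (dup v)) * L)  ≤⟨ *-monoʳ-≤ κ (∑-dup u m) ⟩
    κ * (m * m * L ^ m)                          ≡⟨ *-assoc κ (m * m) _ ⟨
    κ * (m * m) * L ^ m                          <⟨ *-monoˡ-< (L ^ m) {{m^n≢0 L m {{>-nonZero (≤-trans (s≤s z≤n) big)}}}} big ⟩
    L * L ^ m                                    ≡⟨ *-comm L _ ⟩
    L ^ m * L                                    ∎)
    where open ≤-Reasoning
  -- The term with `dup` is a penalty: to win the average, a tuple with a repeated entry would need
  -- more than |Y| common neighbours.
  found : ∃ λ v → Y + κ * (Y * 𝟙 (dup v)) < 1 + κ * Z v
  found = ∑<⇒∃ (tuples xs m) (begin-strict
    ∑ (tuples xs m) (λ v → Y + κ * (Y * 𝟙 (dup v)))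
      ≡⟨ trans (∑-+ (tuples xs m) _ _) (cong₂ _+_ (trans (∑-const (tuples xs m) Y) (cong (_* Y) (length-tuples xs m)))
           (trans (∑-* (tuples xs m) κ _) (cong (κ *_) (∑-* (tuples xs m) Y _)))) ⟩
    L ^ m * Y + κ * (Y * D)
      ≡⟨ cong (L ^ m * Y +_) (e3 κ Y D) ⟩
    L ^ m * Y + κ * D * Y
      <⟨ +-monoʳ-< (L ^ m * Y) (*-monoˡ-< Y dups) ⟩
    L ^ m * Y + L ^ m * Y
      ≤⟨ +-mono-≤ mass mass ⟩
    k ^ m * ∑ (tuples xs m) Z + k ^ m * ∑ (tuples xs m) Z
      ≡⟨ e4 (k ^ m) _ ⟩
    κ * ∑ (tuples xs m) Z
      ≤⟨ m≤n+m _ (length (tuples xs m) * 1) ⟩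
    length (tuples xs m) * 1 + κ * ∑ (tuples xs m) Z
      ≡⟨ cong₂ _+_ (∑-const (tuples xs m) 1) (∑-* (tuples xs m) κ Z) ⟨
    ∑ (tuples xs m) (λ _ → 1) + ∑ (tuples xs m) (λ v → κ * Z v)
      ≡⟨ ∑-+ (tuples xs m) _ _ ⟨
    ∑ (tuples xs m) (λ v → 1 + κ * Z v) ∎)
    where
    open ≤-Reasoning
    D = ∑ (tuples xs m) (λ v → 𝟙 (dup v))
    e3 : ∀ a b c → a * (b * c) ≡ a * c * b
    e3 = solve-∀
    e4 : ∀ a b → a * b + a * b ≡ 2 * a * b
    e4 = solve-∀
  Z≤Y : ∀ v → Z v ≤ Y
  Z≤Y v = ≤-trans (∑-≤const ys (λ y → 𝟙≤1 _)) (≤-reflexive (*-identityʳ Y))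
  finish : (∃ λ v → Y + κ * (Y * 𝟙 (dup v)) < 1 + κ * Z v) → _
  finish (v , lt) with dup v in eq
  ... | false = v , eq , ≤-trans (m≤m+n Y _) (≤-pred lt)
  ... | true  = ⊥-elim (<⇒≱ lt (begin
    1 + κ * Z v       ≤⟨ +-mono-≤ ys≥1 (*-monoʳ-≤ κ (≤-trans (Z≤Y v) (≤-reflexive (sym (*-identityʳ Y))))) ⟩
    Y + κ * (Y * 1)   ∎))
    where open ≤-Reasoning

-- A complete r-partite pattern, nested so that it can be built one class at a time. Unfolding it
-- quantifies over the last class first, which is why witnesses taken from a box are applied in
-- reverse order.
Boxed : ∀ {n} (M r : ℕ) → (Vec (Fin n) r → Set) → Set
Boxed M zero    P = P []
Boxed {n} M (suc r) P = Σ (Fin M → Fin n) λ x → Injective _≡_ _≡_ x × Boxed M r (λ v → ∀ i → P (x i ∷ v))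

Boxed-map : ∀ {n} M r {P Q : Vec (Fin n) r → Set} → (∀ v → P v → Q v) → Boxed M r P → Boxed M r Q
Boxed-map M zero    h p            = h [] p
Boxed-map M (suc r) h (x , inj , b) = x , inj , Boxed-map M r (λ v p i → h (x i ∷ v) (p i)) b

opaque
  -- Fixing one class of M + 1 vertices lowers the density from 1/k to 1/(2k^(M+1)), and the lists
  -- must be long enough for every stage. Opaque, since these iterated powers must never be
  -- evaluated.
  boxSize : (M k r : ℕ) → ℕ
  boxSize M k zero    = 1
  boxSize M k (suc r) = suc (2 * k ^ suc M * (suc M * suc M)) ⊔ boxSize M (2 * k ^ suc M) r

  boxSize≥1 : ∀ M k r → 1 ≤ boxSize M k r
  boxSize≥1 M k zero    = ≤-refl
  boxSize≥1 M k (suc r) = ≤-trans (s≤s z≤n) (m≤m⊔n _ (boxSize M (2 * k ^ suc M) r))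

  boxSize-first : ∀ M k r → 2 * k ^ suc M * (suc M * suc M) < boxSize M k (suc r)
  boxSize-first M k r = m≤m⊔n _ (boxSize M (2 * k ^ suc M) r)

  boxSize-rest : ∀ M k r → boxSize M (2 * k ^ suc M) r ≤ boxSize M k (suc r)
  boxSize-rest M k r = m≤n⊔m (suc (2 * k ^ suc M * (suc M * suc M))) _

Large : ∀ {n r} → ℕ → Vec (List (Fin n)) r → Set
Large N []         = ⊤
Large N (xs ∷ xss) = (Unique xs × N ≤ length xs) × Large N xss

Large-mono : ∀ {n r N N′} → N ≤ N′ → (xss : Vec (List (Fin n)) r) → Large N′ xss → Large N xss
Large-mono le []         _              = tt
Large-mono le (xs ∷ xss) ((u , l) , ls) = (u , ≤-trans le l) , Large-mono le xss ls

Large-nonempty : ∀ {n r N} → 1 ≤ N → (xss : Vec (List (Fin n)) r) → Large N xss → 1 ≤ length (allTuples xss)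
Large-nonempty 1≤N []         _              = ≤-refl
Large-nonempty 1≤N (xs ∷ xss) ((u , l) , ls) = ≤-trans (*-mono-≤ (≤-trans 1≤N l) (Large-nonempty 1≤N xss ls))
  (≤-reflexive (sym (length-allTuples xs xss)))

-- Erdős's theorem on complete r-partite subgraphs, by induction on r: the common neighbourhood of
-- the vertices chosen from the first list is again a dense relation on the other lists. Only the
-- individual lengths of the lists matter, so one list may stay bounded while the others grow.
box : ∀ {n} (M k r : ℕ) (xss : Vec (List (Fin n)) r) (P : Vec (Fin n) r → Bool) →
  Large (boxSize M k r) xss → length (allTuples xss) ≤ k * ∑ (allTuples xss) (λ v → 𝟙 (P v)) →
  Boxed (suc M) r (λ v → P v ≡ true)
box M k zero [] P _ dense with P []
... | true  = refl
... | false = ⊥-elim (1+n≰n (≤-trans dense (≤-reflexive (*-zeroʳ k))))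
box {n} M k (suc r) (xs ∷ xss) P ((u , large) , larges) dense =
  let v , v-distinct , dense′ = common-neighbourhood M k (allTuples xss) (λ x w → P (x ∷ w)) u
        (Large-nonempty (boxSize≥1 M κ r) xss larges′) (≤-trans (boxSize-first M k r) large)
        (≤-trans (≤-reflexive (sym (length-allTuples xs xss)))
          (≤-trans dense (≤-reflexive (cong (k *_) (∑-allTuples xs xss _)))))
  in lookup v , dup-false v v-distinct ,
     Boxed-map (suc M) r (λ w e → allV-lookup (λ x → P (x ∷ w)) v e)
       (box M κ r xss (λ w → allV (λ x → P (x ∷ w)) v) larges′ dense′)
  where
  κ = 2 * k ^ suc M
  larges′ : Large (boxSize M κ r) xss
  larges′ = Large-mono (boxSize-rest M k r) xss larges

-- Embedding F₅ˢ

≡ᵇ-sym : ∀ a b → (a ≡ᵇ b) ≡ (b ≡ᵇ a)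
≡ᵇ-sym zero    zero    = refl
≡ᵇ-sym zero    (suc b) = refl
≡ᵇ-sym (suc a) zero    = refl
≡ᵇ-sym (suc a) (suc b) = ≡ᵇ-sym a b

≡ᵇ-refl : ∀ a → (a ≡ᵇ a) ≡ true
≡ᵇ-refl zero    = refl
≡ᵇ-refl (suc a) = ≡ᵇ-refl a

≡ᵇ-true : ∀ a b → (a ≡ᵇ b) ≡ true → a ≡ b
≡ᵇ-true zero    zero    _ = refl
≡ᵇ-true (suc a) (suc b) p = cong suc (≡ᵇ-true a b p)

≢⇒≡ᵇ-false : ∀ a b → a ≢ b → (a ≡ᵇ b) ≡ false
≢⇒≡ᵇ-false a b a≢b with a ≡ᵇ b in eq
... | false = refl
... | true  = ⊥-elim (a≢b (≡ᵇ-true a b eq))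

<⇒<ᵇ-true : ∀ {a b} → a < b → (a <ᵇ b) ≡ true
<⇒<ᵇ-true {zero}  {suc b} _       = refl
<⇒<ᵇ-true {suc a} {suc b} (s≤s p) = <⇒<ᵇ-true {a} {b} p

≤⇒<ᵇ-false : ∀ {a b} → b ≤ a → (a <ᵇ b) ≡ false
≤⇒<ᵇ-false {a}     {zero}  _       = refl
≤⇒<ᵇ-false {suc a} {suc b} (s≤s p) = ≤⇒<ᵇ-false {a} {b} p

<ᵇ-true : ∀ a b → (a <ᵇ b) ≡ true → a < b
<ᵇ-true zero    (suc b) _ = s≤s z≤n
<ᵇ-true (suc a) (suc b) p = s≤s (<ᵇ-true a b p)

<ᵇ-false : ∀ a b → (a <ᵇ b) ≡ false → b ≤ a
<ᵇ-false a       zero    _ = z≤n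
<ᵇ-false (suc a) (suc b) p = s≤s (<ᵇ-false a b p)

∨-true : ∀ {a b} → a ∨ b ≡ true → a ≡ true ⊎ b ≡ true
∨-true {true}  _ = inj₁ refl
∨-true {false} p = inj₂ p

∨-introˡ : ∀ {a b} → a ≡ true → a ∨ b ≡ true
∨-introˡ refl = refl

∨-introʳ : ∀ {a b} → b ≡ true → a ∨ b ≡ true
∨-introʳ {true}  _ = refl
∨-introʳ {false} p = p

not-true : ∀ {a} → not a ≡ true → a ≡ false
not-true {false} _ = refl

neq-sym : ∀ a b → neq a b ≡ neq b a
neq-sym a b = cong not (≡ᵇ-sym a b)

neq-intro : ∀ {a b} → a ≢ b → neq a b ≡ true
neq-intro {a} {b} p = cong not (≢⇒≡ᵇ-false a b p)

neq-elim : ∀ {a b} → neq a b ≡ true → a ≢ b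
neq-elim {a} p refl with trans (sym p) (cong not (≡ᵇ-refl a))
... | ()

distinct3-intro : ∀ {a b c} → a ≢ b → b ≢ c → a ≢ c → distinct3 a b c ≡ true
distinct3-intro p q r = ∧-true (neq-intro p) (∧-true (neq-intro q) (neq-intro r))

distinct3-elim : ∀ {a b c} → distinct3 a b c ≡ true → a ≢ b × b ≢ c × a ≢ c
distinct3-elim {a} {b} {c} p = neq-elim (∧-trueˡ p) ,
  neq-elim (∧-trueˡ (∧-trueʳ {neq a b} p)) , neq-elim (∧-trueʳ {neq b c} (∧-trueʳ {neq a b} p))

distinct3-swap₁₂ : ∀ a b c → distinct3 a b c ≡ distinct3 b a c
distinct3-swap₁₂ a b c rewrite neq-sym a b = cong (neq b a ∧_) (∧-comm (neq b c) (neq a c))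

distinct3-swap₂₃ : ∀ a b c → distinct3 a b c ≡ distinct3 a c b
distinct3-swap₂₃ a b c rewrite neq-sym b c = lemma (neq a b) (neq c b) (neq a c)
  where lemma : ∀ x y z → x ∧ y ∧ z ≡ z ∧ y ∧ x
        lemma true  y     true  = refl
        lemma true  true  false = refl
        lemma true  false false = refl
        lemma false true  true  = refl
        lemma false false true  = refl
        lemma false y     false = refl

edge?-swap₁₂ : ∀ {n} (E : Graph3 n) x y z → edge? E x y z ≡ edge? E y x z
edge?-swap₁₂ E x y z = cong₂ _∧_ (distinct3-swap₁₂ (toℕ x) (toℕ y) (toℕ z))
  (lemma (E x y z) (E x z y) (E y x z) (E y z x) (E z x y) (E z y x))
  where lemma : ∀ a b c d f g → a ∨ b ∨ c ∨ d ∨ f ∨ g ≡ c ∨ d ∨ a ∨ b ∨ g ∨ f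
        lemma true  b     true  d     f     g     = refl
        lemma true  b     false true  f     g     = refl
        lemma true  b     false false f     g     = refl
        lemma false true  true  d     f     g     = refl
        lemma false true  false true  f     g     = refl
        lemma false true  false false f     g     = refl
        lemma false false true  d     f     g     = refl
        lemma false false false true  f     g     = refl
        lemma false false false false true  true  = refl
        lemma false false false false true  false = refl
        lemma false false false false false true  = refl
        lemma false false false false false false = refl

edge?-swap₂₃ : ∀ {n} (E : Graph3 n) x y z → edge? E x y z ≡ edge? E x z y
edge?-swap₂₃ E x y z = cong₂ _∧_ (distinct3-swap₂₃ (toℕ x) (toℕ y) (toℕ z))
  (lemma (E x y z) (E x z y) (E y x z) (E y z x) (E z x y) (E z y x))
  where lemma : ∀ a b c d f g → a ∨ b ∨ c ∨ d ∨ f ∨ g ≡ b ∨ a ∨ f ∨ g ∨ c ∨ d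
        lemma true  true  c     d     f     g     = refl
        lemma true  false c     d     f     g     = refl
        lemma false true  c     d     f     g     = refl
        lemma false false true  d     true  g     = refl
        lemma false false true  d     false true  = refl
        lemma false false true  d     false false = refl
        lemma false false false true  true  g     = refl
        lemma false false false true  false true  = refl
        lemma false false false true  false false = refl
        lemma false false false false true  g     = refl
        lemma false false false false false true  = refl
        lemma false false false false false false = refl

edge?-distinct : ∀ {n} (E : Graph3 n) {x y z} → edge? E x y z ≡ true → x ≢ y × y ≢ z × x ≢ z
edge?-distinct E p with distinct3-elim (∧-trueˡ p)
... | q₁ , q₂ , q₃ = q₁ ∘ cong toℕ , q₂ ∘ cong toℕ , q₃ ∘ cong toℕ

edge?-intro : ∀ {n} (E : Graph3 n) {x y z} → x ≢ y → y ≢ z → x ≢ z → E x y z ≡ true → edge? E x y z ≡ true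
edge?-intro E p q r h = ∧-true (distinct3-intro (p ∘ toℕ-injective) (q ∘ toℕ-injective) (r ∘ toℕ-injective)) (∨-introˡ h)

-- A property of ordered triples invariant under permutations, checked on the ordering for which E holds.
edge?-elim : ∀ {n} (E : Graph3 n) (R : Fin n → Fin n → Fin n → Set) →
  (∀ {x y z} → R x y z → R y x z) → (∀ {x y z} → R x y z → R x z y) →
  (∀ {x y z} → E x y z ≡ true → R x y z) → ∀ x y z → edge? E x y z ≡ true → R x y z
edge?-elim E R s₁₂ s₂₃ h x y z p with ∨-true (∧-trueʳ {distinct3 (toℕ x) (toℕ y) (toℕ z)} p)
... | inj₁ q = h q
... | inj₂ q with ∨-true q
... | inj₁ q = s₂₃ (h q)
... | inj₂ q with ∨-true q
... | inj₁ q = s₁₂ (h q)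
... | inj₂ q with ∨-true q
... | inj₁ q = s₁₂ (s₂₃ (h q))
... | inj₂ q with ∨-true q
... | inj₁ q = s₂₃ (s₁₂ (h q))
... | inj₂ q = s₁₂ (s₂₃ (s₁₂ (h q)))

module _ {n : ℕ} (H : Graph3 n) where
  IsEdge-swap₁₂ : ∀ {x y z} → IsEdge H x y z → IsEdge H y x z
  IsEdge-swap₁₂ {x} {y} {z} p = trans (sym (edge?-swap₁₂ H x y z)) p

  IsEdge-swap₂₃ : ∀ {x y z} → IsEdge H x y z → IsEdge H x z y
  IsEdge-swap₂₃ {x} {y} {z} p = trans (sym (edge?-swap₂₃ H x y z)) p

cong₃ : ∀ (f : ℕ → ℕ → ℕ → Bool) {a a′ b b′ c c′} → a ≡ a′ → b ≡ b′ → c ≡ c′ → f a b c ≡ f a′ b′ c′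
cong₃ f refl refl refl = refl

-- A vertex of `F5S` by its role. Cases on roles replace arithmetic with remainders and quotients of
-- vertex numbers.
data Place (m t : ℕ) : Set where
  old : Fin 3 → Fin m → Place m t
  new : Fin t → Place m t

code : ∀ {m t} → Place m t → ℕ
code {m} (old r i) = toℕ r + toℕ i * 3
code {m} (new l)   = 3 * m + toℕ l

place : ∀ {m t} k → k < 3 * m + t → Σ (Place m t) λ p → code p ≡ k
place {m} {t} k k< with k <? 3 * m
... | yes p = old (fromℕ< (m%n<n k 3)) (fromℕ< (m<n*o⇒m/o<n (subst (k <_) (*-comm 3 m) p))) ,
      trans (cong₂ (λ a b → a + b * 3) (toℕ-fromℕ< (m%n<n k 3)) (toℕ-fromℕ< (m<n*o⇒m/o<n (subst (k <_) (*-comm 3 m) p)))) (sym (m≡m%n+[m/n]*n k 3))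
... | no ¬p with m≤n⇒∃[o]m+o≡n (≮⇒≥ ¬p)
... | o , refl = new (fromℕ< o<t) , cong (3 * m +_) (toℕ-fromℕ< o<t)
  where o<t : o < t
        o<t = +-cancelˡ-< (3 * m) o t k<

code-old< : ∀ {m} (r : Fin 3) (i : Fin m) → toℕ r + toℕ i * 3 < 3 * m
code-old< {m} r i = begin-strict
  toℕ r + toℕ i * 3  <⟨ +-monoˡ-< (toℕ i * 3) (toℕ<n r) ⟩
  suc (toℕ i) * 3    ≤⟨ *-monoˡ-≤ 3 (toℕ<n i) ⟩
  m * 3              ≡⟨ *-comm m 3 ⟩
  3 * m              ∎
  where open ≤-Reasoning

code-% : ∀ (r : Fin 3) i → (toℕ r + i * 3) % 3 ≡ toℕ r
code-% r i = trans ([m+kn]%n≡m%n (toℕ r) i 3) (m<n⇒m%n≡m (toℕ<n r))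

code-/ : ∀ (r : Fin 3) i → (toℕ r + i * 3) / 3 ≡ i
code-/ r i = begin
  (toℕ r + i * 3) / 3      ≡⟨ +-distrib-/-∣ʳ (toℕ r) (divides i refl) ⟩
  toℕ r / 3 + i * 3 / 3    ≡⟨ cong₂ _+_ (m<n⇒m/n≡0 (toℕ<n r)) (m*n/n≡m i 3) ⟩
  i                        ∎
  where open ≡-Reasoning

-- The distinctness assumptions are those that no hyperedge supplies; for instance S₀ and S₁ are
-- disjoint because each of their pairs lies in an edge with some τ. X is indexed by all positions
-- of its part, so that a position i ≥ 2s is sent to X i without renumbering.
module Embedding {m t s n : ℕ} (1≤t : 1 ≤ t) (1≤s : 1 ≤ s) (4≤2s : 4 ≤ 2 * s) (2s≤m : 2 * s ≤ m) (H : Graph3 n)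
  (S₀ S₁ : Fin s → Fin n) (X U W : Fin m → Fin n) (τ : Fin t → Fin n)
  (S₀-inj : Injective _≡_ _≡_ S₀) (S₁-inj : Injective _≡_ _≡_ S₁) (X-inj : Injective _≡_ _≡_ X)
  (U-inj : Injective _≡_ _≡_ U) (W-inj : Injective _≡_ _≡_ W) (τ-inj : Injective _≡_ _≡_ τ)
  (X≢S₀ : ∀ i j → X i ≢ S₀ j) (X≢S₁ : ∀ i j → X i ≢ S₁ j) (X≢τ : ∀ i j → X i ≢ τ j)
  (U≢τ : ∀ i j → U i ≢ τ j) (W≢τ : ∀ i j → W i ≢ τ j)
  (τS₀S₁ : ∀ l i j → IsEdge H (τ l) (S₀ i) (S₁ j))
  (S₀UW : ∀ i j k → IsEdge H (S₀ i) (U j) (W k)) (S₁UW : ∀ i j k → IsEdge H (S₁ i) (U j) (W k))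
  (XUW : ∀ i j k → IsEdge H (X i) (U j) (W k))
  where

  private
    0ₜ : Fin t
    0ₜ = fromℕ< 1≤t
    0ₘ : Fin m
    0ₘ = fromℕ< (≤-trans (s≤s z≤n) (≤-trans 4≤2s 2s≤m))

  S₀≢S₁ : ∀ i j → S₀ i ≢ S₁ j
  S₀≢S₁ i j = proj₁ (proj₂ (edge?-distinct H (τS₀S₁ 0ₜ i j)))

  0ₛ : Fin s
  0ₛ = fromℕ< 1≤s

  -- A relation between position and image rather than a function, so that injectivity is a case
  -- analysis on two derivations and the comparisons inside `part` need not be unfolded.
  data Part (i : Fin m) : Fin n → Set where
    first  : ∀ j → toℕ j ≡ toℕ i → Part i (S₀ j)
    second : ∀ j → s + toℕ j ≡ toℕ i → Part i (S₁ j)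
    third  : 2 * s ≤ toℕ i → Part i (X i)

  part : ∀ i → Σ (Fin n) (Part i)
  part i with toℕ i <? s
  ... | yes p = S₀ (fromℕ< p) , first _ (toℕ-fromℕ< p)
  ... | no ¬p with toℕ i <? 2 * s
  ... | no ¬q = X i , third (≮⇒≥ ¬q)
  ... | yes q with m≤n⇒∃[o]m+o≡n (≮⇒≥ ¬p)
  ... | o , eq = S₁ (fromℕ< o<s) , second _ (trans (cong (s +_) (toℕ-fromℕ< o<s)) eq)
    where o<s : o < s
          o<s = +-cancelˡ-< s o s (subst₂ _<_ (sym eq) (cong (s +_) (+-identityʳ s)) q)

  P : Fin m → Fin n
  P i = proj₁ (part i)

  Part-inj : ∀ {i j x} → Part i x → Part j x → i ≡ j
  Part-inj p q = go p q refl
    where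
    go : ∀ {i j x y} → Part i x → Part j y → x ≡ y → i ≡ j
    go (first a p)  (first b q)  e′ = toℕ-injective (trans (sym p) (trans (cong toℕ (S₀-inj e′)) q))
    go (first a p)  (second b q) e′ = ⊥-elim (S₀≢S₁ a b e′)
    go (first a p)  (third q)    e′ = ⊥-elim (X≢S₀ _ a (sym e′))
    go (second a p) (first b q)  e′ = ⊥-elim (S₀≢S₁ b a (sym e′))
    go (second a p) (second b q) e′ = toℕ-injective (trans (sym p) (trans (cong (λ z → s + toℕ z) (S₁-inj e′)) q))
    go (second a p) (third q)    e′ = ⊥-elim (X≢S₁ _ a (sym e′))
    go (third p)    (first b q)  e′ = ⊥-elim (X≢S₀ _ b e′)
    go (third p)    (second b q) e′ = ⊥-elim (X≢S₁ _ b e′)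
    go (third p)    (third q)    e′ = X-inj e′

  P-inj : Injective _≡_ _≡_ P
  P-inj {i} {j} eq = Part-inj (proj₂ (part i)) (subst (Part j) (sym eq) (proj₂ (part j)))

  PUW : ∀ i j k → IsEdge H (P i) (U j) (W k)
  PUW i j k with part i
  ... | _ , first a _  = S₀UW a j k
  ... | _ , second a _ = S₁UW a j k
  ... | _ , third _    = XUW i j k

  P≢τ : ∀ i l → P i ≢ τ l
  P≢τ i l with part i
  ... | _ , first a _  = λ p → proj₁ (edge?-distinct H (τS₀S₁ l a 0ₛ)) (sym p)
  ... | _ , second a _ = λ p → proj₂ (proj₂ (edge?-distinct H (τS₀S₁ l 0ₛ a))) (sym p)
  ... | _ , third _    = X≢τ i l

  τPP : ∀ l i j → toℕ i < s → s ≤ toℕ j → toℕ j < 2 * s → IsEdge H (τ l) (P i) (P j)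
  τPP l i j i<s s≤j j<2s with part i | part j
  ... | _ , first a _  | _ , second b _ = τS₀S₁ l a b
  ... | _ , first a _  | _ , first b q  = ⊥-elim (<⇒≱ (subst (_< s) q (toℕ<n b)) s≤j)
  ... | _ , _          | _ , third q    = ⊥-elim (<⇒≱ j<2s q)
  ... | _ , second a p | _ , _          = ⊥-elim (<⇒≱ i<s (subst (s ≤_) p (m≤m+n s _)))
  ... | _ , third p    | _ , _          = ⊥-elim (<⇒≱ i<s (≤-trans (m≤m+n s _) p))

  image : Place m t → Fin n
  image (old fzero i)               = P i
  image (old (fsuc fzero) i)        = U i
  image (old (fsuc (fsuc fzero)) i) = W i
  image (new l)                     = τ l

  P≢U : ∀ i j → P i ≢ U j
  P≢U i j = proj₁ (edge?-distinct H (PUW i j 0ₘ))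

  P≢W : ∀ i j → P i ≢ W j
  P≢W i j = proj₂ (proj₂ (edge?-distinct H (PUW i 0ₘ j)))

  U≢W : ∀ i j → U i ≢ W j
  U≢W i j = proj₁ (proj₂ (edge?-distinct H (PUW 0ₘ i j)))

  image-inj : ∀ p q → image p ≡ image q → p ≡ q
  image-inj (old fzero i) (old fzero j) eq = cong (old fzero) (P-inj eq)
  image-inj (old fzero i) (old (fsuc fzero) j) eq = ⊥-elim (P≢U i j eq)
  image-inj (old fzero i) (old (fsuc (fsuc fzero)) j) eq = ⊥-elim (P≢W i j eq)
  image-inj (old fzero i) (new l) eq = ⊥-elim (P≢τ i l eq)
  image-inj (old (fsuc fzero) i) (old fzero j) eq = ⊥-elim (P≢U j i (sym eq))
  image-inj (old (fsuc fzero) i) (old (fsuc fzero) j) eq = cong (old (fsuc fzero)) (U-inj eq)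
  image-inj (old (fsuc fzero) i) (old (fsuc (fsuc fzero)) j) eq = ⊥-elim (U≢W i j eq)
  image-inj (old (fsuc fzero) i) (new l) eq = ⊥-elim (U≢τ i l eq)
  image-inj (old (fsuc (fsuc fzero)) i) (old fzero j) eq = ⊥-elim (P≢W j i (sym eq))
  image-inj (old (fsuc (fsuc fzero)) i) (old (fsuc fzero) j) eq = ⊥-elim (U≢W j i (sym eq))
  image-inj (old (fsuc (fsuc fzero)) i) (old (fsuc (fsuc fzero)) j) eq = cong (old (fsuc (fsuc fzero))) (W-inj eq)
  image-inj (old (fsuc (fsuc fzero)) i) (new l) eq = ⊥-elim (W≢τ i l eq)
  image-inj (new l) (old fzero j) eq = ⊥-elim (P≢τ j l (sym eq))
  image-inj (new l) (old (fsuc fzero) j) eq = ⊥-elim (U≢τ j l (sym eq))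
  image-inj (new l) (old (fsuc (fsuc fzero)) j) eq = ⊥-elim (W≢τ j l (sym eq))
  image-inj (new l) (new k) eq = cong new (τ-inj eq)

  pl : Fin (3 * m + t) → Place m t
  pl x = proj₁ (place {m} {t} (toℕ x) (toℕ<n x))

  code-pl : ∀ x → code (pl x) ≡ toℕ x
  code-pl x = proj₂ (place {m} {t} (toℕ x) (toℕ<n x))

  φ : Fin (3 * m + t) → Fin n
  φ x = image (pl x)

  φ-inj : Injective _≡_ _≡_ φ
  φ-inj {x} {y} eq = toℕ-injective (begin
    toℕ x         ≡⟨ code-pl x ⟨
    code (pl x)   ≡⟨ cong code (image-inj (pl x) (pl y) eq) ⟩
    code (pl y)   ≡⟨ code-pl y ⟩
    toℕ y         ∎)
    where open ≡-Reasoning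

  rainbow : ∀ r₁ r₂ r₃ i j k → toℕ r₁ ≢ toℕ r₂ → toℕ r₂ ≢ toℕ r₃ → toℕ r₁ ≢ toℕ r₃ →
    IsEdge H (image (old r₁ i)) (image (old r₂ j)) (image (old r₃ k))
  rainbow fzero fzero _ i j k p q r = ⊥-elim (p refl)
  rainbow fzero (fsuc fzero) fzero i j k p q r = ⊥-elim (r refl)
  rainbow fzero (fsuc fzero) (fsuc fzero) i j k p q r = ⊥-elim (q refl)
  rainbow fzero (fsuc fzero) (fsuc (fsuc fzero)) i j k p q r = PUW i j k
  rainbow fzero (fsuc (fsuc fzero)) fzero i j k p q r = ⊥-elim (r refl)
  rainbow fzero (fsuc (fsuc fzero)) (fsuc fzero) i j k p q r = IsEdge-swap₂₃ H (PUW i k j)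
  rainbow fzero (fsuc (fsuc fzero)) (fsuc (fsuc fzero)) i j k p q r = ⊥-elim (q refl)
  rainbow (fsuc fzero) fzero fzero i j k p q r = ⊥-elim (q refl)
  rainbow (fsuc fzero) fzero (fsuc fzero) i j k p q r = ⊥-elim (r refl)
  rainbow (fsuc fzero) fzero (fsuc (fsuc fzero)) i j k p q r = IsEdge-swap₁₂ H (PUW j i k)
  rainbow (fsuc fzero) (fsuc fzero) _ i j k p q r = ⊥-elim (p refl)
  rainbow (fsuc fzero) (fsuc (fsuc fzero)) fzero i j k p q r = IsEdge-swap₂₃ H (IsEdge-swap₁₂ H (PUW k i j))
  rainbow (fsuc fzero) (fsuc (fsuc fzero)) (fsuc fzero) i j k p q r = ⊥-elim (r refl)
  rainbow (fsuc fzero) (fsuc (fsuc fzero)) (fsuc (fsuc fzero)) i j k p q r = ⊥-elim (q refl)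
  rainbow (fsuc (fsuc fzero)) fzero fzero i j k p q r = ⊥-elim (q refl)
  rainbow (fsuc (fsuc fzero)) fzero (fsuc fzero) i j k p q r = IsEdge-swap₁₂ H (IsEdge-swap₂₃ H (PUW j k i))
  rainbow (fsuc (fsuc fzero)) fzero (fsuc (fsuc fzero)) i j k p q r = ⊥-elim (r refl)
  rainbow (fsuc (fsuc fzero)) (fsuc fzero) fzero i j k p q r = IsEdge-swap₁₂ H (IsEdge-swap₂₃ H (IsEdge-swap₁₂ H (PUW k j i)))
  rainbow (fsuc (fsuc fzero)) (fsuc fzero) (fsuc fzero) i j k p q r = ⊥-elim (q refl)
  rainbow (fsuc (fsuc fzero)) (fsuc fzero) (fsuc (fsuc fzero)) i j k p q r = ⊥-elim (r refl)
  rainbow (fsuc (fsuc fzero)) (fsuc (fsuc fzero)) _ i j k p q r = ⊥-elim (p refl)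

  inOld⇒old : ∀ (p : Place m t) → inOld m (code p) ≡ true →
    Σ (Fin 3) λ r → Σ (Fin m) λ i → p ≡ old r i × code p % 3 ≡ toℕ r × code p / 3 ≡ toℕ i
  inOld⇒old (old r i) _ = r , i , refl , code-% r (toℕ i) , code-/ r (toℕ i)
  inOld⇒old (new l)   h = ⊥-elim (<⇒≱ (<ᵇ-true (3 * m + toℕ l) (3 * m) h) (m≤m+n (3 * m) _))

  inT⇒new : ∀ (p : Place m t) → inT m (code p) ≡ true → Σ (Fin t) λ l → p ≡ new l
  inT⇒new (new l)   _ = l , refl
  inT⇒new (old r i) h with trans (sym h) (cong not (<⇒<ᵇ-true (code-old< r i)))
  ... | ()

  residue-zero : ∀ (r : Fin 3) (x : ℕ) → x % 3 ≡ toℕ r → (x % 3 ≡ᵇ 0) ≡ true → r ≡ fzero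
  residue-zero r x p q = toℕ-injective (trans (sym p) (≡ᵇ-true (x % 3) 0 q))

  image-edge : ∀ p q r →
    ((inOld m (code p) ∧ inOld m (code q) ∧ inOld m (code r) ∧ distinct3 (code p % 3) (code q % 3) (code r % 3))
      ∨ (inT m (code p) ∧ inS0 m s (code q) ∧ inS1 m s (code r))) ≡ true →
    IsEdge H (image p) (image q) (image r)
  image-edge p q r h with ∨-true h
  ... | inj₁ h₁ with inOld⇒old p (∧-trueˡ h₁) | inOld⇒old q (∧-trueˡ (∧-trueʳ {inOld m (code p)} h₁))
                   | inOld⇒old r (∧-trueˡ (∧-trueʳ {inOld m (code q)} (∧-trueʳ {inOld m (code p)} h₁)))
                   | distinct3-elim {code p % 3} {code q % 3} {code r % 3} (∧-trueʳ {inOld m (code r)} (∧-trueʳ {inOld m (code q)} (∧-trueʳ {inOld m (code p)} h₁)))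
  ... | a , i , refl , ea , _ | b , j , refl , eb , _ | c , k , refl , ec , _ | d₁ , d₂ , d₃ =
    rainbow a b c i j k (λ z → d₁ (trans ea (trans z (sym eb)))) (λ z → d₂ (trans eb (trans z (sym ec))))
      (λ z → d₃ (trans ea (trans z (sym ec))))
  image-edge p q r h | inj₂ h₂
    with inT⇒new p (∧-trueˡ h₂)
       | inOld⇒old q (∧-trueˡ (∧-trueˡ (∧-trueʳ {inT m (code p)} h₂)))
       | inOld⇒old r (∧-trueˡ (∧-trueʳ {inS0 m s (code q)} (∧-trueʳ {inT m (code p)} h₂)))
       | ∧-trueʳ {inOld m (code q)} (∧-trueˡ (∧-trueʳ {inT m (code p)} h₂))
       | ∧-trueʳ {inOld m (code r)} (∧-trueʳ {inS0 m s (code q)} (∧-trueʳ {inT m (code p)} h₂))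
  ... | l , refl | b , j , refl , eb , fb | c , k , refl , ec , fc | hq | hr
    with residue-zero b (code q) eb (∧-trueˡ hq) | residue-zero c (code r) ec (∧-trueˡ hr)
  ... | refl | refl =
    τPP l j k (subst (_< s) fb (<ᵇ-true (code q / 3) s (∧-trueʳ {code q % 3 ≡ᵇ 0} hq)))
      (subst (s ≤_) fc (<ᵇ-false (code r / 3) s (not-true (∧-trueˡ (∧-trueʳ {code r % 3 ≡ᵇ 0} hr)))))
      (subst (_< 2 * s) fc (<ᵇ-true (code r / 3) (2 * s)
        (∧-trueʳ {not (code r / 3 <ᵇ s)} (∧-trueʳ {code r % 3 ≡ᵇ 0} hr))))

  embedded : Contains (F5S m t s) H
  embedded = φ , (λ {x} {y} → φ-inj {x} {y}) ,
    edge?-elim (F5S m t s) (λ x y z → IsEdge H (φ x) (φ y) (φ z)) (IsEdge-swap₁₂ H) (IsEdge-swap₂₃ H) edge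
    where
    edge : ∀ {x y z} → F5S m t s x y z ≡ true → IsEdge H (φ x) (φ y) (φ z)
    edge {x} {y} {z} h = image-edge (pl x) (pl y) (pl z) (trans (cong₃ at (code-pl x) (code-pl y) (code-pl z)) h)
      where
      at : ℕ → ℕ → ℕ → Bool
      at a b c = (inOld m a ∧ inOld m b ∧ inOld m c ∧ distinct3 (a % 3) (b % 3) (c % 3))
        ∨ (inT m a ∧ inS0 m s b ∧ inS1 m s c)

-- Consequences of being F₅ˢ-free

opaque
  -- Opaque, so that nested sums keep their shape and equations between them are solved by comparing
  -- summands.
  ∑₁ : ∀ {n} → (Fin n → ℕ) → ℕ
  ∑₁ {n} f = ∑ (allFin n) f

∑₂ : ∀ {n} → (Fin n → Fin n → ℕ) → ℕ
∑₂ f = ∑₁ λ a → ∑₁ (f a)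

∑₃ : ∀ {n} → (Fin n → Fin n → Fin n → ℕ) → ℕ
∑₃ f = ∑₁ λ a → ∑₂ (f a)

∑₄ : ∀ {n} → (Fin n → Fin n → Fin n → Fin n → ℕ) → ℕ
∑₄ f = ∑₁ λ a → ∑₃ (f a)

module _ {n : ℕ} where
  private V = allFin n

  opaque
    unfolding ∑₁

    ∑-allFin : ∀ {f g : Fin n → ℕ} → (∀ a → f a ≡ g a) → ∑ V f ≡ ∑₁ g
    ∑-allFin = ∑-cong V

    ∑₁-mono : ∀ {f g : Fin n → ℕ} → (∀ a → f a ≤ g a) → ∑₁ f ≤ ∑₁ g
    ∑₁-mono = ∑-mono V

    ∑₁-cong : ∀ {f g : Fin n → ℕ} → (∀ a → f a ≡ g a) → ∑₁ f ≡ ∑₁ g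
    ∑₁-cong = ∑-cong V

    ∑₁-+ : ∀ (f g : Fin n → ℕ) → ∑₁ (λ a → f a + g a) ≡ ∑₁ f + ∑₁ g
    ∑₁-+ = ∑-+ V

    ∑₁-* : ∀ c (f : Fin n → ℕ) → ∑₁ (λ a → c * f a) ≡ c * ∑₁ f
    ∑₁-* = ∑-* V

    ∑₁-*ʳ : ∀ c (f : Fin n → ℕ) → ∑₁ (λ a → f a * c) ≡ ∑₁ f * c
    ∑₁-*ʳ = ∑-*ʳ V

    ∑₁-const : ∀ c → ∑₁ {n} (λ _ → c) ≡ n * c
    ∑₁-const c = trans (∑-const V c) (cong (_* c) (length-allFin n))

    ∑₁-== : ∀ (x : Fin n) → ∑₁ (λ y → 𝟙 (y == x)) ≤ 1
    ∑₁-== = ∑-== (allFin⁺ n)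

    ∑₁<⇒∃ : ∀ {f g : Fin n → ℕ} → ∑₁ f < ∑₁ g → ∃ λ x → f x < g x
    ∑₁<⇒∃ = ∑<⇒∃ V

    ∑₁-swap : ∀ {k} (f : Fin n → Fin k → ℕ) → ∑₁ (λ a → ∑₁ (f a)) ≡ ∑₁ (λ b → ∑₁ λ a → f a b)
    ∑₁-swap {k} = ∑-swap V (allFin k)

    ∑-∑₁-swap : ∀ {A : Set} (xs : List A) (f : A → Fin n → ℕ) → ∑ xs (λ x → ∑₁ (f x)) ≡ ∑₁ (λ b → ∑ xs λ x → f x b)
    ∑-∑₁-swap xs = ∑-swap xs V

    ∑₁-suc : ∀ (f : Fin (suc n) → ℕ) → ∑₁ f ≡ f fzero + ∑₁ (λ x → f (fsuc x))
    ∑₁-suc = ∑-allFin-suc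

  ∑₂-mono : ∀ {f g : Fin n → Fin n → ℕ} → (∀ a b → f a b ≤ g a b) → ∑₂ f ≤ ∑₂ g
  ∑₂-mono h = ∑₁-mono λ a → ∑₁-mono (h a)

  ∑₃-mono : ∀ {f g : Fin n → Fin n → Fin n → ℕ} → (∀ a b c → f a b c ≤ g a b c) → ∑₃ f ≤ ∑₃ g
  ∑₃-mono h = ∑₁-mono λ a → ∑₂-mono (h a)

  ∑₂-cong : ∀ {f g : Fin n → Fin n → ℕ} → (∀ a b → f a b ≡ g a b) → ∑₂ f ≡ ∑₂ g
  ∑₂-cong h = ∑₁-cong λ a → ∑₁-cong (h a)

  ∑₃-cong : ∀ {f g : Fin n → Fin n → Fin n → ℕ} → (∀ a b c → f a b c ≡ g a b c) → ∑₃ f ≡ ∑₃ g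
  ∑₃-cong h = ∑₁-cong λ a → ∑₂-cong (h a)

  ∑₂-+ : ∀ (f g : Fin n → Fin n → ℕ) → ∑₂ (λ a b → f a b + g a b) ≡ ∑₂ f + ∑₂ g
  ∑₂-+ f g = trans (∑₁-cong λ a → ∑₁-+ (f a) (g a)) (∑₁-+ _ _)

  ∑₃-+ : ∀ (f g : Fin n → Fin n → Fin n → ℕ) → ∑₃ (λ a b c → f a b c + g a b c) ≡ ∑₃ f + ∑₃ g
  ∑₃-+ f g = trans (∑₁-cong λ a → ∑₂-+ (f a) (g a)) (∑₁-+ _ _)

  ∑₂-* : ∀ c (f : Fin n → Fin n → ℕ) → ∑₂ (λ a b → c * f a b) ≡ c * ∑₂ f
  ∑₂-* c f = trans (∑₁-cong λ a → ∑₁-* c (f a)) (∑₁-* c _)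

  ∑₃-* : ∀ c (f : Fin n → Fin n → Fin n → ℕ) → ∑₃ (λ a b d → c * f a b d) ≡ c * ∑₃ f
  ∑₃-* c f = trans (∑₁-cong λ a → ∑₂-* c (f a)) (∑₁-* c _)

  ∑₁-≤ : ∀ {c} {f : Fin n → ℕ} → (∀ a → f a ≤ c) → ∑₁ f ≤ n * c
  ∑₁-≤ h = ≤-trans (∑₁-mono h) (≤-reflexive (∑₁-const _))

  ∑₂-const : ∀ c → ∑₂ {n} (λ _ _ → c) ≡ n * (n * c)
  ∑₂-const c = trans (∑₁-cong λ _ → ∑₁-const c) (∑₁-const _)

  ∑₃-const : ∀ c → ∑₃ {n} (λ _ _ _ → c) ≡ n * (n * (n * c))
  ∑₃-const c = trans (∑₁-cong λ _ → ∑₂-const c) (∑₁-const _)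

  ∑₁-*∑₁ : ∀ (f g : Fin n → ℕ) → ∑₂ (λ a b → f a * g b) ≡ ∑₁ f * ∑₁ g
  ∑₁-*∑₁ f g = trans (∑₁-cong λ a → ∑₁-* (f a) g) (∑₁-*ʳ (∑₁ g) f)

  ∑₃-swap₁₂ : ∀ (f : Fin n → Fin n → Fin n → ℕ) → ∑₃ f ≡ ∑₃ (λ a b c → f b a c)
  ∑₃-swap₁₂ f = ∑₁-swap λ a b → ∑₁ (f a b)

  ∑₃-swap₂₃ : ∀ (f : Fin n → Fin n → Fin n → ℕ) → ∑₃ f ≡ ∑₃ (λ a b c → f a c b)
  ∑₃-swap₂₃ f = ∑₁-cong λ a → ∑₁-swap (f a)

  ∑₃-swap₁₃ : ∀ (f : Fin n → Fin n → Fin n → ℕ) → ∑₃ f ≡ ∑₃ (λ a b c → f c b a)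
  ∑₃-swap₁₃ f = trans (∑₃-swap₁₂ f) (trans (∑₃-swap₂₃ λ a b c → f b a c) (∑₃-swap₁₂ λ a b c → f c a b))

  ∑₃-rotate : ∀ (f : Fin n → Fin n → Fin n → ℕ) → ∑₃ f ≡ ∑₃ (λ c a b → f a b c)
  ∑₃-rotate f = trans (∑₃-swap₂₃ f) (∑₃-swap₁₂ λ a b c → f a c b)

  ∑₃<⇒∃ : ∀ {f g : Fin n → Fin n → Fin n → ℕ} → ∑₃ f < ∑₃ g → ∃ λ x → ∃ λ y → ∃ λ z → f x y z < g x y z
  ∑₃<⇒∃ lt =
    let x , ltˣ = ∑₁<⇒∃ lt
        y , ltʸ = ∑₁<⇒∃ ltˣ
        z , ltᶻ = ∑₁<⇒∃ ltʸ
    in x , y , z , ltᶻ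

allF : ∀ {s} → (Fin s → Bool) → Bool
allF {zero}  p = true
allF {suc s} p = p fzero ∧ allF (λ i → p (fsuc i))

allF-elim : ∀ {s} (p : Fin s → Bool) → allF p ≡ true → ∀ i → p i ≡ true
allF-elim p h fzero    = ∧-trueˡ h
allF-elim p h (fsuc i) = allF-elim (λ i → p (fsuc i)) (∧-trueʳ {p fzero} h) i

-- The union bound in additive form: the conjunction holds or one of its failures is counted. Summed
-- over triples, it bounds what a universal condition can lose.
allF-union : ∀ {s} (p : Fin s → Bool) → 1 ≤ 𝟙 (allF p) + ∑₁ (λ i → 𝟙 (not (p i)))
allF-union {zero}  p = s≤s z≤n
allF-union {suc s} p = subst (λ z → 1 ≤ 𝟙 (allF p) + z) (sym (∑₁-suc (λ i → 𝟙 (not (p i)))))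
  (step (p fzero) (allF-union (λ i → p (fsuc i))))
  where
  step : ∀ b {c S} → 1 ≤ 𝟙 c + S → 1 ≤ 𝟙 (b ∧ c) + (𝟙 (not b) + S)
  step true  h = h
  step false h = s≤s z≤n

distinct-from : ∀ {n s} (y : Fin s → Fin n) {x} → allF (λ i → not (x == y i)) ≡ true → ∀ i → x ≢ y i
distinct-from y {x} h i = ==-false (not-true (allF-elim (λ i → not (x == y i)) h i))

-- A copy of F₅ = {τab, auv, buv}; only the pairs not covered by an edge have to be required distinct.
isF₅ : ∀ {n} → Graph3 n → (τ a b u v : Fin n) → Bool
isF₅ H τ a b u v = edge? H τ a b ∧ edge? H a u v ∧ edge? H b u v ∧ not (u == τ) ∧ not (v == τ)

module Free (m t s : ℕ) (1≤t : 1 ≤ t) (1≤s : 1 ≤ s) (4≤2s : 4 ≤ 2 * s) (2s≤m : 2 * s ≤ m)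
  (n : ℕ) (H : Graph3 n) (free : ¬ Contains (F5S m t s) H) where

  -- One index type serves all five classes of a box, with disjoint ranges of m, s and t indices.
  -- The class of a supplies both S₀ and X, which is where disjointness of ranges matters. The
  -- additional index `fzero` of `suc blowUp` stands for an arbitrary member wherever an edge serves
  -- only to separate two vertices.
  blowUp : ℕ
  blowUp = m + s + t

  no-F₅-box : (τ a b u v : Fin (suc blowUp) → Fin n) →
    Injective _≡_ _≡_ τ → Injective _≡_ _≡_ a → Injective _≡_ _≡_ b → Injective _≡_ _≡_ u → Injective _≡_ _≡_ v →
    (∀ i j k p q → isF₅ H (τ i) (a j) (b k) (u p) (v q) ≡ true) → ⊥
  no-F₅-box τ a b u v τ-inj a-inj b-inj u-inj v-inj h = free (Embedding.embedded 1≤t 1≤s 4≤2s 2s≤m H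
    (a ∘ S) (b ∘ S) (a ∘ X) (u ∘ X) (v ∘ X) (τ ∘ R)
    (S-inj ∘ a-inj) (S-inj ∘ b-inj) (X-inj ∘ a-inj) (X-inj ∘ u-inj) (X-inj ∘ v-inj) (R-inj ∘ τ-inj)
    (λ i j eq → X≢S i j (a-inj eq))
    (λ i j → proj₁ (proj₂ (edge?-distinct H (τab fzero (X i) (S j)))))
    (λ i j eq → proj₁ (edge?-distinct H (τab (R j) (X i) fzero)) (sym eq))
    (λ i j → ==-false (not-true (∧-trueˡ (rest (R j) fzero fzero (X i) fzero))))
    (λ i j → ==-false (not-true (∧-trueʳ {not (u fzero == τ (R j))} (rest (R j) fzero fzero fzero (X i)))))
    (λ l i j → τab (R l) (S i) (S j))
    (λ i j k → auv (S i) (X j) (X k))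
    (λ i j k → buv (S i) (X j) (X k))
    (λ i j k → auv (X i) (X j) (X k)))
    where
    X : Fin m → Fin (suc blowUp)
    X i = fsuc ((i ↑ˡ s) ↑ˡ t)
    S : Fin s → Fin (suc blowUp)
    S i = fsuc ((m ↑ʳ i) ↑ˡ t)
    R : Fin t → Fin (suc blowUp)
    R i = fsuc ((m + s) ↑ʳ i)
    X-inj : Injective _≡_ _≡_ X
    X-inj = ↑ˡ-injective s _ _ ∘ ↑ˡ-injective t _ _ ∘ suc-injective
    S-inj : Injective _≡_ _≡_ S
    S-inj = ↑ʳ-injective m _ _ ∘ ↑ˡ-injective t _ _ ∘ suc-injective
    R-inj : Injective _≡_ _≡_ R
    R-inj = ↑ʳ-injective (m + s) _ _ ∘ suc-injective
    X≢S : ∀ i j → X i ≢ S j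
    X≢S i j eq = <⇒≱ (toℕ<n i) (≤-trans (m≤m+n m (toℕ j)) (≤-reflexive (begin
      m + toℕ j          ≡⟨ toℕ-↑ʳ m j ⟨
      toℕ (m ↑ʳ j)       ≡⟨ cong toℕ (↑ˡ-injective t _ _ (suc-injective eq)) ⟨
      toℕ (i ↑ˡ s)       ≡⟨ toℕ-↑ˡ i s ⟩
      toℕ i              ∎)))
      where open ≡-Reasoning
    τab : ∀ i j k → IsEdge H (τ i) (a j) (b k)
    τab i j k = ∧-trueˡ (h i j k fzero fzero)
    after : ∀ i j k p q → _
    after i j k p q = ∧-trueʳ {edge? H (τ i) (a j) (b k)} (h i j k p q)
    auv : ∀ j p q → IsEdge H (a j) (u p) (v q)
    auv j p q = ∧-trueˡ (after fzero j fzero p q)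
    after₂ : ∀ i j k p q → _
    after₂ i j k p q = ∧-trueʳ {edge? H (a j) (u p) (v q)} (after i j k p q)
    buv : ∀ j p q → IsEdge H (b j) (u p) (v q)
    buv k p q = ∧-trueˡ (after₂ fzero fzero k p q)
    rest : ∀ i j k p q → not (u p == τ i) ∧ not (v q == τ i) ≡ true
    rest i j k p q = ∧-trueʳ {edge? H (b k) (u p) (v q)} (after₂ i j k p q)

  private
    V = allFin n

  boxSize₅ : ℕ → ℕ
  boxSize₅ k = boxSize blowUp k 5

  uncurry₅ : {B : Set} → (Fin n → Fin n → Fin n → Fin n → Fin n → B) → Vec (Fin n) 5 → B
  uncurry₅ f (w ∷ a ∷ b ∷ c ∷ d ∷ []) = f w a b c d

  dense₅⇒box : ∀ k (X : List (Fin n)) → Unique X → boxSize₅ k ≤ length X → boxSize₅ k ≤ n →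
    (P : Fin n → Fin n → Fin n → Fin n → Fin n → Bool) →
    length X * (n * (n * (n * n))) ≤ k * ∑ X (λ w → ∑₄ (λ a b c d → 𝟙 (P w a b c d))) →
    Boxed (suc blowUp) 5 (λ v → uncurry₅ P v ≡ true)
  dense₅⇒box k X uX X≥ n≥ P dense =
    (box blowUp k 5 (X ∷ V ∷ V ∷ V ∷ V ∷ []) (uncurry₅ P) large
        (≤-trans (≤-reflexive size) (≤-trans dense (≤-reflexive (cong (k *_) (sym count))))))
    where
    V≥ : Unique V × boxSize₅ k ≤ length V
    V≥ = allFin⁺ n , subst (boxSize₅ k ≤_) (sym (length-allFin n)) n≥
    large : Large (boxSize₅ k) (X ∷ V ∷ V ∷ V ∷ V ∷ [])
    large = (uX , X≥) , V≥ , V≥ , V≥ , V≥ , tt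
    step : ∀ {r} (xss : Vec (List (Fin n)) r) → length (allTuples (V ∷ xss)) ≡ n * length (allTuples xss)
    step xss = trans (length-allTuples V xss) (cong (_* length (allTuples xss)) (length-allFin n))
    size : length (allTuples (X ∷ V ∷ V ∷ V ∷ V ∷ [])) ≡ length X * (n * (n * (n * n)))
    size = trans (length-allTuples X (V ∷ V ∷ V ∷ V ∷ [])) (cong (length X *_)
      (trans (step (V ∷ V ∷ V ∷ [])) (cong (n *_) (trans (step (V ∷ V ∷ [])) (cong (n *_)
        (trans (step (V ∷ [])) (cong (n *_) (trans (step []) (*-identityʳ n)))))))))
    count : ∑ (allTuples (X ∷ V ∷ V ∷ V ∷ V ∷ [])) (λ v → 𝟙 (uncurry₅ P v)) ≡ ∑ X (λ w → ∑₄ (λ a b c d → 𝟙 (P w a b c d)))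
    count = trans (∑-allTuples X (V ∷ V ∷ V ∷ V ∷ []) _) (∑-cong X λ w →
      trans (∑-allTuples V (V ∷ V ∷ V ∷ []) _) (∑-allFin λ a →
      trans (∑-allTuples V (V ∷ V ∷ []) _) (∑-allFin λ b →
      trans (∑-allTuples V (V ∷ []) _) (∑-allFin λ c →
      trans (∑-allTuples V [] _) (∑-allFin λ d → +-identityʳ _)))))

  -- Applied to all vertices, this is the sparsity of F₅ that stability uses. Applied to a list of
  -- exceptional vertices, it says that their number is bounded, because only `boxSize₅ k` members
  -- are required.
  F₅-sparse-τ : ∀ k (X : List (Fin n)) → Unique X → boxSize₅ k ≤ length X → boxSize₅ k ≤ n →
    k * ∑ X (λ τ → ∑₄ (λ a b u v → 𝟙 (isF₅ H τ a b u v))) < length X * (n * (n * (n * n)))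
  F₅-sparse-τ k X uX X≥ n≥ = ≰⇒> λ dense →
    case dense₅⇒box k X uX X≥ n≥ (isF₅ H) dense of λ where
      (τ , τ-inj , a , a-inj , b , b-inj , u , u-inj , v , v-inj , h) →
        no-F₅-box τ a b u v τ-inj a-inj b-inj u-inj v-inj (λ i j k p q → h q p k j i)

  -- The coordinates are permuted because it is the first one that is restricted to X.
  F₅-sparse-a : ∀ k (X : List (Fin n)) → Unique X → boxSize₅ k ≤ length X → boxSize₅ k ≤ n →
    k * ∑ X (λ a → ∑₄ (λ b τ u v → 𝟙 (isF₅ H τ a b u v))) < length X * (n * (n * (n * n)))
  F₅-sparse-a k X uX X≥ n≥ = ≰⇒> λ dense →
    case dense₅⇒box k X uX X≥ n≥ (λ a b τ u v → isF₅ H τ a b u v) dense of λ where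
      (a , a-inj , b , b-inj , τ , τ-inj , u , u-inj , v , v-inj , h) →
        no-F₅-box τ a b u v τ-inj a-inj b-inj u-inj v-inj (λ i j k p q → h q p i k j)

  module Completion (S₀ S₁ : Fin s → Fin n) (τ : Fin t → Fin n)
    (S₀-inj : Injective _≡_ _≡_ S₀) (S₁-inj : Injective _≡_ _≡_ S₁) (τ-inj : Injective _≡_ _≡_ τ)
    (τS₀S₁ : ∀ l i j → IsEdge H (τ l) (S₀ i) (S₁ j)) where

    -- The triple offers what the given K_{t,s,s} still lacks for F₅ˢ: x is a further vertex of the
    -- part that contains S₀ and S₁, while u and v come from the two other parts.
    completes : Fin n → Fin n → Fin n → Bool
    completes x u v = edge? H x u v ∧ allF (λ i → edge? H (S₀ i) u v) ∧ allF (λ i → edge? H (S₁ i) u v)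
      ∧ allF (λ i → not (x == S₀ i)) ∧ allF (λ i → not (x == S₁ i)) ∧ allF (λ i → not (x == τ i))
      ∧ allF (λ i → not (u == τ i)) ∧ allF (λ i → not (v == τ i))

    record Completes (x u v : Fin n) : Set where
      field
        xuv  : IsEdge H x u v
        S₀uv : ∀ i → IsEdge H (S₀ i) u v
        S₁uv : ∀ i → IsEdge H (S₁ i) u v
        x≢S₀ : ∀ i → x ≢ S₀ i
        x≢S₁ : ∀ i → x ≢ S₁ i
        x≢τ  : ∀ i → x ≢ τ i
        u≢τ  : ∀ i → u ≢ τ i
        v≢τ  : ∀ i → v ≢ τ i

    completes-sound : ∀ x u v → completes x u v ≡ true → Completes x u v
    completes-sound x u v h₁ =
      let h₂ = ∧-trueʳ {edge? H x u v} h₁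
          h₃ = ∧-trueʳ {allF (λ i → edge? H (S₀ i) u v)} h₂
          h₄ = ∧-trueʳ {allF (λ i → edge? H (S₁ i) u v)} h₃
          h₅ = ∧-trueʳ {allF (λ i → not (x == S₀ i))} h₄
          h₆ = ∧-trueʳ {allF (λ i → not (x == S₁ i))} h₅
          h₇ = ∧-trueʳ {allF (λ i → not (x == τ i))} h₆
          h₈ = ∧-trueʳ {allF (λ i → not (u == τ i))} h₇
      in record
        { xuv  = ∧-trueˡ h₁
        ; S₀uv = allF-elim _ (∧-trueˡ h₂)
        ; S₁uv = allF-elim _ (∧-trueˡ h₃)
        ; x≢S₀ = distinct-from S₀ (∧-trueˡ h₄)
        ; x≢S₁ = distinct-from S₁ (∧-trueˡ h₅)
        ; x≢τ  = distinct-from τ (∧-trueˡ h₆)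
        ; u≢τ  = distinct-from τ (∧-trueˡ h₇)
        ; v≢τ  = distinct-from τ h₈ }

    -- A box of completing triples is a simultaneous choice of X, U and W. Its classes have m + 1
    -- vertices, of which `fsuc` selects m.
    completions-sparse : ∀ k → boxSize m k 3 ≤ n → k * ∑₃ (λ x u v → 𝟙 (completes x u v)) < n * (n * n)
    completions-sparse k n≥ = ≰⇒> λ dense →
      case box m k 3 (V ∷ V ∷ V ∷ []) P′ large
        (≤-trans (≤-reflexive size) (≤-trans dense (≤-reflexive (cong (k *_) (sym count))))) of λ where
        (x , x-inj , u , u-inj , v , v-inj , h) →
          let c : ∀ i j k → Completes (x (fsuc i)) (u (fsuc j)) (v (fsuc k))
              c i j k = completes-sound _ _ _ (h (fsuc k) (fsuc j) (fsuc i))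
          in free (Embedding.embedded 1≤t 1≤s 4≤2s 2s≤m H S₀ S₁ (x ∘ fsuc) (u ∘ fsuc) (v ∘ fsuc) τ
            S₀-inj S₁-inj (suc-injective ∘ x-inj) (suc-injective ∘ u-inj) (suc-injective ∘ v-inj) τ-inj
            (λ i → Completes.x≢S₀ (c i i i)) (λ i → Completes.x≢S₁ (c i i i)) (λ i → Completes.x≢τ (c i i i))
            (λ i → Completes.u≢τ (c i i i)) (λ i → Completes.v≢τ (c i i i))
            τS₀S₁ (λ i j k → Completes.S₀uv (c j j k) i) (λ i j k → Completes.S₁uv (c j j k) i)
            (λ i j k → Completes.xuv (c i j k)))
      where
      P′ : Vec (Fin n) 3 → Bool
      P′ (x ∷ u ∷ v ∷ []) = completes x u v
      V≥ : Unique V × boxSize m k 3 ≤ length V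
      V≥ = allFin⁺ n , subst (boxSize m k 3 ≤_) (sym (length-allFin n)) n≥
      large : Large (boxSize m k 3) (V ∷ V ∷ V ∷ [])
      large = V≥ , V≥ , V≥ , tt
      step : ∀ {r} (xss : Vec (List (Fin n)) r) → length (allTuples (V ∷ xss)) ≡ n * length (allTuples xss)
      step xss = trans (length-allTuples V xss) (cong (_* length (allTuples xss)) (length-allFin n))
      size : length (allTuples (V ∷ V ∷ V ∷ [])) ≡ n * (n * n)
      size = trans (step (V ∷ V ∷ [])) (cong (n *_) (trans (step (V ∷ [])) (cong (n *_) (trans (step []) (*-identityʳ n)))))
      count : ∑ (allTuples (V ∷ V ∷ V ∷ [])) (λ v → 𝟙 (P′ v)) ≡ ∑₃ (λ x u v → 𝟙 (completes x u v))
      count = trans (∑-allTuples V (V ∷ V ∷ []) _) (∑-allFin λ a →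
        trans (∑-allTuples V (V ∷ []) _) (∑-allFin λ b →
        trans (∑-allTuples V [] _) (∑-allFin λ c → +-identityʳ _)))

-- Stability

rainbow? : Fin 3 → Fin 3 → Fin 3 → Bool
rainbow? i j k = distinct3 (toℕ i) (toℕ j) (toℕ k)

2xy≤x²+y² : ∀ x y → 2 * (x * y) ≤ x * x + y * y
2xy≤x²+y² x y with ≤-total x y
... | inj₁ x≤y with m≤n⇒∃[o]m+o≡n x≤y
... | o , refl = eq≤ (o * o) (lemma x o)
  where lemma : ∀ x o → 2 * (x * (x + o)) + o * o ≡ x * x + (x + o) * (x + o)
        lemma = solve-∀
2xy≤x²+y² x y | inj₂ y≤x with m≤n⇒∃[o]m+o≡n y≤x
... | o , refl = eq≤ (o * o) (lemma y o)
  where lemma : ∀ y o → 2 * ((y + o) * y) + o * o ≡ (y + o) * (y + o) + y * y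
        lemma = solve-∀

-- 4(D + E)³ − 27 D E² = (E − 2D)² (4E + D), without subtraction.
cubic-amgm : ∀ D E → 27 * (D * (E * E)) ≤ 4 * ((D + E) * ((D + E) * (D + E)))
cubic-amgm D E = lin≤ 0 (*-monoˡ-≤ (4 * E + D) (2xy≤x²+y² E (2 * D))) (lemma D E)
  where lemma : ∀ D E → 27 * (D * (E * E)) + (E * E + 2 * D * (2 * D)) * (4 * E + D) + 0
                  ≡ 4 * ((D + E) * ((D + E) * (D + E))) + 2 * (E * (2 * D)) * (4 * E + D)
        lemma = solve-∀

n≤ᵇ-true : ∀ a b → (a ≤ᵇ b) ≡ true → a ≤ b
n≤ᵇ-true zero    b p = z≤n
n≤ᵇ-true (suc a) b p = <ᵇ-true a b p

n≤ᵇ-false : ∀ a b → (a ≤ᵇ b) ≡ false → b < a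
n≤ᵇ-false (suc a) b p = s≤s (<ᵇ-false a b p)

module Weights {n : ℕ} (H : Graph3 n) where
  G : Fin n → Fin n → Fin n → ℕ
  G x y z = 𝟙 (edge? H x y z)

  G-swap₁₂ : ∀ x y z → G x y z ≡ G y x z
  G-swap₁₂ x y z = cong 𝟙 (edge?-swap₁₂ H x y z)

  G-swap₂₃ : ∀ x y z → G x y z ≡ G x z y
  G-swap₂₃ x y z = cong 𝟙 (edge?-swap₂₃ H x y z)

  G-rotate : ∀ x y z → G x y z ≡ G z x y
  G-rotate x y z = trans (G-swap₂₃ x y z) (G-swap₁₂ x z y)

  d : Fin n → Fin n → ℕ
  d x y = ∑₁ (G x y)

  δ : Fin n → ℕ
  δ x = ∑₂ (G x)

  S : ℕ
  S = ∑₃ G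

  noncrossing : (Fin n → Fin 3) → ℕ
  noncrossing κ = ∑₃ λ a b c → 𝟙 (edge? H a b c ∧ not (rainbow? (κ a) (κ b) (κ c)))

module Stability {n : ℕ} (H : Graph3 n) (k : ℕ) where
  open Weights H

  heavy : Fin n → Fin n → Bool
  heavy x y = n ≤ᵇ k * d x y

  O : Fin n → Fin n → ℕ
  O x y = 𝟙 (heavy x y)

  D E : Fin n → ℕ
  D c = ∑₁ (O c)
  E c = (n + n) ∸ D c

  -- P is also the sum of d(a, b) over the ordered edges abc. R counts configurations that extend to
  -- linearly many copies of F₅, since a heavy pair c, v has at least n/k vertices τ with cvτ an
  -- edge.
  P R : ℕ
  P = ∑₂ λ a b → d a b * d a b
  R = ∑₂ λ a b → ∑₂ λ c v → G a b c * G a b v * O c v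

  D+E : ∀ c → D c + E c ≡ n + n
  D+E c = m+[n∸m]≡n (≤-trans (∑₁-≤ (λ b → 𝟙≤1 (heavy c b))) (≤-trans (≤-reflexive (*-identityʳ n)) (m≤m+n n n)))

  light : ∀ a b → k * d a b ≤ k * n * O a b + n
  light a b with heavy a b in eq
  ... | true  = ≤-trans (*-monoʳ-≤ k (≤-trans (∑₁-≤ (λ c → 𝟙≤1 _)) (≤-reflexive (*-identityʳ n))))
                  (≤-trans (≤-reflexive (sym (*-identityʳ (k * n)))) (m≤m+n _ n))
  ... | false = ≤-trans (<⇒≤ (n≤ᵇ-false n (k * d a b) eq)) (m≤n+m n _)

  -- Only heavy pairs are charged E², so that the sum over b produces D · E². A light pair has k · d
  -- < n and is absorbed by the last term, which carries no factor k.
  pair-bound : ∀ c b → 8 * (k * (d c b * E c)) ≤ 16 * k * (d c b * d c b) + k * (O c b * (E c * E c)) + 8 * (n * E c)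
  pair-bound c b with heavy c b in eq
  ... | true  = lin≤ (8 * (n * E c)) (*-monoʳ-≤ k (2xy≤x²+y² (4 * d c b) (E c))) (lemma k (d c b) (E c) n)
    where lemma : ∀ k d E n → 8 * (k * (d * E)) + k * (4 * d * (4 * d) + E * E) + 8 * (n * E)
                    ≡ 16 * k * (d * d) + k * (1 * (E * E)) + 8 * (n * E) + k * (2 * (4 * d * E))
          lemma = solve-∀
  ... | false = lin≤ (16 * k * (d c b * d c b)) (*-monoˡ-≤ (8 * E c) (<⇒≤ (n≤ᵇ-false n (k * d c b) eq))) (lemma k (d c b) (E c) n)
    where lemma : ∀ k d E n → 8 * (k * (d * E)) + n * (8 * E) + 16 * k * (d * d)
                    ≡ 16 * k * (d * d) + k * (0 * (E * E)) + 8 * (n * E) + k * d * (8 * E)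
          lemma = solve-∀

  Q : Fin n → ℕ
  Q c = ∑₁ λ b → d c b * d c b

  -- D + E = 2n is used twice: it makes AM-GM applicable to D · E², and it turns δ · E into 2nδ -
  -- Dδ. The summand 54 n³ collects the light pairs and is negligible against 4k n³ once k is large.
  vertex-bound : ∀ c → 54 * (k * (n * δ c)) ≤ 27 * k * (D c * δ c) + 54 * (k * Q c) + (4 * k + 54) * (n * (n * n))
  vertex-bound c = *-cancelˡ-≤ 8 (lin≤ 0
    (+-mono-≤ (*-monoʳ-≤ 27 summed) (+-mono-≤ (*-monoʳ-≤ k (cubic-amgm (D c) (E c)))
      (*-monoʳ-≤ (216 * (n * n)) (subst (E c ≤_) (D+E c) (m≤n+m (E c) (D c))))))
    (begin
      8 * (54 * (k * (n * δ c))) + (27 * (16 * k * Q c + k * (D c * (E c * E c)) + n * (8 * (n * E c)))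
        + (k * (4 * ((D c + E c) * ((D c + E c) * (D c + E c)))) + 216 * (n * n) * (n + n))) + 0
        ≡⟨ cong (λ z → 8 * (54 * (k * (n * δ c))) + (27 * (16 * k * Q c + k * (D c * (E c * E c)) + n * (8 * (n * E c)))
        + (k * (4 * (z * (z * z))) + 216 * (n * n) * (n + n))) + 0) (D+E c) ⟩
      8 * (54 * (k * (n * δ c))) + (27 * (16 * k * Q c + k * (D c * (E c * E c)) + n * (8 * (n * E c)))
        + (k * (4 * ((n + n) * ((n + n) * (n + n)))) + 216 * (n * n) * (n + n))) + 0
        ≡⟨ lemma₁ k n (δ c) (Q c) (D c) (E c) ⟩
      216 * (k * ((n + n) * δ c)) + rest
        ≡⟨ cong (λ z → 216 * (k * (z * δ c)) + rest) {D c + E c} {n + n} (D+E c) ⟨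
      216 * (k * ((D c + E c) * δ c)) + rest
        ≡⟨ lemma₂ k n (δ c) (Q c) (D c) (E c) ⟩
      8 * (27 * k * (D c * δ c) + 54 * (k * Q c) + (4 * k + 54) * (n * (n * n)))
        + (27 * (8 * (k * (δ c * E c))) + (k * (27 * (D c * (E c * E c))) + 216 * (n * n) * E c)) ∎))
    where
    open ≡-Reasoning
    rest = 432 * (k * Q c) + 27 * (k * (D c * (E c * E c))) + 216 * (n * (n * E c)) + 32 * k * (n * (n * n)) + 432 * (n * (n * n))
    lemma₁ : ∀ k n δ Q D E →
      8 * (54 * (k * (n * δ))) + (27 * (16 * k * Q + k * (D * (E * E)) + n * (8 * (n * E)))
        + (k * (4 * ((n + n) * ((n + n) * (n + n)))) + 216 * (n * n) * (n + n))) + 0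
      ≡ 216 * (k * ((n + n) * δ)) + (432 * (k * Q) + 27 * (k * (D * (E * E))) + 216 * (n * (n * E)) + 32 * k * (n * (n * n)) + 432 * (n * (n * n)))
    lemma₁ = solve-∀
    lemma₂ : ∀ k n δ Q D E →
      216 * (k * ((D + E) * δ)) + (432 * (k * Q) + 27 * (k * (D * (E * E))) + 216 * (n * (n * E)) + 32 * k * (n * (n * n)) + 432 * (n * (n * n)))
      ≡ 8 * (27 * k * (D * δ) + 54 * (k * Q) + (4 * k + 54) * (n * (n * n)))
        + (27 * (8 * (k * (δ * E))) + (k * (27 * (D * (E * E))) + 216 * (n * n) * E))
    lemma₂ = solve-∀
    summed : 8 * (k * (δ c * E c)) ≤ 16 * k * Q c + k * (D c * (E c * E c)) + n * (8 * (n * E c))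
    summed = subst₂ _≤_
      (trans (∑₁-* 8 _) (cong (8 *_) (trans (∑₁-* k _) (cong (k *_) (∑₁-*ʳ (E c) (d c))))))
      (trans (∑₁-+ _ _) (cong₂ _+_ (trans (∑₁-+ _ _) (cong₂ _+_ (∑₁-* (16 * k) _)
        (trans (∑₁-* k _) (cong (k *_) (∑₁-*ʳ (E c * E c) (O c)))))) (∑₁-const (8 * (n * E c)))))
      (∑₁-mono (pair-bound c))

  ∑Dδ : ℕ
  ∑Dδ = ∑₁ λ c → D c * δ c

  first-moment : 54 * (k * (n * S)) ≤ 27 * k * ∑Dδ + 54 * (k * P) + n * ((4 * k + 54) * (n * (n * n)))
  first-moment = subst₂ _≤_
    (trans (∑₁-* 54 _) (cong (54 *_) (trans (∑₁-* k _) (cong (k *_) (∑₁-* n δ)))))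
    (trans (∑₁-+ _ _) (cong₂ _+_ (trans (∑₁-+ _ _) (cong₂ _+_ (∑₁-* (27 * k) _)
      (trans (∑₁-* 54 _) (cong (54 *_) (∑₁-* k Q))))) (∑₁-const _)))
    (∑₁-mono vertex-bound)

  -- c ∈ N(ab), and N(ab) is nearly disjoint from the heavy neighbourhood of c.
  second-moment : ∑Dδ + P ≤ n * S + R
  second-moment = subst₂ _≤_ left right (∑₃-mono λ a b c → ∑₁-mono λ v → pointwise (edge? H a b c) (heavy c v) (edge? H a b v))
    where
    pointwise : ∀ x y z → 𝟙 x * (𝟙 y + 𝟙 z) ≤ 𝟙 x + 𝟙 x * 𝟙 z * 𝟙 y
    pointwise false _     _     = z≤n
    pointwise true  false false = z≤n
    pointwise true  false true  = ≤-refl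
    pointwise true  true  false = ≤-refl
    pointwise true  true  true  = ≤-refl
    left : ∑₃ (λ a b c → ∑₁ λ v → G a b c * (O c v + G a b v)) ≡ ∑Dδ + P
    left = begin
      ∑₃ (λ a b c → ∑₁ λ v → G a b c * (O c v + G a b v))
        ≡⟨ ∑₃-cong (λ a b c → trans (∑₁-* (G a b c) _) (trans (cong (G a b c *_) (∑₁-+ (O c) (G a b))) (*-distribˡ-+ (G a b c) _ _))) ⟩
      ∑₃ (λ a b c → G a b c * D c + G a b c * d a b)
        ≡⟨ ∑₃-+ _ _ ⟩
      ∑₃ (λ a b c → G a b c * D c) + ∑₃ (λ a b c → G a b c * d a b)
        ≡⟨ cong₂ _+_ (∑₃-rotate _) (∑₂-cong λ a b → ∑₁-*ʳ (d a b) (G a b)) ⟩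
      ∑₃ (λ c a b → G a b c * D c) + P
        ≡⟨ cong (_+ P) (∑₁-cong λ c → trans (∑₂-cong λ a b → trans (cong (_* D c) (G-rotate a b c)) (*-comm _ (D c))) (∑₂-* (D c) (G c))) ⟩
      ∑Dδ + P ∎
      where open ≡-Reasoning
    right : ∑₃ (λ a b c → ∑₁ λ v → G a b c + G a b c * G a b v * O c v) ≡ n * S + R
    right = begin
      ∑₃ (λ a b c → ∑₁ λ v → G a b c + G a b c * G a b v * O c v)
        ≡⟨ ∑₃-cong (λ a b c → trans (∑₁-+ _ _) (cong-+ˡ (∑₁-const (G a b c)))) ⟩
      ∑₃ (λ a b c → n * G a b c + ∑₁ λ v → G a b c * G a b v * O c v)
        ≡⟨ ∑₃-+ _ _ ⟩
      ∑₃ (λ a b c → n * G a b c) + R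
        ≡⟨ cong (_+ R) (∑₃-* n G) ⟩
      n * S + R ∎
      where open ≡-Reasoning

  -- The first moment contributes (4/27) n⁴, and density 2/9 bounds this by (2/3) n S up to lower
  -- order. What remains of the two moments is n S ≤ 3P plus errors: on average over the edges, the
  -- three codegrees of an edge sum to almost n.
  codegree-bound : 6 * (n * (n * n)) ≤ 27 * S + 12 * (n * n) →
    k * (n * S) ≤ 3 * (k * P) + 3 * (k * R) + k * (n * (n * n)) + 6 * (n * (n * (n * n)))
  codegree-bound many = *-cancelˡ-≤ 27 (lin≤ (3 * k * (n * (n * n)))
    (+-mono-≤ (*-monoʳ-≤ 3 first-moment) (+-mono-≤ (*-monoʳ-≤ (81 * k) second-moment) (*-monoʳ-≤ (2 * (k * n)) many)))
    (lemma k n S ∑Dδ P R))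
    where
    lemma : ∀ k n S X P R →
      27 * (k * (n * S)) + (3 * (27 * k * X + 54 * (k * P) + n * ((4 * k + 54) * (n * (n * n))))
        + (81 * k * (n * S + R) + 2 * (k * n) * (27 * S + 12 * (n * n)))) + 3 * k * (n * (n * n))
      ≡ 27 * (3 * (k * P) + 3 * (k * R) + k * (n * (n * n)) + 6 * (n * (n * (n * n))))
        + (3 * (54 * (k * (n * S))) + (81 * k * (X + P) + 2 * (k * n) * (6 * (n * (n * n)))))
    lemma = solve-∀

  module Cut (x y z : Fin n) where
    N : Fin 3 → Fin n → Bool
    N fzero               v = edge? H y z v
    N (fsuc fzero)        v = edge? H x z v
    N (fsuc (fsuc fzero)) v = edge? H x y v

    -- An uncovered vertex gets the last colour by default. What is used of the colour of a covered
    -- vertex is that it names a neighbourhood containing it.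
    κ : Fin n → Fin 3
    κ v = if edge? H y z v then fzero else if edge? H x z v then fsuc fzero else fsuc (fsuc fzero)

    uncovered : Fin n → Bool
    uncovered v = not (edge? H y z v ∨ edge? H x z v ∨ edge? H x y v)

    C : Fin n → Fin n → ℕ
    C a b = G y z a * G y z b + G x z a * G x z b + G x y a * G x y b

    covered : ∀ v → 1 ≤ 𝟙 (uncovered v) + 𝟙 (N (κ v) v)
    covered v with edge? H y z v in e₁
    ... | true rewrite e₁ = ≤-refl
    ... | false with edge? H x z v in e₂
    ... | true rewrite e₂ = ≤-refl
    ... | false with edge? H x y v
    ... | true  = ≤-refl
    ... | false = ≤-refl

    N*N≤C : ∀ i a b → 𝟙 (N i a) * 𝟙 (N i b) ≤ C a b
    N*N≤C fzero               a b = ≤-trans (m≤m+n _ _) (m≤m+n _ _)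
    N*N≤C (fsuc fzero)        a b = ≤-trans (m≤n+m (G x z a * G x z b) (G y z a * G y z b)) (m≤m+n _ _)
    N*N≤C (fsuc (fsuc fzero)) a b = m≤n+m _ _

    same-colour : ∀ a b → κ a ≡ κ b → 1 ≤ 𝟙 (uncovered a) + 𝟙 (uncovered b) + C a b
    same-colour a b eq = ≤-trans (go (𝟙 (uncovered a)) (𝟙 (uncovered b)) (N (κ a) a) (N (κ a) b)
      (covered a) (subst (λ i → 1 ≤ 𝟙 (uncovered b) + 𝟙 (N i b)) (sym eq) (covered b)))
      (+-monoʳ-≤ (𝟙 (uncovered a) + 𝟙 (uncovered b)) (N*N≤C (κ a) a b))
      where
      go : ∀ u v p q → 1 ≤ u + 𝟙 p → 1 ≤ v + 𝟙 q → 1 ≤ u + v + 𝟙 p * 𝟙 q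
      go u v true  true  _ _ = m≤n+m 1 (u + v)
      go u v false q     h _ = ≤-trans h (≤-trans (≤-reflexive (+-identityʳ u)) (≤-trans (m≤m+n u v) (m≤m+n _ _)))
      go u v true  false _ h = ≤-trans h (≤-trans (≤-reflexive (+-identityʳ v)) (≤-trans (m≤n+m v u) (m≤m+n _ _)))

    -- Two vertices of a noncrossing edge share a colour. Then one of them is uncovered, or both lie
    -- in the same one of the three neighbourhoods, which `C` counts.
    bad-triple : ∀ a b c → 𝟙 (edge? H a b c ∧ not (rainbow? (κ a) (κ b) (κ c))) ≤
      (𝟙 (uncovered a) + 𝟙 (uncovered b) + 𝟙 (uncovered c)) + (G a b c * C a b + G a b c * C b c + G a b c * C a c)
    bad-triple a b c with edge? H a b c
    ... | false = z≤n
    ... | true with κ a ≟ κ b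
    ... | yes p = ≤-trans (𝟙≤1 _) (≤-trans (same-colour a b p)
                    (eq≤ (𝟙 (uncovered c) + C b c + C a c) (lemma (𝟙 (uncovered a)) (𝟙 (uncovered b)) (𝟙 (uncovered c)) (C a b) (C b c) (C a c))))
      where lemma : ∀ u v w p q r → u + v + p + (w + q + r) ≡ (u + v + w) + (1 * p + 1 * q + 1 * r)
            lemma = solve-∀
    ... | no ¬p with κ b ≟ κ c
    ... | yes q = ≤-trans (𝟙≤1 _) (≤-trans (same-colour b c q)
                    (eq≤ (𝟙 (uncovered a) + C a b + C a c) (lemma (𝟙 (uncovered a)) (𝟙 (uncovered b)) (𝟙 (uncovered c)) (C a b) (C b c) (C a c))))
      where lemma : ∀ u v w p q r → v + w + q + (u + p + r) ≡ (u + v + w) + (1 * p + 1 * q + 1 * r)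
            lemma = solve-∀
    ... | no ¬q with κ a ≟ κ c
    ... | yes r = ≤-trans (𝟙≤1 _) (≤-trans (same-colour a c r)
                    (eq≤ (𝟙 (uncovered b) + C a b + C b c) (lemma (𝟙 (uncovered a)) (𝟙 (uncovered b)) (𝟙 (uncovered c)) (C a b) (C b c) (C a c))))
      where lemma : ∀ u v w p q r → u + w + r + (v + p + q) ≡ (u + v + w) + (1 * p + 1 * q + 1 * r)
            lemma = solve-∀
    ... | no ¬r rewrite distinct3-intro (¬p ∘ toℕ-injective) (¬q ∘ toℕ-injective) (¬r ∘ toℕ-injective) = z≤n

    U : ℕ
    U = ∑₁ (𝟙 ∘ uncovered)

    M : ℕ
    M = ∑₂ λ a b → C a b * d a b

    noncrossing-bound : noncrossing κ ≤ 3 * (n * (n * U)) + 3 * M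
    noncrossing-bound = ≤-trans (∑₃-mono bad-triple) (≤-reflexive (begin
      ∑₃ (λ a b c → (u a + u b + u c) + (G a b c * C a b + G a b c * C b c + G a b c * C a c))
        ≡⟨ trans (∑₃-+ _ _) (cong₂ _+_ (trans (∑₃-+ _ _) (cong-+ˡ (∑₃-+ _ _))) (trans (∑₃-+ _ _) (cong-+ˡ (∑₃-+ _ _)))) ⟩
      (∑₃ (λ a b c → u a) + ∑₃ (λ a b c → u b) + ∑₃ (λ a b c → u c))
        + (∑₃ (λ a b c → G a b c * C a b) + ∑₃ (λ a b c → G a b c * C b c) + ∑₃ (λ a b c → G a b c * C a c))
        ≡⟨ cong₂ _+_ (cong₂ _+_ (cong₂ _+_ u₁ (trans (∑₃-swap₁₂ _) u₁)) (trans (∑₃-swap₁₃ _) u₁))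
             (cong₂ _+_ (cong₂ _+_ m₁ m₂) m₃) ⟩
      (n * (n * U) + n * (n * U) + n * (n * U)) + (M + M + M)
        ≡⟨ lemma (n * (n * U)) M ⟩
      3 * (n * (n * U)) + 3 * M ∎))
      where
      open ≡-Reasoning
      u = 𝟙 ∘ uncovered
      lemma : ∀ a b → (a + a + a) + (b + b + b) ≡ 3 * a + 3 * b
      lemma = solve-∀
      u₁ : ∑₃ (λ a b c → u a) ≡ n * (n * U)
      u₁ = trans (∑₁-cong λ a → ∑₂-const (u a)) (trans (∑₁-* n _) (cong (n *_) (∑₁-* n u)))
      m₁ : ∑₃ (λ a b c → G a b c * C a b) ≡ M
      m₁ = ∑₂-cong λ a b → trans (∑₁-*ʳ (C a b) (G a b)) (*-comm _ (C a b))
      m₃ : ∑₃ (λ a b c → G a b c * C a c) ≡ M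
      m₃ = trans (∑₃-swap₂₃ _) (trans (∑₃-cong λ a b c → cong (_* C a b) (G-swap₂₃ a c b)) m₁)
      m₂ : ∑₃ (λ a b c → G a b c * C b c) ≡ M
      m₂ = trans (∑₃-swap₁₂ _) (trans (∑₃-cong λ a b c → cong (_* C a c) (G-swap₁₂ b a c)) m₃)

    -- Bonferroni's inequality for three sets. If the codegrees sum to about n and the
    -- neighbourhoods hardly overlap, then few vertices are uncovered.
    covering : U + (d y z + d x z + d x y) ≤ n + ∑₁ (λ v → G y z v * G x z v + G y z v * G x y v + G x z v * G x y v)
    covering = subst₂ _≤_
      (trans (∑₁-+ _ _) (cong (U +_) (trans (∑₁-+ _ _) (cong-+ˡ (∑₁-+ _ _)))))
      (trans (∑₁-+ _ _) (cong-+ˡ (trans (∑₁-const 1) (*-identityʳ n))))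
      (∑₁-mono λ v → pointwise (edge? H y z v) (edge? H x z v) (edge? H x y v))
      where
      pointwise : ∀ p q r → 𝟙 (not (p ∨ q ∨ r)) + (𝟙 p + 𝟙 q + 𝟙 r) ≤ 1 + (𝟙 p * 𝟙 q + 𝟙 p * 𝟙 r + 𝟙 q * 𝟙 r)
      pointwise true  true  true  = n≤1+n 3
      pointwise true  true  false = ≤-refl
      pointwise true  false true  = ≤-refl
      pointwise true  false false = ≤-refl
      pointwise false true  true  = ≤-refl
      pointwise false true  false = ≤-refl
      pointwise false false true  = ≤-refl
      pointwise false false false = ≤-refl

∑₂-swap : ∀ {n k} (f : Fin n → Fin n → Fin k → Fin k → ℕ) →
  ∑₂ (λ x y → ∑₂ λ z v → f x y z v) ≡ ∑₂ (λ z v → ∑₂ λ x y → f x y z v)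
∑₂-swap f = begin
  ∑₁ (λ x → ∑₁ λ y → ∑₁ λ z → ∑₁ λ v → f x y z v)  ≡⟨ ∑₁-cong (λ x → ∑₁-swap λ y z → ∑₁ (f x y z)) ⟩
  ∑₁ (λ x → ∑₁ λ z → ∑₁ λ y → ∑₁ λ v → f x y z v)  ≡⟨ ∑₁-cong (λ x → ∑₁-cong λ z → ∑₁-swap λ y v → f x y z v) ⟩
  ∑₁ (λ x → ∑₁ λ z → ∑₁ λ v → ∑₁ λ y → f x y z v)  ≡⟨ ∑₁-swap (λ x z → ∑₁ λ v → ∑₁ λ y → f x y z v) ⟩
  ∑₁ (λ z → ∑₁ λ x → ∑₁ λ v → ∑₁ λ y → f x y z v)  ≡⟨ ∑₁-cong (λ z → ∑₁-swap λ x v → ∑₁ λ y → f x y z v) ⟩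
  ∑₁ (λ z → ∑₁ λ v → ∑₁ λ x → ∑₁ λ y → f x y z v)  ∎
  where open ≡-Reasoning

module _ {n : ℕ} where
  ∑₂-*ʳ : ∀ c (f : Fin n → Fin n → ℕ) → ∑₂ (λ a b → f a b * c) ≡ ∑₂ f * c
  ∑₂-*ʳ c f = trans (∑₁-cong λ a → ∑₁-*ʳ c (f a)) (∑₁-*ʳ c _)

  ∑₁-==* : ∀ (x : Fin n) c → ∑₁ (λ y → 𝟙 (y == x) * c) ≤ c
  ∑₁-==* x c = ≤-trans (≤-reflexive (∑₁-*ʳ c _)) (≤-trans (*-monoˡ-≤ c (∑₁-== x)) (≤-reflexive (+-identityʳ c)))

  coincidences : ∀ (τ : Fin n) → ∑₂ (λ a b → 𝟙 (a == τ) + 𝟙 (b == τ)) ≤ n + n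
  coincidences τ = ≤-trans (≤-reflexive (∑₂-+ _ _)) (+-mono-≤
    (≤-trans (≤-reflexive (trans (∑₁-cong λ a → ∑₁-const _) (∑₁-cong λ a → *-comm n _))) (∑₁-==* τ n))
    (≤-trans (∑₁-≤ λ a → ∑₁-== τ) (≤-reflexive (*-identityʳ n))))

-- Choosing an edge whose neighbourhoods give the cut

module StableCut {n : ℕ} (H : Graph3 n) (k : ℕ) where
  open Weights H
  open Stability H k

  A : Fin n → Fin n → Fin n → ℕ
  A x y z = ∑₁ λ v → G x y z * (G x z v * G y z v)

  -- A vertex v in the overlap of N(xz) and N(yz) puts x and y into N(zv). If xy is heavy, R counts
  -- this with z, v as its first pair; if xy is light, fewer than n/k edges contain the pair, each
  -- with at most n choices of v.
  ∑A≤ : k * ∑₃ A ≤ k * R + n * (n * (n * n))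
  ∑A≤ = ≤-trans (*-monoʳ-≤ k (≤-trans (∑₃-mono λ x y z → ∑₁-mono λ v → pointwise x y z v) (≤-reflexive split)))
    (≤-trans (≤-reflexive (*-distribˡ-+ k R _)) (+-monoʳ-≤ (k * R) lights))
    where
    L = ∑₂ λ x y → ∑₂ λ z v → G x y z * 𝟙 (not (heavy x y))
    pointwise : ∀ x y z v → G x y z * (G x z v * G y z v) ≤ G z v x * G z v y * O x y + G x y z * 𝟙 (not (heavy x y))
    pointwise x y z v rewrite G-rotate z v x | G-rotate z v y with heavy x y
    ... | true  = ≤-trans (𝟙*≤ (edge? H x y z) _) (≤-trans (≤-reflexive (sym (*-identityʳ _))) (m≤m+n _ _))
    ... | false = ≤-trans (*-monoʳ-≤ (G x y z) (≤-trans (𝟙*≤ (edge? H x z v) _) (𝟙≤1 _))) (m≤n+m _ (G x z v * G y z v * 0))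
    split : ∑₃ (λ x y z → ∑₁ λ v → G z v x * G z v y * O x y + G x y z * 𝟙 (not (heavy x y))) ≡ R + L
    split = trans (∑₂-cong λ x y → ∑₂-+ _ _) (trans (∑₂-+ _ _) (cong-+ˡ
      (∑₂-swap λ x y z v → G z v x * G z v y * O x y)))
    pair : ∀ x y → k * ∑₂ (λ z v → G x y z * 𝟙 (not (heavy x y))) ≤ n * n
    pair x y = begin
      k * ∑₂ (λ z v → G x y z * 𝟙 (not (heavy x y)))  ≡⟨ cong (k *_) (trans (∑₁-cong λ z → ∑₁-const _) (trans (∑₁-* n _) (cong (n *_) (∑₁-*ʳ _ (G x y))))) ⟩
      k * (n * (d x y * 𝟙 (not (heavy x y))))         ≡⟨ lemma k n (d x y) _ ⟩
      n * (k * d x y * 𝟙 (not (heavy x y)))           ≤⟨ *-monoʳ-≤ n bound ⟩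
      n * n                                           ∎
      where
      open ≤-Reasoning
      lemma : ∀ k n d o → k * (n * (d * o)) ≡ n * (k * d * o)
      lemma = solve-∀
      bound : k * d x y * 𝟙 (not (heavy x y)) ≤ n
      bound with heavy x y in eq
      ... | true  = ≤-trans (≤-reflexive (*-zeroʳ (k * d x y))) z≤n
      ... | false = ≤-trans (≤-reflexive (*-identityʳ _)) (<⇒≤ (n≤ᵇ-false n (k * d x y) eq))
    lights : k * L ≤ n * (n * (n * n))
    lights = begin
      k * L                                                                       ≡⟨ ∑₂-* k _ ⟨
      ∑₂ (λ x y → k * ∑₂ (λ z v → G x y z * 𝟙 (not (heavy x y))))                 ≤⟨ ∑₂-mono pair ⟩
      ∑₂ {n} (λ x y → n * n)                                                      ≡⟨ ∑₂-const (n * n) ⟩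
      n * (n * (n * n)) ∎
      where open ≤-Reasoning

  open Cut

  ∑GU : ℕ
  ∑GU = ∑₃ λ x y z → G x y z * U x y z

  ∑GU-bound : ∑GU + 3 * P ≤ n * S + 3 * ∑₃ A
  ∑GU-bound = subst₂ _≤_ left right (∑₃-mono λ x y z → *-monoʳ-≤ (G x y z) (covering x y z))
    where
    open ≡-Reasoning
    three : ∀ a → a + a + a ≡ 3 * a
    three = solve-∀
    P₃ : ∑₃ (λ x y z → G x y z * d x y) ≡ P
    P₃ = ∑₂-cong λ a b → ∑₁-*ʳ (d a b) (G a b)
    P₂ : ∑₃ (λ x y z → G x y z * d x z) ≡ P
    P₂ = trans (∑₃-swap₂₃ _) (trans (∑₃-cong λ x y z → cong (_* d x y) (G-swap₂₃ x z y)) P₃)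
    P₁ : ∑₃ (λ x y z → G x y z * d y z) ≡ P
    P₁ = trans (∑₃-swap₁₂ _) (trans (∑₃-cong λ x y z → cong (_* d x z) (G-swap₁₂ y x z)) P₂)
    left : ∑₃ (λ x y z → G x y z * (U x y z + (d y z + d x z + d x y))) ≡ ∑GU + 3 * P
    left = begin
      ∑₃ (λ x y z → G x y z * (U x y z + (d y z + d x z + d x y)))
        ≡⟨ ∑₃-cong (λ x y z → lemma (G x y z) (U x y z) (d y z) (d x z) (d x y)) ⟩
      ∑₃ (λ x y z → G x y z * U x y z + (G x y z * d y z + G x y z * d x z + G x y z * d x y))
        ≡⟨ trans (∑₃-+ _ _) (cong (∑GU +_) (trans (∑₃-+ _ _) (cong-+ˡ (∑₃-+ _ _)))) ⟩
      ∑GU + (∑₃ (λ x y z → G x y z * d y z) + ∑₃ (λ x y z → G x y z * d x z) + ∑₃ (λ x y z → G x y z * d x y))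
        ≡⟨ cong (∑GU +_) (trans (cong₂ _+_ (cong₂ _+_ P₁ P₂) P₃) (three P)) ⟩
      ∑GU + 3 * P ∎
      where lemma : ∀ g u a b c → g * (u + (a + b + c)) ≡ g * u + (g * a + g * b + g * c)
            lemma = solve-∀
    A₂ : ∀ x y z v → G x y z * (G y z v * G x y v) ≡ G x z y * (G x y v * G z y v)
    A₂ x y z v rewrite G-swap₂₃ x y z | G-swap₁₂ y z v = cong (G x z y *_) (*-comm (G z y v) _)
    A₃ : ∀ x y z v → G x y z * (G x z v * G x y v) ≡ G y z x * (G y x v * G z x v)
    A₃ x y z v rewrite G-rotate y z x | G-swap₁₂ y x v | G-swap₁₂ z x v = cong (G x y z *_) (*-comm (G x z v) _)
    A₁ : ∀ x y z v → G x y z * (G y z v * G x z v) ≡ G x y z * (G x z v * G y z v)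
    A₁ x y z v = cong (G x y z *_) (*-comm (G y z v) _)
    right : ∑₃ (λ x y z → G x y z * (n + ∑₁ (λ v → G y z v * G x z v + G y z v * G x y v + G x z v * G x y v)))
      ≡ n * S + 3 * ∑₃ A
    right = begin
      ∑₃ (λ x y z → G x y z * (n + ∑₁ (λ v → G y z v * G x z v + G y z v * G x y v + G x z v * G x y v)))
        ≡⟨ ∑₃-cong (λ x y z → trans (*-distribˡ-+ (G x y z) n _) (cong₂ _+_ (*-comm (G x y z) n)
             (trans (sym (∑₁-* (G x y z) _)) (trans (∑₁-cong λ v → trans (lemma (G x y z) _ _ _)
               (cong₂ _+_ (cong₂ _+_ (A₁ x y z v) (A₂ x y z v)) (A₃ x y z v)))
               (trans (∑₁-+ _ _) (cong-+ˡ (∑₁-+ _ _))))))) ⟩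
      ∑₃ (λ x y z → n * G x y z + (A x y z + A x z y + A y z x))
        ≡⟨ trans (∑₃-+ _ _) (cong₂ _+_ (∑₃-* n G) (trans (∑₃-+ _ _) (cong-+ˡ (∑₃-+ _ _)))) ⟩
      n * S + (∑₃ A + ∑₃ (λ x y z → A x z y) + ∑₃ (λ x y z → A y z x))
        ≡⟨ cong (n * S +_) (trans (cong₂ _+_ (cong (∑₃ A +_) (sym (∑₃-swap₂₃ A))) (sym (∑₃-rotate A))) (three (∑₃ A))) ⟩
      n * S + 3 * ∑₃ A ∎
      where lemma : ∀ g a b c → g * (a + b + c) ≡ g * a + g * b + g * c
            lemma = solve-∀

  B : ℕ
  B = ∑₂ λ y z → ∑₂ λ a b → G y z a * G y z b * d a b

  -- By `light`: a heavy pair costs at most n and is counted by R, a light one costs at most n/k.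
  B-bound : k * B ≤ k * n * R + n * (n * (n * (n * n)))
  B-bound = subst₂ _≤_ (trans (∑₂-cong λ y z → ∑₂-* k _) (∑₂-* k _))
    (trans (∑₂-cong λ y z → trans (∑₂-+ _ _) (cong₂ _+_ (∑₂-* (k * n) _) (∑₂-const n)))
      (trans (∑₂-+ _ _) (cong₂ _+_ (∑₂-* (k * n) _) (∑₂-const _))))
    (∑₂-mono λ y z → ∑₂-mono λ a b → pointwise (edge? H y z a) (edge? H y z b) a b)
    where
    pointwise : ∀ p q a b → k * (𝟙 p * 𝟙 q * d a b) ≤ k * n * (𝟙 p * 𝟙 q * O a b) + n
    pointwise true  true  a b rewrite +-identityʳ (d a b) | +-identityʳ (O a b) = light a b
    pointwise true  false a b = ≤-trans (≤-reflexive (*-zeroʳ k)) z≤n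
    pointwise false q     a b = ≤-trans (≤-reflexive (*-zeroʳ k)) z≤n

  -- Each of the three summands of `C` involves only two of x, y, z. The third vertex is free and
  -- yields the factor n.
  ∑M-bound : ∑₃ M ≡ 3 * (n * B)
  ∑M-bound = begin
    ∑₃ (λ x y z → ∑₂ λ a b → C x y z a b * d a b)
      ≡⟨ ∑₃-cong (λ x y z → trans (∑₂-cong λ a b → lemma (G y z a * G y z b) (G x z a * G x z b) (G x y a * G x y b) (d a b))
           (trans (∑₂-+ _ _) (cong-+ˡ (∑₂-+ _ _)))) ⟩
    ∑₃ (λ x y z → b y z + b x z + b x y)
      ≡⟨ trans (∑₃-+ _ _) (cong-+ˡ (∑₃-+ _ _)) ⟩
    ∑₃ (λ x y z → b y z) + ∑₃ (λ x y z → b x z) + ∑₃ (λ x y z → b x y)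
      ≡⟨ cong₂ _+_ (cong₂ _+_ (∑₁-const B) (trans (∑₃-swap₁₂ _) (∑₁-const B))) (trans (∑₃-rotate _) (∑₁-const B)) ⟩
    n * B + n * B + n * B
      ≡⟨ lemma₂ (n * B) ⟩
    3 * (n * B) ∎
    where
    open ≡-Reasoning
    b : Fin n → Fin n → ℕ
    b y z = ∑₂ λ a b → G y z a * G y z b * d a b
    lemma : ∀ p q r d → (p + q + r) * d ≡ p * d + q * d + r * d
    lemma = solve-∀
    lemma₂ : ∀ a → a + a + a ≡ 3 * a
    lemma₂ = solve-∀

  -- An average over the edges xyz. Since S ≥ n³/9, the total 64 n⁶ is at most 576 n³ for each
  -- ordered edge; the strict inequality that produces an edge raises this to 577.
  stable-cut : 1 ≤ n → 3 * k ≤ n → 4 ≤ n → k * R ≤ n * (n * (n * n)) → 6 * (n * (n * n)) ≤ 27 * S + 12 * (n * n) →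
    Σ (Fin n → Fin 3) λ c → k * noncrossing c ≤ 577 * (n * (n * n))
  stable-cut 1≤n 3k≤n 4≤n sparse many =
    let x , y , z , lt = ∑₃<⇒∃ {n} {λ x y z → G x y z * (k * noncrossing (κ x y z))} {λ x y z → G x y z * (577 * (n * (n * n)))} small
    in κ x y z , pick (edge? H x y z) lt
    where
    pick : ∀ b {p q} → 𝟙 b * p < 𝟙 b * q → p ≤ q
    pick true {p} {q} h = <⇒≤ (subst₂ _<_ (+-identityʳ p) (+-identityʳ q) h)
    total : ∑₃ (λ x y z → G x y z * (k * noncrossing (κ x y z))) ≤ 3 * (n * (n * (k * ∑GU))) + 3 * (k * ∑₃ M)
    total = ≤-trans (∑₃-mono λ x y z → ≤-trans (*-monoʳ-≤ (G x y z) (*-monoʳ-≤ k (noncrossing-bound x y z)))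
        (≤-trans (≤-reflexive (lemma (G x y z) k n (U x y z) (M x y z)))
          (+-monoʳ-≤ (3 * (n * (n * k)) * (G x y z * U x y z)) (𝟙*≤ (edge? H x y z) (3 * k * M x y z)))))
      (≤-reflexive (trans (∑₃-+ _ _) (trans (cong₂ _+_ (∑₃-* (3 * (n * (n * k))) _) (∑₃-* (3 * k) M)) (lemma₂ k n ∑GU (∑₃ M)))))
      where
      lemma : ∀ g k n u m → g * (k * (3 * (n * (n * u)) + 3 * m)) ≡ 3 * (n * (n * k)) * (g * u) + g * (3 * k * m)
      lemma = solve-∀
      lemma₂ : ∀ k n u m → 3 * (n * (n * k)) * u + 3 * k * m ≡ 3 * (n * (n * (k * u))) + 3 * (k * m)
      lemma₂ = solve-∀
    kGU : k * ∑GU ≤ 6 * (k * R) + k * (n * (n * n)) + 9 * (n * (n * (n * n)))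
    kGU = lin≤ 0 (+-mono-≤ (*-monoʳ-≤ k ∑GU-bound) (+-mono-≤ (*-monoʳ-≤ 3 ∑A≤) (codegree-bound many))) (lemma k n ∑GU P S (∑₃ A) R)
      where
      lemma : ∀ k n u P S A R →
        k * u + (k * (n * S + 3 * A) + (3 * (k * R + n * (n * (n * n))) + (3 * (k * P) + 3 * (k * R) + k * (n * (n * n)) + 6 * (n * (n * (n * n)))))) + 0
        ≡ 6 * (k * R) + k * (n * (n * n)) + 9 * (n * (n * (n * n))) + (k * (u + 3 * P) + (3 * (k * A) + k * (n * S)))
      lemma = solve-∀
    n⁶ = n * n * n * n * n * n
    -- 64 = 27 + 9 + 27 + 1: from `kGU`, from `B-bound`, from all terms with R, and from 3k · n⁵ ≤
    -- n⁶.
    upper : ∑₃ (λ x y z → G x y z * (k * noncrossing (κ x y z))) ≤ 64 * n⁶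
    upper = ≤-trans total (≤-trans (≤-reflexive (cong (λ z → 3 * (n * (n * (k * ∑GU))) + 3 * (k * z)) ∑M-bound))
      (lin≤ 0 (+-mono-≤ (*-monoʳ-≤ (3 * (n * n)) kGU) (+-mono-≤ (*-monoʳ-≤ (9 * n) B-bound)
         (+-mono-≤ (*-monoʳ-≤ (27 * (n * n)) sparse) (*-monoʳ-≤ (n * (n * (n * (n * n)))) 3k≤n))))
        (lemma k n ∑GU B R)))
      where
      lemma : ∀ k n u B R →
        3 * (n * (n * (k * u))) + 3 * (k * (3 * (n * B)))
          + (3 * (n * n) * (6 * (k * R) + k * (n * (n * n)) + 9 * (n * (n * (n * n))))
          + (9 * n * (k * n * R + n * (n * (n * (n * n)))) + (27 * (n * n) * (n * (n * (n * n))) + n * (n * (n * (n * n))) * n))) + 0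
        ≡ 64 * (n * n * n * n * n * n)
          + (3 * (n * n) * (k * u) + (9 * n * (k * B) + (27 * (n * n) * (k * R) + n * (n * (n * (n * n))) * (3 * k))))
      lemma = solve-∀
    n³≤9S : n * (n * n) ≤ 9 * S
    n³≤9S = *-cancelˡ-≤ 3 (lin≤ 0 (+-mono-≤ many (*-monoʳ-≤ (3 * (n * n)) 4≤n)) (lemma n S))
      where
      lemma : ∀ n S → 3 * (n * (n * n)) + (27 * S + 12 * (n * n) + 3 * (n * n) * n) + 0
        ≡ 3 * (9 * S) + (6 * (n * (n * n)) + 3 * (n * n) * 4)
      lemma = solve-∀
    n³>0 : 0 < n * (n * n)
    n³>0 = *-mono-≤ 1≤n (*-mono-≤ 1≤n 1≤n)
    S>0 : 0 < S
    S>0 = *-cancelˡ-< 9 0 S (≤-trans n³>0 n³≤9S)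
    small : ∑₃ (λ x y z → G x y z * (k * noncrossing (κ x y z))) < ∑₃ (λ x y z → G x y z * (577 * (n * (n * n))))
    small = begin-strict
      ∑₃ (λ x y z → G x y z * (k * noncrossing (κ x y z)))  ≤⟨ upper ⟩
      64 * n⁶                                               ≡⟨ lemma₁ n ⟩
      64 * (n * (n * n)) * (n * (n * n))                    ≤⟨ *-monoʳ-≤ (64 * (n * (n * n))) n³≤9S ⟩
      64 * (n * (n * n)) * (9 * S)                          ≡⟨ lemma₂ (n * (n * n)) S ⟩
      576 * (S * (n * (n * n)))                             <⟨ *-monoˡ-< _ {{>-nonZero (*-mono-≤ S>0 n³>0)}} {576} {577} ≤-refl ⟩
      577 * (S * (n * (n * n)))                             ≡⟨ lemma₃ S (n * (n * n)) ⟩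
      S * (577 * (n * (n * n)))                             ≡⟨ trans (∑₂-cong λ x y → ∑₁-*ʳ _ (G x y)) (∑₂-*ʳ _ _) ⟨
      ∑₃ (λ x y z → G x y z * (577 * (n * (n * n)))) ∎
      where
      open ≤-Reasoning
      lemma₁ : ∀ n → 64 * (n * n * n * n * n * n) ≡ 64 * (n * (n * n)) * (n * (n * n))
      lemma₁ = solve-∀
      lemma₂ : ∀ a S → 64 * a * (9 * S) ≡ 576 * (S * a)
      lemma₂ = solve-∀
      lemma₃ : ∀ S a → 577 * (S * a) ≡ S * (577 * a)
      lemma₃ = solve-∀

module _ (m t s : ℕ) (1≤t : 1 ≤ t) (1≤s : 1 ≤ s) (4≤2s : 4 ≤ 2 * s) (2s≤m : 2 * s ≤ m) where

  -- F₅ has to be sparse at density 1/(2k²): one factor k is lost because heavy means codegree n/k,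
  -- the other is the factor wanted in k · R ≤ n⁴. The 2 leaves half of the bound to degenerate
  -- configurations, which 4k² ≤ n controls.
  stabilitySize : ℕ → ℕ
  stabilitySize k = boxSize (m + s + t) (2 * (k * k)) 5 + (4 * (k * k) + (3 * k + 4))

  stability : ∀ k n → stabilitySize k ≤ n → 1 ≤ k → (H : Graph3 n) → ¬ Contains (F5S m t s) H →
    6 * (n * (n * n)) ≤ 27 * Weights.S H + 12 * (n * n) →
    Σ (Fin n → Fin 3) λ c → k * Weights.noncrossing H c ≤ 577 * (n * (n * n))
  stability k n n≥ 1≤k H free = StableCut.stable-cut H k (≤-trans (s≤s z≤n) 4≤n) 3k≤n 4≤n kR≤
    where
    open Weights H
    open Stability H k
    open Free m t s 1≤t 1≤s 4≤2s 2s≤m n H free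
    rest≤n : 4 * (k * k) + (3 * k + 4) ≤ n
    rest≤n = ≤-trans (m≤n+m _ (boxSize (m + s + t) (2 * (k * k)) 5)) n≥
    3k≤n : 3 * k ≤ n
    3k≤n = ≤-trans (m≤m+n (3 * k) 4) (≤-trans (m≤n+m _ (4 * (k * k))) rest≤n)
    4≤n : 4 ≤ n
    4≤n = ≤-trans (m≤n+m 4 (3 * k)) (≤-trans (m≤n+m _ (4 * (k * k))) rest≤n)
    4k²≤n : 4 * (k * k) ≤ n
    4k²≤n = ≤-trans (m≤m+n _ _) rest≤n
    box≤n : boxSize₅ (2 * (k * k)) ≤ n
    box≤n = ≤-trans (m≤m+n _ _) n≥
    n⁴ = n * (n * (n * n))
    F : ℕ
    F = ∑₁ λ τ → ∑₂ λ c v → ∑₂ λ a b → 𝟙 (isF₅ H τ c v a b)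
    F-sparse : 2 * (k * k) * F ≤ n * n⁴
    F-sparse = subst₂ _≤_ (cong (2 * (k * k) *_) (∑-allFin λ _ → refl)) (cong (_* n⁴) (length-allFin n))
      (<⇒≤ (F₅-sparse-τ (2 * (k * k)) (allFin n) (allFin⁺ n)
        (subst (boxSize₅ (2 * (k * k)) ≤_) (sym (length-allFin n)) box≤n) box≤n))
    W : ℕ
    W = ∑₂ λ a b → ∑₂ λ c v → G a b c * G a b v * d c v
    nR≤kW : n * R ≤ k * W
    nR≤kW = subst₂ _≤_ (trans (∑₂-cong λ a b → ∑₂-* n _) (∑₂-* n _)) (trans (∑₂-cong λ a b → ∑₂-* k _) (∑₂-* k _))
      (∑₂-mono λ a b → ∑₂-mono λ c v → pointwise (G a b c * G a b v) c v)
      where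
      pointwise : ∀ g c v → n * (g * O c v) ≤ k * (g * d c v)
      pointwise g c v with heavy c v in eq
      ... | true  = ≤-trans (≤-reflexive (lemma n g)) (≤-trans (*-monoʳ-≤ g (n≤ᵇ-true n (k * d c v) eq)) (≤-reflexive (lemma₂ g k (d c v))))
        where lemma : ∀ n g → n * (g * 1) ≡ g * n
              lemma = solve-∀
              lemma₂ : ∀ g k d → g * (k * d) ≡ k * (g * d)
              lemma₂ = solve-∀
      ... | false = ≤-trans (≤-reflexive (trans (cong (n *_) (*-zeroʳ g)) (*-zeroʳ n))) z≤n
    -- The loss 2n⁴ is for the coincidences a = τ and b = τ, which `isF₅` excludes.
    W≤F : W ≤ F + 2 * n⁴
    W≤F = begin
      W ≡⟨ ∑₂-cong (λ a b → trans (∑₂-cong λ c v → sym (∑₁-* (G a b c * G a b v) (G c v))) (∑₃-rotate λ c v τ → G a b c * G a b v * G c v τ)) ⟩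
      ∑₂ (λ a b → ∑₁ λ τ → ∑₂ λ c v → G a b c * G a b v * G c v τ)
        ≡⟨ ∑₃-rotate (λ a b τ → ∑₂ λ c v → G a b c * G a b v * G c v τ) ⟩
      ∑₁ (λ τ → ∑₂ λ a b → ∑₂ λ c v → G a b c * G a b v * G c v τ)
        ≡⟨ ∑₁-cong (λ τ → ∑₂-swap λ a b c v → G a b c * G a b v * G c v τ) ⟩
      ∑₁ (λ τ → ∑₂ λ c v → ∑₂ λ a b → G a b c * G a b v * G c v τ)
        ≤⟨ ∑₁-mono (λ τ → ∑₂-mono λ c v → ∑₂-mono λ a b → pointwise τ c v a b) ⟩
      ∑₁ (λ τ → ∑₂ λ c v → ∑₂ λ a b → 𝟙 (isF₅ H τ c v a b) + (𝟙 (a == τ) + 𝟙 (b == τ)))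
        ≡⟨ trans (∑₁-cong λ τ → trans (∑₂-cong λ c v → ∑₂-+ _ _) (∑₂-+ _ _)) (∑₁-+ _ _) ⟩
      F + ∑₁ (λ τ → ∑₂ λ c v → ∑₂ λ a b → 𝟙 (a == τ) + 𝟙 (b == τ))
        ≤⟨ +-monoʳ-≤ F (∑₃-mono λ τ c v → coincidences τ) ⟩
      F + ∑₃ {n} (λ τ c v → n + n)
        ≡⟨ cong (F +_) (trans (∑₃-const (n + n)) (lemma n)) ⟩
      F + 2 * n⁴ ∎
      where
      open ≤-Reasoning
      lemma : ∀ n → n * (n * (n * (n + n))) ≡ 2 * (n * (n * (n * n)))
      lemma = solve-∀
      bools : ∀ p q r x y → 𝟙 p * 𝟙 q * 𝟙 r ≤ 𝟙 (r ∧ p ∧ q ∧ not x ∧ not y) + (𝟙 x + 𝟙 y)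
      bools true  true  true  true  y     = s≤s z≤n
      bools true  true  true  false true  = ≤-refl
      bools true  true  true  false false = ≤-refl
      bools true  true  false x     y     = z≤n
      bools true  false r     x     y     = z≤n
      bools false q     r     x     y     = z≤n
      pointwise : ∀ τ c v a b → G a b c * G a b v * G c v τ ≤ 𝟙 (isF₅ H τ c v a b) + (𝟙 (a == τ) + 𝟙 (b == τ))
      pointwise τ c v a b rewrite G-rotate a b c | G-rotate a b v | G-rotate c v τ =
        bools (edge? H c a b) (edge? H v a b) (edge? H τ c v) (a == τ) (b == τ)
    kR≤ : k * R ≤ n⁴
    kR≤ = *-cancelˡ-≤ (2 * n) {{m*n≢0 2 n {{nonZero}} {{>-nonZero (≤-trans (s≤s z≤n) 4≤n)}}}} (lin≤ 0
      (+-mono-≤ (*-monoʳ-≤ (2 * k) nR≤kW) (+-mono-≤ (*-monoʳ-≤ (2 * (k * k)) W≤F) (+-mono-≤ F-sparse (*-monoˡ-≤ n⁴ 4k²≤n))))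
      (lemma k n R W F))
      where
      lemma : ∀ k n R W F →
        2 * n * (k * R) + (2 * k * (k * W) + (2 * (k * k) * (F + 2 * (n * (n * (n * n)))) + (n * (n * (n * (n * n))) + n * (n * (n * (n * n)))))) + 0
        ≡ 2 * n * (n * (n * (n * n))) + (2 * k * (n * R) + (2 * (k * k) * W + (2 * (k * k) * F + 4 * (k * k) * (n * (n * (n * n))))))
      lemma = solve-∀

-- Locally optimal 3-colourings

∑₁-δ : ∀ {n} (w : Fin n) (f : Fin n → ℕ) → ∑₁ (λ a → 𝟙 (a == w) * f a) ≡ f w
∑₁-δ {suc n} fzero f = trans (∑₁-suc _) (trans (cong₂ _+_ (+-identityʳ (f fzero)) (trans (∑₁-const 0) (*-zeroʳ n))) (+-identityʳ (f fzero)))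
∑₁-δ {suc n} (fsuc w) f = trans (∑₁-suc _)
  (trans (∑₁-cong λ x → cong (λ b → 𝟙 b * f (fsuc x)) (shift x)) (∑₁-δ w (f ∘ fsuc)))
  where shift : ∀ x → (fsuc x == fsuc w) ≡ (x == w)
        shift x with x ≟ w
        ... | yes _ = refl
        ... | no _  = refl

==-sym : ∀ {n} (x y : Fin n) → (x == y) ≡ (y == x)
==-sym x y with x ≟ y | y ≟ x
... | yes _ | yes _ = refl
... | no _  | no _  = refl
... | yes p | no q  = ⊥-elim (q (sym p))
... | no p  | yes q = ⊥-elim (p (sym q))

rainbow-pairs : ∀ p r k i j → rainbow? p r k ≡ true →
  𝟙 (rainbow? p i j) ≡ 𝟙 (i == r) * 𝟙 (j == k) + 𝟙 (i == k) * 𝟙 (j == r)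
rainbow-pairs = toWitness {a? = all? λ p → all? λ r → all? λ k → all? λ i → all? λ j →
  (rainbow? p r k ≟ᵇ true) →-dec (𝟙 (rainbow? p i j) ≟ⁿ (𝟙 (i == r) * 𝟙 (j == k) + 𝟙 (i == k) * 𝟙 (j == r)))} tt

third-colour : ∀ p r → p ≢ r → Σ (Fin 3) λ k → rainbow? p r k ≡ true
third-colour fzero fzero p = ⊥-elim (p refl)
third-colour fzero (fsuc fzero) p = fsuc (fsuc fzero) , refl
third-colour fzero (fsuc (fsuc fzero)) p = fsuc fzero , refl
third-colour (fsuc fzero) fzero p = fsuc (fsuc fzero) , refl
third-colour (fsuc fzero) (fsuc fzero) p = ⊥-elim (p refl)
third-colour (fsuc fzero) (fsuc (fsuc fzero)) p = fzero , refl
third-colour (fsuc (fsuc fzero)) fzero p = fsuc fzero , refl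
third-colour (fsuc (fsuc fzero)) (fsuc fzero) p = fzero , refl
third-colour (fsuc (fsuc fzero)) (fsuc (fsuc fzero)) p = ⊥-elim (p refl)

rainbow-swap₁₂ : ∀ i j k → rainbow? i j k ≡ rainbow? j i k
rainbow-swap₁₂ i j k = distinct3-swap₁₂ (toℕ i) (toℕ j) (toℕ k)

rainbow-swap₂₃ : ∀ i j k → rainbow? i j k ≡ rainbow? i k j
rainbow-swap₂₃ i j k = distinct3-swap₂₃ (toℕ i) (toℕ j) (toℕ k)

recolour : ∀ {n} → (Fin n → Fin 3) → Fin n → Fin 3 → Fin n → Fin 3
recolour κ w i v = if v == w then i else κ v

recolour-other : ∀ {n} (κ : Fin n → Fin 3) w i {v} → v ≢ w → recolour κ w i v ≡ κ v
recolour-other κ w i {v} v≢w with v ≟ w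
... | yes p = ⊥-elim (v≢w p)
... | no _  = refl

recolour-same : ∀ {n} (κ : Fin n → Fin 3) w i → recolour κ w i w ≡ i
recolour-same κ w i rewrite ==-refl w = refl

module LocalOptimum {n : ℕ} (H : Graph3 n) where
  open Weights H

  Optimal : (Fin n → Fin 3) → Set
  Optimal κ = ∀ w i → noncrossing κ ≤ noncrossing (recolour κ w i)

  -- Local search with `N` as fuel: every step lowers the number of noncrossing triples, which `N`
  -- bounds, so the fuel lasts until an optimum is reached.
  optimise : ∀ N κ → noncrossing κ ≤ N → Σ (Fin n → Fin 3) λ κ′ → noncrossing κ′ ≤ noncrossing κ × Optimal κ′
  optimise N κ κ≤N with any? (λ w → any? (λ i → noncrossing (recolour κ w i) <? noncrossing κ))
  ... | no optimal = κ , ≤-refl , λ w i → ≮⇒≥ λ lt → optimal (w , i , lt)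
  optimise zero    κ κ≤N | yes (w , i , lt) = ⊥-elim (<⇒≱ lt (≤-trans κ≤N z≤n))
  optimise (suc N) κ κ≤N | yes (w , i , lt) =
    let κ′ , le , opt = optimise N (recolour κ w i) (≤-pred (≤-trans lt κ≤N))
    in κ′ , ≤-trans le (<⇒≤ lt) , opt

  crossing : (Fin n → Fin 3) → Fin n → Fin n → Fin n → ℕ
  crossing κ a b c = 𝟙 (edge? H a b c ∧ rainbow? (κ a) (κ b) (κ c))

  crossing+noncrossing : ∀ κ → ∑₃ (crossing κ) + noncrossing κ ≡ S
  crossing+noncrossing κ = trans (sym (∑₃-+ _ _)) (∑₃-cong λ a b c → split (edge? H a b c) (rainbow? (κ a) (κ b) (κ c)))
    where split : ∀ x y → 𝟙 (x ∧ y) + 𝟙 (x ∧ not y) ≡ 𝟙 x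
          split true  true  = refl
          split true  false = refl
          split false y     = refl

  crossing-swap₁₂ : ∀ κ a b c → crossing κ a b c ≡ crossing κ b a c
  crossing-swap₁₂ κ a b c = cong₂ (λ x y → 𝟙 (x ∧ y)) (edge?-swap₁₂ H a b c) (rainbow-swap₁₂ (κ a) (κ b) (κ c))

  crossing-swap₂₃ : ∀ κ a b c → crossing κ a b c ≡ crossing κ a c b
  crossing-swap₂₃ κ a b c = cong₂ (λ x y → 𝟙 (x ∧ y)) (edge?-swap₂₃ H a b c) (rainbow-swap₂₃ (κ a) (κ b) (κ c))

  module _ (w : Fin n) where
    avoiding : Fin n → Fin n → Fin n → Bool
    avoiding a b c = not (a == w) ∧ not (b == w) ∧ not (c == w)

    -- An edge contains w at most once, so the four cases exclude each other. Recolouring w does not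
    -- affect the first sum, hence optimality becomes a statement about the link of w alone.
    through-w : ∀ κ → ∑₃ (crossing κ)
      ≡ ∑₃ (λ a b c → 𝟙 (avoiding a b c) * crossing κ a b c) + 3 * ∑₂ (crossing κ w)
    through-w κ = begin
      ∑₃ F
        ≡⟨ ∑₃-cong pointwise ⟩
      ∑₃ (λ a b c → 𝟙 (avoiding a b c) * F a b c + (𝟙 (a == w) * F a b c + 𝟙 (b == w) * F a b c + 𝟙 (c == w) * F a b c))
        ≡⟨ trans (∑₃-+ _ _) (cong (R +_) (trans (∑₃-+ _ _) (cong-+ˡ (∑₃-+ _ _)))) ⟩
      R + (∑₃ (λ a b c → 𝟙 (a == w) * F a b c) + ∑₃ (λ a b c → 𝟙 (b == w) * F a b c) + ∑₃ (λ a b c → 𝟙 (c == w) * F a b c))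
        ≡⟨ cong (R +_) (cong₂ _+_ (cong₂ _+_ first second) third) ⟩
      R + (∑₂ (F w) + ∑₂ (F w) + ∑₂ (F w))
        ≡⟨ lemma R (∑₂ (F w)) ⟩
      R + 3 * ∑₂ (F w) ∎
      where
      open ≡-Reasoning
      F = crossing κ
      R = ∑₃ (λ a b c → 𝟙 (avoiding a b c) * F a b c)
      lemma : ∀ r a → r + (a + a + a) ≡ r + 3 * a
      lemma = solve-∀
      first : ∑₃ (λ a b c → 𝟙 (a == w) * F a b c) ≡ ∑₂ (F w)
      first = trans (∑₁-cong λ a → ∑₂-* (𝟙 (a == w)) (F a)) (∑₁-δ w (λ a → ∑₂ (F a)))
      second : ∑₃ (λ a b c → 𝟙 (b == w) * F a b c) ≡ ∑₂ (F w)
      second = trans (∑₃-swap₁₂ _) (trans (∑₃-cong λ a b c → cong (𝟙 (a == w) *_) (crossing-swap₁₂ κ b a c)) first)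
      third : ∑₃ (λ a b c → 𝟙 (c == w) * F a b c) ≡ ∑₂ (F w)
      third = trans (∑₃-swap₂₃ _) (trans (∑₃-cong λ a b c → cong (𝟙 (b == w) *_) (crossing-swap₂₃ κ a c b)) second)
      pointwise : ∀ a b c → F a b c ≡ 𝟙 (avoiding a b c) * F a b c + (𝟙 (a == w) * F a b c + 𝟙 (b == w) * F a b c + 𝟙 (c == w) * F a b c)
      pointwise a b c with edge? H a b c in eq
      ... | false rewrite *-zeroʳ (𝟙 (avoiding a b c)) | *-zeroʳ (𝟙 (a == w)) | *-zeroʳ (𝟙 (b == w)) | *-zeroʳ (𝟙 (c == w)) = refl
      ... | true with edge?-distinct H eq
      ... | a≢b , b≢c , a≢c with a ≟ w | b ≟ w | c ≟ w
      ... | yes p | yes q | _     = ⊥-elim (a≢b (trans p (sym q)))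
      ... | yes p | no _  | yes r = ⊥-elim (a≢c (trans p (sym r)))
      ... | yes p | no _  | no _  = one (rainbow? (κ a) (κ b) (κ c))
        where one : ∀ x → 𝟙 x ≡ 0 + (1 * 𝟙 x + 0 + 0)
              one true = refl
              one false = refl
      ... | no _  | yes q | yes r = ⊥-elim (b≢c (trans q (sym r)))
      ... | no _  | yes q | no _  = one (rainbow? (κ a) (κ b) (κ c))
        where one : ∀ x → 𝟙 x ≡ 0 + (0 + 1 * 𝟙 x + 0)
              one true = refl
              one false = refl
      ... | no _  | no _  | yes r = one (rainbow? (κ a) (κ b) (κ c))
        where one : ∀ x → 𝟙 x ≡ 0 + (0 + 0 + 1 * 𝟙 x)
              one true = refl
              one false = refl
      ... | no _  | no _  | no _  = one (rainbow? (κ a) (κ b) (κ c))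
        where one : ∀ x → 𝟙 x ≡ 1 * 𝟙 x + 0
              one true = refl
              one false = refl

    local : ∀ κ i → Optimal κ → ∑₂ (crossing (recolour κ w i) w) ≤ ∑₂ (crossing κ w)
    local κ i opt = *-cancelˡ-≤ 3 (+-cancelˡ-≤ R _ _ (begin
      R + 3 * ∑₂ (crossing κ′ w)
        ≡⟨ cong-+ˡ (∑₃-cong same) ⟩
      ∑₃ (λ a b c → 𝟙 (avoiding a b c) * crossing κ′ a b c) + 3 * ∑₂ (crossing κ′ w)
        ≡⟨ through-w κ′ ⟨
      ∑₃ (crossing κ′)
        ≤⟨ +-cancelʳ-≤ (noncrossing κ) _ _ (≤-trans (+-monoʳ-≤ (∑₃ (crossing κ′)) (opt w i))
             (≤-reflexive (trans (crossing+noncrossing κ′) (sym (crossing+noncrossing κ))))) ⟩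
      ∑₃ (crossing κ)
        ≡⟨ through-w κ ⟩
      R + 3 * ∑₂ (crossing κ w) ∎))
      where
      open ≤-Reasoning
      κ′ = recolour κ w i
      R = ∑₃ (λ a b c → 𝟙 (avoiding a b c) * crossing κ a b c)
      same : ∀ a b c → 𝟙 (avoiding a b c) * crossing κ a b c ≡ 𝟙 (avoiding a b c) * crossing κ′ a b c
      same a b c with a == w | b == w | c == w
      ... | true  | _     | _     = refl
      ... | false | true  | _     = refl
      ... | false | false | true  = refl
      ... | false | false | false = refl

  module _ (κ : Fin n → Fin 3) where
    link : Fin n → Fin 3 → Fin 3 → ℕ
    link w q r = ∑₂ λ b c → G w b c * (𝟙 (κ b == q) * 𝟙 (κ c == r))

    link-sym : ∀ w q r → link w q r ≡ link w r q
    link-sym w q r = trans (∑₁-swap _) (∑₂-cong λ b c → cong₂ _*_ (G-swap₂₃ w c b) (*-comm (𝟙 (κ c == q)) _))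

    rainbow-link : ∀ w p r k → rainbow? p r k ≡ true →
      ∑₂ (λ b c → 𝟙 (edge? H w b c ∧ rainbow? p (κ b) (κ c))) ≡ 2 * link w r k
    rainbow-link w p r k h = begin
      ∑₂ (λ b c → 𝟙 (edge? H w b c ∧ rainbow? p (κ b) (κ c)))
        ≡⟨ ∑₂-cong (λ b c → trans (𝟙-∧ (edge? H w b c) _) (trans (cong (G w b c *_) (rainbow-pairs p r k (κ b) (κ c) h))
             (*-distribˡ-+ (G w b c) _ _))) ⟩
      ∑₂ (λ b c → G w b c * (𝟙 (κ b == r) * 𝟙 (κ c == k)) + G w b c * (𝟙 (κ b == k) * 𝟙 (κ c == r)))
        ≡⟨ ∑₂-+ _ _ ⟩
      link w r k + link w k r
        ≡⟨ cong (link w r k +_) (trans (link-sym w k r) (sym (+-identityʳ _))) ⟩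
      2 * link w r k ∎
      where open ≡-Reasoning

    -- Moving w from colour p to k would make the pairs of colours p, r in its link crossing in
    -- place of those of colours r, k; at an optimum this cannot be a gain.
    link-local : Optimal κ → ∀ w p r k → κ w ≡ p → rainbow? p r k ≡ true → link w p r ≤ link w r k
    link-local opt w p r k κw≡p h = *-cancelˡ-≤ 2 (begin
      2 * link w p r
        ≡⟨ rainbow-link w k p r (trans (rainbow-swap₁₂ k p r) (trans (rainbow-swap₂₃ p k r) h)) ⟨
      ∑₂ (λ b c → 𝟙 (edge? H w b c ∧ rainbow? k (κ b) (κ c)))
        ≡⟨ ∑₂-cong same ⟩
      ∑₂ (crossing (recolour κ w k) w)
        ≤⟨ local w κ k opt ⟩
      ∑₂ (crossing κ w)
        ≡⟨ rainbow-link w (κ w) r k (trans (cong (λ z → rainbow? z r k) κw≡p) h) ⟩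
      2 * link w r k ∎)
      where
      open ≤-Reasoning
      same : ∀ b c → 𝟙 (edge? H w b c ∧ rainbow? k (κ b) (κ c)) ≡ crossing (recolour κ w k) w b c
      same b c with edge? H w b c in eq
      ... | false = refl
      ... | true with edge?-distinct H eq
      ... | w≢b , b≢c , w≢c rewrite recolour-same κ w k | recolour-other κ w k (w≢b ∘ sym) | recolour-other κ w k (w≢c ∘ sym) = refl

-- Vertices with many bad edges

∑-filter : ∀ {A : Set} (p : A → Bool) (xs : List A) (f : A → ℕ) → ∑ (filterᵇ p xs) f ≡ ∑ xs (λ x → 𝟙 (p x) * f x)
∑-filter p []       f = refl
∑-filter p (x ∷ xs) f with p x
... | true  = cong₂ _+_ (sym (+-identityʳ (f x))) (∑-filter p xs f)
... | false = ∑-filter p xs f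

guard : ∀ b {x} → (b ≡ true → 1 ≤ x) → 𝟙 b ≤ x
guard true  h = h refl
guard false h = z≤n

module _ {n : ℕ} where
  ∑₂*∑₂ : ∀ (f g : Fin n → Fin n → ℕ) → ∑₂ f * ∑₂ g ≡ ∑₂ (λ a b → ∑₂ λ c d → f a b * g c d)
  ∑₂*∑₂ f g = trans (sym (∑₂-*ʳ (∑₂ g) f)) (∑₂-cong λ a b → sym (∑₂-* (f a b) g))

  members : (Fin n → Bool) → List (Fin n)
  members p = filterᵇ p (allFin n)

  members-unique : ∀ p → Unique (members p)
  members-unique p = filter⁺ (T? ∘ p) (allFin⁺ n)

  ∑-members : ∀ p (f : Fin n → ℕ) → ∑ (members p) f ≡ ∑₁ (λ x → 𝟙 (p x) * f x)
  ∑-members p f = trans (∑-filter p (allFin n) f) (∑-allFin λ _ → refl)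

  length-members : ∀ p → length (members p) ≡ ∑₁ (𝟙 ∘ p)
  length-members p = trans (length-∑ (members p)) (trans (∑-members p _) (∑₁-cong λ x → *-identityʳ _))

other-colours : ∀ q → Σ (Fin 3) λ j → Σ (Fin 3) λ k → rainbow? q j k ≡ true
other-colours fzero                = fsuc fzero , fsuc (fsuc fzero) , refl
other-colours (fsuc fzero)         = fzero , fsuc (fsuc fzero) , refl
other-colours (fsuc (fsuc fzero))  = fzero , fsuc fzero , refl

𝟙*-mono : ∀ b {x y} → (b ≡ true → x ≤ y) → 𝟙 b * x ≤ 𝟙 b * y
𝟙*-mono true  h = *-monoʳ-≤ 1 (h refl)
𝟙*-mono false h = z≤n

-- Under the two smallness assumptions the losses account for at most half of l · n⁴, so the other
-- half must come from F.
few-arithmetic : ∀ l n L F M → l * (n * (n * (n * n))) ≤ L * (F + l * (2 * (n * M) + 2 * (n * (n * n)))) →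
  8 * (L * M) ≤ n * (n * n) → 8 * L ≤ n → l * (n * (n * (n * n))) ≤ 4 * L * F
few-arithmetic l n L F M many 8LM 8L = lin≤ (l * (n * (n * (n * n))))
  (+-mono-≤ (*-monoʳ-≤ 4 many) (+-mono-≤ (*-monoʳ-≤ (n * l) 8LM) (*-monoʳ-≤ (n * (n * n) * l) 8L))) (lemma l n L F M)
  where
  lemma : ∀ l n L F M → l * (n * (n * (n * n))) + (4 * (L * (F + l * (2 * (n * M) + 2 * (n * (n * n))))) + (n * l * (n * (n * n)) + n * (n * n) * l * n)) + l * (n * (n * (n * n)))
    ≡ 4 * L * F + (4 * (l * (n * (n * (n * n)))) + (n * l * (8 * (L * M)) + n * (n * n) * l * (8 * L)))
  lemma = solve-∀

-- Missing and bad triples of a colouring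

module Partition {n : ℕ} (H : Graph3 n) (κ : Fin n → Fin 3) where
  open Weights H

  missing? : Fin n → Fin n → Fin n → Bool
  missing? a b c = rainbow? (κ a) (κ b) (κ c) ∧ not (edge? H a b c)

  mis : Fin n → ℕ
  mis a = ∑₂ λ b c → 𝟙 (missing? a b c)

  Mis Rain : ℕ
  Mis = ∑₁ mis
  Rain = ∑₃ λ a b c → 𝟙 (rainbow? (κ a) (κ b) (κ c))

  bad? : Fin n → Fin n → Fin n → Bool
  bad? a b c = edge? H a b c ∧ not (rainbow? (κ a) (κ b) (κ c))

  bad : Fin n → ℕ
  bad a = ∑₂ λ b c → 𝟙 (bad? a b c)

  class : Fin 3 → ℕ
  class i = ∑₁ λ v → 𝟙 (κ v == i)

  -- Both sides count the triples that are rainbow or edges.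
  Rain+noncrossing : Rain + noncrossing κ ≡ S + Mis
  Rain+noncrossing = trans (sym (∑₃-+ _ _)) (trans (∑₃-cong λ a b c → split (edge? H a b c) (rainbow? (κ a) (κ b) (κ c))) (∑₃-+ _ _))
    where split : ∀ x y → 𝟙 y + 𝟙 (x ∧ not y) ≡ 𝟙 x + 𝟙 (y ∧ not x)
          split true  true  = refl
          split true  false = refl
          split false true  = refl
          split false false = refl

  missing-if : ∀ {b u v q j k} → κ b ≡ q → κ u ≡ j → κ v ≡ k → rainbow? q j k ≡ true →
    𝟙 (missing? b u v) ≡ 𝟙 (not (edge? H b u v))
  missing-if {b} {u} {v} refl refl refl h = cong (λ x → 𝟙 (x ∧ not (edge? H b u v))) h

module LocalAnalysis (m t s : ℕ) (1≤t : 1 ≤ t) (1≤s : 1 ≤ s) (4≤2s : 4 ≤ 2 * s) (2s≤m : 2 * s ≤ m)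
  (n : ℕ) (H : Graph3 n) (free : ¬ Contains (F5S m t s) H)
  (κ : Fin n → Fin 3) (optimal : LocalOptimum.Optimal H κ) where

  open Weights H
  open LocalOptimum H
  open Partition H κ
  open Free m t s 1≤t 1≤s 4≤2s 2s≤m n H free

  n⁴ : ℕ
  n⁴ = n * (n * (n * n))

  -- What can spoil a copy of F₅ built from two pairs: at most two missing crossing triples, each
  -- with one free vertex, and two coincidences with τ.
  losses : ℕ
  losses = 2 * (n * Mis) + 2 * (n * (n * n))

  -- A pair b, c of colour q in the link of w, together with a pair u, v of the two other colours,
  -- is a copy of F₅ with w as τ, unless buv or cuv is missing or w is u or v.
  link-pair-τ : ∀ w q j k → rainbow? q j k ≡ true →
    link κ w q q * (class j * class k) ≤ ∑₄ (λ b c u v → 𝟙 (isF₅ H w b c u v)) + losses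
  link-pair-τ w q j k h = begin
    link κ w q q * (class j * class k)
      ≡⟨ cong (link κ w q q *_) (∑₁-*∑₁ _ _) ⟨
    link κ w q q * ∑₂ (λ u v → 𝟙 (κ u == j) * 𝟙 (κ v == k))
      ≡⟨ ∑₂*∑₂ _ _ ⟩
    ∑₂ (λ b c → ∑₂ λ u v → G w b c * (𝟙 (κ b == q) * 𝟙 (κ c == q)) * (𝟙 (κ u == j) * 𝟙 (κ v == k)))
      ≤⟨ ∑₂-mono (λ b c → ∑₂-mono λ u v → pointwise b c u v) ⟩
    ∑₂ (λ b c → ∑₂ λ u v → 𝟙 (isF₅ H w b c u v) + ((𝟙 (missing? b u v) + 𝟙 (missing? c u v)) + (𝟙 (u == w) + 𝟙 (v == w))))
      ≡⟨ trans (∑₂-cong λ b c → trans (∑₂-+ _ _) (cong (∑₂ (λ u v → 𝟙 (isF₅ H w b c u v)) +_)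
           (trans (∑₂-+ _ _) (cong-+ˡ (∑₂-+ _ _))))) (trans (∑₂-+ _ _) (cong (f +_) (trans (∑₂-+ _ _) (cong-+ˡ (∑₂-+ _ _))))) ⟩
    f + (∑₂ (λ b c → mis b) + ∑₂ (λ b c → mis c) + ∑₂ {n} (λ b c → ∑₂ λ u v → 𝟙 (u == w) + 𝟙 (v == w)))
      ≤⟨ +-monoʳ-≤ f (+-mono-≤ (≤-reflexive (cong₂ _+_ (trans (∑₁-cong λ b → ∑₁-const (mis b)) (∑₁-* n mis)) (∑₁-const Mis)))
           (≤-trans (∑₂-mono λ b c → coincidences w) (≤-reflexive (∑₂-const (n + n))))) ⟩
    f + (n * Mis + n * Mis + n * (n * (n + n)))
      ≡⟨ cong (f +_) (lemma n (n * Mis)) ⟩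
    f + losses ∎
    where
    open ≤-Reasoning
    f = ∑₄ (λ b c u v → 𝟙 (isF₅ H w b c u v))
    lemma : ∀ n a → a + a + n * (n * (n + n)) ≡ 2 * a + 2 * (n * (n * n))
    lemma = solve-∀
    bools : ∀ p a b x y → p ≡ true → 1 ≤ 𝟙 (p ∧ a ∧ b ∧ not x ∧ not y) + ((𝟙 (not a) + 𝟙 (not b)) + (𝟙 x + 𝟙 y))
    bools true true  true  true  y     _ = s≤s z≤n
    bools true true  true  false true  _ = ≤-refl
    bools true true  true  false false _ = ≤-refl
    bools true true  false x     y     _ = s≤s z≤n
    bools true false b     x     y     _ = s≤s z≤n
    pointwise : ∀ b c u v → G w b c * (𝟙 (κ b == q) * 𝟙 (κ c == q)) * (𝟙 (κ u == j) * 𝟙 (κ v == k)) ≤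
      𝟙 (isF₅ H w b c u v) + ((𝟙 (missing? b u v) + 𝟙 (missing? c u v)) + (𝟙 (u == w) + 𝟙 (v == w)))
    pointwise b c u v = ≤-trans (≤-reflexive (sym (trans (𝟙-∧ (X ∧ Y₁ ∧ Y₂) (Z₁ ∧ Z₂))
        (cong₂ _*_ (trans (𝟙-∧ X (Y₁ ∧ Y₂)) (cong (𝟙 X *_) (𝟙-∧ Y₁ Y₂))) (𝟙-∧ Z₁ Z₂)))))
      (guard ((X ∧ Y₁ ∧ Y₂) ∧ Z₁ ∧ Z₂) λ e →
        let e₁ = ∧-trueˡ {X ∧ Y₁ ∧ Y₂} e
            e₂ = ∧-trueʳ {X ∧ Y₁ ∧ Y₂} e
            eᵇ = ==-true (κ b) q (∧-trueˡ {Y₁} (∧-trueʳ {X} e₁))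
            eᶜ = ==-true (κ c) q (∧-trueʳ {Y₁} (∧-trueʳ {X} e₁))
            eᵘ = ==-true (κ u) j (∧-trueˡ {Z₁} e₂)
            eᵛ = ==-true (κ v) k (∧-trueʳ {Z₁} e₂)
        in subst (λ z → 1 ≤ 𝟙 (isF₅ H w b c u v) + (z + (𝟙 (u == w) + 𝟙 (v == w))))
             (cong₂ _+_ (sym (missing-if eᵇ eᵘ eᵛ h)) (sym (missing-if eᶜ eᵘ eᵛ h)))
             (bools X (edge? H b u v) (edge? H c u v) (u == w) (v == w) (∧-trueˡ {X} e₁)))
      where
      X = edge? H w b c
      Y₁ = κ b == q
      Y₂ = κ c == q
      Z₁ = κ u == j
      Z₂ = κ v == k

  -- Two pairs in the link of w, namely b, τ of colours p, r and u, v of colours r, k. The triple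
  -- buv is crossing, so unless it is missing or τ coincides with u or v, there is a copy of F₅ in
  -- which w has the role of a.
  link-pair-a : ∀ w p r k → rainbow? p r k ≡ true →
    link κ w p r * link κ w r k ≤ ∑₄ (λ b τ u v → 𝟙 (isF₅ H τ w b u v)) + losses
  link-pair-a w p r k h = begin
    link κ w p r * link κ w r k
      ≡⟨ ∑₂*∑₂ _ _ ⟩
    ∑₂ (λ b τ → ∑₂ λ u v → G w b τ * (𝟙 (κ b == p) * 𝟙 (κ τ == r)) * (G w u v * (𝟙 (κ u == r) * 𝟙 (κ v == k))))
      ≤⟨ ∑₂-mono (λ b τ → ∑₂-mono λ u v → pointwise b τ u v) ⟩
    ∑₂ (λ b τ → ∑₂ λ u v → 𝟙 (isF₅ H τ w b u v) + (𝟙 (missing? b u v) + (𝟙 (u == τ) + 𝟙 (v == τ))))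
      ≡⟨ trans (∑₂-cong λ b τ → trans (∑₂-+ _ _) (cong (∑₂ (λ u v → 𝟙 (isF₅ H τ w b u v)) +_)
           (∑₂-+ _ _))) (trans (∑₂-+ _ _) (cong (f +_) (∑₂-+ _ _))) ⟩
    f + (∑₂ {n} (λ b τ → mis b) + ∑₂ {n} (λ b τ → ∑₂ λ u v → 𝟙 (u == τ) + 𝟙 (v == τ)))
      ≤⟨ +-monoʳ-≤ f (+-mono-≤ (≤-trans (≤-reflexive (trans (∑₁-cong λ b → ∑₁-const (mis b)) (∑₁-* n mis))) (m≤m+n _ (n * Mis)))
           (≤-trans (∑₂-mono λ b τ → coincidences τ) (≤-reflexive (∑₂-const (n + n))))) ⟩
    f + (n * Mis + n * Mis + n * (n * (n + n)))
      ≡⟨ cong (f +_) (lemma n (n * Mis)) ⟩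
    f + losses ∎
    where
    open ≤-Reasoning
    f = ∑₄ (λ b τ u v → 𝟙 (isF₅ H τ w b u v))
    lemma : ∀ n a → a + a + n * (n * (n + n)) ≡ 2 * a + 2 * (n * (n * n))
    lemma = solve-∀
    bools : ∀ p q a x y → p ≡ true → q ≡ true → 1 ≤ 𝟙 (p ∧ q ∧ a ∧ not x ∧ not y) + (𝟙 (not a) + (𝟙 x + 𝟙 y))
    bools true true true  true  y     _ _ = s≤s z≤n
    bools true true true  false true  _ _ = ≤-refl
    bools true true true  false false _ _ = ≤-refl
    bools true true false x     y     _ _ = s≤s z≤n
    pointwise : ∀ b τ u v → G w b τ * (𝟙 (κ b == p) * 𝟙 (κ τ == r)) * (G w u v * (𝟙 (κ u == r) * 𝟙 (κ v == k))) ≤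
      𝟙 (isF₅ H τ w b u v) + (𝟙 (missing? b u v) + (𝟙 (u == τ) + 𝟙 (v == τ)))
    pointwise b τ u v = ≤-trans (≤-reflexive (sym (trans (𝟙-∧ (X ∧ Y₁ ∧ Y₂) (X′ ∧ Z₁ ∧ Z₂))
        (cong₂ _*_ (trans (𝟙-∧ X (Y₁ ∧ Y₂)) (cong (𝟙 X *_) (𝟙-∧ Y₁ Y₂)))
          (trans (𝟙-∧ X′ (Z₁ ∧ Z₂)) (cong (𝟙 X′ *_) (𝟙-∧ Z₁ Z₂)))))))
      (guard ((X ∧ Y₁ ∧ Y₂) ∧ X′ ∧ Z₁ ∧ Z₂) λ e →
        let e₁ = ∧-trueˡ {X ∧ Y₁ ∧ Y₂} e
            e₂ = ∧-trueʳ {X ∧ Y₁ ∧ Y₂} e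
            eᵇ = ==-true (κ b) p (∧-trueˡ {Y₁} (∧-trueʳ {X} e₁))
            eᵘ = ==-true (κ u) r (∧-trueˡ {Z₁} (∧-trueʳ {X′} e₂))
            eᵛ = ==-true (κ v) k (∧-trueʳ {Z₁} (∧-trueʳ {X′} e₂))
        in subst (λ z → 1 ≤ 𝟙 (isF₅ H τ w b u v) + (z + (𝟙 (u == τ) + 𝟙 (v == τ))))
             (sym (missing-if eᵇ eᵘ eᵛ h))
             (bools (edge? H τ w b) X′ (edge? H b u v) (u == τ) (v == τ)
               (IsEdge-swap₁₂ H (IsEdge-swap₂₃ H (∧-trueˡ {X} e₁))) (∧-trueˡ {X′} e₂)))
      where
      X = edge? H w b τ
      X′ = edge? H w u v
      Y₁ = κ b == p
      Y₂ = κ τ == r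
      Z₁ = κ u == r
      Z₂ = κ v == k

  module Few (K₁ L : ℕ) (1≤K₁ : 1 ≤ K₁) (L≡ : 16 * (K₁ * K₁) ≡ L) (n≥ : boxSize₅ (4 * L) ≤ n) (8L≤n : 8 * L ≤ n)
    (8LMis : 8 * (L * Mis) ≤ n * (n * n)) (classes : ∀ j k → n * n ≤ 16 * (class j * class k)) where

    private
      1≤n : 1 ≤ n
      1≤n = ≤-trans (boxSize≥1 (m + s + t) (4 * L) 5) n≥

    -- Otherwise the vertices with property p form a list long enough for sparsity, while their
    -- copies of F₅ are too many for it.
    few : (f : Fin n → ℕ) →
      (∀ X → Unique X → boxSize₅ (4 * L) ≤ length X → 4 * L * ∑ X f < length X * n⁴) →
      (p : Fin n → Bool) → (∀ w → p w ≡ true → n⁴ ≤ L * (f w + losses)) → ∑₁ (𝟙 ∘ p) ≤ boxSize₅ (4 * L)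
    few f sparse p dense = ≮⇒≥ λ more → <⇒≱ (sparse X (members-unique p) (subst (boxSize₅ (4 * L) ≤_) (sym (length-members p)) (<⇒≤ more)))
        (few-arithmetic l n L F Mis many 8LMis 8L≤n)
      where
      X = members p
      F = ∑ X f
      l = length X
      many : l * n⁴ ≤ L * (F + l * losses)
      many = begin
        l * n⁴                                   ≡⟨ ∑-const X n⁴ ⟨
        ∑ X (λ _ → n⁴)                           ≡⟨ ∑-members p _ ⟩
        ∑₁ (λ w → 𝟙 (p w) * n⁴)                  ≤⟨ ∑₁-mono (λ w → 𝟙*-mono (p w) (dense w)) ⟩
        ∑₁ (λ w → 𝟙 (p w) * (L * (f w + losses)))  ≡⟨ ∑-members p _ ⟨
        ∑ X (λ w → L * (f w + losses))           ≡⟨ trans (∑-* X L _) (cong (L *_) (trans (∑-+ X f _) (cong (F +_) (∑-const X losses)))) ⟩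
        L * (F + l * losses)                     ∎
        where open ≤-Reasoning

    dense? : Fin 3 → Fin 3 → Fin 3 → Fin n → Bool
    dense? p q r w = (κ w == p) ∧ not (rainbow? p q r) ∧ (n * n ≤ᵇ K₁ * link κ w q r)

    dense-elim : ∀ p q r w → dense? p q r w ≡ true → κ w ≡ p × rainbow? p q r ≡ false × n * n ≤ K₁ * link κ w q r
    dense-elim p q r w e = ==-true (κ w) p (∧-trueˡ e) , not-true (∧-trueˡ (∧-trueʳ {κ w == p} e)) ,
      n≤ᵇ-true (n * n) _ (∧-trueʳ {not (rainbow? p q r)} (∧-trueʳ {κ w == p} e))

    private
      from-pair : ∀ {x y z} → n * n ≤ K₁ * x → n * n ≤ K₁ * y → x * y ≤ z → n⁴ ≤ L * z
      from-pair {x} {y} {z} hx hy hxy = begin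
        n * (n * (n * n))        ≡⟨ *-assoc n n (n * n) ⟨
        n * n * (n * n)          ≤⟨ *-mono-≤ hx hy ⟩
        K₁ * x * (K₁ * y)        ≡⟨ lemma K₁ x y ⟩
        K₁ * K₁ * (x * y)        ≤⟨ *-mono-≤ (m≤n*m (K₁ * K₁) 16) hxy ⟩
        16 * (K₁ * K₁) * z       ≡⟨ cong (_* z) L≡ ⟩
        L * z                    ∎
        where
        open ≤-Reasoning
        lemma : ∀ k x y → k * x * (k * y) ≡ k * k * (x * y)
        lemma = solve-∀

      from-pair′ : ∀ {x y z} → n * n ≤ K₁ * x → n * n ≤ 16 * y → x * y ≤ z → n⁴ ≤ L * z
      from-pair′ {x} {y} {z} hx hy hxy = begin
        n * (n * (n * n))        ≡⟨ *-assoc n n (n * n) ⟨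
        n * n * (n * n)          ≤⟨ *-mono-≤ hx hy ⟩
        K₁ * x * (16 * y)        ≡⟨ lemma K₁ x y ⟩
        16 * (K₁ * 1) * (x * y)  ≤⟨ *-mono-≤ (*-monoʳ-≤ 16 (*-monoʳ-≤ K₁ 1≤K₁)) hxy ⟩
        16 * (K₁ * K₁) * z       ≡⟨ cong (_* z) L≡ ⟩
        L * z                    ∎
        where
        open ≤-Reasoning
        lemma : ∀ k x y → k * x * (16 * y) ≡ 16 * (k * 1) * (x * y)
        lemma = solve-∀

    -- If q = r, then w plays τ. Otherwise one of q, r is the colour of w, because pqr is not
    -- rainbow; local optimality makes the link of w dense on the two other colours as well, and the
    -- product of the two links counts copies of F₅ with w as a.
    few-dense : ∀ p q r → ∑₁ (𝟙 ∘ dense? p q r) ≤ boxSize₅ (4 * L)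
    few-dense p q r = by-colours (q ≟ r) (p ≟ q) (p ≟ r)
      where
      as-τ : (∀ w → dense? p q r w ≡ true → n⁴ ≤ L * (∑₄ (λ b c u v → 𝟙 (isF₅ H w b c u v)) + losses)) → ∑₁ (𝟙 ∘ dense? p q r) ≤ boxSize₅ (4 * L)
      as-τ = few (λ w → ∑₄ λ b c u v → 𝟙 (isF₅ H w b c u v)) (λ X uX X≥ → F₅-sparse-τ (4 * L) X uX X≥ n≥) (dense? p q r)
      as-a : (∀ w → dense? p q r w ≡ true → n⁴ ≤ L * (∑₄ (λ b τ u v → 𝟙 (isF₅ H τ w b u v)) + losses)) → ∑₁ (𝟙 ∘ dense? p q r) ≤ boxSize₅ (4 * L)
      as-a = few (λ w → ∑₄ λ b τ u v → 𝟙 (isF₅ H τ w b u v)) (λ X uX X≥ → F₅-sparse-a (4 * L) X uX X≥ n≥) (dense? p q r)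
      by-colours : Dec (q ≡ r) → Dec (p ≡ q) → Dec (p ≡ r) → ∑₁ (𝟙 ∘ dense? p q r) ≤ boxSize₅ (4 * L)
      by-colours (yes q≡r) _ _ = as-τ λ w e →
        let _ , _ , heavy = dense-elim p q r w e
            j , k , h = other-colours q
        in from-pair′ (subst (λ z → n * n ≤ K₁ * link κ w q z) (sym q≡r) heavy) (classes j k) (link-pair-τ w q j k h)
      by-colours (no q≢r) (yes p≡q) _ = as-a λ w e →
        let κw≡p , _ , heavy = dense-elim p q r w e
            k , h = third-colour q r q≢r
        in from-pair heavy (≤-trans heavy (*-monoʳ-≤ K₁ (link-local κ optimal w q r k (trans κw≡p p≡q) h))) (link-pair-a w q r k h)
      by-colours (no q≢r) (no p≢q) (yes p≡r) = as-a λ w e →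
        let κw≡p , _ , heavy = dense-elim p q r w e
            k , h = third-colour r q (q≢r ∘ sym)
            heavy′ = subst (λ z → n * n ≤ K₁ * z) (link-sym κ w q r) heavy
        in from-pair heavy′ (≤-trans heavy′ (*-monoʳ-≤ K₁ (link-local κ optimal w r q k (trans κw≡p p≡r) h))) (link-pair-a w r q k h)
      by-colours (no q≢r) (no p≢q) (no p≢r) = as-a λ w e →
        let _ , nonrainbow , _ = dense-elim p q r w e
        in case trans (sym nonrainbow) (distinct3-intro (p≢q ∘ toℕ-injective) (q≢r ∘ toℕ-injective) (p≢r ∘ toℕ-injective)) of λ ()

∑₁-≥ : ∀ {n} (f : Fin n → ℕ) x → f x ≤ ∑₁ f
∑₁-≥ f x = ≤-trans (≤-reflexive (sym (∑₁-δ x f))) (∑₁-mono λ a → 𝟙*≤ (a == x) (f a))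

∑₁-pick : ∀ {n} (i : Fin n) (f : Fin n → ℕ) → ∑₁ (λ q → 𝟙 (i == q) * f q) ≡ f i
∑₁-pick i f = trans (∑₁-cong λ q → cong (λ b → 𝟙 b * f q) (==-sym i q)) (∑₁-δ i f)

module Decomposition (m t s : ℕ) (1≤t : 1 ≤ t) (1≤s : 1 ≤ s) (4≤2s : 4 ≤ 2 * s) (2s≤m : 2 * s ≤ m)
  (n : ℕ) (H : Graph3 n) (free : ¬ Contains (F5S m t s) H)
  (κ : Fin n → Fin 3) (optimal : LocalOptimum.Optimal H κ)
  (k L : ℕ) (1≤k : 1 ≤ k) (L≡ : 16 * ((27 * k) * (27 * k)) ≡ L)
  (n≥ : boxSize (m + s + t) (4 * L) 5 ≤ n) (8L≤n : 8 * L ≤ n) (8LMis : 8 * (L * Partition.Mis H κ) ≤ n * (n * n))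
  (classes : ∀ i j → n * n ≤ 16 * (Partition.class H κ i * Partition.class H κ j)) where

  open Weights H
  open LocalOptimum H
  open Partition H κ
  open Free m t s 1≤t 1≤s 4≤2s 2s≤m n H free
  open LocalAnalysis m t s 1≤t 1≤s 4≤2s 2s≤m n H free κ optimal
  open Few (27 * k) L (*-mono-≤ {1} {27} (s≤s z≤n) 1≤k) L≡ n≥ 8L≤n 8LMis classes

  N : ℕ
  N = boxSize₅ (4 * L)

  -- The factor 3 in `overfull` anticipates that a bad triple is charged to a deficient vertex in
  -- any of its three positions.
  deficient overfull : Fin n → Bool
  deficient w = n * n ≤ᵇ k * mis w
  overfull w = n * n ≤ᵇ 3 * (k * bad w)

  bad-by-colours : ∀ w → bad w ≡ ∑₂ (λ q r → 𝟙 (not (rainbow? (κ w) q r)) * link κ w q r)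
  bad-by-colours w = begin
    ∑₂ (λ b c → 𝟙 (bad? w b c))
      ≡⟨ ∑₂-cong (λ b c → trans (𝟙-∧ (edge? H w b c) _) (trans (*-comm (G w b c) _) (sym (pick b c)))) ⟩
    ∑₂ (λ b c → ∑₂ λ q r → nr q r * (G w b c * (𝟙 (κ b == q) * 𝟙 (κ c == r))))
      ≡⟨ ∑₂-swap (λ b c q r → nr q r * (G w b c * (𝟙 (κ b == q) * 𝟙 (κ c == r)))) ⟩
    ∑₂ (λ q r → ∑₂ λ b c → nr q r * (G w b c * (𝟙 (κ b == q) * 𝟙 (κ c == r))))
      ≡⟨ ∑₂-cong (λ q r → ∑₂-* (nr q r) _) ⟩
    ∑₂ (λ q r → nr q r * link κ w q r) ∎
    where
    open ≡-Reasoning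
    nr : Fin 3 → Fin 3 → ℕ
    nr q r = 𝟙 (not (rainbow? (κ w) q r))
    lemma : ∀ a g x y → a * (g * (x * y)) ≡ x * (y * (a * g))
    lemma = solve-∀
    pick : ∀ b c → ∑₂ (λ q r → nr q r * (G w b c * (𝟙 (κ b == q) * 𝟙 (κ c == r)))) ≡ nr (κ b) (κ c) * G w b c
    pick b c = trans (∑₁-cong λ q → trans (∑₁-cong λ r → lemma (nr q r) (G w b c) (𝟙 (κ b == q)) (𝟙 (κ c == r)))
      (trans (∑₁-* (𝟙 (κ b == q)) _) (cong (𝟙 (κ b == q) *_) (∑₁-pick (κ c) (λ r → nr q r * G w b c)))))
      (∑₁-pick (κ b) (λ q → nr q (κ c) * G w b c))

  -- Nine colour pairs share at least n²/(3k) bad pairs, so one of them receives n²/(27k); this is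
  -- why `Few` is opened with 27 · k. The `+ 1` in `average` makes the comparison strict.
  overfull⇒dense : ∀ w → overfull w ≡ true → 1 ≤ ∑₃ (λ p q r → 𝟙 (dense? p q r w))
  overfull⇒dense w e =
    let q , ltq = ∑₁<⇒∃ average
        r , ltr = ∑₁<⇒∃ ltq
    in begin
      1                                               ≡⟨ cong 𝟙 (dense q r (≤-pred (≤-trans ltr (≤-reflexive (+-comm _ 1))))) ⟨
      𝟙 (dense? (κ w) q r w)                          ≤⟨ ∑₁-≥ (λ r → 𝟙 (dense? (κ w) q r w)) r ⟩
      ∑₁ (λ r → 𝟙 (dense? (κ w) q r w))               ≤⟨ ∑₁-≥ (λ q → ∑₁ λ r → 𝟙 (dense? (κ w) q r w)) q ⟩
      ∑₂ (λ q r → 𝟙 (dense? (κ w) q r w))             ≤⟨ ∑₁-≥ (λ p → ∑₂ λ q r → 𝟙 (dense? p q r w)) (κ w) ⟩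
      ∑₃ (λ p q r → 𝟙 (dense? p q r w))               ∎
    where
    open ≤-Reasoning
    term : Fin 3 → Fin 3 → ℕ
    term q r = 𝟙 (not (rainbow? (κ w) q r)) * link κ w q r
    average : ∑₂ {3} (λ q r → n * n) < ∑₂ (λ q r → 27 * k * term q r + 1)
    average = begin-strict
      ∑₂ {3} (λ q r → n * n)                          ≡⟨ ∑₂-const (n * n) ⟩
      3 * (3 * (n * n))                               ≤⟨ *-monoʳ-≤ 3 (*-monoʳ-≤ 3 (n≤ᵇ-true (n * n) _ e)) ⟩
      3 * (3 * (3 * (k * bad w)))                     ≡⟨ lemma k (bad w) ⟩
      27 * k * bad w                                  <⟨ m<m+n (27 * k * bad w) {9} (s≤s z≤n) ⟩
      27 * k * bad w + 9                              ≡⟨ cong (λ z → 27 * k * z + 9) (bad-by-colours w) ⟩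
      27 * k * ∑₂ term + 9                            ≡⟨ cong₂ _+_ (∑₂-* (27 * k) term) (∑₂-const 1) ⟨
      ∑₂ (λ q r → 27 * k * term q r) + ∑₂ {3} (λ q r → 1) ≡⟨ ∑₂-+ _ _ ⟨
      ∑₂ (λ q r → 27 * k * term q r + 1)              ∎
      where lemma : ∀ k b → 3 * (3 * (3 * (k * b))) ≡ 27 * k * b
            lemma = solve-∀
    1≤n² : 1 ≤ n * n
    1≤n² = *-mono-≤ 1≤n 1≤n
      where 1≤n : 1 ≤ n
            1≤n = ≤-trans (boxSize≥1 (m + s + t) (4 * L) 5) n≥
    dense : ∀ q r → n * n ≤ 27 * k * term q r → dense? (κ w) q r w ≡ true
    dense q r le rewrite ==-refl (κ w) with rainbow? (κ w) q r
    ... | true  = ⊥-elim (<⇒≱ 1≤n² (≤-trans le (≤-reflexive (*-zeroʳ (27 * k)))))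
    ... | false with n * n ≤ᵇ 27 * k * link κ w q r in eq
    ... | true  = refl
    ... | false = ⊥-elim (<⇒≱ (n≤ᵇ-false (n * n) _ eq) (subst (λ z → n * n ≤ 27 * k * z) (+-identityʳ _) le))

  few-overfull : ∑₁ (𝟙 ∘ overfull) ≤ 27 * N
  few-overfull = begin
    ∑₁ (𝟙 ∘ overfull)                                 ≤⟨ ∑₁-mono (λ w → guard (overfull w) (overfull⇒dense w)) ⟩
    ∑₁ (λ w → ∑₃ λ p q r → 𝟙 (dense? p q r w))        ≡⟨ ∑₁-swap (λ w p → ∑₂ λ q r → 𝟙 (dense? p q r w)) ⟩
    ∑₁ (λ p → ∑₁ λ w → ∑₂ λ q r → 𝟙 (dense? p q r w)) ≡⟨ ∑₁-cong (λ p → ∑₁-swap (λ w q → ∑₁ λ r → 𝟙 (dense? p q r w))) ⟩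
    ∑₂ (λ p q → ∑₁ λ w → ∑₁ λ r → 𝟙 (dense? p q r w)) ≡⟨ ∑₂-cong (λ p q → ∑₁-swap (λ w r → 𝟙 (dense? p q r w))) ⟩
    ∑₃ (λ p q r → ∑₁ λ w → 𝟙 (dense? p q r w))        ≤⟨ ∑₃-mono few-dense ⟩
    ∑₃ {3} (λ p q r → N)                              ≡⟨ ∑₃-const N ⟩
    3 * (3 * (3 * N))                                 ≡⟨ lemma N ⟩
    27 * N                                            ∎
    where
    open ≤-Reasoning
    lemma : ∀ N → 3 * (3 * (3 * N)) ≡ 27 * N
    lemma = solve-∀

  sound? : Fin n → Fin n → Fin n → Bool
  sound? a b c = not (deficient a) ∧ not (deficient b) ∧ not (deficient c)

  -- The part of the noncrossing edges that the extremal numbers of K_{t,s,s} are going to bound.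
  Bad₀ : ℕ
  Bad₀ = ∑₃ λ a b c → 𝟙 (bad? a b c ∧ sound? a b c)

  noncrossing≤ : noncrossing κ ≤ Bad₀ + 3 * ∑₁ (λ w → 𝟙 (deficient w) * bad w)
  noncrossing≤ = ≤-trans (∑₃-mono λ a b c → pointwise (bad? a b c) (deficient a) (deficient b) (deficient c)) (≤-reflexive (begin
    ∑₃ (λ a b c → 𝟙 (bad? a b c ∧ sound? a b c) + (W a * x a b c + W b * x a b c + W c * x a b c))
      ≡⟨ trans (∑₃-+ _ _) (cong (Bad₀ +_) (trans (∑₃-+ _ _) (cong-+ˡ (∑₃-+ _ _)))) ⟩
    Bad₀ + (∑₃ (λ a b c → W a * x a b c) + ∑₃ (λ a b c → W b * x a b c) + ∑₃ (λ a b c → W c * x a b c))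
      ≡⟨ cong (Bad₀ +_) (cong₂ _+_ (cong₂ _+_ first second) third) ⟩
    Bad₀ + (T′ + T′ + T′)
      ≡⟨ cong (Bad₀ +_) (lemma T′) ⟩
    Bad₀ + 3 * T′ ∎))
    where
    open ≡-Reasoning
    W = 𝟙 ∘ deficient
    x : Fin n → Fin n → Fin n → ℕ
    x a b c = 𝟙 (bad? a b c)
    T′ = ∑₁ (λ w → W w * bad w)
    lemma : ∀ a → a + a + a ≡ 3 * a
    lemma = solve-∀
    x-swap₁₂ : ∀ a b c → x a b c ≡ x b a c
    x-swap₁₂ a b c = cong₂ (λ p q → 𝟙 (p ∧ not q)) (edge?-swap₁₂ H a b c) (rainbow-swap₁₂ (κ a) (κ b) (κ c))
    x-swap₂₃ : ∀ a b c → x a b c ≡ x a c b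
    x-swap₂₃ a b c = cong₂ (λ p q → 𝟙 (p ∧ not q)) (edge?-swap₂₃ H a b c) (rainbow-swap₂₃ (κ a) (κ b) (κ c))
    first : ∑₃ (λ a b c → W a * x a b c) ≡ T′
    first = ∑₁-cong λ a → ∑₂-* (W a) (x a)
    second : ∑₃ (λ a b c → W b * x a b c) ≡ T′
    second = trans (∑₃-swap₁₂ _) (trans (∑₃-cong λ a b c → cong (W a *_) (x-swap₁₂ b a c)) first)
    third : ∑₃ (λ a b c → W c * x a b c) ≡ T′
    third = trans (∑₃-swap₂₃ _) (trans (∑₃-cong λ a b c → cong (W b *_) (x-swap₂₃ a c b)) second)
    pointwise : ∀ x a b c → 𝟙 x ≤ 𝟙 (x ∧ not a ∧ not b ∧ not c) + (𝟙 a * 𝟙 x + 𝟙 b * 𝟙 x + 𝟙 c * 𝟙 x)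
    pointwise false a     b     c     = z≤n
    pointwise true  true  b     c     = s≤s z≤n
    pointwise true  false true  c     = s≤s z≤n
    pointwise true  false false true  = s≤s z≤n
    pointwise true  false false false = s≤s z≤n

  -- A deficient vertex that is not overfull loses at least as many crossing triples as it gains bad ones.
  balance : ∀ w → 3 * (𝟙 (deficient w) * bad w) ≤ 3 * (n * n) * 𝟙 (overfull w) + mis w
  balance w with deficient w in e₁
  ... | false = z≤n
  ... | true with overfull w in e₂
  ... | true  = ≤-trans (*-monoʳ-≤ 3 (≤-trans (≤-reflexive (+-identityʳ (bad w))) bad≤))
                  (≤-trans (≤-reflexive (sym (*-identityʳ (3 * (n * n))))) (m≤m+n _ (mis w)))
    where bad≤ : bad w ≤ n * n
          bad≤ = ≤-trans (∑₂-mono λ b c → 𝟙≤1 _) (≤-reflexive (trans (∑₂-const 1) (cong (n *_) (*-identityʳ n))))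
  ... | false = ≤-trans (*-cancelˡ-≤ k {{>-nonZero 1≤k}} (begin
      k * (3 * (1 * bad w))  ≡⟨ lemma k (bad w) ⟩
      3 * (k * bad w)        ≤⟨ <⇒≤ (n≤ᵇ-false (n * n) _ e₂) ⟩
      n * n                  ≤⟨ n≤ᵇ-true (n * n) _ e₁ ⟩
      k * mis w              ∎)) (m≤n+m (mis w) _)
    where
    open ≤-Reasoning
    lemma : ∀ k b → k * (3 * (1 * b)) ≡ 3 * (k * b)
    lemma = solve-∀

  -- `Mis` occurs on both sides and cancels: bad triples at deficient vertices are paid for by
  -- missing ones, except for at most 3n² at each of the 27N overfull vertices.
  edges≤ : S ≤ Rain + Bad₀ + 81 * N * (n * n)
  edges≤ = +-cancelʳ-≤ Mis _ _ (begin
    S + Mis                                                    ≡⟨ Rain+noncrossing ⟨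
    Rain + noncrossing κ                                       ≤⟨ +-monoʳ-≤ Rain noncrossing≤ ⟩
    Rain + (Bad₀ + 3 * ∑₁ (λ w → 𝟙 (deficient w) * bad w))     ≤⟨ +-monoʳ-≤ Rain (+-monoʳ-≤ Bad₀ summed) ⟩
    Rain + (Bad₀ + (3 * (n * n) * (27 * N) + Mis))             ≡⟨ lemma Rain Bad₀ (n * n) N Mis ⟩
    Rain + Bad₀ + 81 * N * (n * n) + Mis                       ∎)
    where
    open ≤-Reasoning
    lemma : ∀ r b x N m → r + (b + (3 * x * (27 * N) + m)) ≡ r + b + 81 * N * x + m
    lemma = solve-∀
    summed : 3 * ∑₁ (λ w → 𝟙 (deficient w) * bad w) ≤ 3 * (n * n) * (27 * N) + Mis
    summed = ≤-trans (≤-reflexive (sym (∑₁-* 3 _))) (≤-trans (∑₁-mono balance)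
      (≤-trans (≤-reflexive (trans (∑₁-+ _ _) (cong-+ˡ (∑₁-* (3 * (n * n)) _))))
        (+-monoˡ-≤ Mis (*-monoʳ-≤ (3 * (n * n)) few-overfull))))

-- The Kővári–Sós–Turán bound

∑₁-empty : ∀ (f : Fin 0 → ℕ) → ∑₁ f ≡ 0
∑₁-empty f = trans (∑₁-cong {0} {g = λ _ → 0} λ ()) (∑₁-const {0} 0)

∑-pairs : ∀ {A B : Set} (xs : List A) (ys : List B) f → ∑ (cartesianProduct xs ys) f ≡ ∑ xs (λ x → ∑ ys (λ y → f (x , y)))
∑-pairs []       ys f = refl
∑-pairs (x ∷ xs) ys f = trans (∑-++ (map (x ,_) ys) _ f) (cong₂ _+_ (∑-map (x ,_) ys f) (∑-pairs xs ys f))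

length-pairs : ∀ {A B : Set} (xs : List A) (ys : List B) → length (cartesianProduct xs ys) ≡ length xs * length ys
length-pairs xs ys = trans (length-∑ (cartesianProduct xs ys)) (trans (∑-pairs xs ys _)
  (trans (∑-const xs _) (cong (length xs *_) (sym (length-∑ ys)))))

pick : ∀ {n} k (xs : List (Fin n)) → Unique xs → k ≤ length xs →
  Σ (Fin k → Fin n) λ f → Injective _≡_ _≡_ f × (∀ i → f i ∈ xs) × (∀ g → ∑ xs g ≡ ∑₁ (g ∘ f) + ∑ (drop k xs) g)
pick zero xs u le = (λ ()) , (λ { {()} }) , (λ ()) , λ g → cong (_+ ∑ xs g) (sym (∑₁-empty _))
pick {n} (suc k) (x ∷ xs) (x∉ ∷ u) (s≤s le) =
  f , (λ {i} {j} → inj i j) , (λ { fzero → here refl ; (fsuc i) → there (f∈ i) }) , λ g →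
    trans (cong (g x +_) (split g)) (trans (sym (+-assoc (g x) _ _)) (cong (_+ ∑ (drop k xs) g) (sym (∑₁-suc _))))
  where
  rest = pick k xs u le
  f∈ = proj₁ (proj₂ (proj₂ rest))
  split = proj₂ (proj₂ (proj₂ rest))
  f : Fin (suc k) → Fin n
  f fzero    = x
  f (fsuc i) = proj₁ rest i
  inj : ∀ i j → f i ≡ f j → i ≡ j
  inj fzero    fzero    _  = refl
  inj fzero    (fsuc j) eq = ⊥-elim (All-lookup x∉ (f∈ j) eq)
  inj (fsuc i) fzero    eq = ⊥-elim (All-lookup x∉ (f∈ i) (sym eq))
  inj (fsuc i) (fsuc j) eq = cong fsuc (proj₁ (proj₂ rest) eq)

pick-members : ∀ {n} k (xs : List (Fin n)) → Unique xs → (p : Fin n → Bool) → k ≤ ∑ xs (𝟙 ∘ p) →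
  Σ (Fin k → Fin n) λ f → Injective _≡_ _≡_ f × (∀ i → p (f i) ≡ true)
pick-members k xs u p le =
  let f , inj , f∈ , _ = pick k (filterᵇ p xs) (filter⁺ (T? ∘ p) u) (≤-trans le (≤-reflexive (sym
        (trans (length-∑ (filterᵇ p xs)) (trans (∑-filter p xs _) (∑-cong xs λ x → *-identityʳ _))))))
  in f , inj , λ i → T⇒true (p (f i)) (proj₂ (∈-filter⁻ (T? ∘ p) {xs = xs} (f∈ i)))
  where
  T⇒true : ∀ b → T b → b ≡ true
  T⇒true true _ = refl

few-tuples-dup : ∀ {n} {xs : List (Fin n)} → Unique xs → ∀ k →
  ∑ (tuples xs (suc k)) (𝟙 ∘ dup) ≤ suc k * suc k * length xs ^ k
few-tuples-dup {xs = []}     u k = z≤n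
few-tuples-dup {xs = x ∷ xs} u k = *-cancelʳ-≤ _ _ (length (x ∷ xs)) (≤-trans (∑-dup u (suc k))
  (≤-reflexive (lemma (suc k * suc k) (length (x ∷ xs)) (length (x ∷ xs) ^ k))))
  where lemma : ∀ a l x → a * (l * x) ≡ a * x * l
        lemma = solve-∀

-- The Kővári–Sós–Turán–Erdős bound, with one of the first two parts of size at most a.
module KőváriSósTurán {n : ℕ} (P : Fin n → Fin n → Fin n → Bool) (r : ℕ)
  (As Bs Cs : List (Fin n)) (uA : Unique As) (uB : Unique Bs) (uC : Unique Cs) (a : ℕ)
  (A≤n : length As ≤ n) (B≤n : length Bs ≤ n) (C≤n : length Cs ≤ n) (a≤n : a ≤ n)
  (small : length As ≤ a ⊎ length Bs ≤ a) where

  private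
    s A B C : ℕ
    s = suc r
    A = length As
    B = length Bs
    C = length Cs

  count : ℕ
  count = ∑ As λ x → ∑ Bs λ y → ∑ Cs λ z → 𝟙 (P x y z)

  Y : ℕ
  Y = ∑ (tuples Bs s) λ v → ∑ As λ x → ∑ Cs λ z → 𝟙 (allV (λ y → P x y z) v)

  -- The first power mean replaces y by an s-tuple, over the pairs (x, z); the second replaces z by
  -- an s-tuple, over the pairs of x and the first tuple. What remains is to count the x common to
  -- two tuples, and t of them would be a K_{t,s,s}.
  step₁ : count ^ s ≤ (A * C) ^ r * Y
  step₁ = begin
    count ^ s
      ≡⟨ cong (_^ s) (trans (∑-cong As λ x → ∑-swap Bs Cs _) (sym (∑-pairs As Cs _))) ⟩
    ∑ (cartesianProduct As Cs) (λ p → ∑ Bs λ y → 𝟙 (P (proj₁ p) y (proj₂ p))) ^ s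
      ≤⟨ power-mean-tuples (cartesianProduct As Cs) Bs (λ p y → P (proj₁ p) y (proj₂ p)) r ⟩
    length (cartesianProduct As Cs) ^ r * ∑ (tuples Bs s) (λ v → ∑ (cartesianProduct As Cs) (λ p → 𝟙 (allV (λ y → P (proj₁ p) y (proj₂ p)) v)))
      ≡⟨ cong₂ (λ x y → x ^ r * y) (length-pairs As Cs) (∑-cong (tuples Bs s) λ v → ∑-pairs As Cs _) ⟩
    (A * C) ^ r * Y ∎
    where open ≤-Reasoning

  full : Fin n → Vec (Fin n) s → Vec (Fin n) s → Bool
  full x v w = allV (λ z → allV (λ y → P x y z) v) w

  Z : ℕ
  Z = ∑ (tuples Cs s) λ w → ∑ (tuples Bs s) λ v → ∑ As λ x → 𝟙 (full x v w)

  step₂ : Y ^ s ≤ (A * B ^ s) ^ r * Z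
  step₂ = begin
    Y ^ s
      ≡⟨ cong (_^ s) (trans (∑-swap (tuples Bs s) As _) (sym (∑-pairs As (tuples Bs s) _))) ⟩
    ∑ ps (λ p → ∑ Cs λ z → 𝟙 (allV (λ y → P (proj₁ p) y z) (proj₂ p))) ^ s
      ≤⟨ power-mean-tuples ps Cs (λ p z → allV (λ y → P (proj₁ p) y z) (proj₂ p)) r ⟩
    length ps ^ r * ∑ (tuples Cs s) (λ w → ∑ ps (λ p → 𝟙 (full (proj₁ p) (proj₂ p) w)))
      ≡⟨ cong₂ (λ x y → x ^ r * y) (trans (length-pairs As (tuples Bs s)) (cong (A *_) (length-tuples Bs s)))
           (∑-cong (tuples Cs s) λ w → trans (∑-pairs As (tuples Bs s) _) (∑-swap As (tuples Bs s) _)) ⟩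
    (A * B ^ s) ^ r * Z ∎
    where
    open ≤-Reasoning
    ps = cartesianProduct As (tuples Bs s)

  private
    x y dB dC : ℕ
    x = n ^ r
    y = a ^ r
    dB = ∑ (tuples Bs s) (𝟙 ∘ dup)
    dC = ∑ (tuples Cs s) (𝟙 ∘ dup)

    ∑-𝟙≤ : ∀ xs (p : Fin n → Bool) → ∑ xs (𝟙 ∘ p) ≤ length xs
    ∑-𝟙≤ xs p = ≤-trans (∑-≤const xs (λ z → 𝟙≤1 (p z))) (≤-reflexive (*-identityʳ _))

    dB≤ : dB ≤ s * s * B ^ r
    dB≤ = few-tuples-dup uB r

    dC≤ : dC ≤ s * s * C ^ r
    dC≤ = few-tuples-dup uC r

  module _ (t : ℕ)
    (free : (τ : Fin t → Fin n) (β γ : Fin s → Fin n) → Injective _≡_ _≡_ τ → Injective _≡_ _≡_ β → Injective _≡_ _≡_ γ →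
      (∀ i j k → P (τ i) (β j) (γ k) ≡ true) → ⊥) where

    common : ∀ v w → ∑ As (λ x → 𝟙 (full x v w)) ≤ t + A * (𝟙 (dup v) + 𝟙 (dup w))
    common v w with dup v in e₁ | dup w in e₂
    ... | true  | _     = ≤-trans (∑-𝟙≤ As _) (≤-trans (m≤m*n A _) (m≤n+m _ t))
    ... | false | true  = ≤-trans (∑-𝟙≤ As _) (≤-trans (m≤m*n A 1) (m≤n+m _ t))
    ... | false | false with ∑ As (λ x → 𝟙 (full x v w)) ≤? t
    ... | yes le = ≤-trans le (m≤m+n t _)
    ... | no ¬le =
      let τ , τ-inj , h = pick-members t As uA (λ x → full x v w) (<⇒≤ (≰⇒> ¬le))
      in ⊥-elim (free τ (lookup v) (lookup w) τ-inj (dup-false v e₁) (dup-false w e₂)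
           (λ i j k → allV-lookup (λ y → P (τ i) y (lookup w k)) v (allV-lookup (λ z → allV (λ y → P (τ i) y z) v) w (h i) k) j))

    Z≤ : Z ≤ C ^ s * (B ^ s * t) + A * (C ^ s * (s * s * B ^ r) + B ^ s * (s * s * C ^ r))
    Z≤ = begin
      Z
        ≤⟨ ∑-mono (tuples Cs s) (λ w → ∑-mono (tuples Bs s) λ v → common v w) ⟩
      ∑ (tuples Cs s) (λ w → ∑ (tuples Bs s) λ v → t + A * (𝟙 (dup v) + 𝟙 (dup w)))
        ≡⟨ ∑-cong (tuples Cs s) (λ w → trans (∑-+ (tuples Bs s) _ _) (cong₂ _+_
             (trans (∑-const (tuples Bs s) t) (cong (_* t) (length-tuples Bs s)))
             (trans (∑-* (tuples Bs s) A _) (cong (A *_) (trans (∑-+ (tuples Bs s) _ _)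
               (cong (dB +_) (trans (∑-const (tuples Bs s) _) (cong (_* 𝟙 (dup w)) (length-tuples Bs s))))))))) ⟩
      ∑ (tuples Cs s) (λ w → B ^ s * t + A * (dB + B ^ s * 𝟙 (dup w)))
        ≡⟨ trans (∑-+ (tuples Cs s) _ _) (cong₂ _+_ (trans (∑-const (tuples Cs s) _) (cong (_* (B ^ s * t)) (length-tuples Cs s)))
             (trans (∑-* (tuples Cs s) A _) (cong (A *_) (trans (∑-+ (tuples Cs s) _ _)
               (cong₂ _+_ (trans (∑-const (tuples Cs s) _) (cong (_* dB) (length-tuples Cs s))) (∑-* (tuples Cs s) (B ^ s) _)))))) ⟩
      C ^ s * (B ^ s * t) + A * (C ^ s * dB + B ^ s * dC)
        ≤⟨ +-monoʳ-≤ (C ^ s * (B ^ s * t)) (*-monoʳ-≤ A (+-mono-≤ (*-monoʳ-≤ (C ^ s) dB≤) (*-monoʳ-≤ (B ^ s) dC≤))) ⟩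
      C ^ s * (B ^ s * t) + A * (C ^ s * (s * s * B ^ r) + B ^ s * (s * s * C ^ r)) ∎
      where open ≤-Reasoning

    private
      c : ℕ
      c = t + 2 * (s * s)

      x^s*n^s : x ^ s * n ^ s ≡ n ^ (s * s)
      x^s*n^s = trans (sym (^-distribʳ-* s x n)) (trans (cong (_^ s) (*-comm x n)) (^-*-assoc n s s))

      swap-exponents : ∀ b → (b ^ s) ^ r ≡ (b ^ r) ^ s
      swap-exponents b = trans (^-*-assoc b s r) (trans (cong (b ^_) (*-comm s r)) (sym (^-*-assoc b r s)))

      y*y^s : y ^ s * y ≡ a ^ (r + r * s)
      y*y^s = trans (*-comm (y ^ s) y) (trans (cong (y *_) (^-*-assoc a r s)) (sym (^-distribˡ-+-* a r (r * s))))

      n^2s² : n ^ (s * s) * n ^ (s * s) ≡ n ^ (2 * (s * s))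
      n^2s² = trans (sym (^-distribˡ-+-* n (s * s) (s * s))) (cong (λ z → n ^ (s * s + z)) (sym (+-identityʳ (s * s))))

    -- The exponent is r + r · s = s² - 1, because s = r + 1. If A is the small length, it comes
    -- from the factors A^(rs) and A^r of the two power means. If B is small, it comes from (B^s)^r
    -- and one more B^r, to which a remaining B^s is weakened by B^s ≤ n · a^r.
    kst : count ^ (s * s) ≤ c * (n ^ (2 * (s * s)) * a ^ (r + r * s))
    kst = begin
      count ^ (s * s)                                ≡⟨ ^-*-assoc count s s ⟨
      (count ^ s) ^ s                                ≤⟨ ^-monoˡ-≤ s step₁ ⟩
      ((A * C) ^ r * Y) ^ s                          ≡⟨ ^-distribʳ-* s ((A * C) ^ r) Y ⟩
      ((A * C) ^ r) ^ s * Y ^ s                      ≤⟨ *-monoʳ-≤ (((A * C) ^ r) ^ s) (≤-trans step₂ (*-monoʳ-≤ ((A * B ^ s) ^ r) Z≤)) ⟩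
      ((A * C) ^ r) ^ s * ((A * B ^ s) ^ r * (C ^ s * (B ^ s * t) + A * (C ^ s * (s * s * B ^ r) + B ^ s * (s * s * C ^ r))))
                                                     ≤⟨ final small ⟩
      c * (y ^ s * y * ((x ^ s * n ^ s) * (x ^ s * n ^ s)))
        ≡⟨ cong (c *_) (trans (cong₂ _*_ y*y^s (trans (cong₂ _*_ x^s*n^s x^s*n^s) n^2s²)) (*-comm (a ^ (r + r * s)) _)) ⟩
      c * (n ^ (2 * (s * s)) * a ^ (r + r * s))      ∎
      where
      open ≤-Reasoning
      final : A ≤ a ⊎ B ≤ a →
        ((A * C) ^ r) ^ s * ((A * B ^ s) ^ r * (C ^ s * (B ^ s * t) + A * (C ^ s * (s * s * B ^ r) + B ^ s * (s * s * C ^ r))))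
        ≤ c * (y ^ s * y * ((x ^ s * n ^ s) * (x ^ s * n ^ s)))
      final (inj₁ A≤a) = begin
        ((A * C) ^ r) ^ s * ((A * B ^ s) ^ r * (C ^ s * (B ^ s * t) + A * (C ^ s * (s * s * B ^ r) + B ^ s * (s * s * C ^ r))))
          ≤⟨ *-mono-≤ (^-monoˡ-≤ s (^-monoˡ-≤ r (*-mono-≤ A≤a C≤n))) (*-mono-≤ (^-monoˡ-≤ r (*-mono-≤ A≤a (^-monoˡ-≤ s B≤n)))
               (+-mono-≤ (*-mono-≤ (^-monoˡ-≤ s C≤n) (*-monoˡ-≤ t (^-monoˡ-≤ s B≤n))) (*-mono-≤ (≤-trans A≤a a≤n)
                 (+-mono-≤ (*-mono-≤ (^-monoˡ-≤ s C≤n) (*-monoʳ-≤ (s * s) (^-monoˡ-≤ r B≤n)))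
                           (*-mono-≤ (^-monoˡ-≤ s B≤n) (*-monoʳ-≤ (s * s) (^-monoˡ-≤ r C≤n))))))) ⟩
        ((a * n) ^ r) ^ s * ((a * n ^ s) ^ r * (n ^ s * (n ^ s * t) + n * (n ^ s * (s * s * x) + n ^ s * (s * s * x))))
          ≡⟨ cong₂ (λ p q → p * (q * (n ^ s * (n ^ s * t) + n * (n ^ s * (s * s * x) + n ^ s * (s * s * x)))))
               (trans (cong (_^ s) (^-distribʳ-* r a n)) (^-distribʳ-* s y x))
               (trans (^-distribʳ-* r a (n ^ s)) (cong (y *_) (swap-exponents n))) ⟩
        y ^ s * x ^ s * (y * x ^ s * (n * x * (n * x * t) + n * (n * x * (s * s * x) + n * x * (s * s * x))))
          ≡⟨ lemma (y ^ s) (x ^ s) y x n t s ⟩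
        c * (y ^ s * y * ((x ^ s * (n * x)) * (x ^ s * (n * x)))) ∎
        where
        lemma : ∀ ys xs y x n t s → ys * xs * (y * xs * (n * x * (n * x * t) + n * (n * x * (s * s * x) + n * x * (s * s * x))))
          ≡ (t + 2 * (s * s)) * (ys * y * ((xs * (n * x)) * (xs * (n * x))))
        lemma = solve-∀
      final (inj₂ B≤a) = begin
        ((A * C) ^ r) ^ s * ((A * B ^ s) ^ r * (C ^ s * (B ^ s * t) + A * (C ^ s * (s * s * B ^ r) + B ^ s * (s * s * C ^ r))))
          ≤⟨ *-mono-≤ (^-monoˡ-≤ s (^-monoˡ-≤ r (*-mono-≤ A≤n C≤n))) (*-mono-≤ (^-monoˡ-≤ r (*-mono-≤ A≤n (^-monoˡ-≤ s B≤a)))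
               (+-mono-≤ (*-mono-≤ (^-monoˡ-≤ s C≤n) (*-monoˡ-≤ t B^s≤)) (*-mono-≤ A≤n
                 (+-mono-≤ (*-mono-≤ (^-monoˡ-≤ s C≤n) (*-monoʳ-≤ (s * s) (^-monoˡ-≤ r B≤a)))
                           (*-mono-≤ B^s≤ (*-monoʳ-≤ (s * s) (^-monoˡ-≤ r C≤n))))))) ⟩
        ((n * n) ^ r) ^ s * ((n * a ^ s) ^ r * (n ^ s * (n * y * t) + n * (n ^ s * (s * s * y) + n * y * (s * s * x))))
          ≡⟨ cong₂ (λ p q → p * (q * (n ^ s * (n * y * t) + n * (n ^ s * (s * s * y) + n * y * (s * s * x)))))
               (trans (cong (_^ s) (^-distribʳ-* r n n)) (^-distribʳ-* s x x))
               (trans (^-distribʳ-* r n (a ^ s)) (cong (x *_) (swap-exponents a))) ⟩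
        x ^ s * x ^ s * (x * y ^ s * (n * x * (n * y * t) + n * (n * x * (s * s * y) + n * y * (s * s * x))))
          ≡⟨ lemma (y ^ s) (x ^ s) y x n t s ⟩
        c * (y ^ s * y * ((x ^ s * (n * x)) * (x ^ s * (n * x)))) ∎
        where
        B^s≤ : B ^ s ≤ n * y
        B^s≤ = ≤-trans (^-monoˡ-≤ s B≤a) (*-monoˡ-≤ y a≤n)
        lemma : ∀ ys xs y x n t s → xs * xs * (x * ys * (n * x * (n * y * t) + n * (n * x * (s * s * y) + n * y * (s * s * x))))
          ≡ (t + 2 * (s * s)) * (ys * y * ((xs * (n * x)) * (xs * (n * x))))
        lemma = solve-∀

  module _
    (free : (α : Fin n) (β γ : Fin s → Fin n) → Injective _≡_ _≡_ β → Injective _≡_ _≡_ γ →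
      (∀ j k → P α (β j) (γ k) ≡ true) → ⊥) where

    common₁ : ∀ v x → ∑ Cs (λ z → 𝟙 (allV (λ y → P x y z) v)) ≤ s + C * 𝟙 (dup v)
    common₁ v x with dup v in e₁
    ... | true  = ≤-trans (∑-𝟙≤ Cs _) (≤-trans (m≤m*n C 1) (m≤n+m _ s))
    ... | false with ∑ Cs (λ z → 𝟙 (allV (λ y → P x y z) v)) ≤? s
    ... | yes le = ≤-trans le (m≤m+n s _)
    ... | no ¬le =
      let γ , γ-inj , h = pick-members s Cs uC (λ z → allV (λ y → P x y z) v) (<⇒≤ (≰⇒> ¬le))
      in ⊥-elim (free x (lookup v) γ (dup-false v e₁) γ-inj (λ j k → allV-lookup (λ y → P x y (γ k)) v (h k) j))

    Y≤ : Y ≤ B ^ s * (A * s) + A * (C * (s * s * B ^ r))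
    Y≤ = begin
      Y
        ≤⟨ ∑-mono (tuples Bs s) (λ v → ∑-≤const As (common₁ v)) ⟩
      ∑ (tuples Bs s) (λ v → A * (s + C * 𝟙 (dup v)))
        ≡⟨ trans (∑-* (tuples Bs s) A _) (cong (A *_) (trans (∑-+ (tuples Bs s) _ _) (cong₂ _+_
             (trans (∑-const (tuples Bs s) s) (cong (_* s) (length-tuples Bs s))) (∑-* (tuples Bs s) C _)))) ⟩
      A * (B ^ s * s + C * dB)
        ≤⟨ *-monoʳ-≤ A (+-monoʳ-≤ (B ^ s * s) (*-monoʳ-≤ C dB≤)) ⟩
      A * (B ^ s * s + C * (s * s * B ^ r))
        ≡⟨ lemma A (B ^ s) s (C * (s * s * B ^ r)) ⟩
      B ^ s * (A * s) + A * (C * (s * s * B ^ r)) ∎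
      where
      open ≤-Reasoning
      lemma : ∀ a b s c → a * (b * s + c) ≡ b * (a * s) + a * c
      lemma = solve-∀

    -- For t = 1 one power mean is enough: a single x and a tuple of distinct y already have at most
    -- s common z. This is what improves s² to s.
    kst₁ : count ^ s ≤ (s + s * s) * (n ^ (2 * s) * a ^ r)
    kst₁ = begin
      count ^ s                                                       ≤⟨ step₁ ⟩
      (A * C) ^ r * Y                                                 ≤⟨ *-monoʳ-≤ ((A * C) ^ r) Y≤ ⟩
      (A * C) ^ r * (B ^ s * (A * s) + A * (C * (s * s * B ^ r)))     ≤⟨ final small ⟩
      (s + s * s) * (n ^ s * n ^ s * y)
        ≡⟨ cong (λ z → (s + s * s) * (z * y)) (trans (sym (^-distribˡ-+-* n s s)) (cong (λ z → n ^ (s + z)) (sym (+-identityʳ s)))) ⟩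
      (s + s * s) * (n ^ (2 * s) * a ^ r) ∎
      where
      open ≤-Reasoning
      final : A ≤ a ⊎ B ≤ a → (A * C) ^ r * (B ^ s * (A * s) + A * (C * (s * s * B ^ r))) ≤ (s + s * s) * (n * x * (n * x) * y)
      final (inj₁ A≤a) = begin
        (A * C) ^ r * (B ^ s * (A * s) + A * (C * (s * s * B ^ r)))
          ≤⟨ *-mono-≤ (^-monoˡ-≤ r (*-mono-≤ A≤a C≤n)) (+-mono-≤ (*-mono-≤ (^-monoˡ-≤ s B≤n) (*-monoˡ-≤ s A≤n))
               (*-mono-≤ A≤n (*-mono-≤ C≤n (*-monoʳ-≤ (s * s) (^-monoˡ-≤ r B≤n))))) ⟩
        (a * n) ^ r * (n * x * (n * s) + n * (n * (s * s * x)))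
          ≡⟨ cong (_* (n * x * (n * s) + n * (n * (s * s * x)))) (^-distribʳ-* r a n) ⟩
        y * x * (n * x * (n * s) + n * (n * (s * s * x)))
          ≡⟨ lemma y x n s ⟩
        (s + s * s) * (n * x * (n * x) * y) ∎
        where
        lemma : ∀ y x n s → y * x * (n * x * (n * s) + n * (n * (s * s * x))) ≡ (s + s * s) * (n * x * (n * x) * y)
        lemma = solve-∀
      final (inj₂ B≤a) = begin
        (A * C) ^ r * (B ^ s * (A * s) + A * (C * (s * s * B ^ r)))
          ≤⟨ *-mono-≤ (^-monoˡ-≤ r (*-mono-≤ A≤n C≤n)) (+-mono-≤ (*-mono-≤ (≤-trans (^-monoˡ-≤ s B≤a) (*-monoˡ-≤ y a≤n)) (*-monoˡ-≤ s A≤n))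
               (*-mono-≤ A≤n (*-mono-≤ C≤n (*-monoʳ-≤ (s * s) (^-monoˡ-≤ r B≤a))))) ⟩
        (n * n) ^ r * (n * y * (n * s) + n * (n * (s * s * y)))
          ≡⟨ cong (_* (n * y * (n * s) + n * (n * (s * s * y)))) (^-distribʳ-* r n n) ⟩
        x * x * (n * y * (n * s) + n * (n * (s * s * y)))
          ≡⟨ lemma y x n s ⟩
        (s + s * s) * (n * x * (n * x) * y) ∎
        where
        lemma : ∀ y x n s → x * x * (n * y * (n * s) + n * (n * (s * s * y))) ≡ (s + s * s) * (n * x * (n * x) * y)
        lemma = solve-∀

-- The balanced 3-partite 3-graph

bool-ext : ∀ {a b} → (a ≡ true → b ≡ true) → (b ≡ true → a ≡ true) → a ≡ b
bool-ext {true}  {b}     f g = sym (f refl)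
bool-ext {false} {true}  f g = g refl
bool-ext {false} {false} f g = refl

e-∑₃ : ∀ {n} (E : Graph3 n) → e E ≡ ∑₃ (λ x y z → 𝟙 ((toℕ x <ᵇ toℕ y) ∧ (toℕ y <ᵇ toℕ z) ∧ edge? E x y z))
e-∑₃ E = ∑-allFin λ x → ∑-allFin λ y → ∑-allFin λ z → refl

<ᵇ-flip : ∀ a b → a ≢ b → (b <ᵇ a) ≡ not (a <ᵇ b)
<ᵇ-flip zero    zero    p = ⊥-elim (p refl)
<ᵇ-flip zero    (suc b) p = refl
<ᵇ-flip (suc a) zero    p = refl
<ᵇ-flip (suc a) (suc b) p = <ᵇ-flip a b (p ∘ cong suc)

ordered-count : ∀ {n} (E : Graph3 n) → ∑₃ (λ x y z → 𝟙 (edge? E x y z)) ≡ 6 * e E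
ordered-count {n} E = begin
  ∑₃ (λ x y z → 𝟙 (edge? E x y z))
    ≡⟨ ∑₃-cong split ⟩
  ∑₃ (λ x y z → o x y z + o x z y + o y x z + o y z x + o z x y + o z y x)
    ≡⟨ trans (∑₃-+ _ _) (cong-+ˡ (trans (∑₃-+ _ _) (cong-+ˡ (trans (∑₃-+ _ _) (cong-+ˡ (trans (∑₃-+ _ _) (cong-+ˡ (∑₃-+ _ _)))))))) ⟩
  ∑₃ o + ∑₃ (λ x y z → o x z y) + ∑₃ (λ x y z → o y x z) + ∑₃ (λ x y z → o y z x) + ∑₃ (λ x y z → o z x y) + ∑₃ (λ x y z → o z y x)
    ≡⟨ cong₂ _+_ (cong₂ _+_ (cong₂ _+_ (cong₂ _+_ (cong (∑₃ o +_) (sym (∑₃-swap₂₃ o))) (sym (∑₃-swap₁₂ o)))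
         (sym (∑₃-rotate o))) (sym (trans (∑₃-rotate o) (∑₃-rotate λ x y z → o y z x)))) (sym (∑₃-swap₁₃ o)) ⟩
  ∑₃ o + ∑₃ o + ∑₃ o + ∑₃ o + ∑₃ o + ∑₃ o
    ≡⟨ lemma (∑₃ o) ⟩
  6 * ∑₃ o
    ≡⟨ cong (6 *_) (e-∑₃ E) ⟨
  6 * e E ∎
  where
  open ≡-Reasoning
  lemma : ∀ a → a + a + a + a + a + a ≡ 6 * a
  lemma = solve-∀
  o : Fin n → Fin n → Fin n → ℕ
  o x y z = 𝟙 ((toℕ x <ᵇ toℕ y) ∧ (toℕ y <ᵇ toℕ z) ∧ edge? E x y z)
  bools : ∀ p q r → (p ≡ true → q ≡ true → r ≡ true) → (p ≡ false → q ≡ false → r ≡ false) →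
    1 ≡ 𝟙 (p ∧ q ∧ true) + 𝟙 (r ∧ not q ∧ true) + 𝟙 (not p ∧ r ∧ true) + 𝟙 (q ∧ not r ∧ true) + 𝟙 (not r ∧ p ∧ true) + 𝟙 (not q ∧ not p ∧ true)
  bools true  true  true  _ _ = refl
  bools true  true  false h _ = case h refl refl of λ ()
  bools true  false true  _ _ = refl
  bools true  false false _ _ = refl
  bools false true  true  _ _ = refl
  bools false true  false _ _ = refl
  bools false false true  _ h = case h refl refl of λ ()
  bools false false false _ _ = refl
  zero₂ : ∀ p q → 𝟙 (p ∧ q ∧ false) ≡ 0
  zero₂ true  true  = refl
  zero₂ true  false = refl
  zero₂ false q     = refl
  orders : ∀ a b c → a ≢ b → b ≢ c → a ≢ c → ∀ {f} → f ≡ true →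
    𝟙 f ≡ 𝟙 ((a <ᵇ b) ∧ (b <ᵇ c) ∧ f) + 𝟙 ((a <ᵇ c) ∧ (c <ᵇ b) ∧ f) + 𝟙 ((b <ᵇ a) ∧ (a <ᵇ c) ∧ f)
        + 𝟙 ((b <ᵇ c) ∧ (c <ᵇ a) ∧ f) + 𝟙 ((c <ᵇ a) ∧ (a <ᵇ b) ∧ f) + 𝟙 ((c <ᵇ b) ∧ (b <ᵇ a) ∧ f)
  orders a b c a≢b b≢c a≢c refl rewrite <ᵇ-flip a b a≢b | <ᵇ-flip b c b≢c | <ᵇ-flip a c a≢c =
    bools (a <ᵇ b) (b <ᵇ c) (a <ᵇ c)
      (λ p q → <⇒<ᵇ-true (<-trans (<ᵇ-true a b p) (<ᵇ-true b c q)))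
      (λ p q → ≤⇒<ᵇ-false (≤-trans (<ᵇ-false b c q) (<ᵇ-false a b p)))
  split : ∀ x y z → 𝟙 (edge? E x y z) ≡ o x y z + o x z y + o y x z + o y z x + o z x y + o z y x
  split x y z
    rewrite edge?-swap₂₃ E x z y | edge?-swap₁₂ E y x z | edge?-swap₂₃ E y z x | edge?-swap₁₂ E y x z
          | edge?-swap₁₂ E z x y | edge?-swap₂₃ E x z y | edge?-swap₂₃ E z y x | edge?-swap₁₂ E z x y | edge?-swap₂₃ E x z y
    with edge? E x y z in eq
  ... | false = sym (cong₂ _+_ (cong₂ _+_ (cong₂ _+_ (cong₂ _+_ (cong₂ _+_ (zero₂ (toℕ x <ᵇ toℕ y) (toℕ y <ᵇ toℕ z))
          (zero₂ (toℕ x <ᵇ toℕ z) (toℕ z <ᵇ toℕ y))) (zero₂ (toℕ y <ᵇ toℕ x) (toℕ x <ᵇ toℕ z)))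
          (zero₂ (toℕ y <ᵇ toℕ z) (toℕ z <ᵇ toℕ x))) (zero₂ (toℕ z <ᵇ toℕ x) (toℕ x <ᵇ toℕ y))) (zero₂ (toℕ z <ᵇ toℕ y) (toℕ y <ᵇ toℕ x)))
  ... | true with edge?-distinct E eq
  ... | x≢y , y≢z , x≢z = orders (toℕ x) (toℕ y) (toℕ z) (x≢y ∘ toℕ-injective) (y≢z ∘ toℕ-injective) (x≢z ∘ toℕ-injective) refl

ordered-count-bip : ∀ {m n} (G : BipGraph m n) → ∑₁ (λ a → ∑₂ λ y z → 𝟙 (bipEdge? G a y z)) ≡ 2 * eBip G
ordered-count-bip {m} {n} G = begin
  ∑₁ (λ a → ∑₂ λ y z → 𝟙 (bipEdge? G a y z))
    ≡⟨ ∑₁-cong (λ a → trans (∑₂-cong (split a)) (trans (∑₂-+ _ _) (cong (∑₂ (o a) +_) (sym (∑₁-swap (o a)))))) ⟩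
  ∑₁ (λ a → ∑₂ (o a) + ∑₂ (o a))
    ≡⟨ ∑₁-+ _ _ ⟩
  ∑₁ (λ a → ∑₂ (o a)) + ∑₁ (λ a → ∑₂ (o a))
    ≡⟨ cong (λ z → z + z) (sym (∑-allFin λ a → ∑-allFin λ y → ∑-allFin λ z → refl)) ⟩
  eBip G + eBip G
    ≡⟨ cong (eBip G +_) (+-identityʳ (eBip G)) ⟨
  2 * eBip G ∎
  where
  open ≡-Reasoning
  o : Fin m → Fin n → Fin n → ℕ
  o a y z = 𝟙 ((toℕ y <ᵇ toℕ z) ∧ bipEdge? G a y z)
  swap : ∀ a y z → bipEdge? G a y z ≡ bipEdge? G a z y
  swap a y z = cong₂ _∧_ (neq-sym (toℕ y) (toℕ z)) (∨-comm (G a y z) (G a z y))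
  orders : ∀ a b → a ≢ b → ∀ f → 𝟙 f ≡ 𝟙 ((a <ᵇ b) ∧ f) + 𝟙 ((b <ᵇ a) ∧ f)
  orders a b a≢b f rewrite <ᵇ-flip a b a≢b with a <ᵇ b
  ... | true  = sym (+-identityʳ _)
  ... | false = refl
  split : ∀ a y z → 𝟙 (bipEdge? G a y z) ≡ o a y z + o a z y
  split a y z = trans (go (bipEdge? G a y z) refl)
    (cong (o a y z +_) (cong (λ b → 𝟙 ((toℕ z <ᵇ toℕ y) ∧ b)) (swap a y z)))
    where
    go : ∀ f → bipEdge? G a y z ≡ f → 𝟙 f ≡ 𝟙 ((toℕ y <ᵇ toℕ z) ∧ f) + 𝟙 ((toℕ z <ᵇ toℕ y) ∧ f)
    go true  eq = orders (toℕ y) (toℕ z) (neq-elim (∧-trueˡ eq)) true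
    go false eq = zeros (toℕ y <ᵇ toℕ z) (toℕ z <ᵇ toℕ y)
      where zeros : ∀ p q → 0 ≡ 𝟙 (p ∧ false) + 𝟙 (q ∧ false)
            zeros true  true  = refl
            zeros true  false = refl
            zeros false true  = refl
            zeros false false = refl

module _ {n : ℕ} (κ : Fin n → Fin 3) where
  classSize : Fin 3 → ℕ
  classSize i = ∑₁ λ v → 𝟙 (κ v == i)

  private
    i₀ i₁ i₂ : Fin 3
    i₀ = fzero
    i₁ = fsuc fzero
    i₂ = fsuc (fsuc fzero)

  ∑₁-by-class : ∀ (f : Fin 3 → ℕ) → ∑₁ (λ v → f (κ v)) ≡ classSize i₀ * f i₀ + classSize i₁ * f i₁ + classSize i₂ * f i₂
  ∑₁-by-class f = begin
    ∑₁ (λ v → f (κ v))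
      ≡⟨ ∑₁-cong (λ v → split (κ v)) ⟩
    ∑₁ (λ v → 𝟙 (κ v == i₀) * f i₀ + 𝟙 (κ v == i₁) * f i₁ + 𝟙 (κ v == i₂) * f i₂)
      ≡⟨ trans (∑₁-+ _ _) (cong₂ _+_ (trans (∑₁-+ _ _) (cong₂ _+_ (∑₁-*ʳ (f i₀) _) (∑₁-*ʳ (f i₁) _))) (∑₁-*ʳ (f i₂) _)) ⟩
    classSize i₀ * f i₀ + classSize i₁ * f i₁ + classSize i₂ * f i₂ ∎
    where
    open ≡-Reasoning
    a₀ : ∀ x → x ≡ 1 * x + 0 + 0
    a₀ = solve-∀
    a₁ : ∀ x → x ≡ 0 + 1 * x + 0
    a₁ = solve-∀
    a₂ : ∀ x → x ≡ 0 + 0 + 1 * x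
    a₂ = solve-∀
    split : ∀ i → f i ≡ 𝟙 (i == i₀) * f i₀ + 𝟙 (i == i₁) * f i₁ + 𝟙 (i == i₂) * f i₂
    split fzero               = a₀ (f i₀)
    split (fsuc fzero)        = a₁ (f i₁)
    split (fsuc (fsuc fzero)) = a₂ (f i₂)

  rainbow-count : ∑₃ (λ a b c → 𝟙 (rainbow? (κ a) (κ b) (κ c))) ≡ 6 * (classSize i₀ * (classSize i₁ * classSize i₂))
  rainbow-count = trans (∑₁-by-class (λ i → ∑₂ λ b c → 𝟙 (rainbow? i (κ b) (κ c))))
    (trans (cong₂ _+_ (cong₂ _+_ (cong (classSize i₀ *_) (pairs i₀ i₁ i₂ refl)) (cong (classSize i₁ *_) (pairs i₁ i₀ i₂ refl)))
      (cong (classSize i₂ *_) (pairs i₂ i₀ i₁ refl))) (lemma (classSize i₀) (classSize i₁) (classSize i₂)))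
    where
    lemma : ∀ a b c → a * (2 * (b * c)) + b * (2 * (a * c)) + c * (2 * (a * b)) ≡ 6 * (a * (b * c))
    lemma = solve-∀
    pairs : ∀ p r k → rainbow? p r k ≡ true → ∑₂ (λ b c → 𝟙 (rainbow? p (κ b) (κ c))) ≡ 2 * (classSize r * classSize k)
    pairs p r k h = trans (∑₂-cong λ b c → rainbow-pairs p r k (κ b) (κ c) h) (trans (∑₂-+ _ _)
      (trans (cong₂ _+_ (∑₁-*∑₁ _ _) (trans (∑₁-*∑₁ _ _) (*-comm (classSize k) _))) (cong (classSize r * classSize k +_) (sym (+-identityʳ _)))))

  classSizes-sum : classSize i₀ + classSize i₁ + classSize i₂ ≡ n
  classSizes-sum = trans (sym (trans (∑₁-by-class (λ _ → 1)) (cong₂ _+_ (cong₂ _+_ (*-identityʳ (classSize i₀)) (*-identityʳ (classSize i₁))) (*-identityʳ (classSize i₂)))))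
    (trans (∑₁-const 1) (*-identityʳ n))

-- Class sizes of the residue colouring

residue : ∀ {n} → Fin n → Fin 3
residue v = fromℕ< (m%n<n (toℕ v) 3)

toℕ-residue : ∀ {n} (v : Fin n) → toℕ (residue v) ≡ toℕ v % 3
toℕ-residue v = toℕ-fromℕ< (m%n<n (toℕ v) 3)

residue-rainbow : ∀ {n} (x y z : Fin n) → rainbow? (residue x) (residue y) (residue z) ≡ T3 n x y z
residue-rainbow x y z rewrite toℕ-residue x | toℕ-residue y | toℕ-residue z = refl

T3-edge : ∀ {n} (x y z : Fin n) → edge? (T3 n) x y z ≡ rainbow? (residue x) (residue y) (residue z)
T3-edge {n} x y z = bool-ext {edge? (T3 n) x y z}
  (edge?-elim (T3 n) (λ x y z → rainbow? (residue x) (residue y) (residue z) ≡ true)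
    (λ {x} {y} {z} h → trans (rainbow-swap₁₂ (residue y) (residue x) (residue z)) h)
    (λ {x} {y} {z} h → trans (rainbow-swap₂₃ (residue x) (residue z) (residue y)) h)
    (λ {x} {y} {z} h → trans (residue-rainbow x y z) h) x y z)
  (λ h → let p , q , r = distinct3-elim {toℕ (residue x)} {toℕ (residue y)} {toℕ (residue z)} h in
    edge?-intro (T3 n) {x} {y} {z} (p ∘ cong (toℕ ∘ residue)) (q ∘ cong (toℕ ∘ residue)) (r ∘ cong (toℕ ∘ residue)) (trans (sym (residue-rainbow x y z)) h))

module _ (n : ℕ) where
  private
    c : Fin 3 → ℕ
    c = classSize {n} residue

  e-T3 : e (T3 n) ≡ c fzero * (c (fsuc fzero) * c (fsuc (fsuc fzero)))
  e-T3 = *-cancelˡ-≡ _ _ 6 (trans (sym (ordered-count (T3 n))) (trans (∑₃-cong λ x y z → cong 𝟙 (T3-edge x y z)) (rainbow-count residue)))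

data Balanced : ℕ → ℕ → ℕ → ℕ → Set where
  bal₀ : ∀ q → Balanced (3 * q) q q q
  bal₁ : ∀ q → Balanced (1 + 3 * q) (1 + q) q q
  bal₂ : ∀ q → Balanced (2 + 3 * q) (1 + q) (1 + q) q

Balanced-step : ∀ {n a b c} → Balanced n a b c → Balanced (3 + n) (1 + a) (1 + b) (1 + c)
Balanced-step (bal₀ q) = subst (λ z → Balanced z (1 + q) (1 + q) (1 + q)) (lemma q) (bal₀ (1 + q))
  where lemma : ∀ q → 3 * (1 + q) ≡ 3 + 3 * q
        lemma = solve-∀
Balanced-step (bal₁ q) = subst (λ z → Balanced z (2 + q) (1 + q) (1 + q)) (lemma q) (bal₁ (1 + q))
  where lemma : ∀ q → 1 + 3 * (1 + q) ≡ 3 + (1 + 3 * q)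
        lemma = solve-∀
Balanced-step (bal₂ q) = subst (λ z → Balanced z (2 + q) (2 + q) (1 + q)) (lemma q) (bal₂ (1 + q))
  where lemma : ∀ q → 2 + 3 * (1 + q) ≡ 3 + (2 + 3 * q)
        lemma = solve-∀

classSize-0 : ∀ i → classSize {0} residue i ≡ 0
classSize-0 i = ∑₁-empty _

residue-3+ : ∀ {n} (v : Fin n) → residue (fsuc (fsuc (fsuc v))) ≡ residue v
residue-3+ v = toℕ-injective (trans (toℕ-residue (fsuc (fsuc (fsuc v)))) (trans
  (trans (cong (_% 3) (+-comm 3 (toℕ v))) ([m+n]%n≡m%n (toℕ v) 3)) (sym (toℕ-residue v))))

classSize-3+ : ∀ n i → classSize {3 + n} residue i ≡ 1 + classSize {n} residue i
classSize-3+ n i = trans (∑₁-suc _) (trans (cong (𝟙 (fzero == i) +_) (trans (∑₁-suc _)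
  (cong (𝟙 (fsuc fzero == i) +_) (∑₁-suc _)))) (trans (cong (λ z → 𝟙 (fzero == i) + (𝟙 (fsuc fzero == i) + (𝟙 (fsuc (fsuc fzero) == i) + z)))
  (∑₁-cong λ v → cong (λ z → 𝟙 (z == i)) (residue-3+ v))) (one i)))
  where
  one : ∀ i {z} → 𝟙 (fzero == i) + (𝟙 (fsuc fzero == i) + (𝟙 (fsuc (fsuc fzero) == i) + z)) ≡ 1 + z
  one fzero               = refl
  one (fsuc fzero)        = refl
  one (fsuc (fsuc fzero)) = refl

Balanced-resp : ∀ {n a b c a′ b′ c′} → a ≡ a′ → b ≡ b′ → c ≡ c′ → Balanced n a b c → Balanced n a′ b′ c′
Balanced-resp refl refl refl h = h

balanced : ∀ n → Balanced n (classSize {n} residue fzero) (classSize {n} residue (fsuc fzero)) (classSize {n} residue (fsuc (fsuc fzero)))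
balanced zero rewrite classSize-0 fzero | classSize-0 (fsuc fzero) | classSize-0 (fsuc (fsuc fzero)) = bal₀ 0
balanced (suc zero) = Balanced-resp (small fzero) (small (fsuc fzero)) (small (fsuc (fsuc fzero))) (bal₁ 0)
  where
  small : ∀ i → 𝟙 (fzero == i) + 0 ≡ classSize {1} residue i
  small i = sym (trans (∑₁-suc _) (cong (𝟙 (fzero == i) +_) (∑₁-empty _)))
balanced (suc (suc zero)) = Balanced-resp (small fzero) (small (fsuc fzero)) (small (fsuc (fsuc fzero))) (bal₂ 0)
  where
  small : ∀ i → 𝟙 (fzero == i) + (𝟙 (fsuc fzero == i) + 0) ≡ classSize {2} residue i
  small i = sym (trans (∑₁-suc _) (cong (𝟙 (fzero == i) +_) (trans (∑₁-suc _)
    (cong (𝟙 (fsuc fzero == i) +_) (∑₁-empty _)))))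
balanced (suc (suc (suc n))) rewrite classSize-3+ n fzero | classSize-3+ n (fsuc fzero) | classSize-3+ n (fsuc (fsuc fzero)) =
  Balanced-step (balanced n)

4ab≤[a+b]² : ∀ a b → 4 * (a * b) ≤ (a + b) * (a + b)
4ab≤[a+b]² a b = lin≤ 0 (2xy≤x²+y² a b) (lemma a b)
  where lemma : ∀ a b → 4 * (a * b) + (a * a + b * b) + 0 ≡ (a + b) * (a + b) + 2 * (a * b)
        lemma = solve-∀

27abc≤n³ : ∀ a b c → 27 * (a * (b * c)) ≤ (a + b + c) * ((a + b + c) * (a + b + c))
27abc≤n³ a b c = *-cancelˡ-≤ 4 (begin
  4 * (27 * (a * (b * c)))                                   ≡⟨ lemma a b c ⟩
  27 * a * (4 * (b * c))                                     ≤⟨ *-monoʳ-≤ (27 * a) (4ab≤[a+b]² b c) ⟩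
  27 * a * ((b + c) * (b + c))                               ≡⟨ *-assoc 27 a _ ⟩
  27 * (a * ((b + c) * (b + c)))                             ≤⟨ cubic-amgm a (b + c) ⟩
  4 * ((a + (b + c)) * ((a + (b + c)) * (a + (b + c))))      ≡⟨ cong (λ z → 4 * (z * (z * z))) (+-assoc a b c) ⟨
  4 * ((a + b + c) * ((a + b + c) * (a + b + c)))            ∎)
  where
  open ≤-Reasoning
  lemma : ∀ a b c → 4 * (27 * (a * (b * c))) ≡ 27 * a * (4 * (b * c))
  lemma = solve-∀

module _ (R : ℕ) (Q : ℕ → Set) (Q? : ∀ a → Dec (Q a)) (N : ℕ)
  (first : ∀ a b c → Q a → a + b + c ≡ N → a * (b * c) ≤ R) where

  -- The product is symmetric, so the part with property Q can be moved to the front.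
  any-part : ∀ a b c → (¬ Q a → ¬ Q b → ¬ Q c → ⊥) → a + b + c ≡ N → a * (b * c) ≤ R
  any-part a b c some eq with Q? a | Q? b | Q? c
  ... | yes p | _     | _     = first a b c p eq
  ... | no _  | yes p | _     = ≤-trans (≤-reflexive (lemma a b c)) (first b a c p (trans (cong (_+ c) (+-comm b a)) eq))
    where lemma : ∀ a b c → a * (b * c) ≡ b * (a * c)
          lemma = solve-∀
  ... | no _  | no _  | yes p = ≤-trans (≤-reflexive (lemma a b c)) (first c a b p (trans (lemma₂ a b c) eq))
    where lemma : ∀ a b c → a * (b * c) ≡ c * (a * b)
          lemma = solve-∀
          lemma₂ : ∀ a b c → c + a + b ≡ a + b + c
          lemma₂ = solve-∀
  ... | no p  | no q  | no r  = ⊥-elim (some p q r)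

-- If a = q + 1 + j then b + c = 2q − j.
large-part : ∀ q a b c → q < a → a + b + c ≡ 1 + 3 * q → a * (b * c) ≤ (1 + q) * (q * q)
large-part q a b c q<a sum with m≤n⇒∃[o]m+o≡n q<a
... | j , refl = *-cancelˡ-≤ 8 (begin
  8 * ((suc q + j) * (b * c))               ≡⟨ lemma₁ q j (b * c) ⟩
  (2 + 2 * q + 2 * j) * (4 * (b * c))       ≤⟨ *-monoʳ-≤ (2 + 2 * q + 2 * j) (4ab≤[a+b]² b c) ⟩
  (2 + 2 * q + 2 * j) * (w * w)             ≡⟨ cong (λ z → (2 + z + 2 * j) * (w * w)) 2q ⟩
  (2 + (w + j) + 2 * j) * (w * w)           ≤⟨ eq≤ (4 * (w * j) + 2 * (j * j) + 3 * (w * (j * j)) + j * (j * j)) (lemma₂ w j) ⟩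
  (2 + (w + j)) * ((w + j) * (w + j))       ≡⟨ cong (λ z → (2 + z) * (z * z)) 2q ⟨
  (2 + 2 * q) * (2 * q * (2 * q))           ≡⟨ lemma₃ q ⟩
  8 * ((1 + q) * (q * q))                   ∎)
  where
  open ≤-Reasoning
  w = b + c
  lemma₀ : ∀ q j b c → 1 + q + (b + c + j) ≡ 1 + q + j + b + c
  lemma₀ = solve-∀
  lemma₀′ : ∀ q → 1 + 3 * q ≡ 1 + q + 2 * q
  lemma₀′ = solve-∀
  2q : 2 * q ≡ w + j
  2q = sym (+-cancelˡ-≡ (1 + q) _ _ (trans (lemma₀ q j b c) (trans sum (lemma₀′ q))))
  lemma₁ : ∀ q j x → 8 * ((1 + q + j) * x) ≡ (2 + 2 * q + 2 * j) * (4 * x)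
  lemma₁ = solve-∀
  lemma₂ : ∀ w j → (2 + (w + j) + 2 * j) * (w * w) + (4 * (w * j) + 2 * (j * j) + 3 * (w * (j * j)) + j * (j * j)) ≡ (2 + (w + j)) * ((w + j) * (w + j))
  lemma₂ = solve-∀
  lemma₃ : ∀ q → (2 + 2 * q) * (2 * q * (2 * q)) ≡ 8 * ((1 + q) * (q * q))
  lemma₃ = solve-∀

-- If a = q − j then b + c = 2a + 3j + 2.
small-part : ∀ q a b c → a ≤ q → a + b + c ≡ 2 + 3 * q → a * (b * c) ≤ (1 + q) * ((1 + q) * q)
small-part q a b c a≤q sum with m≤n⇒∃[o]m+o≡n a≤q
... | j , refl = *-cancelˡ-≤ 4 (begin
  4 * (a * (b * c))                          ≡⟨ lemma₁ a (b * c) ⟩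
  a * (4 * (b * c))                          ≤⟨ *-monoʳ-≤ a (4ab≤[a+b]² b c) ⟩
  a * ((b + c) * (b + c))                    ≡⟨ cong (λ z → a * (z * z)) w ⟩
  a * ((2 * a + 3 * j + 2) * (2 * a + 3 * j + 2))
    ≤⟨ eq≤ (3 * (a * (j * j)) + 4 * (a * j) + 4 * ((j + 1) * (j * j + j))) (lemma₂ a j) ⟩
  4 * ((1 + (a + j)) * ((1 + (a + j)) * (a + j))) ∎)
  where
  open ≤-Reasoning
  lemma₀ : ∀ a j → 2 + 3 * (a + j) ≡ a + (2 * a + 3 * j + 2)
  lemma₀ = solve-∀
  w : b + c ≡ 2 * a + 3 * j + 2
  w = +-cancelˡ-≡ a _ _ (trans (sym (+-assoc a b c)) (trans sum (lemma₀ a j)))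
  lemma₁ : ∀ a x → 4 * (a * x) ≡ a * (4 * x)
  lemma₁ = solve-∀
  lemma₂ : ∀ a j → a * ((2 * a + 3 * j + 2) * (2 * a + 3 * j + 2)) + (3 * (a * (j * j)) + 4 * (a * j) + 4 * ((j + 1) * (j * j + j)))
    ≡ 4 * ((1 + (a + j)) * ((1 + (a + j)) * (a + j)))
  lemma₂ = solve-∀

-- AM-GM is exact over the integers when n = 3q. For n = 3q + 1 some part exceeds q, for n = 3q + 2
-- some part is at most q, and for a part so constrained AM-GM for the other two gives the integer
-- maximum.
balanced-maximal : ∀ {n x y z} → Balanced n x y z → ∀ a b c → a + b + c ≡ n → a * (b * c) ≤ x * (y * z)
balanced-maximal (bal₀ q) a b c eq = *-cancelˡ-≤ 27 (≤-trans (27abc≤n³ a b c)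
  (≤-reflexive (trans (cong (λ z → z * (z * z)) eq) (lemma q))))
  where lemma : ∀ q → 3 * q * (3 * q * (3 * q)) ≡ 27 * (q * (q * q))
        lemma = solve-∀
balanced-maximal (bal₁ q) a b c eq = any-part _ (q <_) (q <?_) (1 + 3 * q) (large-part q) a b c
  (λ p p′ p″ → 1+n≰n (≤-trans (≤-reflexive (sym eq)) (≤-trans (+-mono-≤ (+-mono-≤ (≮⇒≥ p) (≮⇒≥ p′)) (≮⇒≥ p″)) (≤-reflexive (lemma q))))) eq
  where lemma : ∀ q → q + q + q ≡ 3 * q
        lemma = solve-∀
balanced-maximal (bal₂ q) a b c eq = any-part _ (_≤ q) (_≤? q) (2 + 3 * q) (small-part q) a b c
  (λ p p′ p″ → 1+n≰n (≤-trans (≤-reflexive (lemma q)) (≤-trans (+-mono-≤ (+-mono-≤ (≰⇒> p) (≰⇒> p′)) (≰⇒> p″)) (≤-reflexive eq)))) eq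
  where lemma : ∀ q → 1 + (2 + 3 * q) ≡ 1 + q + (1 + q) + (1 + q)
        lemma = solve-∀

balanced-product : ∀ {n x y z} → Balanced n x y z → n * (n * n) ≤ 27 * (x * (y * z)) + 2 * (n * n)
balanced-product (bal₀ q) = eq≤ (2 * (3 * q * (3 * q))) (lemma q)
  where lemma : ∀ q → 3 * q * (3 * q * (3 * q)) + 2 * (3 * q * (3 * q)) ≡ 27 * (q * (q * q)) + 2 * (3 * q * (3 * q))
        lemma = solve-∀
balanced-product (bal₁ q) = eq≤ (18 * (q * q) + 3 * q + 1) (lemma q)
  where lemma : ∀ q → (1 + 3 * q) * ((1 + 3 * q) * (1 + 3 * q)) + (18 * (q * q) + 3 * q + 1)
                  ≡ 27 * ((1 + q) * (q * q)) + 2 * ((1 + 3 * q) * (1 + 3 * q))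
        lemma = solve-∀
balanced-product (bal₂ q) = eq≤ (18 * (q * q) + (15 * q)) (lemma q)
  where lemma : ∀ q → (2 + 3 * q) * ((2 + 3 * q) * (2 + 3 * q)) + (18 * (q * q) + (15 * q))
                  ≡ 27 * ((1 + q) * ((1 + q) * q)) + 2 * ((2 + 3 * q) * (2 + 3 * q))
        lemma = solve-∀

-- Stability of the AM–GM inequality: e = |3a − n|, entering only through e² = (b + c − 2a)².
module _ (a b c n : ℕ) (sum : a + b + c ≡ n) (K : ℕ) (1≤n : 1 ≤ n)
  (large : K * K * (n * (n * n)) ≤ K * K * (27 * (a * (b * c))) + 2601 * (n * (n * n))) where

  private
    w : ℕ
    w = b + c

    a+w : a + w ≡ n
    a+w = trans (sym (+-assoc a b c)) sum

  -- The identity behind `cubic-amgm` for a and w, with the square (w - 2a)² kept instead of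
  -- dropped; its coefficient 4w + a is at least n.
  defect : ∀ d → w * w + 2 * a * (2 * a) ≡ 2 * (w * (2 * a)) + d * d → d * d * n + 27 * (a * (w * w)) ≤ 4 * (n * (n * n))
  defect d eq = begin
    d * d * n + 27 * (a * (w * w))                 ≤⟨ +-monoˡ-≤ _ (*-monoʳ-≤ (d * d) n≤) ⟩
    d * d * (4 * w + a) + 27 * (a * (w * w))       ≡⟨ +-cancelʳ-≡ (2 * (w * (2 * a)) * (4 * w + a)) _ _ (begin-equality
      d * d * (4 * w + a) + 27 * (a * (w * w)) + 2 * (w * (2 * a)) * (4 * w + a)  ≡⟨ lemma₁ a w (d * d) ⟩
      27 * (a * (w * w)) + (2 * (w * (2 * a)) + d * d) * (4 * w + a)              ≡⟨ cong (λ z → 27 * (a * (w * w)) + z * (4 * w + a)) eq ⟨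
      27 * (a * (w * w)) + (w * w + 2 * a * (2 * a)) * (4 * w + a)                ≡⟨ lemma₂ a w ⟩
      4 * ((a + w) * ((a + w) * (a + w))) + 2 * (w * (2 * a)) * (4 * w + a)       ∎) ⟩
    4 * ((a + w) * ((a + w) * (a + w)))            ≡⟨ cong (λ z → 4 * (z * (z * z))) a+w ⟩
    4 * (n * (n * n))                              ∎
    where
    open ≤-Reasoning
    n≤ : n ≤ 4 * w + a
    n≤ = ≤-trans (≤-reflexive (trans (sym a+w) (+-comm a w))) (+-monoˡ-≤ a (m≤n*m w 4))
    lemma₁ : ∀ a w x → x * (4 * w + a) + 27 * (a * (w * w)) + 2 * (w * (2 * a)) * (4 * w + a) ≡ 27 * (a * (w * w)) + (2 * (w * (2 * a)) + x) * (4 * w + a)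
    lemma₁ = solve-∀
    lemma₂ : ∀ a w → 27 * (a * (w * w)) + (w * w + 2 * a * (2 * a)) * (4 * w + a) ≡ 4 * ((a + w) * ((a + w) * (a + w))) + 2 * (w * (2 * a)) * (4 * w + a)
    lemma₂ = solve-∀

  -- Four times the hypothesis gives (K · d)² ≤ 4 · 2601 n², and 2601 = 51².
  defect≤ : ∀ d → w * w + 2 * a * (2 * a) ≡ 2 * (w * (2 * a)) + d * d → K * d ≤ 102 * n
  defect≤ d eq = ≮⇒≥ λ lt → <⇒≱ (*-mono-< lt lt) squares
    where
    squares : K * d * (K * d) ≤ 102 * n * (102 * n)
    squares = *-cancelˡ-≤ n {{>-nonZero 1≤n}} (lin≤ 0
      (+-mono-≤ (*-monoʳ-≤ (K * K) (defect d eq)) (+-mono-≤ (*-monoʳ-≤ (27 * (K * K) * a) (4ab≤[a+b]² b c)) (*-monoʳ-≤ 4 large)))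
      (lemma K n a (b * c) (d * d) ((b + c) * (b + c)) d refl))
      where
      lemma : ∀ K n a x dd ww d → dd ≡ d * d →
        n * (K * d * (K * d)) + (K * K * (4 * (n * (n * n))) + (27 * (K * K) * a * ww + 4 * (K * K * (27 * (a * x)) + 2601 * (n * (n * n))))) + 0
        ≡ n * (102 * n * (102 * n)) + (K * K * (dd * n + 27 * (a * ww)) + (27 * (K * K) * a * (4 * x) + 4 * (K * K * (n * (n * n)))))
      lemma K n a x dd ww d refl = go K n a x ww d
        where
        go : ∀ K n a x ww d →
          n * (K * d * (K * d)) + (K * K * (4 * (n * (n * n))) + (27 * (K * K) * a * ww + 4 * (K * K * (27 * (a * x)) + 2601 * (n * (n * n))))) + 0
          ≡ n * (102 * n * (102 * n)) + (K * K * (d * d * n + 27 * (a * ww)) + (27 * (K * K) * a * (4 * x) + 4 * (K * K * (n * (n * n)))))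
        go = solve-∀

  nearly-third : K * (3 * a) ≤ K * n + 102 * n × K * n ≤ K * (3 * a) + 102 * n
  nearly-third with ≤-total w (2 * a)
  ... | inj₁ w≤2a with m≤n⇒∃[o]m+o≡n w≤2a
  ... | d , eq = upper , ≤-trans (*-monoʳ-≤ K n≤3a) (m≤m+n _ _)
    where
    3a : 3 * a ≡ n + d
    3a = trans (lemma a) (trans (cong (a +_) (sym eq)) (trans (sym (+-assoc a w d)) (cong (_+ d) a+w)))
      where lemma : ∀ a → 3 * a ≡ a + 2 * a
            lemma = solve-∀
    n≤3a : n ≤ 3 * a
    n≤3a = ≤-trans (m≤m+n n d) (≤-reflexive (sym 3a))
    sq : w * w + 2 * a * (2 * a) ≡ 2 * (w * (2 * a)) + d * d
    sq = subst (λ z → w * w + z * z ≡ 2 * (w * z) + d * d) eq (lemma w d)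
      where lemma : ∀ w d → w * w + (w + d) * (w + d) ≡ 2 * (w * (w + d)) + d * d
            lemma = solve-∀
    upper : K * (3 * a) ≤ K * n + 102 * n
    upper = ≤-trans (≤-reflexive (trans (cong (K *_) 3a) (*-distribˡ-+ K n d))) (+-monoʳ-≤ (K * n) (defect≤ d sq))
  nearly-third | inj₂ 2a≤w with m≤n⇒∃[o]m+o≡n 2a≤w
  ... | d , eq = ≤-trans (*-monoʳ-≤ K 3a≤n) (m≤m+n _ _) , lower
    where
    3a : 3 * a + d ≡ n
    3a = trans (lemma a d) (trans (cong (a +_) eq) a+w)
      where lemma : ∀ a d → 3 * a + d ≡ a + (2 * a + d)
            lemma = solve-∀
    3a≤n : 3 * a ≤ n
    3a≤n = ≤-trans (m≤m+n _ d) (≤-reflexive 3a)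
    sq : w * w + 2 * a * (2 * a) ≡ 2 * (w * (2 * a)) + d * d
    sq = subst (λ z → z * z + 2 * a * (2 * a) ≡ 2 * (z * (2 * a)) + d * d) eq (lemma (2 * a) d)
      where lemma : ∀ x d → (x + d) * (x + d) + x * x ≡ 2 * ((x + d) * x) + d * d
            lemma = solve-∀
    lower : K * n ≤ K * (3 * a) + 102 * n
    lower = ≤-trans (≤-reflexive (trans (cong (K *_) (sym 3a)) (*-distribˡ-+ K (3 * a) d))) (+-monoʳ-≤ (K * (3 * a)) (defect≤ d sq))

-- Copies of K_{t,s,s}

module KParts (t s : ℕ) where
  K-τ : Fin t → Fin (t + s + s)
  K-τ l = (l ↑ˡ s) ↑ˡ s

  K-β K-γ : Fin s → Fin (t + s + s)
  K-β x = (t ↑ʳ x) ↑ˡ s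
  K-γ x = (t + s) ↑ʳ x

  K-τ-inj : Injective _≡_ _≡_ K-τ
  K-τ-inj = ↑ˡ-injective s _ _ ∘ ↑ˡ-injective s _ _

  K-β-inj : Injective _≡_ _≡_ K-β
  K-β-inj = ↑ʳ-injective t _ _ ∘ ↑ˡ-injective s _ _

  K-γ-inj : Injective _≡_ _≡_ K-γ
  K-γ-inj = ↑ʳ-injective (t + s) _ _

  part-τ : ∀ l → partK t s (toℕ (K-τ l)) ≡ 0
  part-τ l rewrite toℕ-↑ˡ (l ↑ˡ s) s | toℕ-↑ˡ l s | <⇒<ᵇ-true (toℕ<n l) = refl

  part-β : ∀ x → partK t s (toℕ (K-β x)) ≡ 1
  part-β x rewrite toℕ-↑ˡ (t ↑ʳ x) s | toℕ-↑ʳ t x | ≤⇒<ᵇ-false (m≤m+n t (toℕ x)) | <⇒<ᵇ-true (+-monoʳ-< t (toℕ<n x)) = refl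

  part-γ : ∀ x → partK t s (toℕ (K-γ x)) ≡ 2
  part-γ x rewrite toℕ-↑ʳ (t + s) x | ≤⇒<ᵇ-false (≤-trans (m≤m+n t s) (m≤m+n (t + s) (toℕ x))) | ≤⇒<ᵇ-false (m≤m+n (t + s) (toℕ x)) = refl

  K-edge : ∀ l x y → IsEdge (K t s) (K-τ l) (K-β x) (K-γ y)
  K-edge l x y = edge?-intro (K t s)
    (λ eq → case trans (sym (part-τ l)) (trans (cong (partK t s ∘ toℕ) eq) (part-β x)) of λ ())
    (λ eq → case trans (sym (part-β x)) (trans (cong (partK t s ∘ toℕ) eq) (part-γ y)) of λ ())
    (λ eq → case trans (sym (part-τ l)) (trans (cong (partK t s ∘ toℕ) eq) (part-γ y)) of λ ())
    (cong₃ distinct3 (part-τ l) (part-β x) (part-γ y))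

  data KVertex : Fin (t + s + s) → Set where
    inτ : ∀ l → KVertex (K-τ l)
    inβ : ∀ x → KVertex (K-β x)
    inγ : ∀ x → KVertex (K-γ x)

  K-vertex : ∀ w → KVertex w
  K-vertex w with splitAt (t + s) w in eq
  ... | inj₂ x = subst KVertex (splitAt⁻¹-↑ʳ eq) (inγ x)
  ... | inj₁ v with splitAt t v in eq′
  ... | inj₁ l = subst KVertex (trans (cong (_↑ˡ s) (splitAt⁻¹-↑ˡ eq′)) (splitAt⁻¹-↑ˡ eq)) (inτ l)
  ... | inj₂ x = subst KVertex (trans (cong (_↑ˡ s) (splitAt⁻¹-↑ʳ eq′)) (splitAt⁻¹-↑ˡ eq)) (inβ x)

  module _ {n : ℕ} (F : Graph3 n) (τ : Fin t → Fin n) (β γ : Fin s → Fin n) (1≤t : 1 ≤ t) (1≤s : 1 ≤ s)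
    (τ-inj : Injective _≡_ _≡_ τ) (β-inj : Injective _≡_ _≡_ β) (γ-inj : Injective _≡_ _≡_ γ)
    (edges : ∀ l x y → IsEdge F (τ l) (β x) (γ y)) where

    private
      at : ∀ {w} → KVertex w → Fin n
      at (inτ l) = τ l
      at (inβ x) = β x
      at (inγ x) = γ x

      distinct : ∀ l x y → τ l ≢ β x × β x ≢ γ y × τ l ≢ γ y
      distinct l x y = edge?-distinct F (edges l x y)

      at-inj : ∀ {v w} (p : KVertex v) (q : KVertex w) → at p ≡ at q → v ≡ w
      at-inj (inτ l) (inτ k) eq = cong K-τ (τ-inj eq)
      at-inj (inτ l) (inβ x) eq = ⊥-elim (proj₁ (distinct l x (fromℕ< 1≤s)) eq)
      at-inj (inτ l) (inγ x) eq = ⊥-elim (proj₂ (proj₂ (distinct l (fromℕ< 1≤s) x)) eq)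
      at-inj (inβ x) (inτ l) eq = ⊥-elim (proj₁ (distinct l x (fromℕ< 1≤s)) (sym eq))
      at-inj (inβ x) (inβ y) eq = cong K-β (β-inj eq)
      at-inj (inβ x) (inγ y) eq = ⊥-elim (proj₁ (proj₂ (distinct (fromℕ< 1≤t) x y)) eq)
      at-inj (inγ x) (inτ l) eq = ⊥-elim (proj₂ (proj₂ (distinct l (fromℕ< 1≤s) x)) (sym eq))
      at-inj (inγ x) (inβ y) eq = ⊥-elim (proj₁ (proj₂ (distinct (fromℕ< 1≤t) y x)) (sym eq))
      at-inj (inγ x) (inγ y) eq = cong K-γ (γ-inj eq)

      number : ∀ {w} → KVertex w → ℕ
      number (inτ _) = 0
      number (inβ _) = 1
      number (inγ _) = 2

      partK-number : ∀ {w} (p : KVertex w) → partK t s (toℕ w) ≡ number p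
      partK-number (inτ l) = part-τ l
      partK-number (inβ x) = part-β x
      partK-number (inγ x) = part-γ x

      at-edge : ∀ {u v w} (p : KVertex u) (q : KVertex v) (r : KVertex w) →
        distinct3 (number p) (number q) (number r) ≡ true → IsEdge F (at p) (at q) (at r)
      at-edge (inτ l) (inβ x) (inγ y) _ = edges l x y
      at-edge (inτ l) (inγ y) (inβ x) _ = IsEdge-swap₂₃ F (edges l x y)
      at-edge (inβ x) (inτ l) (inγ y) _ = IsEdge-swap₁₂ F (edges l x y)
      at-edge (inβ x) (inγ y) (inτ l) _ = IsEdge-swap₂₃ F (IsEdge-swap₁₂ F (edges l x y))
      at-edge (inγ y) (inτ l) (inβ x) _ = IsEdge-swap₁₂ F (IsEdge-swap₂₃ F (edges l x y))
      at-edge (inγ y) (inβ x) (inτ l) _ = IsEdge-swap₂₃ F (IsEdge-swap₁₂ F (IsEdge-swap₂₃ F (edges l x y)))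

    K-contained : Contains (K t s) F
    K-contained = (λ w → at (K-vertex w)) , (λ {v} {w} → at-inj (K-vertex v) (K-vertex w)) ,
      edge?-elim (K t s) (λ x y z → IsEdge F (at (K-vertex x)) (at (K-vertex y)) (at (K-vertex z))) (IsEdge-swap₁₂ F) (IsEdge-swap₂₃ F)
        (λ {x} {y} {z} h → at-edge (K-vertex x) (K-vertex y) (K-vertex z)
          (trans (sym (cong₃ distinct3 (partK-number (K-vertex x)) (partK-number (K-vertex y)) (partK-number (K-vertex z)))) h))

-- Edges between sound vertices

∑-drop-++ : ∀ {A : Set} k (xs ys : List A) (g : A → ℕ) → ∑ (drop k (xs ++ ys)) g ≤ ∑ (drop k xs) g + ∑ ys g
∑-drop-++ zero    xs       ys g = ≤-reflexive (∑-++ xs ys g)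
∑-drop-++ (suc k) []       ys g = drop-≤ (suc k) ys
  where drop-≤ : ∀ k ys → ∑ (drop k ys) g ≤ ∑ ys g
        drop-≤ zero    ys       = ≤-refl
        drop-≤ (suc k) []       = z≤n
        drop-≤ (suc k) (y ∷ ys) = ≤-trans (drop-≤ k ys) (m≤n+m _ (g y))
∑-drop-++ (suc k) (x ∷ xs) ys g = ∑-drop-++ k xs ys g

-- The image of φ exhausts ρ as far as possible; it leaves ρ only when ρ has fewer than k elements.
record Selection {n : ℕ} (ρ : Fin n → Bool) (k : ℕ) : Set where
  field
    φ         : Fin k → Fin n
    φ-inj     : Injective _≡_ _≡_ φ
    rest      : List (Fin n)
    rest-uniq : Unique rest
    rest-size : length rest ≤ ∑₁ (𝟙 ∘ ρ) ∸ k
    rest-ρ    : ∀ f → ∑ rest f ≡ ∑ rest (λ x → 𝟙 (ρ x) * f x)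
    split     : ∀ f → ∑ (members ρ) f ≡ ∑₁ (λ x → 𝟙 (ρ (φ x)) * f (φ x)) + ∑ rest f

module _ {n : ℕ} (ρ : Fin n → Bool) (k : ℕ) (k≤n : k ≤ n) where
  private
    -- Members of ρ come first, so the first k entries exhaust them and are padded with other
    -- vertices if there are too few.
    inside outside all : List (Fin n)
    inside  = members ρ
    outside = members (not ∘ ρ)
    all     = inside ++ outside

    all-uniq : Unique all
    all-uniq = ++⁺ (members-unique ρ) (members-unique (not ∘ ρ)) λ { (x∈ , x∈′) →
      clash (proj₂ (∈-filter⁻ (T? ∘ ρ) {xs = allFin n} x∈)) (proj₂ (∈-filter⁻ (T? ∘ not ∘ ρ) {xs = allFin n} x∈′)) }
      where clash : ∀ {b} → T b → T (not b) → ⊥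
            clash {true} _ ()

    complement : ∀ b x → 𝟙 b * x + 𝟙 (not b) * x ≡ x
    complement true  x = trans (+-identityʳ _) (+-identityʳ x)
    complement false x = +-identityʳ x

    ∑-all : ∀ f → ∑ all f ≡ ∑₁ f
    ∑-all f = trans (∑-++ inside outside f) (trans (cong₂ _+_ (∑-members ρ f) (∑-members (not ∘ ρ) f))
      (trans (sym (∑₁-+ _ _)) (∑₁-cong λ x → complement (ρ x) (f x))))

    length-all : length all ≡ n
    length-all = trans (length-∑ all) (trans (∑-all _) (trans (∑₁-const 1) (*-identityʳ n)))

    picked = pick k all all-uniq (subst (k ≤_) (sym length-all) k≤n)

    idem : ∀ b x → 𝟙 b * x ≡ 𝟙 b * (𝟙 b * x)
    idem true  x = sym (+-identityʳ _)
    idem false x = refl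

  opaque
    select : Selection ρ k
    select = record
      { φ = proj₁ picked
      ; φ-inj = proj₁ (proj₂ picked)
      ; rest = filterᵇ ρ (drop k all)
      ; rest-uniq = filter⁺ (T? ∘ ρ) (drop⁺ k all-uniq)
      ; rest-size = size
      ; rest-ρ = λ f → trans (∑-filter ρ (drop k all) f) (trans (∑-cong (drop k all) λ x → idem (ρ x) (f x))
          (sym (∑-filter ρ (drop k all) _)))
      ; split = λ f → trans (∑-members ρ f) (trans (sym (∑-all _)) (trans (proj₂ (proj₂ (proj₂ picked)) _)
          (cong (∑₁ (λ x → 𝟙 (ρ (proj₁ picked x)) * f (proj₁ picked x)) +_) (sym (∑-filter ρ (drop k all) f)))))
      }
      where
      open ≤-Reasoning
      size : length (filterᵇ ρ (drop k all)) ≤ ∑₁ (𝟙 ∘ ρ) ∸ k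
      size = begin
        length (filterᵇ ρ (drop k all))                     ≡⟨ trans (length-∑ (filterᵇ ρ (drop k all))) (trans (∑-filter ρ (drop k all) _) (∑-cong (drop k all) λ x → *-identityʳ _)) ⟩
        ∑ (drop k all) (𝟙 ∘ ρ)                              ≤⟨ ∑-drop-++ k inside outside (𝟙 ∘ ρ) ⟩
        ∑ (drop k inside) (𝟙 ∘ ρ) + ∑ outside (𝟙 ∘ ρ)       ≤⟨ +-mono-≤ (∑-≤const (drop k inside) (λ x → 𝟙≤1 (ρ x)))
                                                                 (≤-reflexive (trans (∑-members (not ∘ ρ) _) (trans (∑₁-cong λ x → disjoint (ρ x)) (trans (∑₁-const 0) (*-zeroʳ n))))) ⟩
        length (drop k inside) * 1 + 0                      ≡⟨ trans (+-identityʳ _) (*-identityʳ _) ⟩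
        length (drop k inside)                              ≡⟨ length-drop k inside ⟩
        length inside ∸ k                                   ≡⟨ cong (_∸ k) (length-members ρ) ⟩
        ∑₁ (𝟙 ∘ ρ) ∸ k                                      ∎
        where disjoint : ∀ b → 𝟙 (not b) * 𝟙 b ≡ 0
              disjoint true  = refl
              disjoint false = refl

-- A datatype instead of the bare inequality, so that unification recovers the condition and its
-- loss when eight of them are combined in `conj`.
data Holds (p : Bool) (loss : ℕ) : Set where
  or : 1 ≤ 𝟙 p + loss → Holds p loss

module _ {n : ℕ} where
  hits : ∀ {s} (f : Fin s → Fin n) → ∑₁ (λ x → ∑₁ λ i → 𝟙 (x == f i)) ≤ s
  hits {s} f = ≤-trans (≤-reflexive (∑₁-swap λ x i → 𝟙 (x == f i)))
    (≤-trans (∑₁-≤ λ i → ∑₁-== (f i)) (≤-reflexive (*-identityʳ s)))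

  not-not : ∀ {s} (f : Fin s → Fin n) x → ∑₁ (λ i → 𝟙 (not (not (x == f i)))) ≡ ∑₁ (λ i → 𝟙 (x == f i))
  not-not f x = ∑₁-cong λ i → double (x == f i)
    where double : ∀ b → 𝟙 (not (not b)) ≡ 𝟙 b
          double true  = refl
          double false = refl

𝟙-mono : ∀ {p q} → (p ≡ true → q ≡ true) → 𝟙 p ≤ 𝟙 q
𝟙-mono {true}  f = ≤-reflexive (sym (cong 𝟙 (f refl)))
𝟙-mono {false} f = z≤n

𝟙-product : ∀ {p q r o} → p ≡ true → q ≡ true → r ≡ true → o ≡ true → 1 ≤ 𝟙 p * (𝟙 q * (𝟙 r * 𝟙 o))
𝟙-product refl refl refl refl = ≤-refl

off : Fin 3 → Fin 3 → ℕ
off i j = 𝟙 (not (j == i))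

off-one : ∀ {i j} → j ≢ i → off i j ≡ 1
off-one {i} {j} p with j ≟ i
... | yes q = ⊥-elim (p q)
... | no _  = refl

off-count : ∑₂ off ≡ 6
off-count = trans (∑₁-cong λ i → +-cancelˡ-≡ 1 _ _ (trans (cong (_+ ∑₁ (off i)) (sym (trans (∑₁-cong λ j → sym (*-identityʳ (𝟙 (j == i)))) (∑₁-δ i (λ _ → 1)))))
  (trans (sym (∑₁-+ _ _)) (trans (∑₁-cong λ j → both (j == i)) (∑₁-const {3} 1))))) (∑₁-const {3} 2)
  where both : ∀ b → 𝟙 b + 𝟙 (not b) ≡ 1
        both true  = refl
        both false = refl

-- Noncrossing edges as K_{t,s,s}-free graphs

module Assembly (m t s : ℕ) (1≤t : 1 ≤ t) (1≤s : 1 ≤ s) (4≤2s : 4 ≤ 2 * s) (2s≤m : 2 * s ≤ m)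
  (n : ℕ) (H : Graph3 n) (free : ¬ Contains (F5S m t s) H)
  (κ : Fin n → Fin 3) (optimal : LocalOptimum.Optimal H κ)
  (k L : ℕ) (1≤k : 1 ≤ k) (L≡ : 16 * ((27 * k) * (27 * k)) ≡ L)
  (n≥ : boxSize (m + s + t) (4 * L) 5 ≤ n) (8L≤n : 8 * L ≤ n) (8LMis : 8 * (L * Partition.Mis H κ) ≤ n * (n * n))
  (classes : ∀ i j → n * n ≤ 16 * (Partition.class H κ i * Partition.class H κ j))
  (classes₁ : ∀ i → n ≤ 4 * Partition.class H κ i)
  (512s≤k : 512 * s ≤ k) (n≥′ : 256 * (2 * s + 3 * t) ≤ n) (n≥″ : boxSize m 256 3 ≤ n) where

  open Weights H
  open Partition H κ
  open Free m t s 1≤t 1≤s 4≤2s 2s≤m n H free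
  open Decomposition m t s 1≤t 1≤s 4≤2s 2s≤m n H free κ optimal k L 1≤k L≡ n≥ 8L≤n 8LMis classes

  ρ : Fin 3 → Fin n → Bool
  ρ i v = (κ v == i) ∧ not (deficient v)

  sufficient : ∀ i v → ρ i v ≡ true → k * mis v ≤ n * n
  sufficient i v h = <⇒≤ (n≤ᵇ-false (n * n) _ (not-true (∧-trueʳ {κ v == i} h)))

  256Mis≤n³ : 256 * Mis ≤ n * (n * n)
  256Mis≤n³ = ≤-trans (≤-trans (*-monoˡ-≤ Mis 256≤8L) (≤-reflexive (*-assoc 8 L Mis))) 8LMis
    where
    256≤8L : 256 ≤ 8 * L
    256≤8L = *-monoʳ-≤ 8 (subst (32 ≤_) L≡ (≤-trans (m≤m+n 32 (16 * 727 ∸ 32))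
      (*-monoʳ-≤ 16 (≤-trans (m≤m+n 727 2) (*-mono-≤ {27} {27 * k} (*-monoʳ-≤ 27 1≤k) (*-monoʳ-≤ 27 1≤k))))))

  -- S₀ and S₁ are sound vertices of one class while T is arbitrary, so the lemma serves the
  -- bipartite and the ordinary pieces alike. Classes of size n/4 give n³/64 crossing triples;
  -- missing triples xuv, missing triples at S₀ and S₁, and coincidences take at most n³/256 each,
  -- and the last n³/256 complete the copy.
  no-K : ∀ i (τ : Fin t → Fin n) (S₀ S₁ : Fin s → Fin n) →
    Injective _≡_ _≡_ τ → Injective _≡_ _≡_ S₀ → Injective _≡_ _≡_ S₁ →
    (∀ a → ρ i (S₀ a) ≡ true) → (∀ a → ρ i (S₁ a) ≡ true) →
    (∀ l a b → IsEdge H (τ l) (S₀ a) (S₁ b)) → ⊥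
  no-K i τ S₀ S₁ τ-inj S₀-inj S₁-inj ρS₀ ρS₁ τS₀S₁ = <⇒≱ (completions-sparse 256 n≥″) (+-cancelʳ-≤ (3 * n³) _ _ (begin
    n³ + 3 * n³
      ≤⟨ *-monoʳ-≤ 4 volume ⟩
    4 * (64 * (class i * (class j * class l)))
      ≤⟨ *-monoʳ-≤ 4 (*-monoʳ-≤ 64 counted) ⟩
    4 * (64 * (C + (Mis + n * (Mis₀ + Mis₁) + n * (n * (2 * s + 3 * t)))))
      ≡⟨ lemma n C Mis Mis₀ Mis₁ (2 * s + 3 * t) ⟩
    256 * C + (256 * Mis + n * (256 * Mis₀ + 256 * Mis₁) + n * (n * (256 * (2 * s + 3 * t))))
      ≤⟨ +-monoʳ-≤ (256 * C) (+-mono-≤ (+-mono-≤ 256Mis≤n³ (*-monoʳ-≤ n halves)) (*-monoʳ-≤ n (*-monoʳ-≤ n n≥′))) ⟩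
    256 * C + (n³ + n³ + n³)
      ≡⟨ cong (256 * C +_) (lemma₂ n³) ⟩
    256 * C + 3 * n³ ∎))
    where
    open ≤-Reasoning
    open Completion S₀ S₁ τ S₀-inj S₁-inj τ-inj τS₀S₁
    n³ = n * (n * n)
    j l : Fin 3
    j = proj₁ (other-colours i)
    l = proj₁ (proj₂ (other-colours i))
    rainbow : rainbow? i j l ≡ true
    rainbow = proj₂ (proj₂ (other-colours i))
    C Mis₀ Mis₁ : ℕ
    C = ∑₃ λ x u v → 𝟙 (completes x u v)
    Mis₀ = ∑₁ (mis ∘ S₀)
    Mis₁ = ∑₁ (mis ∘ S₁)
    lemma : ∀ n C M a b r → 4 * (64 * (C + (M + n * (a + b) + n * (n * r)))) ≡ 256 * C + (256 * M + n * (256 * a + 256 * b) + n * (n * (256 * r)))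
    lemma = solve-∀
    lemma₂ : ∀ a → a + a + a ≡ 3 * a
    lemma₂ = solve-∀
    volume : n³ ≤ 64 * (class i * (class j * class l))
    volume = ≤-trans (*-mono-≤ (classes₁ i) (classes j l)) (≤-reflexive (lemma₃ (class i) (class j * class l)))
      where lemma₃ : ∀ a b → 4 * a * (16 * b) ≡ 64 * (a * b)
            lemma₃ = solve-∀
    -- Soundness with k ≥ 512s allows each of the s vertices to miss n²/(512s) pairs, so S₀ and S₁
    -- together miss at most n²/256.
    half : ∀ (f : Fin s → Fin n) → (∀ a → ρ i (f a) ≡ true) → 512 * ∑₁ (mis ∘ f) ≤ n * n
    half f ρf = *-cancelˡ-≤ s {{>-nonZero 1≤s}} (begin
      s * (512 * ∑₁ (mis ∘ f))    ≡⟨ lemma₄ s (∑₁ (mis ∘ f)) ⟩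
      512 * s * ∑₁ (mis ∘ f)      ≤⟨ *-monoˡ-≤ _ 512s≤k ⟩
      k * ∑₁ (mis ∘ f)            ≡⟨ ∑₁-* k (mis ∘ f) ⟨
      ∑₁ (λ a → k * mis (f a))    ≤⟨ ∑₁-≤ (λ a → sufficient i (f a) (ρf a)) ⟩
      s * (n * n)                 ∎)
      where lemma₄ : ∀ s x → s * (512 * x) ≡ 512 * s * x
            lemma₄ = solve-∀
    halves : 256 * Mis₀ + 256 * Mis₁ ≤ n * n
    halves = *-cancelˡ-≤ 2 (lin≤ 0 (+-mono-≤ (half S₀ ρS₀) (half S₁ ρS₁)) (lemma₅ Mis₀ Mis₁ (n * n)))
      where lemma₅ : ∀ a b c → 2 * (256 * a + 256 * b) + (c + c) + 0 ≡ 2 * c + (512 * a + 512 * b)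
            lemma₅ = solve-∀
    equal : Fin n → ∀ {r} → (Fin r → Fin n) → ℕ
    equal x f = ∑₁ λ a → 𝟙 (x == f a)
    loss : Fin n → Fin n → Fin n → ℕ
    loss x u v = 𝟙 (missing? x u v) + (∑₁ (λ a → 𝟙 (missing? (S₀ a) u v)) + ∑₁ (λ a → 𝟙 (missing? (S₁ a) u v)))
      + ((equal x S₀ + (equal x S₁ + equal x τ)) + (equal u τ + equal v τ))
    conj : ∀ p₁ p₂ p₃ p₄ p₅ p₆ p₇ p₈ {q₂ q₃ q₄ q₅ q₆ q₇ q₈} → Holds p₂ q₂ → Holds p₃ q₃ → Holds p₄ q₄ → Holds p₅ q₅ →
      Holds p₆ q₆ → Holds p₇ q₇ → Holds p₈ q₈ →
      1 ≤ 𝟙 (p₁ ∧ p₂ ∧ p₃ ∧ p₄ ∧ p₅ ∧ p₆ ∧ p₇ ∧ p₈) + (𝟙 (not p₁) + (q₂ + q₃) + ((q₄ + (q₅ + q₆)) + (q₇ + q₈)))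
    conj false _ _ _ _ _ _ _ _ _ _ _ _ _ _ = s≤s z≤n
    conj true false _ _ _ _ _ _ {q₂} {q₃} (or h) _ _ _ _ _ _ = ≤-trans h (≤-trans (m≤m+n q₂ q₃) (m≤m+n _ _))
    conj true true false _ _ _ _ _ {q₂} {q₃} _ (or h) _ _ _ _ _ = ≤-trans h (≤-trans (m≤n+m q₃ q₂) (m≤m+n _ _))
    conj true true true false _ _ _ _ {q₂} {q₃} {q₄} _ _ (or h) _ _ _ _ = ≤-trans h (≤-trans (≤-trans (m≤m+n q₄ _) (m≤m+n _ _)) (m≤n+m _ (q₂ + q₃)))
    conj true true true true false _ _ _ {q₂} {q₃} {q₄} {q₅} _ _ _ (or h) _ _ _ = ≤-trans h (≤-trans (≤-trans (≤-trans (m≤m+n q₅ _) (m≤n+m _ q₄)) (m≤m+n _ _)) (m≤n+m _ (q₂ + q₃)))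
    conj true true true true true false _ _ {q₂} {q₃} {q₄} {q₅} {q₆} _ _ _ _ (or h) _ _ = ≤-trans h (≤-trans (≤-trans (≤-trans (m≤n+m q₆ q₅) (m≤n+m _ q₄)) (m≤m+n _ _)) (m≤n+m _ (q₂ + q₃)))
    conj true true true true true true false _ {q₂} {q₃} {q₄} {q₅} {q₆} {q₇} _ _ _ _ _ (or h) _ = ≤-trans h (≤-trans (≤-trans (m≤m+n q₇ _) (m≤n+m _ (q₄ + (q₅ + q₆)))) (m≤n+m _ (q₂ + q₃)))
    conj true true true true true true true false {q₂} {q₃} {q₄} {q₅} {q₆} {q₇} {q₈} _ _ _ _ _ _ (or h) = ≤-trans h (≤-trans (≤-trans (m≤n+m q₈ q₇) (m≤n+m _ (q₄ + (q₅ + q₆)))) (m≤n+m _ (q₂ + q₃)))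
    conj true true true true true true true true _ _ _ _ _ _ _ = s≤s z≤n
    pointwise : ∀ x u v → 𝟙 (κ x == i) * (𝟙 (κ u == j) * 𝟙 (κ v == l)) ≤ 𝟙 (completes x u v) + loss x u v
    pointwise x u v = ≤-trans (≤-reflexive (sym (trans (𝟙-∧ (κ x == i) _) (cong (𝟙 (κ x == i) *_) (𝟙-∧ (κ u == j) _)))))
      (guard ((κ x == i) ∧ (κ u == j) ∧ (κ v == l)) λ h →
        let hx = ==-true (κ x) i (∧-trueˡ h)
            hu = ==-true (κ u) j (∧-trueˡ {κ u == j} (∧-trueʳ {κ x == i} h))
            hv = ==-true (κ v) l (∧-trueʳ {κ u == j} (∧-trueʳ {κ x == i} h))
            in-class : ∀ (f : Fin s → Fin n) → (∀ a → ρ i (f a) ≡ true) →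
              Holds (allF (λ a → edge? H (f a) u v)) (∑₁ (λ a → 𝟙 (missing? (f a) u v)))
            in-class f ρf = or (subst (λ z → 1 ≤ 𝟙 (allF (λ a → edge? H (f a) u v)) + z)
              (∑₁-cong λ a → sym (missing-if (==-true (κ (f a)) i (∧-trueˡ (ρf a))) hu hv rainbow)) (allF-union _))
            avoid : ∀ y {r} (f : Fin r → Fin n) → Holds (allF (λ a → not (y == f a))) (equal y f)
            avoid y f = or (subst (λ z → 1 ≤ 𝟙 (allF (λ a → not (y == f a))) + z) (not-not f y) (allF-union _))
        in subst (λ z → 1 ≤ 𝟙 (completes x u v) + (z + (∑₁ (λ a → 𝟙 (missing? (S₀ a) u v)) + ∑₁ (λ a → 𝟙 (missing? (S₁ a) u v)))
               + ((equal x S₀ + (equal x S₁ + equal x τ)) + (equal u τ + equal v τ)))) (sym (missing-if hx hu hv rainbow))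
             (conj (edge? H x u v) _ _ _ _ _ _ _ (in-class S₀ ρS₀) (in-class S₁ ρS₁) (avoid x S₀) (avoid x S₁) (avoid x τ) (avoid u τ) (avoid v τ)))
    missed : ∀ (f : Fin s → Fin n) → ∑₃ (λ x u v → ∑₁ λ a → 𝟙 (missing? (f a) u v)) ≡ n * ∑₁ (mis ∘ f)
    missed f = trans (∑₁-const _) (cong (n *_) (∑₃-rotate′ (λ u v a → 𝟙 (missing? (f a) u v))))
      where ∑₃-rotate′ : ∀ (g : Fin n → Fin n → Fin s → ℕ) → ∑₁ (λ u → ∑₁ λ v → ∑₁ (g u v)) ≡ ∑₁ (λ a → ∑₁ λ u → ∑₁ λ v → g u v a)
            ∑₃-rotate′ g = trans (∑₁-cong λ u → ∑₁-swap (g u)) (∑₁-swap λ u a → ∑₁ λ v → g u v a)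
    hit₁ : ∀ {r} (f : Fin r → Fin n) → ∑₃ (λ x u v → equal x f) ≤ n * (n * r)
    hit₁ f = ≤-trans (≤-reflexive (trans (∑₁-cong λ x → ∑₂-const (equal x f)) (trans (∑₁-* n _) (cong (n *_) (∑₁-* n _)))))
      (*-monoʳ-≤ n (*-monoʳ-≤ n (hits f)))
    hit₂ : ∀ {r} (f : Fin r → Fin n) → ∑₃ (λ x u v → equal u f) ≤ n * (n * r)
    hit₂ f = ≤-trans (≤-reflexive (∑₃-swap₁₂ _)) (hit₁ f)
    hit₃ : ∀ {r} (f : Fin r → Fin n) → ∑₃ (λ x u v → equal v f) ≤ n * (n * r)
    hit₃ f = ≤-trans (≤-reflexive (∑₃-swap₂₃ _)) (hit₂ f)
    counted : class i * (class j * class l) ≤ C + (Mis + n * (Mis₀ + Mis₁) + n * (n * (2 * s + 3 * t)))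
    counted = begin
      class i * (class j * class l)
        ≡⟨ trans (∑₁-cong λ x → trans (∑₂-* (𝟙 (κ x == i)) _) (cong (𝟙 (κ x == i) *_) (∑₁-*∑₁ _ _))) (∑₁-*ʳ (class j * class l) _) ⟨
      ∑₃ (λ x u v → 𝟙 (κ x == i) * (𝟙 (κ u == j) * 𝟙 (κ v == l)))
        ≤⟨ ∑₃-mono pointwise ⟩
      ∑₃ (λ x u v → 𝟙 (completes x u v) + loss x u v)
        ≡⟨ trans (∑₃-+ _ _) (cong (C +_) (trans (∑₃-+ _ _) (cong₂ _+_
             (trans (∑₃-+ _ _) (cong (Mis +_) (trans (∑₃-+ _ _) (cong₂ _+_ (missed S₀) (missed S₁)))))
             (trans (∑₃-+ _ _) (cong₂ _+_ (trans (∑₃-+ _ _) (cong (∑₃ (λ x u v → equal x S₀) +_) (∑₃-+ _ _))) (∑₃-+ _ _)))))) ⟩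
      C + (Mis + (n * Mis₀ + n * Mis₁) + ((∑₃ (λ x u v → equal x S₀) + (∑₃ (λ x u v → equal x S₁) + ∑₃ (λ x u v → equal x τ)))
        + (∑₃ (λ x u v → equal u τ) + ∑₃ (λ x u v → equal v τ))))
        ≤⟨ +-monoʳ-≤ C (+-monoʳ-≤ (Mis + (n * Mis₀ + n * Mis₁)) (+-mono-≤ (+-mono-≤ (hit₁ S₀) (+-mono-≤ (hit₁ S₁) (hit₁ τ))) (+-mono-≤ (hit₂ τ) (hit₃ τ)))) ⟩
      C + (Mis + (n * Mis₀ + n * Mis₁) + ((n * (n * s) + (n * (n * s) + n * (n * t))) + (n * (n * t) + n * (n * t))))
        ≡⟨ lemma₆ C Mis n Mis₀ Mis₁ s t ⟩
      C + (Mis + n * (Mis₀ + Mis₁) + n * (n * (2 * s + 3 * t))) ∎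
      where
      lemma₆ : ∀ C M n a b s t → C + (M + (n * a + n * b) + ((n * (n * s) + (n * (n * s) + n * (n * t))) + (n * (n * t) + n * (n * t))))
        ≡ C + (M + n * (a + b) + n * (n * (2 * s + 3 * t)))
      lemma₆ = solve-∀

  class-ρ : ∀ i → ∑₁ (𝟙 ∘ ρ i) ≤ class i
  class-ρ i = ∑₁-mono λ v → ≤-trans (≤-reflexive (𝟙-∧ (κ v == i) _)) (≤-trans (*-monoʳ-≤ (𝟙 (κ v == i)) (𝟙≤1 _)) (≤-reflexive (*-identityʳ _)))

  -- The relation given to the Kővári-Sós-Turán bound. The coordinates y and z, which become S₀ and
  -- S₁, are the ones that `no-K` requires to be sound and in one class.
  P : Fin 3 → Fin n → Fin n → Fin n → Bool
  P i x y z = edge? H x y z ∧ ρ i y ∧ ρ i z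

  module Total (h : ℕ) (h≤n : h ≤ n) (b c : ℕ)
    (b-max : ∀ (F : BipGraph h h) → ¬ ContainsBipK t s F → eBip F ≤ b)
    (c-max : ∀ (F : Graph3 h) → ¬ Contains (K t s) F → e F ≤ c)
    (E a : ℕ) (class≤ : ∀ i → class i ≤ h + a)
    (errors : ∀ i (As Bs Cs : List (Fin n)) → Unique As → Unique Bs → Unique Cs → length As ≤ a ⊎ length Bs ≤ a →
      ∑ As (λ x → ∑ Bs λ y → ∑ Cs λ z → 𝟙 (P i x y z)) ≤ E) where

    sel : ∀ i → Selection (ρ i) h
    sel i = select (ρ i) h h≤n

    module Sel (i : Fin 3) = Selection (sel i)
    open Sel

    V : Fin 3 → List (Fin n)
    V i = members (ρ i)

    V-ρ : ∀ i f → ∑ (V i) f ≡ ∑ (V i) (λ x → 𝟙 (ρ i x) * f x)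
    V-ρ i f = trans (∑-members (ρ i) f) (trans (∑₁-cong λ x → idem (ρ i x) (f x)) (sym (∑-members (ρ i) _)))
      where idem : ∀ b x → 𝟙 b * x ≡ 𝟙 b * (𝟙 b * x)
            idem true  x = sym (+-identityʳ _)
            idem false x = refl

    rest≤a : ∀ i → length (rest i) ≤ a
    rest≤a i = ≤-trans (rest-size i) (≤-trans (∸-monoˡ-≤ h (≤-trans (class-ρ i) (class≤ i))) (≤-reflexive (m+n∸m≡n h a)))

    -- The indicator is there because a class with fewer than h sound vertices has been padded.
    core : Fin 3 → (Fin n → ℕ) → ℕ
    core i f = ∑₁ λ x → 𝟙 (ρ i (φ i x)) * f (φ i x)

    core-+ : ∀ i f g → core i (λ x → f x + g x) ≡ core i f + core i g
    core-+ i f g = trans (∑₁-cong λ x → *-distribˡ-+ (𝟙 (ρ i (φ i x))) _ _) (∑₁-+ _ _)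

    core≤V : ∀ i f → core i f ≤ ∑ (V i) f
    core≤V i f = ≤-trans (m≤m+n _ _) (≤-reflexive (sym (split i f)))

    triples : Fin 3 → Fin 3 → ℕ
    triples j i = ∑ (V j) λ x → ∑ (V i) λ y → ∑ (V i) λ z → G x y z

    errors′ : ∀ i (As Bs Cs : List (Fin n)) → Unique As → Unique Bs → Unique Cs →
      (∀ f → ∑ Bs f ≡ ∑ Bs (λ x → 𝟙 (ρ i x) * f x)) → (∀ f → ∑ Cs f ≡ ∑ Cs (λ x → 𝟙 (ρ i x) * f x)) →
      length As ≤ a ⊎ length Bs ≤ a → ∑ As (λ x → ∑ Bs λ y → ∑ Cs λ z → G x y z) ≤ E
    errors′ i As Bs Cs uA uB uC ρB ρC small = ≤-trans (≤-reflexive (∑-cong As λ x → trans (ρB _) (∑-cong Bs λ y →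
      trans (cong (𝟙 (ρ i y) *_) (ρC _)) (trans (sym (∑-* Cs (𝟙 (ρ i y)) _)) (∑-cong Cs λ z →
        trans (lemma (𝟙 (ρ i y)) (𝟙 (ρ i z)) (G x y z)) (sym (trans (𝟙-∧ (edge? H x y z) _) (cong (G x y z *_) (𝟙-∧ (ρ i y) (ρ i z))))))))))
      (errors i As Bs Cs uA uB uC small)
      where lemma : ∀ p q g → p * (q * g) ≡ g * (p * q)
            lemma = solve-∀

    -- The surplus vertices are removed one coordinate at a time, and each removal leaves a sum with
    -- one short list, which is at most E. A surplus in z becomes one in y by the symmetry of edges.
    triples≤ : ∀ j i → triples j i ≤ core j (λ x → core i λ y → core i λ z → G x y z) + 3 * E
    triples≤ j i = begin
      ∑ (V j) (λ x → ∑ (V i) λ y → ∑ (V i) λ z → G x y z)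
        ≡⟨ split j _ ⟩
      core j (λ x → ∑ (V i) λ y → ∑ (V i) λ z → G x y z) + ∑ (rest j) (λ x → ∑ (V i) λ y → ∑ (V i) λ z → G x y z)
        ≤⟨ +-mono-≤ second (errors′ i (rest j) (V i) (V i) (rest-uniq j) uV uV (V-ρ i) (V-ρ i) (inj₁ (rest≤a j))) ⟩
      core j (λ x → core i λ y → ∑ (V i) λ z → G x y z) + E + E
        ≤⟨ +-monoˡ-≤ E (+-monoˡ-≤ E third) ⟩
      core j (λ x → core i λ y → core i λ z → G x y z) + E + E + E
        ≡⟨ lemma _ E ⟩
      core j (λ x → core i λ y → core i λ z → G x y z) + 3 * E ∎
      where
      open ≤-Reasoning
      uV : Unique (V i)
      uV = members-unique (ρ i)
      lemma : ∀ a e → a + e + e + e ≡ a + 3 * e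
      lemma = solve-∀
      middle : ∑ (V j) (λ x → ∑ (rest i) λ y → ∑ (V i) λ z → G x y z) ≤ E
      middle = errors′ i (V j) (rest i) (V i) (members-unique (ρ j)) (rest-uniq i) uV (rest-ρ i) (V-ρ i) (inj₂ (rest≤a i))
      second : core j (λ x → ∑ (V i) λ y → ∑ (V i) λ z → G x y z) ≤ core j (λ x → core i λ y → ∑ (V i) λ z → G x y z) + E
      second = ≤-trans (≤-reflexive (trans (∑₁-cong λ x → cong (𝟙 (ρ j (φ j x)) *_) (split i _)) (core-+ j (λ x → core i λ y → ∑ (V i) (G x y)) (λ x → ∑ (rest i) λ y → ∑ (V i) (G x y)))))
        (+-monoʳ-≤ (core j λ x → core i λ y → ∑ (V i) λ z → G x y z) (≤-trans (core≤V j _) middle))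
      third : core j (λ x → core i λ y → ∑ (V i) λ z → G x y z) ≤ core j (λ x → core i λ y → core i λ z → G x y z) + E
      third = ≤-trans (≤-reflexive (trans (∑₁-cong λ x → cong (𝟙 (ρ j (φ j x)) *_) (trans
          (∑₁-cong λ y → cong (𝟙 (ρ i (φ i y)) *_) (split i _)) (core-+ i (λ y → core i (G (φ j x) y)) (λ y → ∑ (rest i) (G (φ j x) y)))))
          (core-+ j (λ x → core i λ y → core i (G x y)) (λ x → core i λ y → ∑ (rest i) (G x y)))))
        (+-monoʳ-≤ (core j λ x → core i λ y → core i λ z → G x y z) (≤-trans (core≤V j _) (≤-trans (∑-mono (V j) λ x → core≤V i _)
          (≤-trans (≤-reflexive (∑-cong (V j) λ x → trans (∑-swap (V i) (rest i) _)
            (∑-cong (rest i) λ z → ∑-cong (V i) λ y → G-swap₂₃ x y z))) middle))))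

    core-product : ∀ j i → core j (λ x → core i λ y → core i λ z → G x y z)
      ≡ ∑₃ (λ x y z → 𝟙 (edge? H (φ j x) (φ i y) (φ i z) ∧ ρ j (φ j x) ∧ ρ i (φ i y) ∧ ρ i (φ i z)))
    core-product j i = ∑₁-cong λ x → trans (sym (∑₁-* (α x) (λ y → β y * ∑₁ λ z → β z * g x y z))) (∑₁-cong λ y → trans
      (trans (cong (α x *_) (sym (∑₁-* (β y) (λ z → β z * g x y z)))) (sym (∑₁-* (α x) (λ z → β y * (β z * g x y z))))) (∑₁-cong λ z →
        trans (lemma (α x) (β y) (β z) (g x y z))
          (sym (trans (𝟙-∧ (edge? H (φ j x) (φ i y) (φ i z)) _) (cong (g x y z *_)
            (trans (𝟙-∧ (ρ j (φ j x)) _) (cong (α x *_) (𝟙-∧ (ρ i (φ i y)) _))))))))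
      where
      α β : Fin h → ℕ
      α x = 𝟙 (ρ j (φ j x))
      β y = 𝟙 (ρ i (φ i y))
      g : Fin h → Fin h → Fin h → ℕ
      g x y z = G (φ j x) (φ i y) (φ i z)
      lemma : ∀ p q r g → p * (q * (r * g)) ≡ g * (p * (q * r))
      lemma = solve-∀

    private
      0ₜ : Fin t
      0ₜ = fromℕ< 1≤t
      0ₛ : Fin s
      0ₛ = fromℕ< 1≤s

    module _ (j i : Fin 3) where
      bip : BipGraph h h
      bip x y z = edge? H (φ j x) (φ i y) (φ i z) ∧ ρ j (φ j x) ∧ ρ i (φ i y) ∧ ρ i (φ i z)

      bip-elim : ∀ x y z → IsBipEdge bip x y z → IsEdge H (φ j x) (φ i y) (φ i z) × ρ i (φ i y) ≡ true × ρ i (φ i z) ≡ true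
      bip-elim x y z q with ∨-true (∧-trueʳ {neq (toℕ y) (toℕ z)} q)
      ... | inj₁ r = let r₁ = ∧-trueʳ {ρ j (φ j x)} (∧-trueʳ {edge? H (φ j x) (φ i y) (φ i z)} r)
                     in ∧-trueˡ r , ∧-trueˡ r₁ , ∧-trueʳ {ρ i (φ i y)} r₁
      ... | inj₂ r = let r₁ = ∧-trueʳ {ρ j (φ j x)} (∧-trueʳ {edge? H (φ j x) (φ i z) (φ i y)} r)
                     in IsEdge-swap₂₃ H (∧-trueˡ r) , ∧-trueʳ {ρ i (φ i z)} r₁ , ∧-trueˡ r₁

      bip-free : ¬ ContainsBipK t s bip
      bip-free (α , β , γ , α-inj , β-inj , γ-inj , _ , edges) = no-K i (φ j ∘ α) (φ i ∘ β) (φ i ∘ γ)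
        (α-inj ∘ φ-inj j) (β-inj ∘ φ-inj i) (γ-inj ∘ φ-inj i)
        (λ a → proj₁ (proj₂ (bip-elim (α 0ₜ) (β a) (γ 0ₛ) (edges 0ₜ a 0ₛ)))) (λ a → proj₂ (proj₂ (bip-elim (α 0ₜ) (β 0ₛ) (γ a) (edges 0ₜ 0ₛ a))))
        (λ l x y → proj₁ (bip-elim (α l) (β x) (γ y) (edges l x y)))

      core≤b : core j (λ x → core i λ y → core i λ z → G x y z) ≤ 2 * b
      core≤b = begin
        core j (λ x → core i λ y → core i λ z → G x y z)       ≡⟨ core-product j i ⟩
        ∑₃ (λ x y z → 𝟙 (bip x y z))                           ≤⟨ ∑₃-mono (λ x y z → 𝟙-mono λ q →
          ∧-true (neq-intro {toℕ y} {toℕ z} (proj₁ (proj₂ (edge?-distinct H {φ j x} {φ i y} {φ i z} (∧-trueˡ q))) ∘ cong (φ i) ∘ toℕ-injective)) (∨-introˡ q)) ⟩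
        ∑₃ (λ x y z → 𝟙 (bipEdge? bip x y z))                  ≡⟨ ordered-count-bip bip ⟩
        2 * eBip bip                                           ≤⟨ *-monoʳ-≤ 2 (b-max bip bip-free) ⟩
        2 * b                                                  ∎
        where open ≤-Reasoning

    module _ (i : Fin 3) where
      mono : Graph3 h
      mono x y z = edge? H (φ i x) (φ i y) (φ i z) ∧ ρ i (φ i x) ∧ ρ i (φ i y) ∧ ρ i (φ i z)

      MonoEdge : Fin h → Fin h → Fin h → Set
      MonoEdge x y z = IsEdge H (φ i x) (φ i y) (φ i z) × ρ i (φ i x) ≡ true × ρ i (φ i y) ≡ true × ρ i (φ i z) ≡ true

      mono-elim : ∀ x y z → IsEdge mono x y z → MonoEdge x y z
      mono-elim = edge?-elim mono MonoEdge
        (λ { (p , q , r , u) → IsEdge-swap₁₂ H p , r , q , u }) (λ { (p , q , r , u) → IsEdge-swap₂₃ H p , q , u , r })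
        (λ {x} {y} {z} q → let r = ∧-trueʳ {edge? H (φ i x) (φ i y) (φ i z)} q
                               r₁ = ∧-trueʳ {ρ i (φ i x)} r
                           in ∧-trueˡ q , ∧-trueˡ r , ∧-trueˡ r₁ , ∧-trueʳ {ρ i (φ i y)} r₁)

      mono-free : ¬ Contains (K t s) mono
      mono-free (ψ , ψ-inj , edges) = no-K i (φ i ∘ ψ ∘ K-τ) (φ i ∘ ψ ∘ K-β) (φ i ∘ ψ ∘ K-γ)
        (K-τ-inj ∘ ψ-inj ∘ φ-inj i) (K-β-inj ∘ ψ-inj ∘ φ-inj i) (K-γ-inj ∘ ψ-inj ∘ φ-inj i)
        (λ a → proj₁ (proj₂ (proj₂ (edge 0ₜ a 0ₛ)))) (λ a → proj₂ (proj₂ (proj₂ (edge 0ₜ 0ₛ a)))) (λ l x y → proj₁ (edge l x y))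
        where
        open KParts t s
        edge : ∀ l x y → MonoEdge (ψ (K-τ l)) (ψ (K-β x)) (ψ (K-γ y))
        edge l x y = mono-elim (ψ (K-τ l)) (ψ (K-β x)) (ψ (K-γ y)) (edges (K-τ l) (K-β x) (K-γ y) (K-edge l x y))

      core≤c : core i (λ x → core i λ y → core i λ z → G x y z) ≤ 6 * c
      core≤c = begin
        core i (λ x → core i λ y → core i λ z → G x y z)       ≡⟨ core-product i i ⟩
        ∑₃ (λ x y z → 𝟙 (mono x y z))                          ≤⟨ ∑₃-mono (λ x y z → 𝟙-mono λ q →
          let d₁ , d₂ , d₃ = edge?-distinct H {φ i x} {φ i y} {φ i z} (∧-trueˡ q)
          in edge?-intro mono {x} {y} {z} (d₁ ∘ cong (φ i)) (d₂ ∘ cong (φ i)) (d₃ ∘ cong (φ i)) q) ⟩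
        ∑₃ (λ x y z → 𝟙 (edge? mono x y z))                    ≡⟨ ordered-count mono ⟩
        6 * e mono                                             ≤⟨ *-monoʳ-≤ 6 (c-max mono mono-free) ⟩
        6 * c                                                  ∎
        where open ≤-Reasoning

    τ₃ : Fin 3 → Fin 3 → Fin n → Fin n → Fin n → ℕ
    τ₃ j i x y z = 𝟙 (ρ j x) * (𝟙 (ρ i y) * (𝟙 (ρ i z) * G x y z))

    triples-∑₃ : ∀ j i → ∑₃ (τ₃ j i) ≡ triples j i
    triples-∑₃ j i = sym (trans (∑-members (ρ j) _) (∑₁-cong λ x → trans (cong (𝟙 (ρ j x) *_)
      (trans (∑-members (ρ i) _) (∑₁-cong λ y → trans (cong (𝟙 (ρ i y) *_) (∑-members (ρ i) (G x y)))
        (sym (∑₁-* (𝟙 (ρ i y)) (λ z → 𝟙 (ρ i z) * G x y z))))))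
      (sym (∑₂-* (𝟙 (ρ j x)) (λ y z → 𝟙 (ρ i y) * (𝟙 (ρ i z) * G x y z))))))

    -- A bad triple of sound vertices lies in one class, or exactly two of its vertices share a
    -- class and the odd one stands in one of three positions.
    pattern-bound : ∀ x y z → 𝟙 (bad? x y z ∧ sound? x y z) ≤ ∑₁ (λ i → τ₃ i i x y z)
      + (∑₂ (λ i j → off i j * τ₃ j i x y z) + ∑₂ (λ i j → off i j * τ₃ j i y x z) + ∑₂ (λ i j → off i j * τ₃ j i z x y))
    pattern-bound x y z = guard (bad? x y z ∧ sound? x y z) λ q →
      let xyz = ∧-trueˡ {edge? H x y z} (∧-trueˡ {bad? x y z} q)
          nonrainbow = not-true (∧-trueʳ {edge? H x y z} (∧-trueˡ {bad? x y z} q))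
          snd = ∧-trueʳ {bad? x y z} q
          sx = ∧-trueˡ snd
          sy = ∧-trueˡ (∧-trueʳ {not (deficient x)} snd)
          sz = ∧-trueʳ {not (deficient y)} (∧-trueʳ {not (deficient x)} snd)
      in cases (κ y ≟ κ z) (κ x ≟ κ y) (κ x ≟ κ z) xyz nonrainbow sx sy sz
      where
      A = ∑₁ (λ i → τ₃ i i x y z)
      B₁ = ∑₂ (λ i j → off i j * τ₃ j i x y z)
      B₂ = ∑₂ (λ i j → off i j * τ₃ j i y x z)
      B₃ = ∑₂ (λ i j → off i j * τ₃ j i z x y)
      in-ρ : ∀ v {i} → κ v ≡ i → not (deficient v) ≡ true → ρ i v ≡ true
      in-ρ v refl h′ = ∧-true (==-refl (κ v)) h′
      one : ∀ j i u v w → ρ j u ≡ true → ρ i v ≡ true → ρ i w ≡ true → edge? H u v w ≡ true → 1 ≤ τ₃ j i u v w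
      one j i u v w = 𝟙-product
      split-pair : ∀ u v w → κ v ≡ κ w → κ u ≢ κ v → not (deficient u) ≡ true → not (deficient v) ≡ true → not (deficient w) ≡ true →
        edge? H u v w ≡ true → 1 ≤ ∑₂ (λ i j → off i j * τ₃ j i u v w)
      split-pair u v w vw uv du dv dw uvw = ≤-trans
        (≤-trans (one (κ u) (κ v) u v w (in-ρ u refl du) (in-ρ v refl dv) (in-ρ w (sym vw) dw) uvw)
          (≤-reflexive (sym (trans (cong (_* τ₃ (κ u) (κ v) u v w) (off-one uv)) (+-identityʳ _)))))
        (≤-trans (∑₁-≥ (λ j → off (κ v) j * τ₃ j (κ v) u v w) (κ u)) (∑₁-≥ (λ i → ∑₁ λ j → off i j * τ₃ j i u v w) (κ v)))
      cases : Dec (κ y ≡ κ z) → Dec (κ x ≡ κ y) → Dec (κ x ≡ κ z) →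
        edge? H x y z ≡ true → rainbow? (κ x) (κ y) (κ z) ≡ false → not (deficient x) ≡ true → not (deficient y) ≡ true →
        not (deficient z) ≡ true → 1 ≤ A + (B₁ + B₂ + B₃)
      cases (yes yz) (yes xy) _ xyz nr sx sy sz =
        ≤-trans (one (κ x) (κ x) x y z (in-ρ x refl sx) (in-ρ y (sym xy) sy) (in-ρ z (sym (trans xy yz)) sz) xyz)
          (≤-trans (∑₁-≥ (λ i → τ₃ i i x y z) (κ x)) (m≤m+n A _))
      cases (yes yz) (no xy) _ xyz nr sx sy sz =
        ≤-trans (split-pair x y z yz xy sx sy sz xyz) (≤-trans (≤-trans (m≤m+n B₁ B₂) (m≤m+n _ B₃)) (m≤n+m _ A))
      cases (no yz) _ (yes xz) xyz nr sx sy sz =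
        ≤-trans (split-pair y x z xz (λ yx → yz (trans yx xz)) sy sx sz (IsEdge-swap₁₂ H xyz))
          (≤-trans (≤-trans (m≤n+m B₂ B₁) (m≤m+n _ B₃)) (m≤n+m _ A))
      cases (no yz) (yes xy) (no xz) xyz nr sx sy sz =
        ≤-trans (split-pair z x y xy (xz ∘ sym) sz sx sy (IsEdge-swap₁₂ H (IsEdge-swap₂₃ H xyz)))
          (≤-trans (m≤n+m B₃ (B₁ + B₂)) (m≤n+m _ A))
      cases (no yz) (no xy) (no xz) xyz nr sx sy sz =
        case trans (sym nr) (distinct3-intro (xy ∘ toℕ-injective) (yz ∘ toℕ-injective) (xz ∘ toℕ-injective)) of λ ()

    -- 18 = 3 · 6: classes and orders. 36 = 6 · 3 · 2: ordered pairs of classes, positions of the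
    -- odd vertex, and orders of the other two. 63 = 21 · 3: three removals of surplus in each of
    -- the 3 + 18 sums.
    Bad₀≤ : Bad₀ ≤ 18 * c + 36 * b + 63 * E
    Bad₀≤ = begin
      Bad₀
        ≤⟨ ∑₃-mono pattern-bound ⟩
      ∑₃ (λ x y z → ∑₁ (λ i → τ₃ i i x y z)
        + (∑₂ (λ i j → off i j * τ₃ j i x y z) + ∑₂ (λ i j → off i j * τ₃ j i y x z) + ∑₂ (λ i j → off i j * τ₃ j i z x y)))
        ≡⟨ trans (∑₃-+ _ _) (cong₂ _+_ monochromatic (trans (∑₃-+ _ _) (cong₂ _+_ (trans (∑₃-+ _ _) (cong₂ _+_ two (trans (∑₃-swap₁₂ _) two)))
             (trans (∑₃-rotate _) two)))) ⟩
      ∑₁ (λ i → triples i i) + (Two + Two + Two)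
        ≤⟨ +-mono-≤ (≤-trans (∑₁-mono λ i → ≤-trans (triples≤ i i) (+-monoˡ-≤ (3 * E) (core≤c i))) (≤-reflexive (∑₁-const {3} _)))
             (+-mono-≤ (+-mono-≤ Two≤ Two≤) Two≤) ⟩
      3 * (6 * c + 3 * E) + (6 * (2 * b + 3 * E) + 6 * (2 * b + 3 * E) + 6 * (2 * b + 3 * E))
        ≡⟨ lemma b c E ⟩
      18 * c + 36 * b + 63 * E ∎
      where
      open ≤-Reasoning
      lemma : ∀ b c E → 3 * (6 * c + 3 * E) + (6 * (2 * b + 3 * E) + 6 * (2 * b + 3 * E) + 6 * (2 * b + 3 * E)) ≡ 18 * c + 36 * b + 63 * E
      lemma = solve-∀
      Two : ℕ
      Two = ∑₂ λ i j → off i j * triples j i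
      ∑₃-∑₁ : ∀ {r} (g : Fin n → Fin n → Fin n → Fin r → ℕ) → ∑₃ (λ x y z → ∑₁ (g x y z)) ≡ ∑₁ (λ i → ∑₃ λ x y z → g x y z i)
      ∑₃-∑₁ g = trans (∑₂-cong λ x y → ∑₁-swap (g x y)) (trans (∑₁-cong λ x → ∑₁-swap λ y i → ∑₁ λ z → g x y z i) (∑₁-swap λ x i → ∑₂ λ y z → g x y z i))
      monochromatic : ∑₃ (λ x y z → ∑₁ λ i → τ₃ i i x y z) ≡ ∑₁ (λ i → triples i i)
      monochromatic = trans (∑₃-∑₁ λ x y z i → τ₃ i i x y z) (∑₁-cong λ i → triples-∑₃ i i)
      two : ∑₃ (λ x y z → ∑₂ λ i j → off i j * τ₃ j i x y z) ≡ Two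
      two = trans (∑₃-∑₁ λ x y z i → ∑₁ λ j → off i j * τ₃ j i x y z) (∑₁-cong λ i → trans (∑₃-∑₁ λ x y z j → off i j * τ₃ j i x y z)
        (∑₁-cong λ j → trans (∑₃-* (off i j) (τ₃ j i)) (cong (off i j *_) (triples-∑₃ j i))))
      Two≤ : Two ≤ 6 * (2 * b + 3 * E)
      Two≤ = ≤-trans (∑₂-mono λ i j → *-monoʳ-≤ (off i j) (≤-trans (triples≤ j i) (+-monoˡ-≤ (3 * E) (core≤b j i))))
        (≤-reflexive (trans (∑₂-*ʳ (2 * b + 3 * E) off) (cong (_* (2 * b + 3 * E)) off-count)))

    total : 6 * e H ≤ 6 * e (T3 n) + (18 * c + 36 * b + 63 * E) + 81 * N * (n * n)
    total = begin
      6 * e H                                        ≡⟨ ordered-count H ⟨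
      S                                              ≤⟨ edges≤ ⟩
      Rain + Bad₀ + 81 * N * (n * n)                 ≤⟨ +-monoˡ-≤ _ (+-mono-≤ (≤-trans (≤-reflexive (rainbow-count κ)) (*-monoʳ-≤ 6 Turán)) Bad₀≤) ⟩
      6 * e (T3 n) + (18 * c + 36 * b + 63 * E) + 81 * N * (n * n) ∎
      where
      open ≤-Reasoning
      Turán : classSize κ fzero * (classSize κ (fsuc fzero) * classSize κ (fsuc (fsuc fzero))) ≤ e (T3 n)
      Turán = ≤-trans (balanced-maximal (balanced n) (classSize κ fzero) (classSize κ (fsuc fzero)) (classSize κ (fsuc (fsuc fzero))) (classSizes-sum κ)) (≤-reflexive (sym (e-T3 n)))

-- The lower bound

∑₁-injection : ∀ {h n} (φ : Fin h → Fin n) → Injective _≡_ _≡_ φ → ∀ f → ∑₁ (f ∘ φ) ≤ ∑₁ f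
∑₁-injection {h} {n} φ φ-inj f = begin
  ∑₁ (λ a → f (φ a))                              ≡⟨ ∑₁-cong (λ a → ∑₁-δ (φ a) f) ⟨
  ∑₁ (λ a → ∑₁ λ v → 𝟙 (v == φ a) * f v)          ≡⟨ ∑₁-swap (λ a v → 𝟙 (v == φ a) * f v) ⟩
  ∑₁ (λ v → ∑₁ λ a → 𝟙 (v == φ a) * f v)          ≤⟨ ∑₁-mono (λ v → ≤-trans (≤-reflexive (∑₁-*ʳ (f v) _))
                                                       (≤-trans (*-monoˡ-≤ (f v) (fibre v)) (≤-reflexive (+-identityʳ (f v))))) ⟩
  ∑₁ f                                            ∎
  where
  open ≤-Reasoning
  fibre : ∀ v → ∑₁ (λ a → 𝟙 (v == φ a)) ≤ 1
  fibre v with any? (λ a → v ≟ φ a)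
  ... | yes (a₀ , eq) = ≤-trans (∑₁-mono λ a → guard (v == φ a) λ p →
          ≤-reflexive (sym (cong 𝟙 (trans (cong (_== a₀) (φ-inj (trans (sym (==-true v (φ a) p)) eq))) (==-refl a₀))))) (∑₁-== a₀)
  ... | no none = ≤-trans (∑₁-mono λ a → guard (v == φ a) λ p → ⊥-elim (none (a , ==-true v (φ a) p)))
          (≤-trans (≤-reflexive (∑₁-const 0)) (≤-trans (≤-reflexive (*-zeroʳ h)) z≤n))

module _ (m t : ℕ) where
  code< : ∀ (p : Place m t) → code p < 3 * m + t
  code< (old r i) = ≤-trans (code-old< r i) (m≤m+n (3 * m) t)
  code< (new l)   = +-monoʳ-< (3 * m) (toℕ<n l)

  vertex : Place m t → Fin (3 * m + t)
  vertex p = fromℕ< (code< p)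

  toℕ-vertex : ∀ p → toℕ (vertex p) ≡ code p
  toℕ-vertex p = toℕ-fromℕ< (code< p)

  code-injective : ∀ (p q : Place m t) → code p ≡ code q → p ≡ q
  code-injective (old r i) (old r′ i′) eq = cong₂ old
    (toℕ-injective (trans (sym (code-% r (toℕ i))) (trans (cong (_% 3) eq) (code-% r′ (toℕ i′)))))
    (toℕ-injective (trans (sym (code-/ r (toℕ i))) (trans (cong (_/ 3) eq) (code-/ r′ (toℕ i′)))))
  code-injective (old r i) (new l)     eq = ⊥-elim (<⇒≱ (code-old< r i) (subst (3 * m ≤_) (sym eq) (m≤m+n (3 * m) _)))
  code-injective (new l)   (old r i)   eq = ⊥-elim (<⇒≱ (code-old< r i) (subst (3 * m ≤_) eq (m≤m+n (3 * m) _)))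
  code-injective (new l)   (new l′)    eq = cong new (toℕ-injective (+-cancelˡ-≡ (3 * m) _ _ eq))

  vertex-injective : ∀ p q → vertex p ≡ vertex q → p ≡ q
  vertex-injective p q eq = code-injective p q (trans (sym (toℕ-vertex p)) (trans (cong toℕ eq) (toℕ-vertex q)))

  inOld-old : ∀ r i → inOld m (code (old {m} {t} r i)) ≡ true
  inOld-old r i = <⇒<ᵇ-true (code-old< r i)

  module _ (s : ℕ) where
    adjacent : ℕ → ℕ → ℕ → Bool
    adjacent a b c = (inOld m a ∧ inOld m b ∧ inOld m c ∧ distinct3 (a % 3) (b % 3) (c % 3))
      ∨ (inT m a ∧ inS0 m s b ∧ inS1 m s c)

    F₅-edge : ∀ p q r → p ≢ q → q ≢ r → p ≢ r → adjacent (code p) (code q) (code r) ≡ true →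
      IsEdge (F5S m t s) (vertex p) (vertex q) (vertex r)
    F₅-edge p q r pq qr pr h = edge?-intro (F5S m t s) (pq ∘ vertex-injective p q) (qr ∘ vertex-injective q r) (pr ∘ vertex-injective p r)
      (trans (cong₃ adjacent (toℕ-vertex p) (toℕ-vertex q) (toℕ-vertex r)) h)

    rainbow-edge : ∀ i j k → IsEdge (F5S m t s) (vertex (old fzero i)) (vertex (old (fsuc fzero) j)) (vertex (old (fsuc (fsuc fzero)) k))
    rainbow-edge i j k = F₅-edge (old fzero i) (old (fsuc fzero) j) (old (fsuc (fsuc fzero)) k) (λ ()) (λ ()) (λ ())
      (∨-introˡ (∧-true (inOld-old fzero i) (∧-true (inOld-old (fsuc fzero) j) (∧-true (inOld-old (fsuc (fsuc fzero)) k)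
        (cong₃ distinct3 (code-% fzero (toℕ i)) (code-% (fsuc fzero) (toℕ j)) (code-% (fsuc (fsuc fzero)) (toℕ k)))))))

    τ-edge : ∀ l i j → toℕ i < s → s ≤ toℕ j → toℕ j < 2 * s →
      IsEdge (F5S m t s) (vertex (new l)) (vertex (old fzero i)) (vertex (old fzero j))
    τ-edge l i j i<s s≤j j<2s = F₅-edge (new l) (old fzero i) (old fzero j) (λ ()) (λ { refl → <⇒≱ i<s s≤j }) (λ ())
      (∨-introʳ {inOld m (code (new {m} l)) ∧ inOld m (code (old {m} {t} fzero i)) ∧ inOld m (code (old {m} {t} fzero j))
          ∧ distinct3 (code (new {m} l) % 3) (code (old {m} {t} fzero i) % 3) (code (old {m} {t} fzero j) % 3)}
        (∧-true (cong not (≤⇒<ᵇ-false (m≤m+n (3 * m) (toℕ l)))) (∧-true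
          (∧-true (inOld-old fzero i) (∧-true (cong (_≡ᵇ 0) (code-% fzero (toℕ i))) (trans (cong (_<ᵇ s) (code-/ fzero (toℕ i))) (<⇒<ᵇ-true i<s))))
          (∧-true (inOld-old fzero j) (∧-true (cong (_≡ᵇ 0) (code-% fzero (toℕ j))) (∧-true
            (trans (cong (λ z → not (z <ᵇ s)) (code-/ fzero (toℕ j))) (cong not (≤⇒<ᵇ-false s≤j)))
            (trans (cong (_<ᵇ 2 * s) (code-/ fzero (toℕ j))) (<⇒<ᵇ-true j<2s))))))))

-- Otherwise four different colours would fit into `Fin 3`; their indicators sum to 4, yet to at
-- most 1 at each colour.
colour-determined : ∀ (a b c d : Fin 3) → a ≢ c → a ≢ d → b ≢ c → b ≢ d → c ≢ d → a ≡ b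
colour-determined a b c d ac ad bc bd cd with a ≟ b
... | yes p = p
... | no ab = ⊥-elim (1+n≰n (≤-trans four (≤-reflexive (trans (∑₁-const {3} 1) refl))))
  where
  four : 4 ≤ ∑₁ {3} (λ _ → 1)
  four = ≤-trans (≤-reflexive (sym (cong₂ _+_ (cong₂ _+_ (cong₂ _+_ (δ a) (δ b)) (δ c)) (δ d))))
    (≤-trans (≤-reflexive (sym (trans (∑₁-+ _ _) (cong-+ˡ (trans (∑₁-+ _ _) (cong-+ˡ (∑₁-+ _ _))))))) (∑₁-mono disjoint))
    where
    δ : ∀ i → ∑₁ {3} (λ x → 𝟙 (x == i)) ≡ 1
    δ i = trans (∑₁-cong λ x → sym (*-identityʳ _)) (∑₁-δ i (λ _ → 1))
    disjoint : ∀ x → 𝟙 (x == a) + 𝟙 (x == b) + 𝟙 (x == c) + 𝟙 (x == d) ≤ 1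
    disjoint x with x ≟ a | x ≟ b | x ≟ c | x ≟ d
    ... | yes p | yes q | _     | _     = ⊥-elim (ab (trans (sym p) q))
    ... | yes p | no _  | yes q | _     = ⊥-elim (ac (trans (sym p) q))
    ... | yes p | no _  | no _  | yes q = ⊥-elim (ad (trans (sym p) q))
    ... | yes p | no _  | no _  | no _  = ≤-refl
    ... | no _  | yes p | yes q | _     = ⊥-elim (bc (trans (sym p) q))
    ... | no _  | yes p | no _  | yes q = ⊥-elim (bd (trans (sym p) q))
    ... | no _  | yes p | no _  | no _  = ≤-refl
    ... | no _  | no _  | yes p | yes q = ⊥-elim (cd (trans (sym p) q))
    ... | no _  | no _  | yes p | no _  = ≤-refl
    ... | no _  | no _  | no _  | yes p = ≤-refl
    ... | no _  | no _  | no _  | no _  = z≤n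

-- T₃(n,3) with a copy of F placed inside each residue class.
module Construction (m t s : ℕ) (1≤t : 1 ≤ t) (1≤s : 1 ≤ s) (4≤2s : 4 ≤ 2 * s) (2s≤m : 2 * s ≤ m)
  (n : ℕ) (F : Graph3 (n / 3)) (F-free : ¬ Contains (K t s) F) where

  private
    h : ℕ
    h = n / 3

  -- As n/3 is rounded down, a class can have one vertex more than F. This vertex has no index and
  -- lies in crossing edges only.
  index : Fin n → Maybe (Fin h)
  index v with toℕ v / 3 <? h
  ... | yes p = just (fromℕ< p)
  ... | no _  = nothing

  index-just : ∀ v a → index v ≡ just a → toℕ v / 3 ≡ toℕ a
  index-just v a eq with toℕ v / 3 <? h
  index-just v .(fromℕ< p) refl | yes p = sym (toℕ-fromℕ< p)

  index-injective : ∀ {x y a} → index x ≡ just a → index y ≡ just a → residue x ≡ residue y → x ≡ y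
  index-injective {x} {y} {a} p q r = toℕ-injective (begin
    toℕ x                      ≡⟨ m≡m%n+[m/n]*n (toℕ x) 3 ⟩
    toℕ x % 3 + toℕ x / 3 * 3  ≡⟨ cong₂ (λ u v → u + v * 3) (trans (sym (toℕ-residue x)) (trans (cong toℕ r) (toℕ-residue y)))
                                    (trans (index-just x a p) (sym (index-just y a q))) ⟩
    toℕ y % 3 + toℕ y / 3 * 3  ≡⟨ m≡m%n+[m/n]*n (toℕ y) 3 ⟨
    toℕ y                      ∎)
    where open ≡-Reasoning

  lift : Maybe (Fin h) → Maybe (Fin h) → Maybe (Fin h) → Bool
  lift (just a) (just b) (just c) = edge? F a b c
  lift _        _        _        = false

  inner : Fin 3 → Fin n → Fin n → Fin n → Bool
  inner r x y z = ((residue x == r) ∧ (residue y == r) ∧ (residue z == r)) ∧ lift (index x) (index y) (index z)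

  H : Graph3 n
  H x y z = rainbow? (residue x) (residue y) (residue z) ∨ inner (residue x) x y z

  Placed : Fin 3 → Fin n → Fin h → Set
  Placed r x a = residue x ≡ r × index x ≡ just a

  Mono : Fin n → Fin n → Fin n → Set
  Mono x y z = Σ (Fin 3) λ r → Σ (Fin h) λ a → Σ (Fin h) λ b → Σ (Fin h) λ c →
    Placed r x a × Placed r y b × Placed r z c × IsEdge F a b c

  Rainbow : Fin n → Fin n → Fin n → Set
  Rainbow x y z = residue x ≢ residue y × residue y ≢ residue z × residue x ≢ residue z

  lift-elim : ∀ p q r → lift p q r ≡ true → Σ (Fin h) λ a → Σ (Fin h) λ b → Σ (Fin h) λ c → p ≡ just a × q ≡ just b × r ≡ just c × IsEdge F a b c
  lift-elim (just a) (just b) (just c) e = a , b , c , refl , refl , refl , e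

  H-edge : ∀ x y z → IsEdge H x y z → Rainbow x y z ⊎ Mono x y z
  H-edge = edge?-elim H (λ x y z → Rainbow x y z ⊎ Mono x y z)
    (λ { (inj₁ (p , q , r)) → inj₁ (p ∘ sym , r , q)
       ; (inj₂ (r , a , b , c , pa , pb , pc , e)) → inj₂ (r , b , a , c , pb , pa , pc , IsEdge-swap₁₂ F e) })
    (λ { (inj₁ (p , q , r)) → inj₁ (r , q ∘ sym , p)
       ; (inj₂ (r , a , b , c , pa , pb , pc , e)) → inj₂ (r , a , c , b , pa , pc , pb , IsEdge-swap₂₃ F e) })
    λ {x} {y} {z} e → base x y z (∨-true e)
    where
    base : ∀ x y z → rainbow? (residue x) (residue y) (residue z) ≡ true ⊎ inner (residue x) x y z ≡ true → Rainbow x y z ⊎ Mono x y z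
    base x y z (inj₁ p) = let a , b , c = distinct3-elim {toℕ (residue x)} {toℕ (residue y)} {toℕ (residue z)} p
                          in inj₁ (a ∘ cong toℕ , b ∘ cong toℕ , c ∘ cong toℕ)
    base x y z (inj₂ p) =
      let a , b , c , ea , eb , ec , e = lift-elim (index x) (index y) (index z) (∧-trueʳ {(residue x == residue x) ∧ (residue y == residue x) ∧ (residue z == residue x)} p)
          same = ∧-trueʳ {residue x == residue x} (∧-trueˡ p)
      in inj₂ (residue x , a , b , c , (refl , ea) , (==-true _ _ (∧-trueˡ same) , eb) , (==-true _ _ (∧-trueʳ {residue y == residue x} same) , ec) , e)

  H-free : ¬ Contains (F5S m t s) H
  H-free (ψ , ψ-inj , edges) = F-free (KParts.K-contained t s F (proj₁ ∘ τ-placed) (proj₁ ∘ β-placed) (proj₁ ∘ γ-placed) 1≤t 1≤s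
    (λ {k} {l} eq → new-injective (at-inj (new k) (new l) (placed-inj (new k) (new l) (τ-placed k) (τ-placed l) eq)))
    (λ {x} {y} eq → lo-inj (at-inj (old fzero (lo x)) (old fzero (lo y)) (placed-inj (old fzero (lo x)) (old fzero (lo y)) (β-placed x) (β-placed y) eq)))
    (λ {x} {y} eq → hi-inj (at-inj (old fzero (hi x)) (old fzero (hi y)) (placed-inj (old fzero (hi x)) (old fzero (hi y)) (γ-placed x) (γ-placed y) eq)))
    F-edges)
    where
    at : Place m t → Fin n
    at p = ψ (vertex m t p)
    at-inj : ∀ p q → at p ≡ at q → p ≡ q
    at-inj p q eq = vertex-injective m t p q (ψ-inj eq)
    new-injective : ∀ {k l} → new {m} {t} k ≡ new l → k ≡ l
    new-injective refl = refl
    old-injective : ∀ {i j} → old {m} {t} fzero i ≡ old fzero j → i ≡ j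
    old-injective refl = refl
    2s : s + s ≡ 2 * s
    2s = cong (s +_) (sym (+-identityʳ s))
    lo< : ∀ (x : Fin s) → toℕ x < m
    lo< x = ≤-trans (toℕ<n x) (≤-trans (m≤m+n s (s + 0)) 2s≤m)
    hi< : ∀ (x : Fin s) → s + toℕ x < m
    hi< x = ≤-trans (+-monoʳ-< s (toℕ<n x)) (≤-trans (≤-reflexive 2s) 2s≤m)
    lo hi : Fin s → Fin m
    lo x = fromℕ< (lo< x)
    hi x = fromℕ< (hi< x)
    lo-inj : ∀ {x y} → old {m} {t} fzero (lo x) ≡ old fzero (lo y) → x ≡ y
    lo-inj {x} {y} eq = toℕ-injective (trans (sym (toℕ-fromℕ< (lo< x))) (trans (cong toℕ (old-injective eq)) (toℕ-fromℕ< (lo< y))))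
    hi-inj : ∀ {x y} → old {m} {t} fzero (hi x) ≡ old fzero (hi y) → x ≡ y
    hi-inj {x} {y} eq = toℕ-injective (+-cancelˡ-≡ s _ _ (trans (sym (toℕ-fromℕ< (hi< x))) (trans (cong toℕ (old-injective eq)) (toℕ-fromℕ< (hi< y)))))
    0ₘ : Fin m
    0ₘ = fromℕ< (≤-trans (s≤s z≤n) (≤-trans 4≤2s 2s≤m))
    0ₜ : Fin t
    0ₜ = fromℕ< 1≤t
    0ₛ : Fin s
    0ₛ = fromℕ< 1≤s
    y₀ z₀ : Fin n
    y₀ = at (old (fsuc fzero) 0ₘ)
    z₀ = at (old (fsuc (fsuc fzero)) 0ₘ)
    at-edge : ∀ p q r → IsEdge (F5S m t s) (vertex m t p) (vertex m t q) (vertex m t r) → Rainbow (at p) (at q) (at r) ⊎ Mono (at p) (at q) (at r)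
    at-edge p q r pqr = H-edge (at p) (at q) (at r) (edges (vertex m t p) (vertex m t q) (vertex m t r) pqr)
    -- The fixed pair y₀, z₀ decides: if its residues differ, an edge through it must be rainbow and
    -- the third residue is forced; if they agree, the edge stays in that class.
    third-class : ∀ x x′ → Rainbow x y₀ z₀ ⊎ Mono x y₀ z₀ → Rainbow x′ y₀ z₀ ⊎ Mono x′ y₀ z₀ → residue x ≡ residue x′
    third-class x x′ (inj₁ (p , q , r)) (inj₁ (p′ , _ , r′)) = colour-determined (residue x) (residue x′) (residue y₀) (residue z₀) p r p′ r′ q
    third-class x x′ (inj₁ (p , q , r)) (inj₂ (_ , _ , _ , _ , _ , (pb , _) , (pc , _) , _)) = ⊥-elim (q (trans pb (sym pc)))
    third-class x x′ (inj₂ (_ , _ , _ , _ , _ , (pb , _) , (pc , _) , _)) (inj₁ (_ , q , _)) = ⊥-elim (q (trans pb (sym pc)))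
    third-class x x′ (inj₂ (_ , _ , _ , _ , (pa , _) , (pb , _) , _)) (inj₂ (_ , _ , _ , _ , (pa′ , _) , (pb′ , _) , _)) =
      trans pa (trans (sym pb) (trans pb′ (sym pa′)))
    same-class : ∀ i j → residue (at (old fzero i)) ≡ residue (at (old fzero j))
    same-class i j = third-class (at (old fzero i)) (at (old fzero j)) (crossing i) (crossing j)
      where crossing : ∀ i → Rainbow (at (old fzero i)) y₀ z₀ ⊎ Mono (at (old fzero i)) y₀ z₀
            crossing i = at-edge (old fzero i) (old (fsuc fzero) 0ₘ) (old (fsuc (fsuc fzero)) 0ₘ) (rainbow-edge m t s i 0ₘ 0ₘ)
    r₀ : Fin 3
    r₀ = residue (at (old fzero 0ₘ))
    mono : ∀ l x y → Mono (at (new l)) (at (old fzero (lo x))) (at (old fzero (hi y)))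
    mono l x y = not-rainbow (at-edge (new l) (old fzero (lo x)) (old fzero (hi y)) (τ-edge m t s l (lo x) (hi y)
        (subst (_< s) (sym (toℕ-fromℕ< (lo< x))) (toℕ<n x))
        (subst (s ≤_) (sym (toℕ-fromℕ< (hi< y))) (m≤m+n s _))
        (subst₂ _<_ (sym (toℕ-fromℕ< (hi< y))) 2s (+-monoʳ-< s (toℕ<n y)))))
      where not-rainbow : ∀ {u} → Rainbow u (at (old fzero (lo x))) (at (old fzero (hi y))) ⊎ Mono u (at (old fzero (lo x))) (at (old fzero (hi y)))
                        → Mono u (at (old fzero (lo x))) (at (old fzero (hi y)))
            not-rainbow (inj₁ (_ , q , _)) = ⊥-elim (q (same-class (lo x) (hi y)))
            not-rainbow (inj₂ p) = p
    PlacedAt : Place m t → Set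
    PlacedAt p = Σ (Fin h) λ a → Placed r₀ (at p) a
    τ-placed : ∀ l → PlacedAt (new l)
    τ-placed l = let r , a , b , c , (ra , ia) , (rb , ib) , _ = mono l 0ₛ 0ₛ in a , trans ra (trans (sym rb) (same-class (lo 0ₛ) 0ₘ)) , ia
    β-placed : ∀ x → PlacedAt (old fzero (lo x))
    β-placed x = let r , a , b , c , _ , (rb , ib) , _ = mono 0ₜ x 0ₛ in b , same-class (lo x) 0ₘ , ib
    γ-placed : ∀ x → PlacedAt (old fzero (hi x))
    γ-placed x = let r , a , b , c , _ , _ , (rc , ic) , _ = mono 0ₜ 0ₛ x in c , same-class (hi x) 0ₘ , ic
    placed-inj : ∀ p q (u : PlacedAt p) (v : PlacedAt q) → proj₁ u ≡ proj₁ v → at p ≡ at q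
    placed-inj p q (a , ra , ia) (b , rb , ib) refl = index-injective ia ib (trans ra (sym rb))
    just-injective : ∀ {a b : Fin h} → just a ≡ just b → a ≡ b
    just-injective refl = refl
    F-edges : ∀ l x y → IsEdge F (proj₁ (τ-placed l)) (proj₁ (β-placed x)) (proj₁ (γ-placed y))
    F-edges l x y =
      let r , a , b , c , (_ , ia) , (_ , ib) , (_ , ic) , e = mono l x y
      in subst (λ z → IsEdge F z (proj₁ (β-placed x)) (proj₁ (γ-placed y))) (just-injective (trans (sym ia) (proj₂ (proj₂ (τ-placed l)))))
           (subst (λ z → IsEdge F a z (proj₁ (γ-placed y))) (just-injective (trans (sym ib) (proj₂ (proj₂ (β-placed x)))))
             (subst (λ z → IsEdge F a b z) (just-injective (trans (sym ic) (proj₂ (proj₂ (γ-placed y))))) e))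

  slot< : ∀ (r : Fin 3) (a : Fin h) → toℕ r + toℕ a * 3 < n
  slot< r a = begin-strict
    toℕ r + toℕ a * 3   <⟨ code-old< r a ⟩
    3 * h               ≡⟨ *-comm 3 h ⟩
    h * 3               ≤⟨ m/n*n≤m n 3 ⟩
    n                   ∎
    where open ≤-Reasoning

  slot : Fin 3 → Fin h → Fin n
  slot r a = fromℕ< (slot< r a)

  residue-slot : ∀ r a → residue (slot r a) ≡ r
  residue-slot r a = toℕ-injective (trans (toℕ-residue (slot r a)) (trans (cong (_% 3) (toℕ-fromℕ< (slot< r a))) (code-% r (toℕ a))))

  slot-/ : ∀ r a → toℕ (slot r a) / 3 ≡ toℕ a
  slot-/ r a = trans (cong (_/ 3) (toℕ-fromℕ< (slot< r a))) (code-/ r (toℕ a))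

  index-slot : ∀ r a → index (slot r a) ≡ just a
  index-slot r a with toℕ (slot r a) / 3 <? h
  ... | yes p = cong just (toℕ-injective (trans (toℕ-fromℕ< p) (slot-/ r a)))
  ... | no ¬p = ⊥-elim (¬p (subst (_< h) (sym (slot-/ r a)) (toℕ<n a)))

  slot-injective : ∀ r → Injective _≡_ _≡_ (slot r)
  slot-injective r {a} {b} eq = toℕ-injective (trans (sym (slot-/ r a)) (trans (cong (λ v → toℕ v / 3) eq) (slot-/ r b)))

  inner-count : ∀ r → 6 * e F ≤ ∑₃ (λ x y z → 𝟙 (inner r x y z))
  inner-count r = begin
    6 * e F                                                            ≡⟨ ordered-count F ⟨
    ∑₃ (λ a b c → 𝟙 (edge? F a b c))                                   ≡⟨ ∑₃-cong at-slots ⟨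
    ∑₃ (λ a b c → 𝟙 (inner r (slot r a) (slot r b) (slot r c)))
      ≤⟨ ∑₂-mono (λ a b → ∑₁-injection (slot r) (slot-injective r) (λ z → 𝟙 (inner r (slot r a) (slot r b) z))) ⟩
    ∑₁ (λ a → ∑₁ λ b → ∑₁ λ z → 𝟙 (inner r (slot r a) (slot r b) z))
      ≤⟨ ∑₁-mono (λ a → ∑₁-injection (slot r) (slot-injective r) (λ y → ∑₁ λ z → 𝟙 (inner r (slot r a) y z))) ⟩
    ∑₁ (λ a → ∑₁ λ y → ∑₁ λ z → 𝟙 (inner r (slot r a) y z))
      ≤⟨ ∑₁-injection (slot r) (slot-injective r) (λ x → ∑₁ λ y → ∑₁ λ z → 𝟙 (inner r x y z)) ⟩
    ∑₃ (λ x y z → 𝟙 (inner r x y z)) ∎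
    where
    open ≤-Reasoning
    at-slots : ∀ a b c → 𝟙 (inner r (slot r a) (slot r b) (slot r c)) ≡ 𝟙 (edge? F a b c)
    at-slots a b c = all-true (in-class a) (in-class b) (in-class c) (lift-cong (index-slot r a) (index-slot r b) (index-slot r c))
      where
      in-class : ∀ a → (residue (slot r a) == r) ≡ true
      in-class a = trans (cong (_== r) (residue-slot r a)) (==-refl r)
      lift-cong : ∀ {p q u a b c} → p ≡ just a → q ≡ just b → u ≡ just c → lift p q u ≡ edge? F a b c
      lift-cong refl refl refl = refl
      all-true : ∀ {p q u l l′} → p ≡ true → q ≡ true → u ≡ true → l ≡ l′ → 𝟙 ((p ∧ q ∧ u) ∧ l) ≡ 𝟙 l′
      all-true refl refl refl refl = refl

  -- A triple is not both rainbow and inside a class, and of the three inner terms only the one for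
  -- the residue of x can be nonzero.
  pointwise : ∀ x y z → 𝟙 (rainbow? (residue x) (residue y) (residue z)) + ∑₁ (λ r → 𝟙 (inner r x y z)) ≤ 𝟙 (edge? H x y z)
  pointwise x y z = begin
    𝟙 rb + ∑₁ (λ r → 𝟙 (inner r x y z))
      ≡⟨ cong (𝟙 rb +_) (∑₁-cong λ r → trans (trans (𝟙-∧ _ ℓ) (cong (_* 𝟙 ℓ) (𝟙-∧ (residue x == r) _))) (*-assoc (𝟙 (residue x == r)) _ (𝟙 ℓ))) ⟩
    𝟙 rb + ∑₁ (λ r → 𝟙 (residue x == r) * (𝟙 ((residue y == r) ∧ (residue z == r)) * 𝟙 ℓ))
      ≡⟨ cong (𝟙 rb +_) (∑₁-pick (residue x) (λ r → 𝟙 ((residue y == r) ∧ (residue z == r)) * 𝟙 ℓ)) ⟩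
    𝟙 rb + 𝟙 ((residue y == residue x) ∧ (residue z == residue x)) * 𝟙 ℓ
      ≡⟨ cong (𝟙 rb +_) (𝟙-∧ _ ℓ) ⟨
    𝟙 rb + 𝟙 in?
      ≤⟨ disjoint rb in? (λ p q → proj₁ (distinct3-elim {toℕ (residue x)} {toℕ (residue y)} {toℕ (residue z)} p)
           (cong toℕ (sym (==-true _ _ (∧-trueˡ (∧-trueˡ q)))))) ⟩
    𝟙 (rb ∨ in?)
      ≤⟨ guard (rb ∨ in?) (λ p → ≤-reflexive (sym (cong 𝟙 (is-edge p)))) ⟩
    𝟙 (edge? H x y z) ∎
    where
    open ≤-Reasoning
    rb ℓ in? : Bool
    rb = rainbow? (residue x) (residue y) (residue z)
    ℓ = lift (index x) (index y) (index z)
    in? = ((residue y == residue x) ∧ (residue z == residue x)) ∧ ℓ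
    disjoint : ∀ p q → (p ≡ true → q ≡ true → ⊥) → 𝟙 p + 𝟙 q ≤ 𝟙 (p ∨ q)
    disjoint true  true  f = ⊥-elim (f refl refl)
    disjoint true  false f = ≤-refl
    disjoint false q     f = ≤-refl
    H-true : ∀ p → rb ∨ p ≡ true → p ≡ in? → H x y z ≡ true
    H-true p q refl with ∨-true {rb} q
    ... | inj₁ r = ∨-introˡ r
    ... | inj₂ r = ∨-introʳ {rb} (∧-true (∧-true (==-refl (residue x)) (∧-trueˡ {(residue y == residue x) ∧ (residue z == residue x)} r)) (∧-trueʳ {(residue y == residue x) ∧ (residue z == residue x)} r))
    is-edge : rb ∨ in? ≡ true → edge? H x y z ≡ true
    is-edge p with ∨-true {rb} p
    ... | inj₁ q = let a , b , c = distinct3-elim {toℕ (residue x)} {toℕ (residue y)} {toℕ (residue z)} q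
                   in edge?-intro H {x} {y} {z} (a ∘ cong (toℕ ∘ residue)) (b ∘ cong (toℕ ∘ residue)) (c ∘ cong (toℕ ∘ residue)) (H-true in? p refl)
    ... | inj₂ q =
      let a , b , c , ia , ib , ic , f = lift-elim (index x) (index y) (index z) (∧-trueʳ {(residue y == residue x) ∧ (residue z == residue x)} q)
          d₁ , d₂ , d₃ = edge?-distinct F f
          differ : ∀ {u v p q} → index u ≡ just p → index v ≡ just q → p ≢ q → u ≢ v
          differ = λ { eu ev p≢q refl → p≢q (just-injective (trans (sym eu) ev)) }
      in edge?-intro H {x} {y} {z} (differ ia ib d₁) (differ ib ic d₂) (differ ia ic d₃) (H-true in? p refl)
      where
      just-injective : ∀ {a b : Fin h} → just a ≡ just b → a ≡ b
      just-injective refl = refl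

  lower : e (T3 n) + 3 * e F ≤ e H
  lower = *-cancelˡ-≤ 6 (begin
    6 * (e (T3 n) + 3 * e F)
      ≡⟨ lemma (e (T3 n)) (e F) ⟩
    6 * e (T3 n) + 3 * (6 * e F)
      ≡⟨ cong₂ _+_ (trans (sym (ordered-count (T3 n))) (∑₃-cong λ x y z → cong 𝟙 (T3-edge x y z))) (sym (∑₁-const {3} (6 * e F))) ⟩
    ∑₃ (λ x y z → 𝟙 (rainbow? (residue x) (residue y) (residue z))) + ∑₁ {3} (λ r → 6 * e F)
      ≤⟨ +-monoʳ-≤ (∑₃ λ x y z → 𝟙 (rainbow? (residue {n} x) (residue y) (residue z))) (∑₁-mono inner-count) ⟩
    ∑₃ (λ x y z → 𝟙 (rainbow? (residue x) (residue y) (residue z))) + ∑₁ (λ r → ∑₃ λ x y z → 𝟙 (inner r x y z))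
      ≡⟨ cong (∑₃ (λ x y z → 𝟙 (rainbow? (residue {n} x) (residue y) (residue z))) +_) exchange ⟩
    ∑₃ (λ x y z → 𝟙 (rainbow? (residue x) (residue y) (residue z))) + ∑₃ (λ x y z → ∑₁ λ r → 𝟙 (inner r x y z))
      ≡⟨ ∑₃-+ _ _ ⟨
    ∑₃ (λ x y z → 𝟙 (rainbow? (residue x) (residue y) (residue z)) + ∑₁ λ r → 𝟙 (inner r x y z))
      ≤⟨ ∑₃-mono pointwise ⟩
    ∑₃ (λ x y z → 𝟙 (edge? H x y z))
      ≡⟨ ordered-count H ⟩
    6 * e H ∎)
    where
    open ≤-Reasoning
    lemma : ∀ a b → 6 * (a + 3 * b) ≡ 6 * a + 3 * (6 * b)
    lemma = solve-∀
    exchange : ∑₁ (λ r → ∑₃ λ x y z → 𝟙 (inner r x y z)) ≡ ∑₃ (λ x y z → ∑₁ λ r → 𝟙 (inner r x y z))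
    exchange = trans (∑₁-swap λ r x → ∑₂ λ y z → 𝟙 (inner r x y z)) (∑₁-cong λ x → trans (∑₁-swap λ r y → ∑₁ λ z → 𝟙 (inner r x y z))
      (∑₁-cong λ y → ∑₁-swap λ r z → 𝟙 (inner r x y z)))

-- The upper bound

unique-length : ∀ {n} {xs : List (Fin n)} → Unique xs → length xs ≤ n
unique-length {n} {xs} u = begin
  length xs                                  ≡⟨ length-∑ xs ⟩
  ∑ xs (λ _ → 1)                             ≡⟨ ∑-cong xs (λ x → ∑₁-δ x (λ _ → 1)) ⟨
  ∑ xs (λ x → ∑₁ λ v → 𝟙 (v == x) * 1)       ≡⟨ ∑-∑₁-swap xs (λ x v → 𝟙 (v == x) * 1) ⟩
  ∑₁ (λ v → ∑ xs λ x → 𝟙 (v == x) * 1)       ≤⟨ ∑₁-≤ (λ v → ≤-trans (≤-reflexive (∑-cong xs λ x → trans (*-identityʳ _) (cong 𝟙 (==-sym v x)))) (∑-== u v)) ⟩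
  n * 1                                      ≡⟨ *-identityʳ n ⟩
  n                                          ∎
  where open ≤-Reasoning

-- The integer part of the root. It turns the Kővári-Sós-Turán bound, which compares powers, into a
-- bound E on counts that can be added up.
root : ∀ r B → Σ ℕ λ E → E ^ suc r ≤ B × (∀ x → x ^ suc r ≤ B → x ≤ E)
root r zero = 0 , z≤n , λ { zero _ → z≤n ; (suc x) h → ⊥-elim (<⇒≱ (m^n>0 (suc x) (suc r)) h) }
root r (suc B) with root r B
... | E , E≤ , max with suc E ^ suc r ≤? suc B
... | yes le = suc E , le , λ x h → ≮⇒≥ λ E+1<x → <⇒≱ (^-monoˡ-< (suc r) E+1<x) (≤-trans h
      (≰⇒> λ le′ → 1+n≰n (max (suc E) le′)))
... | no ¬le = E , m≤n⇒m≤1+n E≤ , λ x h → ≮⇒≥ λ E<x → ¬le (≤-trans (^-monoˡ-≤ (suc r) E<x) h)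

-- suc r is the exponent: s² in general and s when t = 1.
KST-Bound : (t s r c₀ : ℕ) → Set
KST-Bound t s r c₀ = ∀ (n a : ℕ) (P : Fin n → Fin n → Fin n → Bool) (As Bs Cs : List (Fin n)) →
  Unique As → Unique Bs → Unique Cs → a ≤ n → length As ≤ a ⊎ length Bs ≤ a →
  ((τ : Fin t → Fin n) (β γ : Fin s → Fin n) → Injective _≡_ _≡_ τ → Injective _≡_ _≡_ β → Injective _≡_ _≡_ γ →
    (∀ i j k → P (τ i) (β j) (γ k) ≡ true) → ⊥) →
  ∑ As (λ x → ∑ Bs λ y → ∑ Cs λ z → 𝟙 (P x y z)) ^ suc r ≤ c₀ * (n ^ (2 * suc r) * a ^ r)

kst-bound : ∀ t r → KST-Bound t (suc r) (r + r * suc r) (t + 2 * (suc r * suc r))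
kst-bound t r n a P As Bs Cs uA uB uC a≤n small free =
  KőváriSósTurán.kst P r As Bs Cs uA uB uC a (unique-length uA) (unique-length uB) (unique-length uC) a≤n small t free

kst-bound₁ : ∀ r → KST-Bound 1 (suc r) r (suc r + suc r * suc r)
kst-bound₁ r n a P As Bs Cs uA uB uC a≤n small free =
  KőváriSósTurán.kst₁ P r As Bs Cs uA uB uC a (unique-length uA) (unique-length uB) (unique-length uC) a≤n small
    λ α β γ β-inj γ-inj h → free (λ _ → α) β γ (λ { {fzero} {fzero} _ → refl }) β-inj γ-inj (λ _ → h)

module Upper (m t s : ℕ) (1≤t : 1 ≤ t) (1≤s : 1 ≤ s) (4≤2s : 4 ≤ 2 * s) (2s≤m : 2 * s ≤ m)
  (r c₀ : ℕ) (1≤r : 1 ≤ r) (kst : KST-Bound t s r c₀) (q : ℕ) where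

  p : ℕ
  p = suc r

  -- A sound vertex misses at most n²/k crossing pairs, F₅ is excluded at density 1/(4L), and the
  -- stability of AM–GM, applied to noncrossing ≤ 577 n³ / J², makes every class exceed n/3 by at most n/K′.
  opaque
    k L N K′ J k₀ stability-size L₈ lossSize boxSize₃ Lo : ℕ
    k  = 512 * s
    L  = 16 * ((27 * k) * (27 * k))
    N  = boxSize (m + s + t) (4 * L) 5
    K′ = 4624 * L + (22 * q) ^ p * c₀
    J  = 102 * K′
    k₀ = J * J
    stability-size = stabilitySize m t s 1≤t 1≤s 4≤2s 2s≤m k₀
    L₈ = 8 * L
    lossSize = 256 * (2 * s + 3 * t)
    boxSize₃ = boxSize m 256 3
    Lo = (28 * q * N) ^ p

    512s≤k : 512 * s ≤ k
    512s≤k = ≤-refl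
    L≡ : 16 * ((27 * k) * (27 * k)) ≡ L
    L≡ = refl
    N≡ : boxSize (m + s + t) (4 * L) 5 ≡ N
    N≡ = refl
    4624L≤K′ : 4624 * L ≤ K′
    4624L≤K′ = m≤m+n (4624 * L) _
    kst≤K′ : (22 * q) ^ p * c₀ ≤ K′
    kst≤K′ = m≤n+m _ (4624 * L)
    J≡ : J ≡ 102 * K′
    J≡ = refl
    k₀≡ : k₀ ≡ J * J
    k₀≡ = refl
    stability-size≡ : stability-size ≡ stabilitySize m t s 1≤t 1≤s 4≤2s 2s≤m k₀
    stability-size≡ = refl
    L₈≡ : L₈ ≡ 8 * L
    L₈≡ = refl
    lossSize≡ : lossSize ≡ 256 * (2 * s + 3 * t)
    lossSize≡ = refl
    boxSize₃≡ : boxSize₃ ≡ boxSize m 256 3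
    boxSize₃≡ = refl
    Lo≡ : Lo ≡ (28 * q * N) ^ p
    Lo≡ = refl

  threshold : ℕ
  threshold = stability-size + (k₀ + (N + (L₈ + (lossSize + (boxSize₃ + (K′ + Lo))))))

  1≤k : 1 ≤ k
  1≤k = ≤-trans (*-mono-≤ {1} {512} (s≤s z≤n) 1≤s) 512s≤k

  1≤L : 1 ≤ L
  1≤L = subst (1 ≤_) L≡ (*-mono-≤ {1} {16} (s≤s z≤n) (*-mono-≤ {1} {27 * k} (*-mono-≤ {1} {27} (s≤s z≤n) 1≤k) (*-mono-≤ {1} {27} (s≤s z≤n) 1≤k)))

  4≤K′ : 4 ≤ K′
  4≤K′ = ≤-trans (*-mono-≤ {4} {4624} (m≤m+n 4 4620) 1≤L) 4624L≤K′

  1≤K′ : 1 ≤ K′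
  1≤K′ = ≤-trans (s≤s z≤n) 4≤K′

  K′≤J : K′ ≤ J
  K′≤J = ≤-trans (m≤n*m K′ 102) (≤-reflexive (sym J≡))

  1≤J : 1 ≤ J
  1≤J = ≤-trans 1≤K′ K′≤J

  408≤J : 408 ≤ J
  408≤J = ≤-trans (*-monoʳ-≤ 102 4≤K′) (≤-reflexive (sym J≡))

  K′≤k₀ : K′ ≤ k₀
  K′≤k₀ = ≤-trans K′≤J (≤-trans (≤-trans (≤-reflexive (sym (*-identityʳ J))) (*-monoʳ-≤ J 1≤J)) (≤-reflexive (sym k₀≡)))

  module _ (n : ℕ) (n≥ : threshold ≤ n) where
    private
      drop-left : ∀ a {b} → a + b ≤ n → b ≤ n
      drop-left a = ≤-trans (m≤n+m _ a)
      h₁ = drop-left stability-size n≥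
      h₂ = drop-left k₀ h₁
      h₃ = drop-left N h₂
      h₄ = drop-left L₈ h₃
      h₅ = drop-left lossSize h₄
      h₆ = drop-left boxSize₃ h₅
      k₀≤n : k₀ ≤ n
      k₀≤n = ≤-trans (m≤m+n k₀ _) h₁
      N≤n : boxSize (m + s + t) (4 * L) 5 ≤ n
      N≤n = subst (_≤ n) (sym N≡) (≤-trans (m≤m+n N _) h₂)
      8L≤n : 8 * L ≤ n
      8L≤n = subst (_≤ n) L₈≡ (≤-trans (m≤m+n L₈ _) h₃)
      lossSize≤n : 256 * (2 * s + 3 * t) ≤ n
      lossSize≤n = subst (_≤ n) lossSize≡ (≤-trans (m≤m+n lossSize _) h₄)
      boxSize₃≤n : boxSize m 256 3 ≤ n
      boxSize₃≤n = subst (_≤ n) boxSize₃≡ (≤-trans (m≤m+n boxSize₃ _) h₅)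
      stable≤n : stabilitySize m t s 1≤t 1≤s 4≤2s 2s≤m k₀ ≤ n
      stable≤n = subst (_≤ n) stability-size≡ (≤-trans (m≤m+n stability-size _) n≥)
      K′≤n : K′ ≤ n
      K′≤n = ≤-trans (m≤m+n K′ _) h₆
      lower-order≤n : (28 * q * N) ^ p ≤ n
      lower-order≤n = subst (_≤ n) Lo≡ (drop-left K′ h₆)
      1≤n : 1 ≤ n
      1≤n = ≤-trans 1≤K′ K′≤n
      n³ = n * (n * n)

    module _ (H : Graph3 n) (free : ¬ Contains (F5S m t s) H) (many : e (T3 n) ≤ e H) where
      open Weights H
      open LocalOptimum H

      S≥ : 6 * n³ ≤ 27 * S + 12 * (n * n)
      S≥ = ≤-trans (*-monoʳ-≤ 6 (≤-trans (balanced-product (balanced n)) (+-monoˡ-≤ (2 * (n * n)) (*-monoʳ-≤ 27 (≤-trans (≤-reflexive (sym (e-T3 n))) many)))))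
        (≤-reflexive (trans (lemma (e H) (n * n)) (cong (λ z → 27 * z + 12 * (n * n)) (sym (ordered-count H)))))
        where lemma : ∀ a b → 6 * (27 * a + 2 * b) ≡ 27 * (6 * a) + 12 * b
              lemma = solve-∀

      initial : Σ (Fin n → Fin 3) λ κ → k₀ * noncrossing κ ≤ 577 * n³
      initial = stability m t s 1≤t 1≤s 4≤2s 2s≤m k₀ n stable≤n (≤-trans 1≤K′ K′≤k₀) H free S≥

      optimum : Σ (Fin n → Fin 3) λ κ → noncrossing κ ≤ noncrossing (proj₁ initial) × Optimal κ
      optimum = optimise (noncrossing (proj₁ initial)) (proj₁ initial) ≤-refl

      κ : Fin n → Fin 3
      κ = proj₁ optimum

      NC : k₀ * noncrossing κ ≤ 577 * n³
      NC = ≤-trans (*-monoʳ-≤ k₀ (proj₁ (proj₂ optimum))) (proj₂ initial)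

      open Partition H κ

      x₀ x₁ x₂ : ℕ
      x₀ = class fzero
      x₁ = class (fsuc fzero)
      x₂ = class (fsuc (fsuc fzero))

      total : x₀ + x₁ + x₂ ≡ n
      total = classSizes-sum κ

      Rain≡ : Rain ≡ 6 * (x₀ * (x₁ * x₂))
      Rain≡ = rainbow-count κ

      27Rain : 27 * Rain ≤ 6 * n³
      27Rain = ≤-trans (≤-reflexive (trans (cong (27 *_) Rain≡) (lemma (x₀ * (x₁ * x₂)))))
        (*-monoʳ-≤ 6 (≤-trans (27abc≤n³ x₀ x₁ x₂) (≤-reflexive (cong (λ z → z * (z * z)) total))))
        where lemma : ∀ a → 27 * (6 * a) ≡ 6 * (27 * a)
              lemma = solve-∀

      k₀n² : k₀ * (n * n) ≤ n³
      k₀n² = *-monoˡ-≤ (n * n) k₀≤n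

      -- By AM-GM and `S≥`, the rainbow triples outnumber the edges by O(n²) only, so `Mis` exceeds
      -- `noncrossing` by no more than that. Because k₀ ≤ n, this raises 577 at most to 578.
      Mis≤ : k₀ * Mis ≤ 578 * n³
      Mis≤ = *-cancelˡ-≤ 27 (lin≤ (15 * n³)
        (+-mono-≤ (*-monoʳ-≤ k₀ 27Rain) (+-mono-≤ (*-monoʳ-≤ 27 NC) (+-mono-≤ (*-monoʳ-≤ k₀ S≥) (+-mono-≤ (*-monoʳ-≤ 12 k₀n²)
          (≤-reflexive (cong (27 * k₀ *_) (sym Rain+noncrossing)))))))
        (lemma k₀ Mis Rain (noncrossing κ) S n³ (n * n)))
        where
        lemma : ∀ k M R C S x y →
          27 * (k * M) + (k * (6 * x) + (27 * (577 * x) + (k * (27 * S + 12 * y) + (12 * x + 27 * k * (R + C))))) + 15 * x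
          ≡ 27 * (578 * x) + (k * (27 * R) + (27 * (k * C) + (k * (6 * x) + (12 * (k * y) + 27 * k * (S + M)))))
        lemma = solve-∀

      -- The summand 4624 · L of `K′` is chosen for this: 4624 = 8 · 578.
      8LMis : 8 * (L * Mis) ≤ n³
      8LMis = *-cancelˡ-≤ 578 (begin
        578 * (8 * (L * Mis))   ≡⟨ lemma L Mis ⟩
        4624 * L * Mis          ≤⟨ *-monoˡ-≤ Mis (≤-trans 4624L≤K′ K′≤k₀) ⟩
        k₀ * Mis                ≤⟨ Mis≤ ⟩
        578 * n³                ∎)
        where
        open ≤-Reasoning
        lemma : ∀ l x → 578 * (8 * (l * x)) ≡ 4624 * l * x
        lemma = solve-∀

      -- The estimate yields (27 · 577 + 12)/6, which is below 2599; it is raised to 2601 = 51² to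
      -- have a square for `defect≤`.
      product-large₀ : k₀ * n³ ≤ k₀ * (27 * (x₀ * (x₁ * x₂))) + 2601 * n³
      product-large₀ = *-cancelˡ-≤ 6 (lin≤ (15 * n³)
        (+-mono-≤ (*-monoʳ-≤ k₀ S≥) (+-mono-≤ (*-monoʳ-≤ (27 * k₀) S≤) (+-mono-≤ (*-monoʳ-≤ 27 NC) (*-monoʳ-≤ 12 k₀n²))))
        (lemma k₀ (x₀ * (x₁ * x₂)) (noncrossing κ) S n³ (n * n)))
        where
        S≤ : S ≤ 6 * (x₀ * (x₁ * x₂)) + noncrossing κ
        S≤ = ≤-trans (m≤m+n S Mis) (≤-reflexive (trans (sym Rain+noncrossing) (cong (_+ noncrossing κ) Rain≡)))
        lemma : ∀ k w C S x y →
          6 * (k * x) + (k * (27 * S + 12 * y) + (27 * k * (6 * w + C) + (27 * (577 * x) + 12 * x))) + 15 * x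
          ≡ 6 * (k * (27 * w) + 2601 * x) + (k * (6 * x) + (27 * k * S + (27 * (k * C) + 12 * (k * y))))
        lemma = solve-∀

      product-large : J * J * n³ ≤ J * J * (27 * (x₀ * (x₁ * x₂))) + 2601 * n³
      product-large = subst (λ z → z * n³ ≤ z * (27 * (x₀ * (x₁ * x₂))) + 2601 * n³) k₀≡ product-large₀

      near : ∀ i → J * (3 * class i) ≤ J * n + 102 * n × J * n ≤ J * (3 * class i) + 102 * n
      near fzero = nearly-third x₀ x₁ x₂ n total J 1≤n product-large
      near (fsuc fzero) = nearly-third x₁ x₀ x₂ n (trans (cong (_+ x₂) (+-comm x₁ x₀)) total) J 1≤n
        (subst (λ z → J * J * n³ ≤ J * J * (27 * z) + 2601 * n³) (lemma x₀ x₁ x₂) product-large)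
        where lemma : ∀ a b c → a * (b * c) ≡ b * (a * c)
              lemma = solve-∀
      near (fsuc (fsuc fzero)) = nearly-third x₂ x₀ x₁ n (trans (trans (+-assoc x₂ x₀ x₁) (+-comm x₂ (x₀ + x₁))) total) J 1≤n
        (subst (λ z → J * J * n³ ≤ J * J * (27 * z) + 2601 * n³) (lemma x₀ x₁ x₂) product-large)
        where lemma : ∀ a b c → a * (b * c) ≡ c * (a * b)
              lemma = solve-∀

      classes₁ : ∀ i → n ≤ 4 * class i
      classes₁ i = *-cancelˡ-≤ (3 * J) {{>-nonZero (*-mono-≤ {1} {3} (s≤s z≤n) 1≤J)}}
        (lin≤ 0 (+-mono-≤ (*-monoʳ-≤ 4 (proj₂ (near i))) (*-monoʳ-≤ n 408≤J)) (lemma J n (class i)))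
        where lemma : ∀ k n x → 3 * k * n + (4 * (k * (3 * x) + 102 * n) + n * k) + 0
                        ≡ 3 * k * (4 * x) + (4 * (k * n) + n * 408)
              lemma = solve-∀

      classes : ∀ i j → n * n ≤ 16 * (class i * class j)
      classes i j = ≤-trans (*-mono-≤ (classes₁ i) (classes₁ j)) (≤-reflexive (lemma (class i) (class j)))
        where lemma : ∀ x y → 4 * x * (4 * y) ≡ 16 * (x * y)
              lemma = solve-∀

      excess : Fin 3 → ℕ
      excess i = class i ∸ n / 3

      -- As J = 102 · K′, `near` says that three times the class is at most n + n/K′. Rounding n/3
      -- down costs at most 2 more, hence at most 2n/K′ because K′ ≤ n; together this is 3n/K′.
      excess≤ : ∀ i → K′ * excess i ≤ n
      excess≤ i = by-size (≤-total (class i) (n / 3))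
        where
        n≤ : n ≤ 2 + n / 3 * 3
        n≤ = ≤-trans (≤-reflexive (m≡m%n+[m/n]*n n 3)) (+-monoˡ-≤ (n / 3 * 3) (≤-pred (m%n<n n 3)))
        arithmetic : ∀ k n h x y → h + x ≡ y → 102 * k * (3 * y) ≤ 102 * k * n + 102 * n → n ≤ 2 + h * 3 → k ≤ n → 306 * (k * x) ≤ 306 * n
        arithmetic k n h x y refl u v w = lin≤ 0 (+-mono-≤ u (+-mono-≤ (*-monoʳ-≤ (102 * k) v) (*-monoʳ-≤ 204 w))) (lemma k n h x)
          where lemma : ∀ k n h x → 306 * (k * x) + (102 * k * n + 102 * n + (102 * k * (2 + h * 3) + 204 * n)) + 0
                          ≡ 306 * n + (102 * k * (3 * (h + x)) + (102 * k * n + 204 * k))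
                lemma = solve-∀
        by-size : class i ≤ n / 3 ⊎ n / 3 ≤ class i → K′ * excess i ≤ n
        by-size (inj₁ le) = ≤-trans (≤-reflexive (trans (cong (K′ *_) (m≤n⇒m∸n≡0 le)) (*-zeroʳ K′))) z≤n
        by-size (inj₂ le) = *-cancelˡ-≤ 306 (arithmetic K′ n (n / 3) (excess i) (class i) (m+[n∸m]≡n le)
          (subst (λ z → z * (3 * class i) ≤ z * n + 102 * n) J≡ (proj₁ (near i))) n≤ K′≤n)

      a : ℕ
      a = excess fzero ⊔ (excess (fsuc fzero) ⊔ excess (fsuc (fsuc fzero)))

      excess≤a : ∀ i → excess i ≤ a
      excess≤a fzero = m≤m⊔n _ _
      excess≤a (fsuc fzero) = ≤-trans (m≤m⊔n _ _) (m≤n⊔m (excess fzero) _)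
      excess≤a (fsuc (fsuc fzero)) = ≤-trans (m≤n⊔m (excess (fsuc fzero)) _) (m≤n⊔m (excess fzero) _)

      K′a≤n : K′ * a ≤ n
      K′a≤n = ≤-trans (≤-reflexive (trans (*-distribˡ-⊔ K′ _ _) (cong (K′ * excess fzero ⊔_) (*-distribˡ-⊔ K′ _ _))))
        (⊔-lub (excess≤ fzero) (⊔-lub (excess≤ (fsuc fzero)) (excess≤ (fsuc (fsuc fzero)))))

      a≤n : a ≤ n
      a≤n = ≤-trans (≤-trans (≤-reflexive (sym (*-identityˡ a))) (*-monoˡ-≤ a 1≤K′)) K′a≤n

      class≤ : ∀ i → class i ≤ n / 3 + a
      class≤ i = ≤-trans (m≤n+m∸n (class i) (n / 3)) (+-monoʳ-≤ (n / 3) (excess≤a i))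

      B : ℕ
      B = c₀ * (n ^ (2 * p) * a ^ r)

      E : ℕ
      E = proj₁ (root r B)

      module A = Assembly m t s 1≤t 1≤s 4≤2s 2s≤m n H free κ (proj₂ (proj₂ optimum)) k L 1≤k L≡ N≤n
        8L≤n 8LMis classes classes₁ 512s≤k lossSize≤n boxSize₃≤n

      errors : ∀ i (As Bs Cs : List (Fin n)) → Unique As → Unique Bs → Unique Cs → length As ≤ a ⊎ length Bs ≤ a →
        ∑ As (λ x → ∑ Bs λ y → ∑ Cs λ z → 𝟙 (A.P i x y z)) ≤ E
      errors i As Bs Cs uA uB uC small = proj₂ (proj₂ (root r B)) _ (kst n a (A.P i) As Bs Cs uA uB uC a≤n small
        λ τ β γ τ-inj β-inj γ-inj edges → A.no-K i τ β γ τ-inj β-inj γ-inj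
          (λ j → ∧-trueˡ (∧-trueʳ {edge? H (τ 0ₜ) (β j) (γ 0ₛ)} (edges 0ₜ j 0ₛ)))
          (λ j → ∧-trueʳ {A.ρ i (β 0ₛ)} (∧-trueʳ {edge? H (τ 0ₜ) (β 0ₛ) (γ j)} (edges 0ₜ 0ₛ j)))
          (λ l x y → ∧-trueˡ (edges l x y)))
        where
        0ₜ : Fin t
        0ₜ = fromℕ< 1≤t
        0ₛ : Fin s
        0ₛ = fromℕ< 1≤s

      module _ (b c : ℕ)
        (b-max : ∀ (F : BipGraph (n / 3) (n / 3)) → ¬ ContainsBipK t s F → eBip F ≤ b)
        (c-max : ∀ (F : Graph3 (n / 3)) → ¬ Contains (K t s) F → e F ≤ c) where

        diff : ℕ
        diff = e H ∸ (e (T3 n) + 6 * b + 3 * c)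

        -- 63/6 and 81/6, the coefficients for unordered edges, rounded up.
        diff≤ : diff ≤ 11 * E + 14 * (N * (n * n))
        diff≤ = arithmetic (e H) (e (T3 n)) b c E N (n * n)
          (subst (λ z → 6 * e H ≤ 6 * e (T3 n) + (18 * c + 36 * b + 63 * E) + 81 * z * (n * n)) N≡
            (A.Total.total (n / 3) (m/n≤m n 3) b c b-max c-max E a class≤ errors))
          where
          arithmetic : ∀ h T b c E N x → 6 * h ≤ 6 * T + (18 * c + 36 * b + 63 * E) + 81 * N * x →
            h ∸ (T + 6 * b + 3 * c) ≤ 11 * E + 14 * (N * x)
          arithmetic h T b c E N x le = m≤n+o⇒m∸n≤o h (T + 6 * b + 3 * c) (*-cancelˡ-≤ 6 (lin≤ (3 * E + 3 * (N * x)) le (lemma h T b c E N x)))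
            where lemma : ∀ h T b c E N x → 6 * h + (6 * T + (18 * c + 36 * b + 63 * E) + 81 * N * x) + (3 * E + 3 * (N * x))
                            ≡ 6 * (T + 6 * b + 3 * c + (11 * E + 14 * (N * x))) + 6 * h
                  lemma = solve-∀

        n^p : n ^ r * n ^ (2 * p) ≡ n ^ (3 * p ∸ 1)
        n^p = sym (^-distribˡ-+-* n r (2 * p))

        -- Here O becomes o: E^p contains a^r with r ≥ 1, and a ≤ n/K′ wins the factor K′^r ≥ K′,
        -- which exceeds (22q)^p · c₀ by the choice of K′.
        kst-term : (22 * (q * E)) ^ p ≤ n ^ (3 * p ∸ 1)
        kst-term = begin
          (22 * (q * E)) ^ p                    ≡⟨ cong (_^ p) (*-assoc 22 q E) ⟨
          (22 * q * E) ^ p                      ≡⟨ ^-distribʳ-* p (22 * q) E ⟩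
          Q^p * E ^ p                         ≤⟨ *-monoʳ-≤ Q^p (proj₁ (proj₂ (root r B))) ⟩
          Q^p * (c₀ * (n ^ (2 * p) * a ^ r))  ≡⟨ lemma (Q^p) c₀ (n ^ (2 * p)) (a ^ r) ⟩
          Q^p * c₀ * a ^ r * n ^ (2 * p)      ≤⟨ *-monoˡ-≤ (n ^ (2 * p)) small ⟩
          n ^ r * n ^ (2 * p)                   ≡⟨ n^p ⟩
          n ^ (3 * p ∸ 1)                       ∎
          where
          open ≤-Reasoning
          lemma : ∀ a b c d → a * (b * (c * d)) ≡ a * b * d * c
          lemma = solve-∀
          Q^p = (22 * q) ^ p
          K′≤K′^r : K′ ≤ K′ ^ r
          K′≤K′^r = ≤-trans (≤-reflexive (sym (*-identityʳ K′))) (^-monoʳ-≤ K′ {{>-nonZero 1≤K′}} 1≤r)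
          small : Q^p * c₀ * a ^ r ≤ n ^ r
          small = ≤-trans (*-monoˡ-≤ (a ^ r) (≤-trans kst≤K′ K′≤K′^r))
            (≤-trans (≤-reflexive (sym (^-distribʳ-* r K′ a))) (^-monoˡ-≤ r K′a≤n))

        -- The constant to the power p is absorbed by a single factor n, and n^(1 + 2p) ≤ n^(r + 2p)
        -- since r ≥ 1.
        quadratic-term : (28 * (q * (N * (n * n)))) ^ p ≤ n ^ (3 * p ∸ 1)
        quadratic-term = begin
          (28 * (q * (N * (n * n)))) ^ p        ≡⟨ cong (_^ p) (lemma q N (n * n)) ⟩
          (28 * q * N * (n * n)) ^ p            ≡⟨ ^-distribʳ-* p (28 * q * N) (n * n) ⟩
          (28 * q * N) ^ p * (n * n) ^ p        ≤⟨ *-monoˡ-≤ ((n * n) ^ p) lower-order≤n ⟩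
          n * (n * n) ^ p                       ≡⟨ cong (n *_) (trans (^-distribʳ-* p n n) (trans (sym (^-distribˡ-+-* n p p)) (cong (λ z → n ^ (p + z)) (sym (+-identityʳ p))))) ⟩
          n * n ^ (2 * p)                       ≤⟨ *-monoˡ-≤ (n ^ (2 * p)) (≤-trans (≤-reflexive (sym (*-identityʳ n))) (^-monoʳ-≤ n {{>-nonZero 1≤n}} 1≤r)) ⟩
          n ^ r * n ^ (2 * p)                   ≡⟨ n^p ⟩
          n ^ (3 * p ∸ 1)                       ∎
          where
          open ≤-Reasoning
          lemma : ∀ q N x → 28 * (q * (N * x)) ≡ 28 * q * N * x
          lemma = solve-∀

        conclusion : (q * diff) ^ p ≤ n ^ (3 * p ∸ 1)
        conclusion = ≤-trans (^-monoˡ-≤ p (*-monoʳ-≤ q diff≤)) larger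
          where
          x y : ℕ
          x = 11 * (q * E)
          y = 14 * (q * (N * (n * n)))
          distribute : ∀ q E z → q * (11 * E + 14 * z) ≡ 11 * (q * E) + 14 * (q * z)
          distribute = solve-∀
          double₁ : ∀ z → 11 * z + 11 * z ≡ 22 * z
          double₁ = solve-∀
          double₂ : ∀ z → 14 * z + 14 * z ≡ 28 * z
          double₂ = solve-∀
          -- A sum is at most twice its larger term, which turns 11 and 14 into the 22 and 28 of the
          -- threshold.
          by-size : x ≤ y ⊎ y ≤ x → (x + y) ^ p ≤ n ^ (3 * p ∸ 1)
          by-size (inj₁ x≤y) = ≤-trans (^-monoˡ-≤ p (≤-trans (+-monoˡ-≤ y x≤y) (≤-reflexive (double₂ (q * (N * (n * n))))))) quadratic-term
          by-size (inj₂ y≤x) = ≤-trans (^-monoˡ-≤ p (≤-trans (+-monoʳ-≤ x y≤x) (≤-reflexive (double₁ (q * E))))) kst-term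
          larger : (q * (11 * E + 14 * (N * (n * n)))) ^ p ≤ n ^ (3 * p ∸ 1)
          larger = ≤-trans (≤-reflexive (cong (_^ p) (distribute q E (N * (n * n))))) (by-size (≤-total x y))

  upper : (n : ℕ) → threshold ≤ n → (ex5 b c : ℕ) →
    IsEx n (F5S m t s) ex5 → IsExBip (n / 3) (n / 3) t s b → IsEx (n / 3) (K t s) c →
    (q * (ex5 ∸ (e (T3 n) + 6 * b + 3 * c))) ^ p ≤ n ^ (3 * p ∸ 1)
  upper n n≥ ex5 b c ((H , free , refl) , _) (_ , b-max) (_ , c-max) = by-size (≤-total (e (T3 n)) (e H))
    where
    by-size : e (T3 n) ≤ e H ⊎ e H ≤ e (T3 n) → (q * (e H ∸ (e (T3 n) + 6 * b + 3 * c))) ^ p ≤ n ^ (3 * p ∸ 1)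
    by-size (inj₁ many) = conclusion n n≥ H free many b c b-max c-max
    -- If H has at most as many edges as T₃(n,3), the truncated difference is zero.
    by-size (inj₂ few)  = ≤-trans (≤-reflexive (cong (_^ p) (trans (cong (q *_) (m≤n⇒m∸n≡0
      (≤-trans few (≤-trans (m≤m+n _ (6 * b)) (m≤m+n _ (3 * c)))))) (*-zeroʳ q)))) z≤n

theorem1p2 : (m t s : ℕ) → 1 ≤ t → 1 ≤ s → 3 ≤ t + s → 4 ≤ 2 * s → 2 * s ≤ m →
    (Σ ℕ λ N → (n : ℕ) → N ≤ n → (ex5 c : ℕ) →
    IsEx n (F5S m t s) ex5 → IsEx (n / 3) (K t s) c →
    e (T3 n) + 3 * c ≤ ex5)
    ×
    ((q : ℕ) → 1 ≤ q → Σ ℕ λ N → (n : ℕ) → N ≤ n → (ex5 b c : ℕ) →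
    IsEx n (F5S m t s) ex5 → IsExBip (n / 3) (n / 3) t s b → IsEx (n / 3) (K t s) c →
    (q * (ex5 ∸ (e (T3 n) + 6 * b + 3 * c))) ^ (s * s) ≤ n ^ (3 * (s * s) ∸ 1))
    ×
    (t ≡ 1 → (q : ℕ) → 1 ≤ q → Σ ℕ λ N → (n : ℕ) → N ≤ n → (ex5 b c : ℕ) →
    IsEx n (F5S m t s) ex5 → IsExBip (n / 3) (n / 3) t s b → IsEx (n / 3) (K t s) c →
    (q * (ex5 ∸ (e (T3 n) + 6 * b + 3 * c))) ^ s ≤ n ^ (3 * s ∸ 1))
theorem1p2 m t zero 1≤t () _ _ _
theorem1p2 m t (suc zero) 1≤t 1≤s _ (s≤s (s≤s ())) _
-- Now s ≥ 2, so r = s - 1 ≥ 1 as the gain in `kst-term` requires. The exponent `suc (r + r * s)`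
-- computes to s · s, hence `Upper` applies once with s² and, for t = 1, once with s. The
-- construction for the lower bound works from n = 0 on.
theorem1p2 m t s@(suc r@(suc _)) 1≤t 1≤s _ 4≤2s 2s≤m =
  (0 , λ { n _ ex5 c (_ , ex5-max) ((F , F-free , refl) , _) →
    ≤-trans (Construction.lower m t s 1≤t 1≤s 4≤2s 2s≤m n F F-free) (ex5-max (Construction.H m t s 1≤t 1≤s 4≤2s 2s≤m n F F-free) (Construction.H-free m t s 1≤t 1≤s 4≤2s 2s≤m n F F-free)) }) ,
  (λ q _ → Upper.threshold m t s 1≤t 1≤s 4≤2s 2s≤m (r + r * s) (t + 2 * (s * s)) (s≤s z≤n) (kst-bound t r) q ,
    Upper.upper m t s 1≤t 1≤s 4≤2s 2s≤m (r + r * s) (t + 2 * (s * s)) (s≤s z≤n) (kst-bound t r) q) ,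
  λ { refl q _ → Upper.threshold m 1 s 1≤t 1≤s 4≤2s 2s≤m r (s + s * s) (s≤s z≤n) (kst-bound₁ r) q ,
    Upper.upper m 1 s 1≤t 1≤s 4≤2s 2s≤m r (s + s * s) (s≤s z≤n) (kst-bound₁ r) q }
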